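{- Let $\ell\equiv3\pmod4$ be a prime with $\ell\ge N_{1/2}$ such that property $\mathbf{P}(\ell)$ holds. Then the action of $\overline{Q}_\ell$ on $\mathcal{O}(\ell)$ is primitive.
   Context: $X^*(\ell)$ is the set of $(x,y,z)\in\mathbb{F}_\ell^3-\{(0,0,0)\}$ with $x^2+y^2+z^2-xyz=0$; $Y^*(\ell)$ is its quotient by the group of maps negating exactly two coordinates. $Q_\ell$ is the permutation group on $Y^*(\ell)$ induced by the group generated by $(x,y,z)\mapsto(x,y,xy-z)$, $(x,y,z)\mapsto(y,x,z)$, $(x,y,z)\mapsto(x,z,y)$. $\mathcal{O}(\ell)$ is a $Q_\ell$-orbit of maximal size in $Y^*(\ell)$ and $\overline{Q}_\ell$ the permutation group induced on it. $N_{1/2}$ is the smallest integer such that for all primes $\ell\ge N_{1/2}$, $|\mathcal{O}(\ell)|\ge|Y^*(\ell)|-\ell^{1/2}$. $\mathbf{P}(\ell)$: either $\ell\equiv1\pmod4$ or the multiplicative order of $\frac{3+\sqrt5}{2}\in\mathbb{F}_{\ell^2}$ is at least $32\sqrt{\ell+1}$. An action is primitive if the only blocks (subsets $B$ with $gB=B$ or $gB\cap B=\emptyset$ for all $g$) are singletons and the whole set. -}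

module Defs where

open import Data.Nat using (ℕ; zero; suc; _+_; _*_; _∸_; _≤_; _%_; _/_)
open import Data.Nat.Primality using (Prime)
open import Data.Product using (_×_; _,_; Σ; ∃; ∃-syntax)
open import Data.Sum using (_⊎_)
open import Data.Empty using (⊥)
open import Data.Unit using (⊤)
open import Data.List using (List; []; _∷_; length)
open import Data.List.Relation.Unary.All using (All)
open import Data.List.Relation.Unary.Any using (Any)
open import Data.List.Relation.Unary.AllPairs using (AllPairs)
open import Relation.Nullary using (¬_)
open import Relation.Binary.PropositionalEquality using (_≡_)

-- Arithmetic in F_ℓ, elements represented by their canonical
-- representatives 0 … ℓ-1 (as natural numbers).

md : ℕ → ℕ → ℕ
md zero    n = n
md (suc k) n = n % suc k

negm : ℕ → ℕ → ℕ
negm ℓ x = md ℓ (ℓ ∸ x)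

Triple : Set
Triple = ℕ × ℕ × ℕ

data NonZeroTriple : Triple → Set where
  nz₁ : ∀ {x y z} → ¬ (x ≡ 0) → NonZeroTriple (x , y , z)
  nz₂ : ∀ {x y z} → ¬ (y ≡ 0) → NonZeroTriple (x , y , z)
  nz₃ : ∀ {x y z} → ¬ (z ≡ 0) → NonZeroTriple (x , y , z)

Xs : ℕ → Triple → Set
Xs ℓ (x , y , z) =
  (suc x ≤ ℓ) × (suc y ≤ ℓ) × (suc z ≤ ℓ) × NonZeroTriple (x , y , z)
  × (md ℓ (x * x + y * y + z * z) ≡ md ℓ (x * y * z))

s₁ s₂ s₃ : ℕ → Triple → Triple
s₁ ℓ (x , y , z) = (negm ℓ x , negm ℓ y , z)
s₂ ℓ (x , y , z) = (negm ℓ x , y , negm ℓ z)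
s₃ ℓ (x , y , z) = (x , negm ℓ y , negm ℓ z)

-- t ~ u : t and u define the same point of Y*(ℓ) = X*(ℓ)/(sign changes)
_∼[_]_ : Triple → ℕ → Triple → Set
t ∼[ ℓ ] u = (u ≡ t) ⊎ (u ≡ s₁ ℓ t) ⊎ (u ≡ s₂ ℓ t) ⊎ (u ≡ s₃ ℓ t)

-- Generators of Q_ℓ and words in them (all generators are involutions,
-- so the group they generate is the set of finite words).

data Gen : Set where
  vieta sw₁₂ sw₂₃ : Gen

gen : ℕ → Gen → Triple → Triple
gen ℓ vieta (x , y , z) = (x , y , md ℓ (x * y + (ℓ ∸ z)))
gen ℓ sw₁₂  (x , y , z) = (y , x , z)
gen ℓ sw₂₃  (x , y , z) = (x , z , y)

act : ℕ → List Gen → Triple → Triple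
act ℓ []      t = t
act ℓ (g ∷ w) t = gen ℓ g (act ℓ w t)

-- Subsets of Y*(ℓ): predicates on X*(ℓ) invariant under ∼.

Respects∼ : ℕ → (Triple → Set) → Set
Respects∼ ℓ P = ∀ t u → Xs ℓ t → t ∼[ ℓ ] u → P t → P u

HasSize : ℕ → (Triple → Set) → ℕ → Set
HasSize ℓ P n = Σ (List Triple) λ L →
  (length L ≡ n)
  × All (λ t → Xs ℓ t × P t) L
  × AllPairs (λ t u → ¬ (t ∼[ ℓ ] u)) L
  × (∀ t → Xs ℓ t → P t → Any (λ u → t ∼[ ℓ ] u) L)

Whole : Triple → Set
Whole _ = ⊤

Orbit : ℕ → Triple → Triple → Set
Orbit ℓ p q = ∃[ w ] (act ℓ w p ∼[ ℓ ] q)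

IsMaxOrbit : ℕ → Triple → Set
IsMaxOrbit ℓ p = Xs ℓ p × (∀ p' → Xs ℓ p' → ∀ n n' →
  HasSize ℓ (Orbit ℓ p) n → HasSize ℓ (Orbit ℓ p') n' → n' ≤ n)

-- |O(p)| ≥ |Y*(p)| - p^{1/2}, i.e. (|Y*(p)| - |O(p)|)² ≤ p
HalfCond : ℕ → Set
HalfCond p = ∀ o → IsMaxOrbit p o → ∀ m y →
  HasSize p (Orbit p o) m → HasSize p Whole y → (y ∸ m) * (y ∸ m) ≤ p

IsNHalf : ℕ → Set
IsNHalf N = (∀ p → Prime p → N ≤ p → HalfCond p)
  × (∀ M → (∀ p → Prime p → M ≤ p → HalfCond p) → N ≤ M)

-- Property P(ℓ).  Arithmetic in F_ℓ[√5] = F_ℓ[t]/(t²-5), elements a + b√5.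

F2 : Set
F2 = ℕ × ℕ

mul2 : ℕ → F2 → F2 → F2
mul2 ℓ (a , b) (c , d) = (md ℓ (a * c + 5 * (b * d)) , md ℓ (a * d + b * c))

pow2 : ℕ → F2 → ℕ → F2
pow2 ℓ α zero    = (md ℓ 1 , 0)
pow2 ℓ α (suc k) = mul2 ℓ α (pow2 ℓ α k)

-- (3 + √5)/2, with 1/2 = (ℓ+1)/2 for odd ℓ
golden² : ℕ → F2
golden² ℓ = (md ℓ (3 * (suc ℓ / 2)) , md ℓ (suc ℓ / 2))

IsMulOrder : ℕ → F2 → ℕ → Set
IsMulOrder ℓ α k = (1 ≤ k) × (pow2 ℓ α k ≡ (md ℓ 1 , 0))
  × (∀ j → 1 ≤ j → pow2 ℓ α j ≡ (md ℓ 1 , 0) → k ≤ j)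

-- P(ℓ): ℓ ≡ 1 mod 4, or ord((3+√5)/2) ≥ 32 √(ℓ+1)  (⇔ ord² ≥ 1024 (ℓ+1))
PropP : ℕ → Set
PropP ℓ = (ℓ % 4 ≡ 1) ⊎ (∀ k → IsMulOrder ℓ (golden² ℓ) k → 1024 * (ℓ + 1) ≤ k * k)

Image : ℕ → List Gen → (Triple → Set) → Triple → Set
Image ℓ w B q = ∃[ b ] (Xs ℓ b × B b × (act ℓ w b ∼[ ℓ ] q))

IsBlock : ℕ → (Triple → Set) → Set
IsBlock ℓ B = ∀ (w : List Gen) →
  (∀ q → Xs ℓ q → (Image ℓ w B q → B q) × (B q → Image ℓ w B q))
  ⊎ (∀ q → Xs ℓ q → Image ℓ w B q → B q → ⊥)

IsSingleton : ℕ → (Triple → Set) → Set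
IsSingleton ℓ B = ∃[ c ] (Xs ℓ c × (∀ q → Xs ℓ q → (B q → c ∼[ ℓ ] q) × (c ∼[ ℓ ] q → B q)))

SameAs : ℕ → (Triple → Set) → (Triple → Set) → Set
SameAs ℓ B O = ∀ q → Xs ℓ q → (B q → O q) × (O q → B q)

Primitive : ℕ → (Triple → Set) → Set₁
Primitive ℓ O = ∀ (B : Triple → Set) → Respects∼ ℓ B
  → (∀ q → Xs ℓ q → B q → O q)
  → (∃[ b ] (Xs ℓ b × B b))
  → IsBlock ℓ B
  → IsSingleton ℓ B ⊎ SameAs ℓ B O

{-# OPTIONS --safe #-}
-- Let T be the rotation (x, y, z) ↦ (x, z, xz - y).  On the conic of triples with
-- first coordinate x it multiplies by an eigenvalue ω with ω + ω⁻¹ = x, whose order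
-- modulo ±1 divides M = (ℓ - 1)/2 or M + 1 according to the type of x, the quadratic
-- character of x² - 4.  Since M and M + 1 are coprime, a block containing points
-- with first coordinates of both types is stabilised by T.  By P(ℓ) the T-orbit of
-- (3, 3, 3) has length L ≥ 16 √(ℓ+1), so the hypothesis on N puts this point in the
-- maximal orbit, and we may let it belong to the block.  The permutations of the
-- coordinates then stabilise the block, so it is the whole orbit as soon as T
-- stabilises it; and (3, 3, 3) is their only common fixed point.
-- Otherwise a block with a second element contains two points (x, y, z) and
-- (x, y', z') of one conic with T-period at least L; let u_i and u'_i be the second
-- coordinates of their T-iterates.  If u_i and u'_i have different types then the
-- rotation fixing u_i stabilises the i-th translate of the block, which forces u_{i±1}
-- and u'_{i±1} to have the type of x, and the relations of PSL₂(ℤ) exclude that this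
-- happens for i + 1, and essentially for i + 2, as well.  Stepanov's method shows on
-- the other hand that the types of u_i, of u'_i, and their product are close enough
-- to being equidistributed to contradict this pattern.
module Submission where

open import Defs
open import Data.Nat using (ℕ; _≤_; _%_)
open import Data.Nat.Primality using (Prime)
open import Relation.Binary.PropositionalEquality using (_≡_)

open import Algebra.Bundles using (CommutativeRing)
open import Algebra.Solver.Ring.AlmostCommutativeRing
  using (fromCommutativeRing; _-Raw-AlmostCommutative⟶_)
import Algebra.Structures as AS
open import Data.Empty using (⊥; ⊥-elim; ⊥-elim-irr)
open import Data.Fin.Base as Fin using (Fin; toℕ)
import Data.Fin.Properties as Finₚ
open import Data.Integer.Base as ℤ using (ℤ; -[1+_]) renaming (+_ to ⁺_)
import Data.Integer.Properties as ℤₚ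
open import Data.List.Base
  using (List; []; _∷_; _++_; map; length; upTo; drop; filter; cartesianProduct)
open import Data.List.Membership.Propositional using (_∈_; find; lose)
open import Data.List.Membership.Propositional.Properties
  using (∈-map⁺; ∈-upTo⁺; ∈-filter⁺; ∈-cartesianProduct⁺)
open import Data.List.Properties using (length-++; length-map; length-upTo)
open import Data.List.Relation.Unary.All as All using (All; []; _∷_)
import Data.List.Relation.Unary.All.Properties as Allₚ
open import Data.List.Relation.Unary.AllPairs as AllPairs using (AllPairs; []; _∷_)
import Data.List.Relation.Unary.AllPairs.Properties as AllPairsₚ
open import Data.List.Relation.Unary.Any as Any using (Any; here; there)
import Data.List.Relation.Unary.Any.Properties as Anyₚ
open import Data.Maybe.Base using (Maybe; just; nothing)
open import Data.Nat.Base as ℕ using (zero; suc; s≤s; z≤n)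
open import Data.Nat.Combinatorics
  using (nCn≡1; nCk+nC[k+1]≡[n+1]C[k+1]; k>n⇒nCk≡0; nC1≡n) renaming (_C_ to _choose_)
open import Data.Nat.DivMod
  using (_/_; m%n<n; m<n⇒m%n≡m; m%n%n≡m%n; n%n≡0; %-distribˡ-+; %-distribˡ-*;
         m≡m%n+[m/n]*n; m/n*n≤m; m*n/n≡m; /-monoˡ-≤)
open import Data.Nat.Divisibility using (_∣_; divides; ∣⇒≤; m∣m*n; m%n≡0⇒n∣m)
open import Data.Nat.Primality using (euclidsLemma)
import Data.Nat.Properties as ℕₚ
open import Data.Nat.Solver using (module +-*-Solver)
open import Data.Product using (_×_; _,_; proj₁; proj₂; ∃; Σ)
open import Data.Sign.Base as Sign using (Sign)
open import Data.Sum using (_⊎_; inj₁; inj₂)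
open import Data.Unit using (⊤; tt)
open import Data.Vec.Base as Vec using (Vec; []; _∷_; zipWith; replicate; toList)
open import Data.Vec.Properties using (take++drop≡id)
import Data.Vec.Relation.Unary.All as VAll
import Data.Vec.Relation.Unary.All.Properties as VAllₚ
open import Relation.Binary using (IsEquivalence)
open import Relation.Binary.PropositionalEquality as ≡
  using (refl; sym; trans; cong; cong₂; subst; subst₂)
open import Relation.Nullary using (¬_; Dec; yes; no)
open import Relation.Nullary.Decidable using (¬?; _×-dec_; _⊎-dec_)

-- That -1 is a non-residue keeps the coordinates of solutions away from 0 and ±2, and makes the
-- single extension K = F(𝕚) contain the eigenvalues for every x. Adjoining 𝕚 serves a second
-- purpose: u_i² - 4, multiplied by ω^(2i), is a quadratic polynomial in ω^(2i) whose roots are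
-- explicit once -4/(x² - 4) has a square root.
--
-- Stepanov's method must work on a group whose order L may be a mere multiple of √ℓ. Hence the
-- auxiliary polynomial is cut into blocks X^(jL) (A + f^M B), whose outer factors can be eliminated
-- at the points counted. Multiplicity 8t against blocks of length about 64t, with t about L/128,
-- bounds the share of one type by 9/16 and that of agreement of two types by 10/16, up to small
-- errors. The pattern forced by the block would make a weighted sum at least 5 per index, where
-- these shares allow 68/16. For two types a simple root of a product of two quadratics is needed;
-- it can fail to exist only for x² = 8 and special pairs of points, whose types differ at every
-- index, and there the relations between the rotations suffice.

-- Binomial coefficients, numerals in rings, and the p-th power map

absorption : ∀ n k → suc k ℕ.* (suc n choose suc k) ≡ suc n ℕ.* (n choose k)
absorption zero    zero    = ≡.refl
absorption zero    (suc k) = ≡.trans (≡.cong (suc (suc k) ℕ.*_) (k>n⇒nCk≡0 {1} {suc (suc k)} (ℕ.s≤s (ℕ.s≤s ℕ.z≤n))))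
                               (≡.trans (ℕₚ.*-zeroʳ (suc (suc k))) (≡.sym (≡.cong (ℕ._+ 0) (k>n⇒nCk≡0 {0} {suc k} (ℕ.s≤s ℕ.z≤n)))))
absorption (suc n) zero    = ≡.trans (≡.cong (ℕ._+ 0) (nC1≡n (suc (suc n))))
                               (≡.trans (ℕₚ.+-identityʳ _) (≡.sym (ℕₚ.*-identityʳ _)))
absorption (suc n) (suc k) = begin
  suc (suc k) ℕ.* (suc (suc n) choose suc (suc k))
    ≡⟨ ≡.cong (suc (suc k) ℕ.*_) (≡.sym (nCk+nC[k+1]≡[n+1]C[k+1] (suc n) (suc k))) ⟩
  suc (suc k) ℕ.* (a ℕ.+ (suc n choose suc (suc k)))
    ≡⟨ ℕₚ.*-distribˡ-+ (suc (suc k)) a _ ⟩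
  (a ℕ.+ suc k ℕ.* a) ℕ.+ suc (suc k) ℕ.* (suc n choose suc (suc k))
    ≡⟨ ≡.cong₂ (λ u w → (a ℕ.+ u) ℕ.+ w) (absorption n k) (absorption n (suc k)) ⟩
  (a ℕ.+ suc n ℕ.* (n choose k)) ℕ.+ suc n ℕ.* (n choose suc k)
    ≡⟨ ℕₚ.+-assoc a _ _ ⟩
  a ℕ.+ (suc n ℕ.* (n choose k) ℕ.+ suc n ℕ.* (n choose suc k))
    ≡⟨ ≡.cong (a ℕ.+_) (≡.sym (ℕₚ.*-distribˡ-+ (suc n) (n choose k) _)) ⟩
  a ℕ.+ suc n ℕ.* ((n choose k) ℕ.+ (n choose suc k))
    ≡⟨ ≡.cong (λ u → a ℕ.+ suc n ℕ.* u) (nCk+nC[k+1]≡[n+1]C[k+1] n k) ⟩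
  suc (suc n) ℕ.* (suc n choose suc k) ∎
  where
  open ≡.≡-Reasoning
  a = suc n choose suc k

-- By `absorption`, p divides k + 1 times this coefficient, and it cannot divide k + 1 < p.
p∣pCk : ∀ {p} → Prime p → ∀ k → suc k ℕ.< p → p ∣ (p choose suc k)
p∣pCk {zero}  pr k ()
p∣pCk {suc n} pr k k<p with euclidsLemma (suc k) (suc n choose suc k) pr
                              (≡.subst (suc n ∣_) (≡.sym (absorption n k)) (m∣m*n (n choose k)))
... | inj₁ d = ⊥-elim (ℕₚ.<⇒≱ k<p (∣⇒≤ d))
... | inj₂ d = d

module RingSolver {c ℓ} (R : CommutativeRing c ℓ) where
  open CommutativeRing R renaming (refl to ≈-refl; sym to ≈-sym; trans to ≈-trans; reflexive to ≈-reflexive)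
  open import Algebra.Properties.Ring ring
    using (-0#≈0#; -‿distribˡ-*; -‿distribʳ-*; -‿involutive; -‿+-comm)
  open import Algebra.Properties.Semiring.Mult.TCOptimised semiring
    using (×-homo-+; ×1-homo-*) renaming (_×_ to _×ᴿ_)
  open import Relation.Binary.Reasoning.Setoid setoid

  -- With the type-checking-optimised multiple, `ι 2` and `ι 3` are definitionally `1# + 1#` and
  -- `1# + 1# + 1#`; later proofs rely on this when they turn facts about numerals into facts about
  -- sums of ones.
  ι : ℕ → Carrier
  ι n = n ×ᴿ 1#

  ⟦_⟧ᶻ : ℤ → Carrier
  ⟦ ⁺ n ⟧ᶻ = ι n
  ⟦ -[1+ n ] ⟧ᶻ = - ι (suc n)

  private
    neg-homo : ∀ i → ⟦ ℤ.- i ⟧ᶻ ≈ - ⟦ i ⟧ᶻ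
    neg-homo (⁺ zero)  = ≈-sym -0#≈0#
    neg-homo (⁺ suc n) = ≈-refl
    neg-homo -[1+ n ]  = ≈-sym (-‿involutive _)

    ∸-homo : ∀ {m n} → m ℕ.≤ n → ι (n ℕ.∸ m) ≈ ι n + - ι m
    ∸-homo {m} {n} m≤n = begin
      ι (n ℕ.∸ m)                       ≈⟨ +-identityʳ _ ⟨
      ι (n ℕ.∸ m) + 0#                  ≈⟨ +-congˡ (-‿inverseʳ (ι m)) ⟨
      ι (n ℕ.∸ m) + (ι m + - ι m)       ≈⟨ +-assoc _ _ _ ⟨
      (ι (n ℕ.∸ m) + ι m) + - ι m       ≈⟨ +-congʳ (×-homo-+ 1# (n ℕ.∸ m) m) ⟨
      ι (n ℕ.∸ m ℕ.+ m) + - ι m         ≡⟨ ≡.cong (λ u → ι u + - ι m) (ℕₚ.m∸n+n≡m m≤n) ⟩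
      ι n + - ι m                       ∎

    ⊖-homo : ∀ m n → ⟦ m ℤ.⊖ n ⟧ᶻ ≈ ι m + - ι n
    ⊖-homo m n with ℕₚ.≤-total n m
    ... | inj₁ n≤m = begin
      ⟦ m ℤ.⊖ n ⟧ᶻ  ≡⟨ ≡.cong ⟦_⟧ᶻ (ℤₚ.⊖-≥ n≤m) ⟩
      ι (m ℕ.∸ n)   ≈⟨ ∸-homo n≤m ⟩
      ι m + - ι n   ∎
    ... | inj₂ m≤n = begin
      ⟦ m ℤ.⊖ n ⟧ᶻ            ≡⟨ ≡.cong ⟦_⟧ᶻ (ℤₚ.⊖-≤ m≤n) ⟩
      ⟦ ℤ.- (⁺ (n ℕ.∸ m)) ⟧ᶻ  ≈⟨ neg-homo (⁺ (n ℕ.∸ m)) ⟩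
      - ι (n ℕ.∸ m)           ≈⟨ -‿cong (∸-homo m≤n) ⟩
      - (ι n + - ι m)         ≈⟨ -‿+-comm _ _ ⟨
      - ι n + - - ι m         ≈⟨ +-congˡ (-‿involutive _) ⟩
      - ι n + ι m             ≈⟨ +-comm _ _ ⟩
      ι m + - ι n             ∎

    +-homoᶻ : ∀ i j → ⟦ i ℤ.+ j ⟧ᶻ ≈ ⟦ i ⟧ᶻ + ⟦ j ⟧ᶻ
    +-homoᶻ (⁺ m)    (⁺ n)    = ×-homo-+ 1# m n
    +-homoᶻ (⁺ m)    -[1+ n ] = ⊖-homo m (suc n)
    +-homoᶻ -[1+ m ] (⁺ n)    = ≈-trans (⊖-homo n (suc m)) (+-comm _ _)
    +-homoᶻ -[1+ m ] -[1+ n ] = begin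
      - ι (suc (suc (m ℕ.+ n)))    ≡⟨ ≡.cong (λ u → - ι u) (≡.sym (ℕₚ.+-suc (suc m) n)) ⟩
      - ι (suc m ℕ.+ suc n)        ≈⟨ -‿cong (×-homo-+ 1# (suc m) (suc n)) ⟩
      - (ι (suc m) + ι (suc n))    ≈⟨ -‿+-comm _ _ ⟨
      - ι (suc m) + - ι (suc n)    ∎

    -◃-homo : ∀ n → ⟦ Sign.- ℤ.◃ n ⟧ᶻ ≈ - ι n
    -◃-homo zero    = ≈-sym -0#≈0#
    -◃-homo (suc n) = ≈-refl

    *-homoᶻ : ∀ i j → ⟦ i ℤ.* j ⟧ᶻ ≈ ⟦ i ⟧ᶻ * ⟦ j ⟧ᶻ
    *-homoᶻ (⁺ m)    (⁺ n)    = begin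
      ⟦ Sign.+ ℤ.◃ m ℕ.* n ⟧ᶻ  ≡⟨ ≡.cong ⟦_⟧ᶻ (ℤₚ.+◃n≡+n (m ℕ.* n)) ⟩
      ι (m ℕ.* n)              ≈⟨ ×1-homo-* m n ⟩
      ι m * ι n                ∎
    *-homoᶻ (⁺ m)    -[1+ n ] = begin
      ⟦ Sign.- ℤ.◃ m ℕ.* suc n ⟧ᶻ  ≈⟨ -◃-homo (m ℕ.* suc n) ⟩
      - ι (m ℕ.* suc n)            ≈⟨ -‿cong (×1-homo-* m (suc n)) ⟩
      - (ι m * ι (suc n))          ≈⟨ -‿distribʳ-* _ _ ⟩
      ι m * - ι (suc n)            ∎
    *-homoᶻ -[1+ m ] (⁺ n)    = begin
      ⟦ Sign.- ℤ.◃ suc m ℕ.* n ⟧ᶻ  ≈⟨ -◃-homo (suc m ℕ.* n) ⟩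
      - ι (suc m ℕ.* n)            ≈⟨ -‿cong (×1-homo-* (suc m) n) ⟩
      - (ι (suc m) * ι n)          ≈⟨ -‿distribˡ-* _ _ ⟩
      - ι (suc m) * ι n            ∎
    *-homoᶻ -[1+ m ] -[1+ n ] = begin
      ι (suc m ℕ.* suc n)            ≈⟨ ×1-homo-* (suc m) (suc n) ⟩
      ι (suc m) * ι (suc n)          ≈⟨ -‿involutive _ ⟨
      - - (ι (suc m) * ι (suc n))    ≈⟨ -‿cong (-‿distribʳ-* _ _) ⟩
      - (ι (suc m) * - ι (suc n))    ≈⟨ -‿distribˡ-* _ _ ⟩
      - ι (suc m) * - ι (suc n)      ∎

    -- Coefficients are taken in ℤ, where equality is decidable, so that the solver can cancel
    -- numerals even in rings whose own equality comes without a decision procedure, such as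
    -- polynomials.
    morphism : ℤ.+-*-rawRing -Raw-AlmostCommutative⟶ fromCommutativeRing R
    morphism = record
      { ⟦_⟧    = ⟦_⟧ᶻ
      ; +-homo = +-homoᶻ
      ; *-homo = *-homoᶻ
      ; -‿homo = neg-homo
      ; 0-homo = ≈-refl
      ; 1-homo = ≈-refl
      }

    _coeff≟_ : ∀ i j → Maybe (⟦ i ⟧ᶻ ≈ ⟦ j ⟧ᶻ)
    i coeff≟ j with i ℤₚ.≟ j
    ... | yes i≡j = just (≈-reflexive (≡.cong ⟦_⟧ᶻ i≡j))
    ... | no  _   = nothing

  open import Algebra.Solver.Ring ℤ.+-*-rawRing (fromCommutativeRing R) morphism _coeff≟_ public
    using (Polynomial; solve; _:=_; _:+_; _:*_; _:-_; :-_; con; _:^_)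

  :ι : ∀ {n} → ℕ → Polynomial n
  :ι k = con (⁺ k)

module FreshmansDream {c ℓ} (R : CommutativeRing c ℓ) where
  open CommutativeRing R renaming (refl to ≈-refl; sym to ≈-sym; trans to ≈-trans; reflexive to ≈-reflexive)
  open import Algebra.Properties.Semiring.Mult semiring
    using (×-congʳ; ×-assocˡ; ×-assoc-*; ×-homo-1) renaming (_×_ to _×ᴿ_)
  open import Algebra.Properties.Semiring.Exp semiring using (_^_; ^-cong)
  open import Algebra.Properties.CommutativeMonoid.Sum +-commutativeMonoid
    using (sum; sum-cong-≋; sum-init-last; sum-replicate-zero)
  open import Algebra.Properties.CommutativeSemiring.Binomial commutativeSemiring
    using (theorem; binomialTerm; binomialExpansion)
  open import Relation.Binary.Reasoning.Setoid setoid

  multiple-vanishes : ∀ {p} → p ×ᴿ 1# ≈ 0# → ∀ {n} → p ∣ n → ∀ x → n ×ᴿ x ≈ 0#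
  multiple-vanishes {p} p×1≈0 (divides q ≡.refl) x = begin
    (q ℕ.* p) ×ᴿ x          ≡⟨ ≡.cong (_×ᴿ x) (ℕₚ.*-comm q p) ⟩
    (p ℕ.* q) ×ᴿ x          ≈⟨ ×-assocˡ x p q ⟨
    p ×ᴿ (q ×ᴿ x)            ≈⟨ ×-congʳ p (*-identityˡ _) ⟨
    p ×ᴿ (1# * (q ×ᴿ x))     ≈⟨ ×-assoc-* p 1# (q ×ᴿ x) ⟨
    (p ×ᴿ 1#) * (q ×ᴿ x)     ≈⟨ *-congʳ p×1≈0 ⟩
    0# * (q ×ᴿ x)           ≈⟨ zeroˡ _ ⟩
    0#                     ∎

  private
    sum-zero : ∀ n (f : Fin n → Carrier) → (∀ i → f i ≈ 0#) → sum f ≈ 0#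
    sum-zero n f f≈0 = ≈-trans (sum-cong-≋ f≈0) (sum-replicate-zero n)

  -- All inner binomial coefficients are multiples of p. The generality serves three rings:
  -- polynomials (p-th powers modulo X^p), the prime field (Fermat) and the extension by 𝕚
  -- (Frobenius).
  freshman : ∀ {p} → Prime p → p ×ᴿ 1# ≈ 0# → ∀ x y → (x + y) ^ p ≈ x ^ p + y ^ p
  freshman {suc (suc n)} pr p×1≈0 x y = begin
    (x + y) ^ p                        ≈⟨ theorem p x y ⟩
    sum t                              ≈⟨ +-congˡ (sum-init-last (λ i → t (Fin.suc i))) ⟩
    t Fin.zero + (sum inner + t (Fin.fromℕ p))
                                       ≈⟨ +-cong first (≈-trans (+-congʳ (sum-zero _ inner inner≈0)) (+-identityˡ _)) ⟩
    y ^ p + t (Fin.fromℕ p)            ≈⟨ +-congˡ last ⟩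
    y ^ p + x ^ p                      ≈⟨ +-comm _ _ ⟩
    x ^ p + y ^ p                      ∎
    where
    p = suc (suc n)
    t = binomialTerm x y p
    inner : Fin (suc n) → Carrier
    inner i = t (Fin.suc (Fin.inject₁ i))
    inner≈0 : ∀ i → inner i ≈ 0#
    inner≈0 i = multiple-vanishes p×1≈0
      (≡.subst (λ u → p ∣ (p choose suc u)) (≡.sym (Finₚ.toℕ-inject₁ i))
         (p∣pCk pr (toℕ i) (ℕ.s≤s (Finₚ.toℕ<n i)))) _
    first : t Fin.zero ≈ y ^ p
    first = ≈-trans (×-homo-1 _) (*-identityˡ _)
    last : t (Fin.fromℕ p) ≈ x ^ p
    last = begin
      (p choose toℕ (Fin.fromℕ p)) ×ᴿ (x ^ toℕ (Fin.fromℕ p) * y ^ (p ℕ.∸ toℕ (Fin.fromℕ p)))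
        ≡⟨ ≡.cong (λ u → (p choose u) ×ᴿ (x ^ u * y ^ (p ℕ.∸ u))) (Finₚ.toℕ-fromℕ p) ⟩
      (p choose p) ×ᴿ (x ^ p * y ^ (p ℕ.∸ p))
        ≡⟨ ≡.cong₂ (λ u w → u ×ᴿ (x ^ p * y ^ w)) (nCn≡1 p) (ℕₚ.n∸n≡0 p) ⟩
      1 ×ᴿ (x ^ p * 1#)
        ≈⟨ ×-homo-1 _ ⟩
      x ^ p * 1#
        ≈⟨ *-identityʳ _ ⟩
      x ^ p ∎

-- Fields and polynomials

record Field : Set₁ where
  infix  8 -_
  infixl 7 _*_
  infixl 6 _+_
  infix  4 _≟_
  field
    Carrier : Set
    _+_ _*_ : Carrier → Carrier → Carrier
    -_      : Carrier → Carrier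
    0# 1#   : Carrier
    isCommutativeRing : AS.IsCommutativeRing _≡_ _+_ _*_ -_ 0# 1#
    _⁻¹     : Carrier → Carrier
    inverse : ∀ x → ¬ (x ≡ 0#) → x * (x ⁻¹) ≡ 1#
    1≢0     : ¬ (1# ≡ 0#)
    _≟_     : (x y : Carrier) → Dec (x ≡ y)

  commutativeRing : CommutativeRing _ _
  commutativeRing = record { isCommutativeRing = isCommutativeRing }

  open CommutativeRing commutativeRing public
    using (_-_; +-comm; +-assoc; +-identityˡ; +-identityʳ; -‿inverseʳ; -‿inverseˡ;
           *-comm; *-assoc; *-identityˡ; *-identityʳ; zeroˡ; zeroʳ; distribˡ; distribʳ; semiring; ring)
  open import Algebra.Properties.Semiring.Exp semiring public using (_^_; ^-homo-*; ^-assocʳ)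
  open import Algebra.Properties.CommutativeSemiring.Exp (CommutativeRing.commutativeSemiring commutativeRing) public using (^-distrib-*)
  open RingSolver commutativeRing public using (ι)

module FieldProps (F : Field) where
  open Field F
  open RingSolver commutativeRing hiding (ι)
  open import Algebra.Properties.Semiring.Mult.TCOptimised semiring using (1+×)

  ι-suc : ∀ n → ι (suc n) ≡ 1# + ι n
  ι-suc n = 1+× n 1#

  *-cancel-0 : ∀ {x y} → ¬ (x ≡ 0#) → x * y ≡ 0# → y ≡ 0#
  *-cancel-0 {x} {y} x≢0 xy≡0 = begin
    y                ≡⟨ sym (*-identityˡ y) ⟩
    1# * y           ≡⟨ cong (_* y) (sym (inverse x x≢0)) ⟩
    x * x ⁻¹ * y     ≡⟨ solve 3 (λ x x' y → x :* x' :* y := x' :* (x :* y)) refl x (x ⁻¹) y ⟩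
    x ⁻¹ * (x * y)   ≡⟨ cong (x ⁻¹ *_) xy≡0 ⟩
    x ⁻¹ * 0#        ≡⟨ zeroʳ _ ⟩
    0#               ∎
    where open ≡.≡-Reasoning

  zero-product : ∀ {x y} → x * y ≡ 0# → x ≡ 0# ⊎ y ≡ 0#
  zero-product {x} xy≡0 with x ≟ 0#
  ... | yes x≡0 = inj₁ x≡0
  ... | no  x≢0 = inj₂ (*-cancel-0 x≢0 xy≡0)

  square-zero : ∀ {x} → x * x ≡ 0# → x ≡ 0#
  square-zero {x} e with x ≟ 0#
  ... | yes x≡0 = x≡0
  ... | no  x≢0 = *-cancel-0 x≢0 e

  *-nonzero : ∀ {x y} → ¬ (x ≡ 0#) → ¬ (y ≡ 0#) → ¬ (x * y ≡ 0#)
  *-nonzero x≢0 y≢0 xy≡0 = y≢0 (*-cancel-0 x≢0 xy≡0)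

  ^-nonzero : ∀ {x} n → ¬ (x ≡ 0#) → ¬ (x ^ n ≡ 0#)
  ^-nonzero zero    x≢0 = 1≢0
  ^-nonzero (suc n) x≢0 = *-nonzero x≢0 (^-nonzero n x≢0)

  x-y≡0⇒x≡y : ∀ {x y} → x - y ≡ 0# → x ≡ y
  x-y≡0⇒x≡y {x} {y} e = begin
    x            ≡⟨ solve 2 (λ x y → x := x :- y :+ y) refl x y ⟩
    x - y + y    ≡⟨ cong (_+ y) e ⟩
    0# + y       ≡⟨ +-identityˡ y ⟩
    y            ∎
    where open ≡.≡-Reasoning

  x≡y⇒x-y≡0 : ∀ {x y} → x ≡ y → x - y ≡ 0#
  x≡y⇒x-y≡0 {x} refl = -‿inverseʳ x

  *-cancelˡ : ∀ {x y z} → ¬ (x ≡ 0#) → x * y ≡ x * z → y ≡ z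
  *-cancelˡ {x} {y} {z} x≢0 e = x-y≡0⇒x≡y (*-cancel-0 x≢0 (trans
    (solve 3 (λ x y z → x :* (y :- z) := x :* y :- x :* z) refl x y z) (x≡y⇒x-y≡0 e)))

  square-eq : ∀ {x y} → x * x ≡ y * y → x ≡ y ⊎ x ≡ - y
  square-eq {x} {y} e with zero-product {x - y} {x + y} (trans
    (solve 2 (λ x y → (x :- y) :* (x :+ y) := x :* x :- y :* y) refl x y) (x≡y⇒x-y≡0 e))
  ... | inj₁ d = inj₁ (x-y≡0⇒x≡y d)
  ... | inj₂ s = inj₂ (x-y≡0⇒x≡y (trans (solve 2 (λ x y → x :- (:- y) := x :+ y) refl x y) s))

  1^n : ∀ n → 1# ^ n ≡ 1#
  1^n zero    = refl
  1^n (suc n) = trans (*-identityˡ _) (1^n n)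

module Polynomials (F : Field) where
  open Field F
  open FieldProps F
  open RingSolver commutativeRing hiding (ι)
  open ≡.≡-Reasoning

  Poly : Set
  Poly = List Carrier

  coef : Poly → ℕ → Carrier
  coef []      i       = 0#
  coef (a ∷ p) zero    = a
  coef (a ∷ p) (suc i) = coef p i

  infix 4 _≈_
  -- Lists may end in zeros, so polynomials are compared coefficient by coefficient. The record
  -- keeps `p` and `q` recoverable by unification, which a bare function type would not.
  record _≈_ (p q : Poly) : Set where
    constructor mk
    field at : ∀ i → coef p i ≡ coef q i
  open _≈_ public

  ≈-refl : ∀ {p} → p ≈ p
  ≈-refl .at i = refl
  ≈-sym : ∀ {p q} → p ≈ q → q ≈ p
  ≈-sym e .at i = sym (e .at i)
  ≈-trans : ∀ {p q r} → p ≈ q → q ≈ r → p ≈ r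
  ≈-trans e f .at i = trans (e .at i) (f .at i)

  ∷-cong : ∀ {a b p q} → a ≡ b → p ≈ q → a ∷ p ≈ b ∷ q
  ∷-cong a≡b e .at zero    = a≡b
  ∷-cong a≡b e .at (suc i) = e .at i

  0∷[] : 0# ∷ [] ≈ []
  0∷[] .at zero    = refl
  0∷[] .at (suc i) = refl

  infixl 6 _⊕_
  infixl 7 _⊗_
  infixr 7 _∙_ X^_⊙_

  _⊕_ : Poly → Poly → Poly
  []      ⊕ q       = q
  (a ∷ p) ⊕ []      = a ∷ p
  (a ∷ p) ⊕ (b ∷ q) = (a + b) ∷ (p ⊕ q)

  _∙_ : Carrier → Poly → Poly
  a ∙ p = map (a *_) p

  ⊖_ : Poly → Poly
  ⊖ p = map -_ p

  _⊗_ : Poly → Poly → Poly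
  []      ⊗ q = []
  (a ∷ p) ⊗ q = a ∙ q ⊕ (0# ∷ p ⊗ q)

  coef-⊕ : ∀ p q i → coef (p ⊕ q) i ≡ coef p i + coef q i
  coef-⊕ []      q       i       = sym (+-identityˡ _)
  coef-⊕ (a ∷ p) []      i       = sym (+-identityʳ _)
  coef-⊕ (a ∷ p) (b ∷ q) zero    = refl
  coef-⊕ (a ∷ p) (b ∷ q) (suc i) = coef-⊕ p q i

  coef-∙ : ∀ a p i → coef (a ∙ p) i ≡ a * coef p i
  coef-∙ a []      i       = sym (zeroʳ a)
  coef-∙ a (b ∷ p) zero    = refl
  coef-∙ a (b ∷ p) (suc i) = coef-∙ a p i

  coef-⊖ : ∀ p i → coef (⊖ p) i ≡ - coef p i
  coef-⊖ []      i       = solve 0 (:ι 0 := :- :ι 0) refl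
  coef-⊖ (b ∷ p) zero    = refl
  coef-⊖ (b ∷ p) (suc i) = coef-⊖ p i

  ⊕-cong : ∀ {p p′ q q′} → p ≈ p′ → q ≈ q′ → p ⊕ q ≈ p′ ⊕ q′
  ⊕-cong {p} {p′} {q} {q′} e f .at i = begin
    coef (p ⊕ q) i          ≡⟨ coef-⊕ p q i ⟩
    coef p i + coef q i     ≡⟨ cong₂ _+_ (e .at i) (f .at i) ⟩
    coef p′ i + coef q′ i   ≡⟨ sym (coef-⊕ p′ q′ i) ⟩
    coef (p′ ⊕ q′) i        ∎

  ∙-cong : ∀ {a b p q} → a ≡ b → p ≈ q → a ∙ p ≈ b ∙ q
  ∙-cong {a} {b} {p} {q} refl e .at i = begin
    coef (a ∙ p) i   ≡⟨ coef-∙ a p i ⟩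
    a * coef p i     ≡⟨ cong (a *_) (e .at i) ⟩
    a * coef q i     ≡⟨ sym (coef-∙ a q i) ⟩
    coef (a ∙ q) i   ∎

  ⊖-cong : ∀ {p q} → p ≈ q → ⊖ p ≈ ⊖ q
  ⊖-cong {p} {q} e .at i = trans (coef-⊖ p i) (trans (cong -_ (e .at i)) (sym (coef-⊖ q i)))

  ⊕-comm : ∀ p q → p ⊕ q ≈ q ⊕ p
  ⊕-comm p q .at i = trans (coef-⊕ p q i) (trans (+-comm _ _) (sym (coef-⊕ q p i)))

  ⊕-assoc : ∀ p q r → (p ⊕ q) ⊕ r ≈ p ⊕ (q ⊕ r)
  ⊕-assoc p q r .at i = begin
    coef ((p ⊕ q) ⊕ r) i                ≡⟨ coef-⊕ (p ⊕ q) r i ⟩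
    coef (p ⊕ q) i + coef r i           ≡⟨ cong (_+ coef r i) (coef-⊕ p q i) ⟩
    coef p i + coef q i + coef r i      ≡⟨ +-assoc _ _ _ ⟩
    coef p i + (coef q i + coef r i)    ≡⟨ cong (coef p i +_) (sym (coef-⊕ q r i)) ⟩
    coef p i + coef (q ⊕ r) i           ≡⟨ sym (coef-⊕ p (q ⊕ r) i) ⟩
    coef (p ⊕ (q ⊕ r)) i                ∎

  ⊕-identityʳ : ∀ p → p ⊕ [] ≈ p
  ⊕-identityʳ p .at i = trans (coef-⊕ p [] i) (+-identityʳ _)

  ⊖-inverseˡ : ∀ p → ⊖ p ⊕ p ≈ []
  ⊖-inverseˡ p .at i = trans (coef-⊕ (⊖ p) p i) (trans (cong (_+ coef p i) (coef-⊖ p i)) (-‿inverseˡ _))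

  ⊖-inverseʳ : ∀ p → p ⊕ ⊖ p ≈ []
  ⊖-inverseʳ p = ≈-trans (⊕-comm p (⊖ p)) (⊖-inverseˡ p)

  ⊕-interchange : ∀ p q r s → (p ⊕ q) ⊕ (r ⊕ s) ≈ (p ⊕ r) ⊕ (q ⊕ s)
  ⊕-interchange p q r s .at i = begin
    coef ((p ⊕ q) ⊕ (r ⊕ s)) i
      ≡⟨ trans (coef-⊕ (p ⊕ q) (r ⊕ s) i) (cong₂ _+_ (coef-⊕ p q i) (coef-⊕ r s i)) ⟩
    coef p i + coef q i + (coef r i + coef s i)
      ≡⟨ solve 4 (λ p q r s → p :+ q :+ (r :+ s) := p :+ r :+ (q :+ s)) refl _ _ _ _ ⟩
    coef p i + coef r i + (coef q i + coef s i)
      ≡⟨ sym (trans (coef-⊕ (p ⊕ r) (q ⊕ s) i) (cong₂ _+_ (coef-⊕ p r i) (coef-⊕ q s i))) ⟩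
    coef ((p ⊕ r) ⊕ (q ⊕ s)) i ∎

  ∙-distrib-⊕ : ∀ a p q → a ∙ (p ⊕ q) ≈ a ∙ p ⊕ a ∙ q
  ∙-distrib-⊕ a p q .at i = begin
    coef (a ∙ (p ⊕ q)) i               ≡⟨ trans (coef-∙ a (p ⊕ q) i) (cong (a *_) (coef-⊕ p q i)) ⟩
    a * (coef p i + coef q i)          ≡⟨ distribˡ a _ _ ⟩
    a * coef p i + a * coef q i        ≡⟨ sym (trans (coef-⊕ (a ∙ p) (a ∙ q) i) (cong₂ _+_ (coef-∙ a p i) (coef-∙ a q i))) ⟩
    coef (a ∙ p ⊕ a ∙ q) i             ∎

  ∙-assoc : ∀ a b p → (a * b) ∙ p ≈ a ∙ (b ∙ p)
  ∙-assoc a b p .at i = begin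
    coef ((a * b) ∙ p) i     ≡⟨ coef-∙ (a * b) p i ⟩
    a * b * coef p i         ≡⟨ *-assoc a b _ ⟩
    a * (b * coef p i)       ≡⟨ cong (a *_) (sym (coef-∙ b p i)) ⟩
    a * coef (b ∙ p) i       ≡⟨ sym (coef-∙ a (b ∙ p) i) ⟩
    coef (a ∙ (b ∙ p)) i     ∎

  0∙ : ∀ p → 0# ∙ p ≈ []
  0∙ p .at i = trans (coef-∙ 0# p i) (zeroˡ _)

  1∙ : ∀ p → 1# ∙ p ≈ p
  1∙ p .at i = trans (coef-∙ 1# p i) (*-identityˡ _)

  ∙-0∷ : ∀ a p → a ∙ (0# ∷ p) ≈ 0# ∷ a ∙ p
  ∙-0∷ a p = ∷-cong (zeroʳ a) ≈-refl

  0∷-⊕ : ∀ p q → (0# ∷ p) ⊕ (0# ∷ q) ≈ 0# ∷ (p ⊕ q)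
  0∷-⊕ p q = ∷-cong (+-identityˡ 0#) ≈-refl

  0∷-cong : ∀ {p q} → p ≈ q → 0# ∷ p ≈ 0# ∷ q
  0∷-cong = ∷-cong refl

  ⊗-congˡ : ∀ p {q r} → q ≈ r → p ⊗ q ≈ p ⊗ r
  ⊗-congˡ []      e = ≈-refl
  ⊗-congˡ (a ∷ p) e = ⊕-cong (∙-cong refl e) (0∷-cong (⊗-congˡ p e))

  ⊗-distribˡ : ∀ p q r → p ⊗ (q ⊕ r) ≈ p ⊗ q ⊕ p ⊗ r
  ⊗-distribˡ []      q r = ≈-refl
  ⊗-distribˡ (a ∷ p) q r = ≈-trans
    (⊕-cong (∙-distrib-⊕ a q r) (≈-trans (0∷-cong (⊗-distribˡ p q r)) (≈-sym (0∷-⊕ (p ⊗ q) (p ⊗ r)))))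
    (⊕-interchange (a ∙ q) (a ∙ r) (0# ∷ p ⊗ q) (0# ∷ p ⊗ r))

  ⊗-zeroʳ : ∀ p → p ⊗ [] ≈ []
  ⊗-zeroʳ []      = ≈-refl
  ⊗-zeroʳ (a ∷ p) = ≈-trans (0∷-cong (⊗-zeroʳ p)) 0∷[]

  ⊗-∷ : ∀ p b q → p ⊗ (b ∷ q) ≈ b ∙ p ⊕ (0# ∷ p ⊗ q)
  ⊗-∷ []      b q = ≈-sym 0∷[]
  ⊗-∷ (a ∷ p) b q = ∷-cong (cong (_+ 0#) (*-comm a b)) (≈-trans
    (⊕-cong (≈-refl {a ∙ q}) (⊗-∷ p b q))
    (≈-trans (≈-sym (⊕-assoc (a ∙ q) (b ∙ p) _))
      (≈-trans (⊕-cong (⊕-comm (a ∙ q) (b ∙ p)) ≈-refl) (⊕-assoc (b ∙ p) (a ∙ q) _))))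

  ⊗-comm : ∀ p q → p ⊗ q ≈ q ⊗ p
  ⊗-comm []      q = ≈-sym (⊗-zeroʳ q)
  ⊗-comm (a ∷ p) q = ≈-trans (⊕-cong (≈-refl {a ∙ q}) (0∷-cong (⊗-comm p q))) (≈-sym (⊗-∷ q a p))

  ⊗-cong : ∀ {p p′ q q′} → p ≈ p′ → q ≈ q′ → p ⊗ q ≈ p′ ⊗ q′
  ⊗-cong {p} {p′} {q} {q′} e f = ≈-trans (⊗-congˡ p f)
    (≈-trans (⊗-comm p q′) (≈-trans (⊗-congˡ q′ e) (⊗-comm q′ p′)))

  ⊗-distribʳ : ∀ r p q → (p ⊕ q) ⊗ r ≈ p ⊗ r ⊕ q ⊗ r
  ⊗-distribʳ r p q = ≈-trans (⊗-comm (p ⊕ q) r)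
    (≈-trans (⊗-distribˡ r p q) (⊕-cong (⊗-comm r p) (⊗-comm r q)))

  ∙-⊗ : ∀ a p q → (a ∙ p) ⊗ q ≈ a ∙ (p ⊗ q)
  ∙-⊗ a []      q = ≈-refl
  ∙-⊗ a (b ∷ p) q = ≈-trans
    (⊕-cong (∙-assoc a b q) (≈-trans (0∷-cong (∙-⊗ a p q)) (≈-sym (∙-0∷ a (p ⊗ q)))))
    (≈-sym (∙-distrib-⊕ a (b ∙ q) (0# ∷ p ⊗ q)))

  0∷-⊗ : ∀ p q → (0# ∷ p) ⊗ q ≈ 0# ∷ (p ⊗ q)
  0∷-⊗ p q = ⊕-cong (0∙ q) (≈-refl {0# ∷ p ⊗ q})

  ⊗-assoc : ∀ p q r → (p ⊗ q) ⊗ r ≈ p ⊗ (q ⊗ r)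
  ⊗-assoc []      q r = ≈-refl
  ⊗-assoc (a ∷ p) q r = ≈-trans (⊗-distribʳ r (a ∙ q) (0# ∷ p ⊗ q))
    (⊕-cong (∙-⊗ a q r) (≈-trans (0∷-⊗ (p ⊗ q) r) (0∷-cong (⊗-assoc p q r))))

  ⊗-identityˡ : ∀ p → (1# ∷ []) ⊗ p ≈ p
  ⊗-identityˡ p = ≈-trans (⊕-cong (1∙ p) 0∷[]) (⊕-identityʳ p)

  polyRing : CommutativeRing _ _
  polyRing = record
    { Carrier = Poly ; _≈_ = _≈_ ; _+_ = _⊕_ ; _*_ = _⊗_ ; -_ = ⊖_ ; 0# = [] ; 1# = 1# ∷ []
    ; isCommutativeRing = record
      { isRing = record
        { +-isAbelianGroup = record
          { isGroup = record
            { isMonoid = record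
              { isSemigroup = record
                { isMagma = record { isEquivalence = equiv ; ∙-cong = ⊕-cong }
                ; assoc = ⊕-assoc }
              ; identity = (λ _ → ≈-refl) , ⊕-identityʳ }
            ; inverse = ⊖-inverseˡ , ⊖-inverseʳ
            ; ⁻¹-cong = ⊖-cong }
          ; comm = ⊕-comm }
        ; *-cong = ⊗-cong
        ; *-assoc = ⊗-assoc
        ; *-identity = ⊗-identityˡ , (λ p → ≈-trans (⊗-comm p (1# ∷ [])) (⊗-identityˡ p))
        ; distrib = ⊗-distribˡ , ⊗-distribʳ }
      ; *-comm = ⊗-comm } }
    where
    equiv : IsEquivalence _≈_
    equiv = record { refl = ≈-refl ; sym = ≈-sym ; trans = ≈-trans }

  open CommutativeRing polyRing public using () renaming (setoid to polySetoid; semiring to polySemiring)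
  open import Algebra.Properties.Semiring.Exp polySemiring public
    using () renaming (_^_ to _^ᴾ_; ^-cong to ^ᴾ-cong; ^-homo-* to ^ᴾ-homo)

  ∙≈⊗ : ∀ a p → a ∙ p ≈ (a ∷ []) ⊗ p
  ∙≈⊗ a p = ≈-sym (≈-trans (⊕-cong (≈-refl {a ∙ p}) 0∷[]) (⊕-identityʳ _))

  ev : Poly → Carrier → Carrier
  ev []      x = 0#
  ev (a ∷ p) x = a + x * ev p x

  ev-⊕ : ∀ p q x → ev (p ⊕ q) x ≡ ev p x + ev q x
  ev-⊕ []      q       x = sym (+-identityˡ _)
  ev-⊕ (a ∷ p) []      x = sym (+-identityʳ _)
  ev-⊕ (a ∷ p) (b ∷ q) x = trans (cong (λ u → a + b + x * u) (ev-⊕ p q x))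
    (solve 5 (λ a b x p q → a :+ b :+ x :* (p :+ q) := a :+ x :* p :+ (b :+ x :* q)) refl a b x _ _)

  ev-∙ : ∀ a p x → ev (a ∙ p) x ≡ a * ev p x
  ev-∙ a []      x = sym (zeroʳ a)
  ev-∙ a (b ∷ p) x = trans (cong (λ u → a * b + x * u) (ev-∙ a p x))
    (solve 4 (λ a b x p → a :* b :+ x :* (a :* p) := a :* (b :+ x :* p)) refl a b x _)

  ev-⊗ : ∀ p q x → ev (p ⊗ q) x ≡ ev p x * ev q x
  ev-⊗ []      q x = sym (zeroˡ _)
  ev-⊗ (a ∷ p) q x = trans (ev-⊕ (a ∙ q) (0# ∷ p ⊗ q) x)
    (trans (cong₂ (λ u w → u + (0# + x * w)) (ev-∙ a q x) (ev-⊗ p q x))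
      (solve 4 (λ a x p q → a :* q :+ (:ι 0 :+ x :* (p :* q)) := (a :+ x :* p) :* q) refl a x _ _))

  ev-^ : ∀ p n x → ev (p ^ᴾ n) x ≡ ev p x ^ n
  ev-^ p zero    x = trans (cong (1# +_) (zeroʳ x)) (+-identityʳ 1#)
  ev-^ p (suc n) x = trans (ev-⊗ p (p ^ᴾ n) x) (cong (ev p x *_) (ev-^ p n x))

  ev-zero : ∀ p x → p ≈ [] → ev p x ≡ 0#
  ev-zero []      x e = refl
  ev-zero (a ∷ p) x e = trans (cong₂ (λ u w → u + x * w) (e .at 0) (ev-zero p x (mk λ i → e .at (suc i))))
                          (solve 1 (λ x → :ι 0 :+ x :* :ι 0 := :ι 0) refl x)

  ev-cong : ∀ {p q} x → p ≈ q → ev p x ≡ ev q x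
  ev-cong {[]}    {q}     x e = sym (ev-zero q x (≈-sym e))
  ev-cong {a ∷ p} {[]}    x e = ev-zero (a ∷ p) x e
  ev-cong {a ∷ p} {b ∷ q} x e = cong₂ (λ u w → u + x * w) (e .at 0) (ev-cong {p} {q} x (mk λ i → e .at (suc i)))

  X^_⊙_ : ℕ → Poly → Poly
  X^ zero  ⊙ p = p
  X^ suc n ⊙ p = 0# ∷ X^ n ⊙ p

  X^-cong : ∀ n {p q} → p ≈ q → X^ n ⊙ p ≈ X^ n ⊙ q
  X^-cong zero    e = e
  X^-cong (suc n) e = 0∷-cong (X^-cong n e)

  X^-coef : ∀ n p i → coef (X^ n ⊙ p) (n ℕ.+ i) ≡ coef p i
  X^-coef zero    p i = refl
  X^-coef (suc n) p i = X^-coef n p i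

  X^-low : ∀ n p i → i ℕ.< n → coef (X^ n ⊙ p) i ≡ 0#
  X^-low (suc n) p zero    _         = refl
  X^-low (suc n) p (suc i) (s≤s i<n) = X^-low n p i i<n

  X^-⊗ : ∀ n p q → (X^ n ⊙ p) ⊗ q ≈ X^ n ⊙ (p ⊗ q)
  X^-⊗ zero    p q = ≈-refl
  X^-⊗ (suc n) p q = ≈-trans (0∷-⊗ (X^ n ⊙ p) q) (0∷-cong (X^-⊗ n p q))

  X^-⊕ : ∀ n p q → X^ n ⊙ (p ⊕ q) ≈ X^ n ⊙ p ⊕ X^ n ⊙ q
  X^-⊕ zero    p q = ≈-refl
  X^-⊕ (suc n) p q = ≈-trans (0∷-cong (X^-⊕ n p q)) (≈-sym (0∷-⊕ (X^ n ⊙ p) (X^ n ⊙ q)))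

  X^-∙ : ∀ n a p → X^ n ⊙ (a ∙ p) ≈ a ∙ (X^ n ⊙ p)
  X^-∙ zero    a p = ≈-refl
  X^-∙ (suc n) a p = ≈-trans (0∷-cong (X^-∙ n a p)) (≈-sym (∙-0∷ a _))

  X^-zero : ∀ n → X^ n ⊙ [] ≈ []
  X^-zero zero    = ≈-refl
  X^-zero (suc n) = ≈-trans (0∷-cong (X^-zero n)) 0∷[]

  ev-X^ : ∀ n p x → ev (X^ n ⊙ p) x ≡ x ^ n * ev p x
  ev-X^ zero    p x = sym (*-identityˡ _)
  ev-X^ (suc n) p x = trans (cong (λ u → 0# + x * u) (ev-X^ n p x))
    (solve 3 (λ x y e → :ι 0 :+ x :* (y :* e) := x :* y :* e) refl x (x ^ n) _)

  -- the Euler derivation X d/dX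

  private
    euler : ℕ → Poly → Poly
    euler n []      = []
    euler n (a ∷ p) = ι n * a ∷ euler (suc n) p

    coef-euler : ∀ n p i → coef (euler n p) i ≡ ι (n ℕ.+ i) * coef p i
    coef-euler n []      i       = sym (zeroʳ _)
    coef-euler n (a ∷ p) zero    = cong (λ u → ι u * a) (sym (ℕₚ.+-identityʳ n))
    coef-euler n (a ∷ p) (suc i) = trans (coef-euler (suc n) p i)
                                     (cong (λ u → ι u * coef p i) (sym (ℕₚ.+-suc n i)))

  D : Poly → Poly
  D = euler 0

  length-D : ∀ p → length (D p) ≡ length p
  length-D = go 0
    where
    go : ∀ n p → length (euler n p) ≡ length p
    go n []      = refl
    go n (a ∷ p) = cong suc (go (suc n) p)

  coef-D : ∀ p i → coef (D p) i ≡ ι i * coef p i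
  coef-D = coef-euler 0

  D-cong : ∀ {p q} → p ≈ q → D p ≈ D q
  D-cong {p} {q} e .at i = trans (coef-D p i) (trans (cong (ι i *_) (e .at i)) (sym (coef-D q i)))

  D-⊕ : ∀ p q → D (p ⊕ q) ≈ D p ⊕ D q
  D-⊕ p q .at i = begin
    coef (D (p ⊕ q)) i                   ≡⟨ trans (coef-D (p ⊕ q) i) (cong (ι i *_) (coef-⊕ p q i)) ⟩
    ι i * (coef p i + coef q i)          ≡⟨ distribˡ _ _ _ ⟩
    ι i * coef p i + ι i * coef q i      ≡⟨ cong₂ _+_ (sym (coef-D p i)) (sym (coef-D q i)) ⟩
    coef (D p) i + coef (D q) i          ≡⟨ sym (coef-⊕ (D p) (D q) i) ⟩
    coef (D p ⊕ D q) i                   ∎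

  D-∙ : ∀ a p → D (a ∙ p) ≈ a ∙ D p
  D-∙ a p .at i = begin
    coef (D (a ∙ p)) i       ≡⟨ trans (coef-D (a ∙ p) i) (cong (ι i *_) (coef-∙ a p i)) ⟩
    ι i * (a * coef p i)     ≡⟨ solve 3 (λ i a p → i :* (a :* p) := a :* (i :* p)) refl (ι i) a _ ⟩
    a * (ι i * coef p i)     ≡⟨ cong (a *_) (sym (coef-D p i)) ⟩
    a * coef (D p) i         ≡⟨ sym (coef-∙ a (D p) i) ⟩
    coef (a ∙ D p) i         ∎

  D-∷ : ∀ a p → D (a ∷ p) ≈ 0# ∷ (p ⊕ D p)
  D-∷ a p .at zero    = zeroˡ a
  D-∷ a p .at (suc i) = begin
    coef (euler 1 p) i             ≡⟨ coef-euler 1 p i ⟩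
    ι (suc i) * coef p i           ≡⟨ cong (_* coef p i) (ι-suc i) ⟩
    (1# + ι i) * coef p i          ≡⟨ solve 2 (λ i p → (:ι 1 :+ i) :* p := p :+ i :* p) refl (ι i) _ ⟩
    coef p i + ι i * coef p i      ≡⟨ cong (coef p i +_) (sym (coef-D p i)) ⟩
    coef p i + coef (D p) i        ≡⟨ sym (coef-⊕ p (D p) i) ⟩
    coef (p ⊕ D p) i               ∎

  D-⊗ : ∀ p q → D (p ⊗ q) ≈ D p ⊗ q ⊕ p ⊗ D q
  D-⊗ []      q = ≈-refl
  D-⊗ (a ∷ p) q = begin⟨⟩
    where
    module S = RingSolver polyRing
    begin⟨⟩ : D (a ∙ q ⊕ (0# ∷ p ⊗ q)) ≈ D (a ∷ p) ⊗ q ⊕ (a ∙ D q ⊕ (0# ∷ p ⊗ D q))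
    begin⟨⟩ = ≈-trans (D-⊕ (a ∙ q) (0# ∷ p ⊗ q))
      (≈-trans (⊕-cong (D-∙ a q) (≈-trans (D-∷ 0# (p ⊗ q)) (≈-trans (0∷-cong (≈-trans
         (⊕-cong (≈-refl {p ⊗ q}) (D-⊗ p q))
         (S.solve 4 (λ p q p′ q′ → p S.:* q S.:+ (p′ S.:* q S.:+ p S.:* q′) S.:= (p S.:+ p′) S.:* q S.:+ p S.:* q′) ≈-refl p q (D p) (D q))))
         (≈-sym (0∷-⊕ ((p ⊕ D p) ⊗ q) (p ⊗ D q))))))
      (≈-trans (S.solve 3 (λ x y z → x S.:+ (y S.:+ z) S.:= y S.:+ (x S.:+ z)) ≈-refl (a ∙ D q) (0# ∷ (p ⊕ D p) ⊗ q) (0# ∷ p ⊗ D q))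
        (⊕-cong (≈-trans (≈-sym (0∷-⊗ (p ⊕ D p) q)) (⊗-cong (≈-sym (D-∷ a p)) (≈-refl {q}))) ≈-refl)))

  -- The reason for preferring X d/dX to d/dX: it acts on X^n by the scalar n, so a sum of blocks
  -- with factors X^(jL) keeps its shape under differentiation.
  D-X^ : ∀ n p → D (X^ n ⊙ p) ≈ X^ n ⊙ (D p ⊕ ι n ∙ p)
  D-X^ zero    p = ≈-sym (≈-trans (⊕-cong (≈-refl {D p}) (0∙ p)) (⊕-identityʳ _))
  D-X^ (suc n) p = ≈-trans (D-∷ 0# _) (0∷-cong (≈-trans (⊕-cong (≈-refl {X^ n ⊙ p}) (D-X^ n p))
    (≈-trans (≈-sym (X^-⊕ n p (D p ⊕ ι n ∙ p))) (X^-cong n lemma))))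
    where
    lemma : p ⊕ (D p ⊕ ι n ∙ p) ≈ D p ⊕ ι (suc n) ∙ p
    lemma .at i = begin
      coef (p ⊕ (D p ⊕ ι n ∙ p)) i
        ≡⟨ trans (coef-⊕ p _ i) (cong (coef p i +_) (trans (coef-⊕ (D p) _ i) (cong (coef (D p) i +_) (coef-∙ (ι n) p i)))) ⟩
      coef p i + (coef (D p) i + ι n * coef p i)
        ≡⟨ solve 3 (λ p d n → p :+ (d :+ n :* p) := d :+ (:ι 1 :+ n) :* p) refl _ _ (ι n) ⟩
      coef (D p) i + (1# + ι n) * coef p i
        ≡⟨ cong (λ u → coef (D p) i + u * coef p i) (sym (ι-suc n)) ⟩
      coef (D p) i + ι (suc n) * coef p i
        ≡⟨ sym (trans (coef-⊕ (D p) _ i) (cong (coef (D p) i +_) (coef-∙ (ι (suc n)) p i))) ⟩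
      coef (D p ⊕ ι (suc n) ∙ p) i ∎

  -- Degree less than n, in a form that is invariant under `≈`, as the length of a list is not.
  Bound : Poly → ℕ → Set
  Bound p n = ∀ i → n ℕ.≤ i → coef p i ≡ 0#

  bound-≈ : ∀ {p q n} → p ≈ q → Bound p n → Bound q n
  bound-≈ e b i n≤i = trans (sym (e .at i)) (b i n≤i)

  bound-≤ : ∀ {p m n} → m ℕ.≤ n → Bound p m → Bound p n
  bound-≤ m≤n b i n≤i = b i (ℕₚ.≤-trans m≤n n≤i)

  bound-length : ∀ p {n} → length p ℕ.≤ n → Bound p n
  bound-length []      l       i       _         = refl
  bound-length (a ∷ p) (s≤s l) (suc i) (s≤s n≤i) = bound-length p l i n≤i

  bound-⊕ : ∀ {n} p q → Bound p n → Bound q n → Bound (p ⊕ q) n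
  bound-⊕ p q b c i n≤i = trans (coef-⊕ p q i) (trans (cong₂ _+_ (b i n≤i) (c i n≤i)) (+-identityˡ 0#))

  bound-∙ : ∀ {n} a p → Bound p n → Bound (a ∙ p) n
  bound-∙ a p b i n≤i = trans (coef-∙ a p i) (trans (cong (a *_) (b i n≤i)) (zeroʳ a))

  bound-⊖ : ∀ {n} p → Bound p n → Bound (⊖ p) n
  bound-⊖ p b i n≤i = trans (coef-⊖ p i) (trans (cong -_ (b i n≤i)) (solve 0 (:- :ι 0 := :ι 0) refl))

  bound-D : ∀ {n} p → Bound p n → Bound (D p) n
  bound-D p b i n≤i = trans (coef-D p i) (trans (cong (ι i *_) (b i n≤i)) (zeroʳ _))

  bound-X^ : ∀ k {n} p → Bound p n → Bound (X^ k ⊙ p) (k ℕ.+ n)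
  bound-X^ zero    p b = b
  bound-X^ (suc k) p b (suc i) (s≤s n≤i) = bound-X^ k p b i n≤i

  -- The first factor is measured by its length because the induction follows its list; the second
  -- only needs the invariant form.
  bound-⊗ : ∀ p q {k n} → length p ℕ.≤ suc k → Bound q n → Bound (p ⊗ q) (k ℕ.+ n)
  bound-⊗ []           q         l       b i n≤i = refl
  bound-⊗ (a ∷ [])     q {k} {n} l       b = bound-≈ (∙≈⊗ a q) (bound-≤ {a ∙ q} (ℕₚ.m≤n+m n k) (bound-∙ a q b))
  bound-⊗ (a ∷ a′ ∷ p) q {suc k} {n} (s≤s l) b = bound-⊕ (a ∙ q) (0# ∷ (a′ ∷ p) ⊗ q)
    (bound-≤ {a ∙ q} (ℕₚ.m≤n+m n (suc k)) (bound-∙ a q b))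
    (bound-X^ 1 ((a′ ∷ p) ⊗ q) (bound-⊗ (a′ ∷ p) q l b))

  bound-^⊗ : ∀ p q {k n} m → length p ℕ.≤ suc k → Bound q n → Bound (p ^ᴾ m ⊗ q) (k ℕ.* m ℕ.+ n)
  bound-^⊗ p q {k} {n} zero    l b = bound-≈ (≈-sym (⊗-identityˡ q))
    (subst (Bound q) (cong (ℕ._+ n) (sym (ℕₚ.*-zeroʳ k))) b)
  bound-^⊗ p q {k} {n} (suc m) l b = bound-≈ (≈-sym (⊗-assoc p (p ^ᴾ m) q))
    (subst (Bound (p ⊗ (p ^ᴾ m ⊗ q))) (trans (sym (ℕₚ.+-assoc k (k ℕ.* m) n)) (cong (ℕ._+ n) (sym (ℕₚ.*-suc k m))))
      (bound-⊗ p (p ^ᴾ m ⊗ q) l (bound-^⊗ p q m l b)))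

-- Homogeneous linear systems with more unknowns than equations

module LinearSystems (F : Field) where
  open Field F
  open RingSolver commutativeRing hiding (ι)
  open ≡.≡-Reasoning

  combine : ∀ {n} → Carrier → Carrier → Vec Carrier n → Vec Carrier n → Vec Carrier n
  combine a b = zipWith (λ u v → a * u + b * v)

  -- The equations to be solved are coefficients of iterated differential operators, so a linear
  -- form is kept as a function with a proof of linearity and no matrix is written down.
  record Functional (n : ℕ) : Set where
    field
      _⟨_⟩  : Vec Carrier n → Carrier
      linear : ∀ a b x y → _⟨_⟩ (combine a b x y) ≡ a * _⟨_⟩ x + b * _⟨_⟩ y
  open Functional public

  private
    e₀ : ∀ {n} → Vec Carrier (suc n)
    e₀ = 1# ∷ replicate _ 0#

    split : ∀ {n} c (x : Vec Carrier n) → c ∷ x ≡ combine c 1# e₀ (0# ∷ x)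
    split c x = cong₂ _∷_ (solve 1 (λ c → c := c :* :ι 1 :+ :ι 1 :* :ι 0) refl c) (tail c x)
      where
      tail : ∀ {n} c (x : Vec Carrier n) → x ≡ combine c 1# (replicate n 0#) x
      tail c []      = refl
      tail c (u ∷ x) = cong₂ _∷_ (solve 2 (λ c u → u := c :* :ι 0 :+ :ι 1 :* u) refl c u) (tail c x)

    Pick : ∀ {n} → List (Functional (suc n)) → Set₁
    Pick {n} φs = Σ (Functional (suc n)) λ φ → Σ (List (Functional (suc n))) λ rest →
      ¬ (φ ⟨ e₀ ⟩ ≡ 0#) × length φs ≡ suc (length rest)
      × (∀ (Q : Functional (suc n) → Set) → Q φ → All Q rest → All Q φs)

    pick : ∀ {n} (φs : List (Functional (suc n))) → All (λ φ → φ ⟨ e₀ ⟩ ≡ 0#) φs ⊎ Pick φs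
    pick [] = inj₁ []
    pick (φ ∷ φs) with φ ⟨ e₀ ⟩ ≟ 0#
    ... | no  φe≢0 = inj₂ (φ , φs , φe≢0 , refl , λ Q q qs → q ∷ qs)
    ... | yes φe≡0 with pick φs
    ...   | inj₁ zs = inj₁ (φe≡0 ∷ zs)
    ...   | inj₂ (ψ , rest , ψe≢0 , len , back) =
      inj₂ (ψ , φ ∷ rest , ψe≢0 , cong suc len , λ { Q q (r ∷ rs) → r ∷ back Q q rs })

  -- Gaussian elimination of the first unknown. If every form vanishes at `e₀`, that vector is a
  -- solution; otherwise a form with nonzero value there is solved for the first coordinate (`lift`)
  -- and substituted into the others (`pull`).
  underdetermined : ∀ n (φs : List (Functional n)) → length φs ℕ.< n →
                    ∃ λ x → ¬ VAll.All (_≡ 0#) x × All (λ φ → φ ⟨ x ⟩ ≡ 0#) φs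
  underdetermined (suc n) φs l with pick φs
  ... | inj₁ zs = e₀ , (λ { (e VAll.∷ _) → 1≢0 e }) , zs
  ... | inj₂ (φ , rest , φe≢0 , len , back) with underdetermined n (Data.List.Base.map pull rest)
                                                   (subst (ℕ._< n) (sym (length-map pull rest)) (ℕₚ.≤-pred (subst (ℕ._< suc n) len l)))
    where
    a = φ ⟨ e₀ ⟩
    lift : Vec Carrier n → Vec Carrier (suc n)
    lift x = - (φ ⟨ 0# ∷ x ⟩) * a ⁻¹ ∷ x

    lift-combine : ∀ s t x y → lift (combine s t x y) ≡ combine s t (lift x) (lift y)
    lift-combine s t x y = cong (_∷ combine s t x y) (begin
      - (φ ⟨ 0# ∷ combine s t x y ⟩) * a ⁻¹
        ≡⟨ cong (λ u → - (φ ⟨ u ∷ combine s t x y ⟩) * a ⁻¹) (solve 2 (λ s t → :ι 0 := s :* :ι 0 :+ t :* :ι 0) refl s t) ⟩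
      - (φ ⟨ combine s t (0# ∷ x) (0# ∷ y) ⟩) * a ⁻¹
        ≡⟨ cong (λ u → - u * a ⁻¹) (φ .linear s t (0# ∷ x) (0# ∷ y)) ⟩
      - (s * φ ⟨ 0# ∷ x ⟩ + t * φ ⟨ 0# ∷ y ⟩) * a ⁻¹
        ≡⟨ solve 5 (λ s t x y a → :- (s :* x :+ t :* y) :* a := s :* (:- x :* a) :+ t :* (:- y :* a)) refl s t _ _ _ ⟩
      s * (- (φ ⟨ 0# ∷ x ⟩) * a ⁻¹) + t * (- (φ ⟨ 0# ∷ y ⟩) * a ⁻¹) ∎)

    pull : Functional (suc n) → Functional n
    pull ψ = record
      { _⟨_⟩ = λ x → ψ ⟨ lift x ⟩
      ; linear = λ s t x y → trans (cong (ψ ⟨_⟩) (lift-combine s t x y)) (ψ .linear s t (lift x) (lift y)) }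
  ... | (x , x≢0 , zs) = lift x , (λ { (_ VAll.∷ e) → x≢0 e }) , back _ φ-zero (Allₚ.map⁻ zs)
    where
    a = φ ⟨ e₀ ⟩
    lift : Vec Carrier n → Vec Carrier (suc n)
    lift x = - (φ ⟨ 0# ∷ x ⟩) * a ⁻¹ ∷ x
    φ-zero : φ ⟨ lift x ⟩ ≡ 0#
    φ-zero = begin
      φ ⟨ lift x ⟩
        ≡⟨ cong (φ ⟨_⟩) (split _ x) ⟩
      φ ⟨ combine (- (φ ⟨ 0# ∷ x ⟩) * a ⁻¹) 1# e₀ (0# ∷ x) ⟩
        ≡⟨ φ .linear _ _ _ _ ⟩
      - (φ ⟨ 0# ∷ x ⟩) * a ⁻¹ * a + 1# * φ ⟨ 0# ∷ x ⟩
        ≡⟨ solve 3 (λ u a a' → :- u :* a' :* a :+ :ι 1 :* u := u :* (:ι 1 :- a :* a')) refl _ a (a ⁻¹) ⟩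
      φ ⟨ 0# ∷ x ⟩ * (1# - a * a ⁻¹)
        ≡⟨ cong (λ u → φ ⟨ 0# ∷ x ⟩ * (1# - u)) (inverse a φe≢0) ⟩
      φ ⟨ 0# ∷ x ⟩ * (1# - 1#)
        ≡⟨ solve 1 (λ u → u :* (:ι 1 :- :ι 1) := :ι 0) refl _ ⟩
      0# ∎

-- Linear factors and zeros with multiplicity

module RootCounting (F : Field) where
  open Field F
  open FieldProps F
  open Polynomials F
  open RingSolver commutativeRing hiding (ι)
  module S = RingSolver polyRing

  lin : Carrier → Poly
  lin τ = - τ ∷ 1# ∷ []

  ev-lin : ∀ τ x → ev (lin τ) x ≡ x - τ
  ev-lin τ x = solve 2 (λ τ x → :- τ :+ x :* (:ι 1 :+ x :* :ι 0) := x :- τ) refl τ x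

  coef-lin₀ : ∀ τ p → coef (lin τ ⊗ p) 0 ≡ - τ * coef p 0
  coef-lin₀ τ p = trans (coef-⊕ ((- τ) ∙ p) _ 0) (trans (+-identityʳ _) (coef-∙ (- τ) p 0))

  coef-lin : ∀ τ p i → coef (lin τ ⊗ p) (suc i) ≡ - τ * coef p (suc i) + coef p i
  coef-lin τ p i = trans (coef-⊕ ((- τ) ∙ p) _ (suc i))
    (cong₂ _+_ (coef-∙ (- τ) p (suc i)) (⊗-identityˡ p .at i))

  -- The coefficients of p are killed from the constant term upwards, each time dividing by -τ; this
  -- way no degree has to be known.
  lin-cancel-0 : ∀ τ p → ¬ (τ ≡ 0#) → lin τ ⊗ p ≈ [] → p ≈ []
  lin-cancel-0 τ p τ≢0 e .at = go
    where
    -τ≢0 : ¬ (- τ ≡ 0#)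
    -τ≢0 d = τ≢0 (trans (solve 1 (λ τ → τ := :- (:- τ)) refl τ) (trans (cong -_ d) (solve 0 (:- :ι 0 := :ι 0) refl)))
    go : ∀ i → coef p i ≡ 0#
    go zero    = *-cancel-0 -τ≢0 (trans (sym (coef-lin₀ τ p)) (e .at 0))
    go (suc i) = *-cancel-0 -τ≢0 (trans (trans (sym (+-identityʳ _)) (cong (- τ * coef p (suc i) +_) (sym (go i))))
                   (trans (sym (coef-lin τ p i)) (e .at (suc i))))

  lin-cancel : ∀ τ p q → ¬ (τ ≡ 0#) → lin τ ⊗ p ≈ lin τ ⊗ q → p ≈ q
  lin-cancel τ p q τ≢0 e = ≈-trans (S.solve 2 (λ p q → p S.:= p S.:- q S.:+ q) ≈-refl p q)
    (⊕-cong (lin-cancel-0 τ (p ⊕ ⊖ q) τ≢0 (≈-trans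
      (S.solve 3 (λ l p q → l S.:* (p S.:- q) S.:= l S.:* p S.:- l S.:* q) ≈-refl (lin τ) p q)
      (≈-trans (⊕-cong e ≈-refl) (⊖-inverseʳ (lin τ ⊗ q))))) (≈-refl {q}))

  -- Synthetic division: the coefficients of the quotient are the intermediate values of Horner's
  -- scheme, the last entry being a formal 0.
  quo : Carrier → Poly → Poly
  quo τ []      = []
  quo τ (a ∷ p) = ev p τ ∷ quo τ p

  quo-correct : ∀ τ p → p ≈ lin τ ⊗ quo τ p ⊕ (ev p τ ∷ [])
  quo-correct τ []      .at zero    = solve 1 (λ τ → :ι 0 := :ι 0 :+ :ι 0) refl τ
  quo-correct τ []      .at (suc zero) = refl
  quo-correct τ []      .at (suc (suc i)) = refl
  quo-correct τ (a ∷ p) .at zero    = sym (trans (coef-⊕ (lin τ ⊗ quo τ (a ∷ p)) (ev (a ∷ p) τ ∷ []) 0) (trans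
    (cong (_+ (a + τ * ev p τ)) (coef-lin₀ τ (quo τ (a ∷ p))))
    (solve 3 (λ a τ e → :- τ :* e :+ (a :+ τ :* e) := a) refl a τ _)))
  quo-correct τ (a ∷ p) .at (suc i) = sym (trans (coef-⊕ (lin τ ⊗ quo τ (a ∷ p)) (ev (a ∷ p) τ ∷ []) (suc i)) (trans
    (cong (_+ 0#) (coef-lin τ (quo τ (a ∷ p)) i)) (lemma i)))
    where
    lemma : ∀ i → - τ * coef (quo τ p) i + coef (ev p τ ∷ quo τ p) i + 0# ≡ coef p i
    lemma zero = sym (trans (quo-correct τ p .at 0) (trans (coef-⊕ (lin τ ⊗ quo τ p) (ev p τ ∷ []) 0)
      (trans (cong (_+ ev p τ) (coef-lin₀ τ (quo τ p))) (sym (+-identityʳ _)))))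
    lemma (suc i) = sym (trans (quo-correct τ p .at (suc i)) (trans (coef-⊕ (lin τ ⊗ quo τ p) (ev p τ ∷ []) (suc i))
      (cong (_+ 0#) (coef-lin τ (quo τ p) i))))

  factor : ∀ τ p → ev p τ ≡ 0# → p ≈ lin τ ⊗ quo τ p
  factor τ p e = ≈-trans (quo-correct τ p) (≈-trans (⊕-cong (≈-refl {lin τ ⊗ quo τ p}) (≈-trans (∷-cong e ≈-refl) 0∷[])) (⊕-identityʳ _))

  bound-0 : ∀ {p} → Bound p 0 → p ≈ []
  bound-0 b .at i = b i z≤n

  bound-quo : ∀ τ p n → Bound p (suc n) → Bound (quo τ p) n
  bound-quo τ []      n       b i       n≤i       = refl
  bound-quo τ (a ∷ p) zero    b zero    _         = ev-zero p τ (mk λ i → b (suc i) (s≤s z≤n))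
  bound-quo τ (a ∷ p) zero    b (suc i) _         = bound-quo τ p zero (λ j _ → b (suc j) (s≤s z≤n)) i z≤n
  bound-quo τ (a ∷ p) (suc n) b (suc i) (s≤s n≤i) = bound-quo τ p n (λ j l → b (suc j) (s≤s l)) i n≤i

  -- Vanishing to order m at τ, measured by the Euler derivation.
  Van : ℕ → Poly → Carrier → Set
  Van zero    p τ = ⊤
  Van (suc m) p τ = ev p τ ≡ 0# × Van m (D p) τ

  van-≈ : ∀ m {p q τ} → p ≈ q → Van m p τ → Van m q τ
  van-≈ zero    e v       = tt
  van-≈ (suc m) {p} {q} {τ} e (z , v) = trans (sym (ev-cong {p} {q} τ e)) z , van-≈ m (D-cong e) v

  van-⊕ : ∀ m {p q τ} → Van m p τ → Van m q τ → Van m (p ⊕ q) τ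
  van-⊕ zero    v w = tt
  van-⊕ (suc m) {p} {q} {τ} (y , v) (z , w) =
    trans (ev-⊕ p q τ) (trans (cong₂ _+_ y z) (+-identityˡ 0#)) , van-≈ m (≈-sym (D-⊕ p q)) (van-⊕ m v w)

  van-pred : ∀ m {p τ} → Van (suc m) p τ → Van m p τ
  van-pred zero    v       = tt
  van-pred (suc m) (z , v) = z , van-pred m v

  van-⊗ : ∀ m g {p τ} → Van m p τ → Van m (g ⊗ p) τ
  van-⊗ zero    g v = tt
  van-⊗ (suc m) g {p} {τ} (z , v) = trans (ev-⊗ g p τ) (trans (cong (ev g τ *_) z) (zeroʳ _)) ,
    van-≈ m (≈-sym (D-⊗ g p)) (van-⊕ m (van-⊗ m (D g) (van-pred m (z , v))) (van-⊗ m g v))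

  van-⊖ : ∀ m {p q τ} → Van m (p ⊕ q) τ → Van m p τ → Van m q τ
  van-⊖ m {p} {q} v w = van-≈ m
    (S.solve 2 (λ p q → p S.:+ q S.:+ (S.:- S.:ι 1) S.:* p S.:= q) ≈-refl p q)
    (van-⊕ m {p ⊕ q} v (van-⊗ m (⊖ (1# ∷ [])) w))

  -- Write D (g p) = D g · p + g · D p. By induction p vanishes to order m, hence so do the first
  -- summand and g · D p, and the induction hypothesis applies once more to D p.
  van-cancel : ∀ m g {p τ} → ¬ (ev g τ ≡ 0#) → Van m (g ⊗ p) τ → Van m p τ
  van-cancel zero    g gτ≢0 v = tt
  van-cancel (suc m) g {p} {τ} gτ≢0 v@(z , w) = *-cancel-0 gτ≢0 (trans (sym (ev-⊗ g p τ)) z) ,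
    van-cancel m g {D p} gτ≢0 (van-⊖ m {D g ⊗ p} (van-≈ m (D-⊗ g p) w)
      (van-⊗ m (D g) (van-cancel m g {p} gτ≢0 (van-pred m v))))

  module _ (p : ℕ) (ι≢0 : ∀ j → 0 ℕ.< j → j ℕ.< p → ¬ (ι j ≡ 0#)) where

    private
      X : Poly
      X = 0# ∷ 1# ∷ []

      C : ℕ → Poly
      C j = ι j ∷ []

      C-suc : ∀ j → C (suc j) ≈ (1# ∷ []) ⊕ C j
      C-suc j = ∷-cong (ι-suc j) ≈-refl

      D-C : ∀ j → D (C j) ≈ []
      D-C j = ≈-trans (D-∷ (ι j) []) 0∷[]

      D-X : D X ≈ X
      D-X = ≈-trans (D-∷ 0# (1# ∷ [])) (∷-cong refl (∷-cong (solve 0 (:ι 1 :+ :ι 0 :* :ι 1 := :ι 1) refl) ≈-refl))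

      D-lin : ∀ τ → D (lin τ) ≈ X
      D-lin τ = ≈-trans (D-∷ (- τ) (1# ∷ [])) (∷-cong refl (∷-cong (solve 0 (:ι 1 :+ :ι 0 :* :ι 1 := :ι 1) refl) ≈-refl))

      -- The operators c X + (X - τ) D, for c = 1, 2, …, are what is left of
      -- multiplication by X - τ after c applications of D.
      V : ℕ → Carrier → Poly → Poly
      V j τ q = (C j ⊗ X) ⊗ q ⊕ lin τ ⊗ D q

      D-V : ∀ j τ q → D (V j τ q) ≈ (C j ⊗ X) ⊗ q ⊕ V (suc j) τ (D q)
      D-V j τ q = ≈-trans (D-⊕ ((C j ⊗ X) ⊗ q) (lin τ ⊗ D q))
        (≈-trans (⊕-cong (≈-trans (D-⊗ (C j ⊗ X) q) (⊕-cong (⊗-cong dcx (≈-refl {q})) ≈-refl))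
                         (≈-trans (D-⊗ (lin τ) (D q)) (⊕-cong (⊗-cong (D-lin τ) (≈-refl {D q})) ≈-refl)))
        (≈-trans (S.solve 6 (λ c x q q′ l q″ → c S.:* x S.:* q S.:+ c S.:* x S.:* q′ S.:+ (x S.:* q′ S.:+ l S.:* q″)
                    S.:= c S.:* x S.:* q S.:+ ((S.:ι 1 S.:+ c) S.:* x S.:* q′ S.:+ l S.:* q″))
                    ≈-refl (C j) X q (D q) (lin τ) (D (D q)))
          (⊕-cong (≈-refl {(C j ⊗ X) ⊗ q}) (⊕-cong {((1# ∷ []) ⊕ C j) ⊗ X ⊗ D q} {C (suc j) ⊗ X ⊗ D q}
            (⊗-cong (⊗-cong (≈-sym (C-suc j)) (≈-refl {X})) (≈-refl {D q})) (≈-refl {lin τ ⊗ D (D q)})))))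
        where
        dcx : D (C j ⊗ X) ≈ C j ⊗ X
        dcx = ≈-trans (D-⊗ (C j) X) (⊕-cong (⊗-cong (D-C j) (≈-refl {X})) (⊗-congˡ (C j) D-X))

      -- `V j τ q` takes the value j τ q(τ) at τ, and D (V j τ q) - j X q = V (j + 1) τ (D q). The
      -- multiplier grows by one with every derivative; j + m ≤ p keeps it invertible throughout.
      van-V : ∀ m j τ q → ¬ (τ ≡ 0#) → 0 ℕ.< j → j ℕ.+ m ℕ.≤ p → Van m (V j τ q) τ → Van m q τ
      van-V zero    j τ q τ≢0 0<j l v       = tt
      van-V (suc m) j τ q τ≢0 0<j l v@(z , w) = value ,
        van-V m (suc j) τ (D q) τ≢0 (s≤s z≤n) l′
          (van-⊖ m {(C j ⊗ X) ⊗ q} (van-≈ m (D-V j τ q) w)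
            (van-⊗ m (C j ⊗ X) (van-V m j τ q τ≢0 0<j (ℕₚ.≤-trans (ℕₚ.+-monoʳ-≤ j (ℕₚ.n≤1+n m)) l) (van-pred m v))))
        where
        l′ : suc j ℕ.+ m ℕ.≤ p
        l′ = subst (ℕ._≤ p) (ℕₚ.+-suc j m) l
        value : ev q τ ≡ 0#
        value = *-cancel-0 (*-nonzero (ι≢0 j 0<j (ℕₚ.<-≤-trans (ℕₚ.m<m+n j (s≤s z≤n)) l)) τ≢0) (begin
          ι j * τ * ev q τ
            ≡⟨ solve 4 (λ c τ e d → c :* τ :* e := (c :+ τ :* :ι 0) :* (:ι 0 :+ τ :* (:ι 1 :+ τ :* :ι 0)) :* e
                         :+ (:- τ :+ τ :* (:ι 1 :+ τ :* :ι 0)) :* d) refl (ι j) τ (ev q τ) (ev (D q) τ) ⟩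
          ev (C j) τ * ev X τ * ev q τ + ev (lin τ) τ * ev (D q) τ
            ≡⟨ sym (cong₂ _+_ (trans (ev-⊗ (C j ⊗ X) q τ) (cong (_* ev q τ) (ev-⊗ (C j) X τ))) (ev-⊗ (lin τ) (D q) τ)) ⟩
          ev ((C j ⊗ X) ⊗ q) τ + ev (lin τ ⊗ D q) τ
            ≡⟨ sym (ev-⊕ ((C j ⊗ X) ⊗ q) (lin τ ⊗ D q) τ) ⟩
          ev (V j τ q) τ ≡⟨ z ⟩
          0# ∎)
          where open ≡.≡-Reasoning

      van-factor : ∀ m τ q → ¬ (τ ≡ 0#) → suc m ℕ.≤ p → Van (suc m) (lin τ ⊗ q) τ → Van m q τ
      van-factor m τ q τ≢0 l (_ , w) = van-V m 1 τ q τ≢0 (s≤s z≤n) l (van-≈ m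
        (≈-trans (D-⊗ (lin τ) q) (⊕-cong (⊗-cong (≈-trans (D-lin τ) (≈-sym (⊗-identityˡ X))) (≈-refl {q})) ≈-refl)) w)

      -- Dividing by X - τ lowers the order at τ by one and leaves the orders elsewhere unchanged.
      -- After k divisions the degree bound has dropped by k, and the remaining points are left to
      -- the continuation `rec`.
      peel : ∀ m k τ τs q N → k ℕ.≤ p → ¬ (τ ≡ 0#) → All (λ t → ¬ (τ ≡ t)) τs →
             Van k q τ → All (Van m q) τs → Bound q (k ℕ.+ N) →
             (∀ r → All (Van m r) τs → Bound r N → r ≈ []) → q ≈ []
      peel m zero    τ τs q N l τ≢0 ≢τs v vs b rec = rec q vs b
      peel m (suc k) τ τs q N l τ≢0 ≢τs v vs b rec =
        ≈-trans q≈ (≈-trans (⊗-congˡ (lin τ) r≈0) (⊗-zeroʳ (lin τ)))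
        where
        q≈ = factor τ q (proj₁ v)
        r = quo τ q
        others : ∀ {ts} → All (λ t → ¬ (τ ≡ t)) ts → All (Van m q) ts → All (Van m r) ts
        others []         []       = []
        others {t ∷ _} (τ≢t ∷ ds) (w ∷ ws) = van-cancel m (lin τ) {r} {t}
          (λ e → τ≢t (sym (x-y≡0⇒x≡y (trans (sym (ev-lin τ t)) e)))) (van-≈ m q≈ w) ∷ others ds ws
        r≈0 : r ≈ []
        r≈0 = peel m k τ τs r N (ℕₚ.≤-trans (ℕₚ.n≤1+n k) l) τ≢0 ≢τs
          (van-factor k τ r τ≢0 l (van-≈ (suc k) q≈ v)) (others ≢τs vs) (bound-quo τ q (k ℕ.+ N) b) rec

    -- Derivatives measure multiplicity faithfully only up to the characteristic, whence m ≤ p.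
    too-many-roots : ∀ m τs q → m ℕ.≤ p → All (λ t → ¬ (t ≡ 0#)) τs → AllPairs (λ s t → ¬ (s ≡ t)) τs →
                     All (Van m q) τs → Bound q (length τs ℕ.* m) → q ≈ []
    too-many-roots m []       q l nz ds vs b = bound-0 b
    too-many-roots m (τ ∷ τs) q l (n ∷ nz) (d ∷ ds) (v ∷ vs) b =
      peel m m τ τs q (length τs ℕ.* m) l n d v vs b (λ r → too-many-roots m τs r l nz ds)

-- Stepanov’s method

module Stepanov (F : Field) (p : ℕ) (p-prime : Prime p)
                (ιp≡0 : Field.ι F p ≡ Field.0# F)
                (ι≢0 : ∀ j → 0 ℕ.< j → j ℕ.< p → ¬ (Field.ι F j ≡ Field.0# F)) where
  open Field F
  open FieldProps F
  open Polynomials F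
  open LinearSystems F
  open RootCounting F
  open RingSolver commutativeRing hiding (ι)

  C : Carrier → Poly
  C a = a ∷ []

  -- Divisibility by X^n.
  Low : ℕ → Poly → Set
  Low n q = ∀ i → i ℕ.< n → coef q i ≡ 0#

  low-≈ : ∀ {n q r} → q ≈ r → Low n q → Low n r
  low-≈ e l i i<n = trans (sym (e .at i)) (l i i<n)

  low-⊕ : ∀ {n} q r → Low n q → Low n r → Low n (q ⊕ r)
  low-⊕ q r l k i i<n = trans (coef-⊕ q r i) (trans (cong₂ _+_ (l i i<n) (k i i<n)) (+-identityˡ 0#))

  low-⊖ : ∀ {n} q → Low n q → Low n (⊖ q)
  low-⊖ q l i i<n = trans (coef-⊖ q i) (trans (cong -_ (l i i<n)) (solve 0 (:- :ι 0 := :ι 0) refl))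

  low-drop : ∀ n q → Low n q → q ≈ X^ n ⊙ drop n q
  low-drop zero    q       l = ≈-refl
  low-drop (suc n) []      l = ≈-sym (≈-trans (0∷-cong (X^-zero n)) 0∷[])
  low-drop (suc n) (a ∷ q) l = ∷-cong (l 0 (s≤s z≤n)) (low-drop n q (λ i i<n → l (suc i) (s≤s i<n)))

  low-⊗ : ∀ {n} q r → Low n q → Low n (q ⊗ r)
  low-⊗ {n} q r l = low-≈ (≈-sym (≈-trans (⊗-cong (low-drop n q l) (≈-refl {r})) (X^-⊗ n (drop n q) r)))
    (X^-low n (drop n q ⊗ r))

  low-bound : ∀ {n q} → Low n q → Bound q n → q ≈ []
  low-bound {n} l b .at i with i ℕₚ.<? n
  ... | yes i<n = l i i<n
  ... | no  i≮n = b i (ℕₚ.≮⇒≥ i≮n)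

  private
    open import Algebra.Properties.Semiring.Mult polySemiring using () renaming (_×_ to _×ᴾ_)
    open import Algebra.Properties.Semiring.Mult.TCOptimised semiring using () renaming (1+× to 1+×ᴷ)

    ×ᴾ-const : ∀ n → n ×ᴾ (1# ∷ []) ≈ C (ι n)
    ×ᴾ-const zero    = ≈-sym 0∷[]
    ×ᴾ-const (suc n) = ≈-trans (⊕-cong (≈-refl {1# ∷ []}) (×ᴾ-const n)) (∷-cong (sym (ι-suc n)) ≈-refl)

    char : p ×ᴾ (1# ∷ []) ≈ []
    char = ≈-trans (×ᴾ-const p) (≈-trans (∷-cong ιp≡0 ≈-refl) 0∷[])

    X-power : ∀ n q → (0# ∷ q) ^ᴾ n ≈ X^ n ⊙ (q ^ᴾ n)
    X-power zero    q = ≈-refl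
    X-power (suc n) q = ≈-trans (0∷-⊗ q ((0# ∷ q) ^ᴾ n)) (0∷-cong (≈-trans (⊗-congˡ q (X-power n q))
      (≈-trans (⊗-comm q (X^ n ⊙ (q ^ᴾ n))) (≈-trans (X^-⊗ n (q ^ᴾ n) q) (X^-cong n (⊗-comm (q ^ᴾ n) q))))))

    C-power : ∀ n a → C a ^ᴾ n ≈ C (a ^ n)
    C-power zero    a = ≈-refl
    C-power (suc n) a = ≈-trans (⊗-congˡ (C a) (C-power n a)) (∷-cong (+-identityʳ _) ≈-refl)

  -- With f = c + X g, the p-th power map gives f^p = c^p + X^p g^p.
  pth-power : ∀ f → Low p (f ^ᴾ p ⊕ ⊖ C (coef f 0 ^ p))
  pth-power f = low-≈ (≈-sym e) (X^-low p (drop 1 f ^ᴾ p))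
    where
    f≈ : f ≈ C (coef f 0) ⊕ (0# ∷ drop 1 f)
    f≈ = go f
      where
      go : ∀ f → f ≈ C (coef f 0) ⊕ (0# ∷ drop 1 f)
      go []      = ≈-sym (≈-trans (∷-cong (+-identityˡ 0#) ≈-refl) 0∷[])
      go (a ∷ f) = ∷-cong (sym (+-identityʳ a)) ≈-refl
    e : f ^ᴾ p ⊕ ⊖ C (coef f 0 ^ p) ≈ X^ p ⊙ (drop 1 f ^ᴾ p)
    e = ≈-trans (⊕-cong (≈-trans (^ᴾ-cong f≈ (refl {x = p}))
          (≈-trans (FreshmansDream.freshman polyRing p-prime char (C (coef f 0)) (0# ∷ drop 1 f))
            (⊕-cong (C-power p (coef f 0)) (X-power p (drop 1 f))))) (≈-refl {⊖ C (coef f 0 ^ p)}))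
        (S.solve 2 (λ c x → c S.:+ x S.:- c S.:= x) ≈-refl (C (coef f 0 ^ p)) _)

  -- Compare the parities of the orders of vanishing at ρ.
  simple-root-descent : ∀ ρ h c → ¬ (ρ ≡ 0#) → ¬ (ev h ρ ≡ 0#) → ¬ (c ≡ 0#) →
    ∀ n A B → Bound A n → Bound B n →
    lin ρ ⊗ (h ⊗ (A ⊗ A)) ≈ C c ⊗ (B ⊗ B) → A ≈ [] × B ≈ []
  simple-root-descent ρ h c ρ≢0 hρ≢0 c≢0 zero    A B a b e = bound-0 a , bound-0 b
  simple-root-descent ρ h c ρ≢0 hρ≢0 c≢0 (suc n) A B a b e = A≈0 , B≈0
    where
    Bρ : ev B ρ ≡ 0#
    Bρ = square-zero (*-cancel-0 c≢0 (begin
      c * (ev B ρ * ev B ρ)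
        ≡⟨ sym (trans (ev-⊗ (C c) (B ⊗ B) ρ) (cong₂ _*_ (solve 2 (λ c ρ → c :+ ρ :* :ι 0 := c) refl c ρ) (ev-⊗ B B ρ))) ⟩
      ev (C c ⊗ (B ⊗ B)) ρ                 ≡⟨ ev-cong ρ (≈-sym e) ⟩
      ev (lin ρ ⊗ (h ⊗ (A ⊗ A))) ρ         ≡⟨ trans (ev-⊗ (lin ρ) (h ⊗ (A ⊗ A)) ρ) (cong (_* ev (h ⊗ (A ⊗ A)) ρ) (trans (ev-lin ρ ρ) (-‿inverseʳ ρ))) ⟩
      0# * ev (h ⊗ (A ⊗ A)) ρ              ≡⟨ zeroˡ _ ⟩
      0# ∎))
      where open ≡.≡-Reasoning
    B₁ = quo ρ B
    B≈ = factor ρ B Bρ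
    e₁ : h ⊗ (A ⊗ A) ≈ C c ⊗ (lin ρ ⊗ (B₁ ⊗ B₁))
    e₁ = lin-cancel ρ _ _ ρ≢0 (≈-trans e (≈-trans (⊗-congˡ (C c) (⊗-cong B≈ B≈))
      (S.solve 3 (λ c l b → c S.:* (l S.:* b S.:* (l S.:* b)) S.:= l S.:* (c S.:* (l S.:* (b S.:* b)))) ≈-refl (C c) (lin ρ) B₁)))
    Aρ : ev A ρ ≡ 0#
    Aρ = square-zero (*-cancel-0 hρ≢0 (begin
      ev h ρ * (ev A ρ * ev A ρ)           ≡⟨ sym (trans (ev-⊗ h (A ⊗ A) ρ) (cong (ev h ρ *_) (ev-⊗ A A ρ))) ⟩
      ev (h ⊗ (A ⊗ A)) ρ                   ≡⟨ ev-cong ρ e₁ ⟩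
      ev (C c ⊗ (lin ρ ⊗ (B₁ ⊗ B₁))) ρ     ≡⟨ trans (ev-⊗ (C c) (lin ρ ⊗ (B₁ ⊗ B₁)) ρ) (cong (ev (C c) ρ *_) (trans (ev-⊗ (lin ρ) (B₁ ⊗ B₁) ρ)
                                                (cong (_* ev (B₁ ⊗ B₁) ρ) (trans (ev-lin ρ ρ) (-‿inverseʳ ρ))))) ⟩
      ev (C c) ρ * (0# * ev (B₁ ⊗ B₁) ρ)   ≡⟨ solve 2 (λ c b → c :* (:ι 0 :* b) := :ι 0) refl _ _ ⟩
      0# ∎))
      where open ≡.≡-Reasoning
    A₁ = quo ρ A
    A≈ = factor ρ A Aρ
    e₂ : lin ρ ⊗ (h ⊗ (A₁ ⊗ A₁)) ≈ C c ⊗ (B₁ ⊗ B₁)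
    e₂ = lin-cancel ρ _ _ ρ≢0 (≈-trans
      (S.solve 3 (λ l h a → l S.:* (l S.:* (h S.:* (a S.:* a))) S.:= h S.:* (l S.:* a S.:* (l S.:* a))) ≈-refl (lin ρ) h A₁)
      (≈-trans (⊗-congˡ h (⊗-cong (≈-sym A≈) (≈-sym A≈))) (≈-trans e₁
        (S.solve 3 (λ c l b → c S.:* (l S.:* b) S.:= l S.:* (c S.:* b)) ≈-refl (C c) (lin ρ) (B₁ ⊗ B₁)))))
    ih = simple-root-descent ρ h c ρ≢0 hρ≢0 c≢0 n A₁ B₁ (bound-quo ρ A n a) (bound-quo ρ B n b) e₂
    A≈0 = ≈-trans A≈ (≈-trans (⊗-congˡ (lin ρ) (proj₁ ih)) (⊗-zeroʳ (lin ρ)))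
    B≈0 = ≈-trans B≈ (≈-trans (⊗-congˡ (lin ρ) (proj₂ ih)) (⊗-zeroʳ (lin ρ)))

  module Auxiliary
    (f : Poly) (k₀ : ℕ) (f-length : length f ℕ.≤ suc k₀) (f₀≢0 : ¬ (coef f 0 ≡ 0#))
    (ρ : Carrier) (h : Poly) (f≈ : f ≈ lin ρ ⊗ h) (ρ≢0 : ¬ (ρ ≡ 0#)) (hρ≢0 : ¬ (ev h ρ ≡ 0#))
    (M : ℕ) (p≡ : p ≡ suc (M ℕ.+ M))
    (L I : ℕ) (I-small : suc I ℕ.+ suc I ℕ.+ k₀ ℕ.≤ suc L) (L≤p : L ℕ.≤ p)
    where

    G : Poly
    G = f ^ᴾ M

    fG²≈fᵖ : f ⊗ (G ⊗ G) ≈ f ^ᴾ p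
    fG²≈fᵖ = ≈-trans (⊗-congˡ f (≈-sym (^ᴾ-homo f M M))) (reflexive (cong (f ^ᴾ_) (sym p≡)))
      where open CommutativeRing polyRing using (reflexive)

    -- Multiply A + G B ≡ 0 modulo X^L by f (A - G B). As f G² = f^p and L ≤ p, the result is f A² -
    -- f(0)^p B² ≡ 0. This polynomial has degree below L, so it is 0 exactly, and the simple root ρ
    -- of f then forces A = B = 0.
    independent : ∀ A B → length A ℕ.≤ suc I → length B ℕ.≤ suc I → Low L (A ⊕ G ⊗ B) → A ≈ [] × B ≈ []
    independent A B a b l = simple-root-descent ρ h c ρ≢0 hρ≢0 (^-nonzero p f₀≢0) (suc I) A B (bound-length A a) (bound-length B b)
      (≈-trans (≈-trans (≈-sym (⊗-assoc (lin ρ) h (A ⊗ A))) (≈-trans (⊗-cong (≈-sym f≈) (≈-refl {A ⊗ A}))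
          (S.solve 2 (λ f a → f S.:* (a S.:* a) S.:= a S.:* (f S.:* a)) ≈-refl f A)))
        (≈-trans (S.solve 2 (λ x y → x S.:= x S.:- y S.:+ y) ≈-refl (A ⊗ (f ⊗ A)) (C c ⊗ (B ⊗ B)))
          (⊕-cong {A ⊗ (f ⊗ A) ⊕ ⊖ (C c ⊗ (B ⊗ B))} {[]} (low-bound low-Z bound-Z) (≈-refl {C c ⊗ (B ⊗ B)}))))
      where
      c = coef f 0 ^ p
      Z = A ⊗ (f ⊗ A) ⊕ ⊖ (C c ⊗ (B ⊗ B))
      E = (A ⊕ G ⊗ B) ⊗ (f ⊗ (A ⊕ ⊖ (G ⊗ B)))
      R = (f ^ᴾ p ⊕ ⊖ C c) ⊗ (B ⊗ B)
      Z≈ : E ⊕ R ≈ Z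
      Z≈ = ≈-trans (⊕-cong (≈-refl {E}) (⊗-cong (⊕-cong (≈-sym fG²≈fᵖ) (≈-refl {⊖ C c})) (≈-refl {B ⊗ B})))
        (S.solve 5 (λ a b g f c → (a S.:+ g S.:* b) S.:* (f S.:* (a S.:- g S.:* b)) S.:+ (f S.:* (g S.:* g) S.:- c) S.:* (b S.:* b)
          S.:= a S.:* (f S.:* a) S.:- c S.:* (b S.:* b)) ≈-refl A B G f (C c))
      low-Z : Low L Z
      low-Z = low-≈ Z≈ (low-⊕ E R (low-⊗ (A ⊕ G ⊗ B) _ l)
        (low-⊗ (f ^ᴾ p ⊕ ⊖ C c) (B ⊗ B) (λ i i<L → pth-power f i (ℕₚ.<-≤-trans i<L L≤p))))
      sizes : I ℕ.+ (k₀ ℕ.+ suc I) ℕ.≤ L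
      sizes = ℕₚ.≤-pred (subst (ℕ._≤ suc L) (trans (ℕₚ.+-assoc (suc I) (suc I) k₀) (cong (suc I ℕ.+_) (ℕₚ.+-comm (suc I) k₀))) I-small)
      bound-Z : Bound Z L
      bound-Z = bound-⊕ (A ⊗ (f ⊗ A)) (⊖ (C c ⊗ (B ⊗ B)))
        (bound-≤ {A ⊗ (f ⊗ A)} sizes (bound-⊗ A (f ⊗ A) a (bound-⊗ f A f-length (bound-length A a))))
        (bound-⊖ (C c ⊗ (B ⊗ B)) (bound-⊗ (C c) (B ⊗ B) {0} (s≤s z≤n)
          (bound-≤ {B ⊗ B} (ℕₚ.≤-trans (ℕₚ.+-monoʳ-≤ I (ℕₚ.m≤n+m (suc I) k₀)) sizes) (bound-⊗ B B b (bound-length B b)))))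

    Xᴸ : Poly
    Xᴸ = X^ L ⊙ (1# ∷ [])

    Xᴸ⊗ : ∀ q → Xᴸ ⊗ q ≈ X^ L ⊙ q
    Xᴸ⊗ q = ≈-trans (X^-⊗ L (1# ∷ []) q) (X^-cong L (⊗-identityˡ q))

    Pairs : Set
    Pairs = List (Poly × Poly)

    total : Pairs → Poly
    total []             = []
    total ((A , B) ∷ ps) = (A ⊕ G ⊗ B) ⊕ Xᴸ ⊗ total ps

    -- Modulo X^L only the first pair survives; once it is known to be 0, a factor X^L can be taken
    -- off the rest.
    total-zero : ∀ ps → All (λ AB → length (proj₁ AB) ℕ.≤ suc I × length (proj₂ AB) ℕ.≤ suc I) ps →
                 total ps ≈ [] → All (λ AB → proj₁ AB ≈ [] × proj₂ AB ≈ []) ps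
    total-zero []             []             e = []
    total-zero ((A , B) ∷ ps) ((a , b) ∷ ls) e = AB≈0 ∷ total-zero ps ls rest
      where
      Y = X^ L ⊙ total ps
      e′ : (A ⊕ G ⊗ B) ⊕ Y ≈ []
      e′ = ≈-trans (⊕-cong (≈-refl {A ⊕ G ⊗ B}) (≈-sym (Xᴸ⊗ (total ps)))) e
      AB≈0 = independent A B a b (low-≈ (≈-sym (≈-trans
        (S.solve 2 (λ x y → x S.:= x S.:+ y S.:- y) ≈-refl (A ⊕ G ⊗ B) Y) (⊕-cong e′ (≈-refl {⊖ Y}))))
        (low-⊖ Y (X^-low L (total ps))))
      Y≈0 : Y ≈ []
      Y≈0 = ≈-trans (≈-sym (⊕-cong {A ⊕ G ⊗ B} {[]} (≈-trans (⊕-cong (proj₁ AB≈0) (⊗-congˡ G (proj₂ AB≈0))) (⊗-zeroʳ G)) (≈-refl {Y}))) e′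
      rest : total ps ≈ []
      rest .at i = trans (sym (X^-coef L (total ps) i)) (Y≈0 .at (L ℕ.+ i))

    -- If W is the sum of the pairs, then f D W - k (D f) W is the sum of the
    -- pairs produced by  step k;  applied to f^k D^k F it yields f^(k+1) D^(k+1) F.
    step₁ : ℕ → Carrier → Poly × Poly → Poly × Poly
    step₁ k s (A , B) = f ⊗ (D A ⊕ C s ⊗ A) ⊕ C (- ι k) ⊗ (D f ⊗ A)
                      , f ⊗ (D B ⊕ C s ⊗ B) ⊕ C (ι M + - ι k) ⊗ (D f ⊗ B)

    step : ℕ → Carrier → Pairs → Pairs
    step k s []        = []
    step k s (AB ∷ ps) = step₁ k s AB ∷ step k (s + ι L) ps

    D-C : ∀ a → D (C a) ≈ []
    D-C a = ≈-trans (D-∷ a []) 0∷[]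

    D-Xᴸ : D Xᴸ ≈ C (ι L) ⊗ Xᴸ
    D-Xᴸ = ≈-trans (D-X^ L (1# ∷ [])) (≈-trans (X^-cong L (⊕-cong {D (1# ∷ [])} {[]} (D-C 1#) (≈-refl {ι L ∙ (1# ∷ [])})))
      (≈-trans (X^-∙ L (ι L) (1# ∷ [])) (∙≈⊗ (ι L) Xᴸ)))

    -- The additional factor f replaces the exponent n - 1 of the usual formula by n and so avoids a
    -- subtraction.
    D-power : ∀ n → f ⊗ D (f ^ᴾ n) ≈ C (ι n) ⊗ (D f ⊗ f ^ᴾ n)
    D-power zero    = ≈-trans (⊗-congˡ f (D-C 1#)) (≈-trans (⊗-zeroʳ f) (≈-sym (⊗-cong {C (ι 0)} {[]} 0∷[] (≈-refl {D f ⊗ (1# ∷ [])}))))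
    D-power (suc n) = ≈-trans (⊗-congˡ f (D-⊗ f (f ^ᴾ n))) (≈-trans
      (S.solve 4 (λ f f′ g g′ → f S.:* (f′ S.:* g S.:+ f S.:* g′) S.:= f S.:* (f′ S.:* g) S.:+ f S.:* (f S.:* g′)) ≈-refl f (D f) (f ^ᴾ n) (D (f ^ᴾ n)))
      (≈-trans (⊕-cong (≈-refl {f ⊗ (D f ⊗ f ^ᴾ n)}) (⊗-congˡ f (D-power n)))
      (≈-trans (S.solve 4 (λ f f′ g c → f S.:* (f′ S.:* g) S.:+ f S.:* (c S.:* (f′ S.:* g)) S.:= (S.:ι 1 S.:+ c) S.:* (f′ S.:* (f S.:* g))) ≈-refl f (D f) (f ^ᴾ n) (C (ι n)))
        (⊗-cong {(1# ∷ []) ⊕ C (ι n)} {C (ι (suc n))} (∷-cong (sym (ι-suc n)) ≈-refl) (≈-refl {D f ⊗ (f ⊗ f ^ᴾ n)})))))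

    -- The scalar s is the multiple jL by which D acts on X^(jL), and the second components receive
    -- an extra M because D also meets f^M. Everything else stays polynomial, the degrees growing by
    -- at most k₀.
    total-step : ∀ k s ps → f ⊗ (D (total ps) ⊕ C s ⊗ total ps) ⊕ C (- ι k) ⊗ (D f ⊗ total ps) ≈ total (step k s ps)
    total-step k s [] = ≈-trans (S.solve 4 (λ f s k f′ → f S.:* (S.:ι 0 S.:+ s S.:* S.:ι 0) S.:+ k S.:* (f′ S.:* S.:ι 0) S.:= S.:ι 0) ≈-refl f (C s) (C (- ι k)) (D f)) ≈-refl
    total-step k s ((A , B) ∷ ps) = ≈-trans
      (⊕-cong (⊗-congˡ f (⊕-cong dT (≈-refl {C s ⊗ ((A ⊕ G ⊗ B) ⊕ Xᴸ ⊗ T)}))) (≈-refl {C (- ι k) ⊗ (D f ⊗ ((A ⊕ G ⊗ B) ⊕ Xᴸ ⊗ T))}))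
      (≈-trans (solve₁ f A (D A) G (D G) B (D B) Xᴸ T (D T) (C s) (C (ι L)) (C (- ι k)) (D f))
      (⊕-cong (⊕-cong {f ⊗ (D A ⊕ C s ⊗ A) ⊕ C (- ι k) ⊗ (D f ⊗ A)} (≈-refl {f ⊗ (D A ⊕ C s ⊗ A) ⊕ C (- ι k) ⊗ (D f ⊗ A)})
          (≈-trans (⊕-cong {f ⊗ D G ⊗ B} (⊗-cong (D-power M) (≈-refl {B})) (≈-refl {G ⊗ (f ⊗ (D B ⊕ C s ⊗ B) ⊕ C (- ι k) ⊗ (D f ⊗ B))}))
            (solve₂ (C (ι M)) (D f) G B (f ⊗ (D B ⊕ C s ⊗ B)) (C (- ι k)))))
        (⊗-congˡ Xᴸ (total-step k (s + ι L) ps))))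
      where
      T = total ps
      dT : D ((A ⊕ G ⊗ B) ⊕ Xᴸ ⊗ T) ≈ (D A ⊕ (D G ⊗ B ⊕ G ⊗ D B)) ⊕ ((C (ι L) ⊗ Xᴸ) ⊗ T ⊕ Xᴸ ⊗ D T)
      dT = ≈-trans (D-⊕ (A ⊕ G ⊗ B) (Xᴸ ⊗ T)) (⊕-cong
        (≈-trans (D-⊕ A (G ⊗ B)) (⊕-cong (≈-refl {D A}) (D-⊗ G B)))
        (≈-trans (D-⊗ Xᴸ T) (⊕-cong (⊗-cong D-Xᴸ (≈-refl {T})) (≈-refl {Xᴸ ⊗ D T}))))
      solve₁ : ∀ f a a′ g g′ b b′ x t t′ s l k f′ →
        f ⊗ (((a′ ⊕ (g′ ⊗ b ⊕ g ⊗ b′)) ⊕ ((l ⊗ x) ⊗ t ⊕ x ⊗ t′)) ⊕ s ⊗ ((a ⊕ g ⊗ b) ⊕ x ⊗ t)) ⊕ k ⊗ (f′ ⊗ ((a ⊕ g ⊗ b) ⊕ x ⊗ t))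
        ≈ (f ⊗ (a′ ⊕ s ⊗ a) ⊕ k ⊗ (f′ ⊗ a) ⊕ (f ⊗ g′ ⊗ b ⊕ g ⊗ (f ⊗ (b′ ⊕ s ⊗ b) ⊕ k ⊗ (f′ ⊗ b)))) ⊕ x ⊗ (f ⊗ (t′ ⊕ (s ⊕ l) ⊗ t) ⊕ k ⊗ (f′ ⊗ t))
      solve₁ = S.solve 14 (λ f a a′ g g′ b b′ x t t′ s l k f′ →
        f S.:* (((a′ S.:+ (g′ S.:* b S.:+ g S.:* b′)) S.:+ ((l S.:* x) S.:* t S.:+ x S.:* t′)) S.:+ s S.:* ((a S.:+ g S.:* b) S.:+ x S.:* t)) S.:+ k S.:* (f′ S.:* ((a S.:+ g S.:* b) S.:+ x S.:* t))
        S.:= (f S.:* (a′ S.:+ s S.:* a) S.:+ k S.:* (f′ S.:* a) S.:+ (f S.:* g′ S.:* b S.:+ g S.:* (f S.:* (b′ S.:+ s S.:* b) S.:+ k S.:* (f′ S.:* b)))) S.:+ x S.:* (f S.:* (t′ S.:+ (s S.:+ l) S.:* t) S.:+ k S.:* (f′ S.:* t))) ≈-refl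
      solve₂ : ∀ m f′ g b y k → m ⊗ (f′ ⊗ g) ⊗ b ⊕ g ⊗ (y ⊕ k ⊗ (f′ ⊗ b)) ≈ g ⊗ (y ⊕ (m ⊕ k) ⊗ (f′ ⊗ b))
      solve₂ = S.solve 6 (λ m f′ g b y k → m S.:* (f′ S.:* g) S.:* b S.:+ g S.:* (y S.:+ k S.:* (f′ S.:* b)) S.:= g S.:* (y S.:+ (m S.:+ k) S.:* (f′ S.:* b))) ≈-refl

    iterate : ℕ → Pairs → Pairs
    iterate zero    ps = ps
    iterate (suc k) ps = step k 0# (iterate k ps)

    total-iterate : ∀ k ps → f ⊗ D (total (iterate k ps)) ⊕ C (- ι k) ⊗ (D f ⊗ total (iterate k ps)) ≈ total (iterate (suc k) ps)
    total-iterate k ps = ≈-trans (⊕-cong (⊗-congˡ f (≈-sym (≈-trans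
        (⊕-cong (≈-refl {D T}) (⊗-cong {C 0#} {[]} 0∷[] (≈-refl {T}))) (⊕-identityʳ (D T))))) (≈-refl {C (- ι k) ⊗ (D f ⊗ T)}))
      (total-step k 0# (iterate k ps))
      where T = total (iterate k ps)

    -- With W_k the k-th total, f · D W_k = W_(k+1) + k · D f · W_k. If the later totals vanish at
    -- τ, both summands vanish to the order required, and f can be cancelled because f(τ) ≠ 0.
    iterate-van : ∀ m k ps τ → ¬ (ev f τ ≡ 0#) →
                  (∀ l → k ℕ.≤ l → l ℕ.< k ℕ.+ m → ev (total (iterate l ps)) τ ≡ 0#) → Van m (total (iterate k ps)) τ
    iterate-van zero    k ps τ fτ≢0 z = tt
    iterate-van (suc m) k ps τ fτ≢0 z = z k ℕₚ.≤-refl (ℕₚ.m<m+n k (s≤s z≤n)) ,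
      van-cancel m f {D T} fτ≢0 (van-⊖ m {C (- ι k) ⊗ (D f ⊗ T)}
        (van-≈ m (≈-trans (≈-sym (total-iterate k ps)) (⊕-comm (f ⊗ D T) _))
          (iterate-van m (suc k) ps τ fτ≢0 (λ l k<l l< → z l (ℕₚ.<⇒≤ k<l) (subst (l ℕ.<_) (sym (ℕₚ.+-suc k m)) l<))))
        (van-⊗ m (C (- ι k)) (van-⊗ m (D f) (iterate-van m k ps τ fτ≢0
          (λ l k≤l l< → z l k≤l (ℕₚ.<-trans l< (ℕₚ.+-monoʳ-< k (ℕₚ.n<1+n m))))))))
      where T = total (iterate k ps)

    module Bounds (κ : ℕ) (c : Carrier) where

      -- At a point with τᴸ = 1 and τ^κ f(τ)^M = c the sum of the pairs becomes a
      -- polynomial of small degree, since the factors X^(jL) and f^M disappear.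
      residue : Pairs → Poly
      residue []             = []
      residue ((A , B) ∷ ps) = (X^ κ ⊙ A ⊕ C c ⊗ B) ⊕ residue ps

      ev-residue : ∀ τ → τ ^ L ≡ 1# → τ ^ κ * ev f τ ^ M ≡ c → ∀ ps →
                   τ ^ κ * ev (total ps) τ ≡ ev (residue ps) τ
      ev-residue τ τᴸ good []             = zeroʳ _
      ev-residue τ τᴸ good ((A , B) ∷ ps) = begin
        τ ^ κ * ev ((A ⊕ G ⊗ B) ⊕ Xᴸ ⊗ total ps) τ
          ≡⟨ cong (τ ^ κ *_) (trans (ev-⊕ (A ⊕ G ⊗ B) (Xᴸ ⊗ total ps) τ) (cong₂ _+_
               (trans (ev-⊕ A (G ⊗ B) τ) (cong (ev A τ +_) (trans (ev-⊗ G B τ) (cong (_* ev B τ) (ev-^ f M τ)))))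
               (trans (ev-cong τ (Xᴸ⊗ (total ps))) (trans (ev-X^ L (total ps) τ) (cong (_* ev (total ps) τ) τᴸ))))) ⟩
        τ ^ κ * ((ev A τ + ev f τ ^ M * ev B τ) + 1# * ev (total ps) τ)
          ≡⟨ solve 5 (λ t a g b s → t :* ((a :+ g :* b) :+ :ι 1 :* s) := (t :* a :+ t :* g :* b) :+ t :* s) refl (τ ^ κ) _ _ _ _ ⟩
        (τ ^ κ * ev A τ + τ ^ κ * ev f τ ^ M * ev B τ) + τ ^ κ * ev (total ps) τ
          ≡⟨ cong₂ (λ u w → (τ ^ κ * ev A τ + u * ev B τ) + w) good (ev-residue τ τᴸ good ps) ⟩
        (τ ^ κ * ev A τ + c * ev B τ) + ev (residue ps) τ
          ≡⟨ sym (trans (ev-⊕ (X^ κ ⊙ A ⊕ C c ⊗ B) (residue ps) τ) (cong (_+ ev (residue ps) τ)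
               (trans (ev-⊕ (X^ κ ⊙ A) (C c ⊗ B) τ) (cong₂ _+_ (ev-X^ κ A τ)
                 (trans (ev-⊗ (C c) B τ) (cong (_* ev B τ) (solve 2 (λ c τ → c :+ τ :* :ι 0 := c) refl c τ))))))) ⟩
        ev ((X^ κ ⊙ A ⊕ C c ⊗ B) ⊕ residue ps) τ ∎
        where open ≡.≡-Reasoning

      Bounded : ℕ → Pairs → Set
      Bounded n = All (λ AB → Bound (proj₁ AB) n × Bound (proj₂ AB) n)

      bounded-step : ∀ k s {n ps} → Bounded n ps → Bounded (k₀ ℕ.+ n) (step k s ps)
      bounded-step k s {n} []                            = []
      bounded-step k s {n} {(A , B) ∷ ps} ((a , b) ∷ bs) = (one A _ a , one B _ b) ∷ bounded-step k (s + ι L) bs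
        where
        one : ∀ A t → Bound A n → Bound (f ⊗ (D A ⊕ C s ⊗ A) ⊕ C t ⊗ (D f ⊗ A)) (k₀ ℕ.+ n)
        one A t a = bound-⊕ (f ⊗ (D A ⊕ C s ⊗ A)) (C t ⊗ (D f ⊗ A))
          (bound-⊗ f (D A ⊕ C s ⊗ A) f-length (bound-⊕ (D A) (C s ⊗ A) (bound-D A a) (bound-⊗ (C s) A {0} (s≤s z≤n) a)))
          (bound-⊗ (C t) (D f ⊗ A) {0} (s≤s z≤n) (bound-⊗ (D f) A D-length a))
          where
          D-length : length (D f) ℕ.≤ suc k₀
          D-length = subst (ℕ._≤ suc k₀) (sym (length-D f)) f-length

      degree : ℕ → ℕ
      degree zero    = suc I
      degree (suc k) = k₀ ℕ.+ degree k

      bounded-iterate : ∀ k {ps} → Bounded (suc I) ps → Bounded (degree k) (iterate k ps)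
      bounded-iterate zero    b = b
      bounded-iterate (suc k) b = bounded-step k 0# (bounded-iterate k b)

      bounded-residue : ∀ {n ps} → Bounded n ps → Bound (residue ps) (κ ℕ.+ n)
      bounded-residue []                                = λ _ _ → refl
      bounded-residue {n} {(A , B) ∷ ps} ((a , b) ∷ bs) = bound-⊕ (X^ κ ⊙ A ⊕ C c ⊗ B) (residue ps)
        (bound-⊕ (X^ κ ⊙ A) (C c ⊗ B) (bound-X^ κ A a)
          (bound-≤ {C c ⊗ B} (ℕₚ.m≤n+m n κ) (bound-⊗ (C c) B {0} (s≤s z≤n) b)))
        (bounded-residue bs)

      -- Linear dependence of lists of pairs on coefficient vectors, stated only up to `≈` in each
      -- component. It is transported through `step` and `residue`, which makes the vanishing
      -- conditions linear forms.
      data Comb (a b : Carrier) : Pairs → Pairs → Pairs → Set where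
        []  : Comb a b [] [] []
        _∷_ : ∀ {A B A₁ B₁ A₂ B₂ ps qs rs} →
              A ≈ C a ⊗ A₁ ⊕ C b ⊗ A₂ × B ≈ C a ⊗ B₁ ⊕ C b ⊗ B₂ →
              Comb a b ps qs rs → Comb a b ((A , B) ∷ ps) ((A₁ , B₁) ∷ qs) ((A₂ , B₂) ∷ rs)

      comb-step : ∀ k s {a b ps qs rs} → Comb a b ps qs rs → Comb a b (step k s ps) (step k s qs) (step k s rs)
      comb-step k s []              = []
      comb-step k s {a} {b} (_∷_ {A} {B} {A₁} {B₁} {A₂} {B₂} (e , e′) cs) =
        (one A A₁ A₂ (- ι k) e , one B B₁ B₂ (ι M + - ι k) e′) ∷ comb-step k (s + ι L) cs
        where
        one : ∀ A A₁ A₂ t → A ≈ C a ⊗ A₁ ⊕ C b ⊗ A₂ →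
          f ⊗ (D A ⊕ C s ⊗ A) ⊕ C t ⊗ (D f ⊗ A) ≈
          C a ⊗ (f ⊗ (D A₁ ⊕ C s ⊗ A₁) ⊕ C t ⊗ (D f ⊗ A₁)) ⊕ C b ⊗ (f ⊗ (D A₂ ⊕ C s ⊗ A₂) ⊕ C t ⊗ (D f ⊗ A₂))
        one A A₁ A₂ t e = ≈-trans
          (⊕-cong (⊗-congˡ f (⊕-cong dA (⊗-congˡ (C s) e))) (⊗-congˡ (C t) (⊗-congˡ (D f) e)))
          (arrange (C a) (C b) f (D A₁) (D A₂) (C s) A₁ A₂ (C t) (D f))
          where
          D-scale : ∀ a A → D (C a ⊗ A) ≈ C a ⊗ D A
          D-scale a A = ≈-trans (D-cong (≈-sym (∙≈⊗ a A))) (≈-trans (D-∙ a A) (∙≈⊗ a (D A)))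
          dA : D A ≈ C a ⊗ D A₁ ⊕ C b ⊗ D A₂
          dA = ≈-trans (D-cong e) (≈-trans (D-⊕ (C a ⊗ A₁) (C b ⊗ A₂)) (⊕-cong (D-scale a A₁) (D-scale b A₂)))
          arrange : ∀ a b f d₁ d₂ s x y t g →
            f ⊗ ((a ⊗ d₁ ⊕ b ⊗ d₂) ⊕ s ⊗ (a ⊗ x ⊕ b ⊗ y)) ⊕ t ⊗ (g ⊗ (a ⊗ x ⊕ b ⊗ y)) ≈
            a ⊗ (f ⊗ (d₁ ⊕ s ⊗ x) ⊕ t ⊗ (g ⊗ x)) ⊕ b ⊗ (f ⊗ (d₂ ⊕ s ⊗ y) ⊕ t ⊗ (g ⊗ y))
          arrange = S.solve 10 (λ a b f d₁ d₂ s x y t g →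
            f S.:* ((a S.:* d₁ S.:+ b S.:* d₂) S.:+ s S.:* (a S.:* x S.:+ b S.:* y)) S.:+ t S.:* (g S.:* (a S.:* x S.:+ b S.:* y)) S.:=
            a S.:* (f S.:* (d₁ S.:+ s S.:* x) S.:+ t S.:* (g S.:* x)) S.:+ b S.:* (f S.:* (d₂ S.:+ s S.:* y) S.:+ t S.:* (g S.:* y))) ≈-refl

      comb-iterate : ∀ k {a b ps qs rs} → Comb a b ps qs rs → Comb a b (iterate k ps) (iterate k qs) (iterate k rs)
      comb-iterate zero    cs = cs
      comb-iterate (suc k) cs = comb-step k 0# (comb-iterate k cs)

      comb-residue : ∀ {a b ps qs rs} → Comb a b ps qs rs → residue ps ≈ C a ⊗ residue qs ⊕ C b ⊗ residue rs
      comb-residue {a} {b} [] = ≈-sym (≈-trans (⊕-cong (⊗-zeroʳ (C a)) (⊗-zeroʳ (C b))) ≈-refl)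
      comb-residue {a} {b} (_∷_ {A} {B} {A₁} {B₁} {A₂} {B₂} {ps} {qs} {rs} (e , e′) cs) = ≈-trans
        (⊕-cong (⊕-cong (≈-trans (X^-cong κ e) (≈-trans (X^-⊕ κ (C a ⊗ A₁) (C b ⊗ A₂)) (⊕-cong (X^-scale a A₁) (X^-scale b A₂))))
                        (⊗-congˡ (C c) e′)) (comb-residue cs))
        (arrange (C a) (C b) (X^ κ ⊙ A₁) (X^ κ ⊙ A₂) (C c) B₁ B₂ (residue qs) (residue rs))
        where
        X^-scale : ∀ a A → X^ κ ⊙ (C a ⊗ A) ≈ C a ⊗ (X^ κ ⊙ A)
        X^-scale a A = ≈-trans (X^-cong κ (≈-sym (∙≈⊗ a A))) (≈-trans (X^-∙ κ a A) (∙≈⊗ a _))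
        arrange : ∀ a b x y c u v r s → (a ⊗ x ⊕ b ⊗ y) ⊕ c ⊗ (a ⊗ u ⊕ b ⊗ v) ⊕ (a ⊗ r ⊕ b ⊗ s)
                  ≈ a ⊗ (x ⊕ c ⊗ u ⊕ r) ⊕ b ⊗ (y ⊕ c ⊗ v ⊕ s)
        arrange = S.solve 9 (λ a b x y c u v r s → (a S.:* x S.:+ b S.:* y) S.:+ c S.:* (a S.:* u S.:+ b S.:* v) S.:+ (a S.:* r S.:+ b S.:* s)
                  S.:= a S.:* (x S.:+ c S.:* u S.:+ r) S.:+ b S.:* (y S.:+ c S.:* v S.:+ s)) ≈-refl

      -- J pairs with both components free, then Q pairs with second component 0. A free second
      -- component reaches k₀ M higher in degree because of f^M; if k₀ M ≤ Q L, the Q additional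
      -- blocks fit below the same degree (J + Q) L.
      dim : ℕ → ℕ → ℕ
      dim zero    zero    = zero
      dim zero    (suc Q) = suc I ℕ.+ dim zero Q
      dim (suc J) Q       = suc I ℕ.+ (suc I ℕ.+ dim J Q)

      build : ∀ J Q → Vec Carrier (dim J Q) → Pairs
      build zero    zero    x = []
      build zero    (suc Q) x = (toList (Vec.take (suc I) x) , []) ∷ build zero Q (Vec.drop (suc I) x)
      build (suc J) Q       x = (toList (Vec.take (suc I) x) , toList (Vec.take (suc I) (Vec.drop (suc I) x)))
                                ∷ build J Q (Vec.drop (suc I) (Vec.drop (suc I) x))

      private
        comb-vec : ∀ {n} a b (x y : Vec Carrier n) → toList (combine a b x y) ≈ C a ⊗ toList x ⊕ C b ⊗ toList y
        comb-vec {n} a b x y = ≈-trans (go x y) (⊕-cong (∙≈⊗ a (toList x)) (∙≈⊗ b (toList y)))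
          where
          go : ∀ {n} (x y : Vec Carrier n) → toList (combine a b x y) ≈ a ∙ toList x ⊕ b ∙ toList y
          go []      []      = ≈-refl
          go (u ∷ x) (v ∷ y) = ∷-cong refl (go x y)

        take-combine : ∀ m {n} a b (x y : Vec Carrier (m ℕ.+ n)) →
                       Vec.take m (combine a b x y) ≡ combine a b (Vec.take m x) (Vec.take m y)
        take-combine zero    a b x       y       = refl
        take-combine (suc m) a b (u ∷ x) (v ∷ y) = cong (_ ∷_) (take-combine m a b x y)

        drop-combine : ∀ m {n} a b (x y : Vec Carrier (m ℕ.+ n)) →
                       Vec.drop m (combine a b x y) ≡ combine a b (Vec.drop m x) (Vec.drop m y)
        drop-combine zero    a b x       y       = refl
        drop-combine (suc m) a b (u ∷ x) (v ∷ y) = drop-combine m a b x y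

        comb-take : ∀ {n} a b (x y : Vec Carrier (suc I ℕ.+ n)) →
          toList (Vec.take (suc I) (combine a b x y)) ≈ C a ⊗ toList (Vec.take (suc I) x) ⊕ C b ⊗ toList (Vec.take (suc I) y)
        comb-take a b x y = subst (λ u → toList u ≈ C a ⊗ toList (Vec.take (suc I) x) ⊕ C b ⊗ toList (Vec.take (suc I) y)) (sym (take-combine (suc I) a b x y)) (comb-vec a b _ _)

      comb-build : ∀ J Q a b x y → Comb a b (build J Q (combine a b x y)) (build J Q x) (build J Q y)
      comb-build zero    zero    a b x y = []
      comb-build zero    (suc Q) a b x y =
        (comb-take a b x y , ≈-sym (≈-trans (⊕-cong (⊗-zeroʳ (C a)) (⊗-zeroʳ (C b))) ≈-refl))
        ∷ subst (λ u → Comb a b (build zero Q u) _ _) (sym (drop-combine (suc I) a b x y)) (comb-build zero Q a b _ _)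
      comb-build (suc J) Q       a b x y =
        (comb-take a b x y , subst (λ u → toList (Vec.take (suc I) u) ≈ C a ⊗ toList (Vec.take (suc I) (Vec.drop (suc I) x)) ⊕ C b ⊗ toList (Vec.take (suc I) (Vec.drop (suc I) y)))
            (sym (drop-combine (suc I) a b x y)) (comb-take a b (Vec.drop (suc I) x) (Vec.drop (suc I) y)))
        ∷ subst (λ u → Comb a b (build J Q (Vec.drop (suc I) u)) _ _) (sym (drop-combine (suc I) a b x y))
            (subst (λ u → Comb a b (build J Q u) _ _) (sym (drop-combine (suc I) a b (Vec.drop (suc I) x) (Vec.drop (suc I) y))) (comb-build J Q a b _ _))

      private
        length-toList : ∀ {n} (x : Vec Carrier n) → length (toList x) ℕ.≤ n
        length-toList []      = z≤n
        length-toList (u ∷ x) = s≤s (length-toList x)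

      build-lengths : ∀ J Q x → All (λ AB → length (proj₁ AB) ℕ.≤ suc I × length (proj₂ AB) ℕ.≤ suc I) (build J Q x)
      build-lengths zero    zero    x = []
      build-lengths zero    (suc Q) x = (length-toList (Vec.take (suc I) x) , z≤n) ∷ build-lengths zero Q _
      build-lengths (suc J) Q       x = (length-toList (Vec.take (suc I) x) , length-toList (Vec.take (suc I) (Vec.drop (suc I) x)))
                                        ∷ build-lengths J Q _

      private
        zero-vec : ∀ {n} (x : Vec Carrier n) → toList x ≈ [] → VAll.All (_≡ 0#) x
        zero-vec []      e = VAll.[]
        zero-vec (u ∷ x) e = e .at 0 VAll.∷ zero-vec x (mk λ i → e .at (suc i))

        zero-join : ∀ m {n} (x : Vec Carrier (m ℕ.+ n)) → toList (Vec.take m x) ≈ [] → VAll.All (_≡ 0#) (Vec.drop m x) → VAll.All (_≡ 0#) x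
        zero-join m x e d = subst (VAll.All (_≡ 0#)) (take++drop≡id m x) (VAllₚ.++⁺ (zero-vec (Vec.take m x) e) d)

      build-zero : ∀ J Q x → All (λ AB → proj₁ AB ≈ [] × proj₂ AB ≈ []) (build J Q x) → VAll.All (_≡ 0#) x
      build-zero zero    zero    []  zs             = VAll.[]
      build-zero zero    (suc Q) x ((z , _) ∷ zs) = zero-join (suc I) x z (build-zero zero Q _ zs)
      build-zero (suc J) Q       x ((z , y) ∷ zs) = zero-join (suc I) x z (zero-join (suc I) _ y (build-zero J Q _ zs))

      build-degree : ∀ Q → k₀ ℕ.* M ℕ.≤ Q ℕ.* L → suc I ℕ.≤ L → ∀ J x → Bound (total (build J Q x)) ((J ℕ.+ Q) ℕ.* L)
      build-degree Q k₀M≤QL I<L zero x = as Q x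
        where
        as : ∀ Q x → Bound (total (build zero Q x)) (Q ℕ.* L)
        as zero    x = λ _ _ → refl
        as (suc Q) x = bound-⊕ (A ⊕ G ⊗ []) (Xᴸ ⊗ T)
          (bound-⊕ A (G ⊗ []) (bound-length A (ℕₚ.≤-trans (length-toList (Vec.take (suc I) x)) (ℕₚ.≤-trans I<L (ℕₚ.m≤m+n L (Q ℕ.* L)))))
            (bound-≈ (≈-sym (⊗-zeroʳ G)) (λ _ _ → refl)))
          (bound-≈ (≈-sym (Xᴸ⊗ T)) (bound-X^ L T (as Q _)))
          where
          A = toList (Vec.take (suc I) x)
          T = total (build zero Q (Vec.drop (suc I) x))
      build-degree Q k₀M≤QL I<L (suc J) x = bound-⊕ (A ⊕ G ⊗ B) (Xᴸ ⊗ T)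
        (bound-⊕ A (G ⊗ B) (bound-length A (ℕₚ.≤-trans (length-toList (Vec.take (suc I) x)) (ℕₚ.≤-trans I<L (ℕₚ.m≤m+n L ((J ℕ.+ Q) ℕ.* L)))))
          (bound-≤ {G ⊗ B} size (bound-^⊗ f B M f-length (bound-length B (length-toList (Vec.take (suc I) (Vec.drop (suc I) x)))))))
        (bound-≈ (≈-sym (Xᴸ⊗ T)) (bound-X^ L T (build-degree Q k₀M≤QL I<L J _)))
        where
        A = toList (Vec.take (suc I) x)
        B = toList (Vec.take (suc I) (Vec.drop (suc I) x))
        T = total (build J Q (Vec.drop (suc I) (Vec.drop (suc I) x)))
        size : k₀ ℕ.* M ℕ.+ suc I ℕ.≤ L ℕ.+ (J ℕ.+ Q) ℕ.* L
        size = ℕₚ.≤-trans (ℕₚ.+-mono-≤ (ℕₚ.≤-trans k₀M≤QL (ℕₚ.*-monoˡ-≤ L (ℕₚ.m≤n+m Q J))) I<L) (ℕₚ.≤-reflexive (ℕₚ.+-comm _ L))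

      equations : ℕ → ℕ
      equations zero    = 0
      equations (suc m) = κ ℕ.+ degree m ℕ.+ equations m

      functional : ∀ J Q → ℕ → ℕ → Functional (dim J Q)
      functional J Q k i = record
        { _⟨_⟩ = λ x → coef (residue (iterate k (build J Q x))) i
        ; linear = λ a b x y →
            trans (comb-residue (comb-iterate k (comb-build J Q a b x y)) .at i)
              (trans (coef-⊕ (C a ⊗ r x) (C b ⊗ r y) i) (cong₂ _+_ (scale a (r x)) (scale b (r y)))) }
        where
        r = λ x → residue (iterate k (build J Q x))
        scale : ∀ a q → coef (C a ⊗ q) i ≡ a * coef q i
        scale a q = trans (≈-sym (∙≈⊗ a q) .at i) (coef-∙ a q i)

      conditions : ∀ J Q → ℕ → List (Functional (dim J Q))
      conditions J Q zero    = []
      conditions J Q (suc m) = map (functional J Q m) (upTo (κ ℕ.+ degree m)) ++ conditions J Q m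

      length-conditions : ∀ J Q m → length (conditions J Q m) ≡ equations m
      length-conditions J Q zero    = refl
      length-conditions J Q (suc m) = trans (length-++ (map (functional J Q m) (upTo (κ ℕ.+ degree m))))
        (cong₂ ℕ._+_ (trans (length-map (functional J Q m) (upTo (κ ℕ.+ degree m))) (length-upTo (κ ℕ.+ degree m))) (length-conditions J Q m))

      solution-residue : ∀ J Q m x → All (λ φ → φ ⟨ x ⟩ ≡ 0#) (conditions J Q m) →
                         ∀ k → k ℕ.< m → residue (iterate k (build J Q x)) ≈ []
      solution-residue J Q (suc m) x zs k k<m with k ℕₚ.≟ m
      ... | yes refl = low-bound {κ ℕ.+ degree m}
        (λ i i< → All.lookup (Allₚ.map⁻ (Allₚ.++⁻ˡ (map (functional J Q m) (upTo (κ ℕ.+ degree m))) zs)) (∈-upTo⁺ i<))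
        (bounded-residue (bounded-iterate m (All.map (λ {AB} (a , b) → bound-length (proj₁ AB) a , bound-length (proj₂ AB) b) (build-lengths J Q x))))
      ... | no k≢m = solution-residue J Q m x (Allₚ.++⁻ʳ (map (functional J Q m) (upTo (κ ℕ.+ degree m))) zs) k (ℕₚ.≤∧≢⇒< (ℕₚ.≤-pred k<m) k≢m)

      -- Stepanov's method: there are more coefficients than conditions, so some
      -- non-zero F = Σ X^(jL) (A_j + f^M B_j) vanishes to order m at every good point.
      few-good-points : ∀ m J Q → m ℕ.≤ p → suc I ℕ.≤ L → k₀ ℕ.* M ℕ.≤ Q ℕ.* L → equations m ℕ.< dim J Q →
        ∀ τs → All (λ τ → ¬ (τ ≡ 0#) × ¬ (ev f τ ≡ 0#) × τ ^ L ≡ 1# × τ ^ κ * ev f τ ^ M ≡ c) τs →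
        AllPairs (λ s t → ¬ (s ≡ t)) τs →
        length τs ℕ.* m ℕ.< (J ℕ.+ Q) ℕ.* L
      few-good-points m J Q m≤p I<L k₀M≤QL eqs<dim τs good distinct with underdetermined (dim J Q) (conditions J Q m)
                                                                (subst (ℕ._< dim J Q) (sym (length-conditions J Q m)) eqs<dim)
      ... | x , x≢0 , zs = ℕₚ.≰⇒> λ l → x≢0 (build-zero J Q x (total-zero (build J Q x) (build-lengths J Q x)
              (too-many-roots p ι≢0 m τs W m≤p (All.map proj₁ good) distinct (All.map vanish good)
                (bound-≤ {W} l (build-degree Q k₀M≤QL I<L J x)))))
        where
        W = total (build J Q x)
        vanish : ∀ {τ} → ¬ (τ ≡ 0#) × ¬ (ev f τ ≡ 0#) × τ ^ L ≡ 1# × τ ^ κ * ev f τ ^ M ≡ c → Van m W τ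
        vanish {τ} (τ≢0 , fτ≢0 , τᴸ , g) = iterate-van m 0 (build J Q x) τ fτ≢0 λ l _ l<m →
          *-cancel-0 (^-nonzero κ τ≢0) (trans (ev-residue τ τᴸ g (iterate l (build J Q x)))
            (ev-zero (residue (iterate l (build J Q x))) τ (solution-residue J Q m x zs l l<m)))

-- Finite fields

module PrimeField (k : ℕ) (p-prime : Prime (suc (suc k))) where

  p : ℕ
  p = suc (suc k)

  -- The bound is irrelevant, so that equality of representatives is already equality of elements.
  record 𝔽 : Set where
    constructor mk𝔽
    field
      val    : ℕ
      .val<p : val ℕ.< p
  open 𝔽 public

  val-injective : ∀ {a b} → val a ≡ val b → a ≡ b
  val-injective refl = refl

  [_] : ℕ → 𝔽
  [ n ] = mk𝔽 (n % p) (m%n<n n p)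

  [val] : ∀ a → [ val a ] ≡ a
  [val] (mk𝔽 n n<p) = val-injective (reduce n n<p)
    where
    reduce : ∀ n → .(n ℕ.< p) → n % p ≡ n
    -- An irrelevant bound may not be used for a relevant result. It is decided afresh and serves
    -- only to refute the negative answer.
    reduce n n<p with n ℕₚ.<? p
    ... | yes l = m<n⇒m%n≡m l
    ... | no ¬l = ⊥-elim-irr (¬l n<p)

  infix  8 neg_
  infixl 7 _*ᶠ_
  infixl 6 _+ᶠ_

  _+ᶠ_ _*ᶠ_ : 𝔽 → 𝔽 → 𝔽
  a +ᶠ b = [ val a ℕ.+ val b ]
  a *ᶠ b = [ val a ℕ.* val b ]

  neg_ : 𝔽 → 𝔽
  neg a = [ p ℕ.∸ val a ]

  []-+ : ∀ m n → [ m ] +ᶠ [ n ] ≡ [ m ℕ.+ n ]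
  []-+ m n = val-injective (sym (%-distribˡ-+ m n p))

  []-* : ∀ m n → [ m ] *ᶠ [ n ] ≡ [ m ℕ.* n ]
  []-* m n = val-injective (sym (%-distribˡ-* m n p))

  private
    -- every element is a residue, so the ring laws follow from those of ℕ
    lift₃ : (P : 𝔽 → 𝔽 → 𝔽 → Set) → (∀ l m n → P [ l ] [ m ] [ n ]) → ∀ a b c → P a b c
    lift₃ P h a b c = subst (λ u → P u b c) ([val] a) (subst (λ u → P [ val a ] u c) ([val] b)
      (subst (P [ val a ] [ val b ]) ([val] c) (h (val a) (val b) (val c))))

    +-assocᶠ : ∀ a b c → (a +ᶠ b) +ᶠ c ≡ a +ᶠ (b +ᶠ c)
    +-assocᶠ = lift₃ (λ a b c → (a +ᶠ b) +ᶠ c ≡ a +ᶠ (b +ᶠ c)) λ l m n → trans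
      (trans (cong (_+ᶠ [ n ]) ([]-+ l m)) ([]-+ (l ℕ.+ m) n))
      (trans (cong [_] (ℕₚ.+-assoc l m n)) (sym (trans (cong ([ l ] +ᶠ_) ([]-+ m n)) ([]-+ l (m ℕ.+ n)))))

    *-assocᶠ : ∀ a b c → (a *ᶠ b) *ᶠ c ≡ a *ᶠ (b *ᶠ c)
    *-assocᶠ = lift₃ (λ a b c → (a *ᶠ b) *ᶠ c ≡ a *ᶠ (b *ᶠ c)) λ l m n → trans
      (trans (cong (_*ᶠ [ n ]) ([]-* l m)) ([]-* (l ℕ.* m) n))
      (trans (cong [_] (ℕₚ.*-assoc l m n)) (sym (trans (cong ([ l ] *ᶠ_) ([]-* m n)) ([]-* l (m ℕ.* n)))))

    distribˡᶠ : ∀ a b c → a *ᶠ (b +ᶠ c) ≡ a *ᶠ b +ᶠ a *ᶠ c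
    distribˡᶠ = lift₃ (λ a b c → a *ᶠ (b +ᶠ c) ≡ a *ᶠ b +ᶠ a *ᶠ c) λ l m n → trans
      (trans (cong ([ l ] *ᶠ_) ([]-+ m n)) ([]-* l (m ℕ.+ n)))
      (trans (cong [_] (ℕₚ.*-distribˡ-+ l m n)) (sym (trans (cong₂ _+ᶠ_ ([]-* l m) ([]-* l n)) ([]-+ (l ℕ.* m) (l ℕ.* n)))))

    +-commᶠ : ∀ a b → a +ᶠ b ≡ b +ᶠ a
    +-commᶠ a b = cong [_] (ℕₚ.+-comm (val a) (val b))

    *-commᶠ : ∀ a b → a *ᶠ b ≡ b *ᶠ a
    *-commᶠ a b = cong [_] (ℕₚ.*-comm (val a) (val b))

    +-identityˡᶠ : ∀ a → [ 0 ] +ᶠ a ≡ a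
    +-identityˡᶠ a = [val] a

    *-identityˡᶠ : ∀ a → [ 1 ] *ᶠ a ≡ a
    *-identityˡᶠ a = trans (cong [_] (ℕₚ.*-identityˡ (val a))) ([val] a)

  [p]≡0 : [ p ] ≡ [ 0 ]
  [p]≡0 = val-injective (n%n≡0 p)

  private
    negˡ : ∀ a → neg a +ᶠ a ≡ [ 0 ]
    negˡ a@(mk𝔽 n n<p) = trans (cong (neg a +ᶠ_) (sym ([val] a))) (trans ([]-+ (p ℕ.∸ n) n)
      (trans (cong [_] (fill n n<p)) [p]≡0))
      where
      fill : ∀ n → .(n ℕ.< p) → p ℕ.∸ n ℕ.+ n ≡ p
      fill n n<p with n ℕₚ.<? p
      ... | yes l = ℕₚ.m∸n+n≡m (ℕₚ.<⇒≤ l)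
      ... | no ¬l = ⊥-elim-irr (¬l n<p)

  isCommutativeRingᶠ : AS.IsCommutativeRing _≡_ _+ᶠ_ _*ᶠ_ neg_ [ 0 ] [ 1 ]
  isCommutativeRingᶠ = record
    { isRing = record
      { +-isAbelianGroup = record
        { isGroup = record
          { isMonoid = record
            { isSemigroup = record
              { isMagma = record { isEquivalence = ≡.isEquivalence ; ∙-cong = cong₂ _+ᶠ_ }
              ; assoc = +-assocᶠ }
            ; identity = +-identityˡᶠ , (λ a → trans (+-commᶠ a [ 0 ]) (+-identityˡᶠ a)) }
          ; inverse = negˡ , (λ a → trans (+-commᶠ a (neg a)) (negˡ a))
          ; ⁻¹-cong = cong neg_ }
        ; comm = +-commᶠ }
      ; *-cong = cong₂ _*ᶠ_
      ; *-assoc = *-assocᶠ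
      ; *-identity = *-identityˡᶠ , (λ a → trans (*-commᶠ a [ 1 ]) (*-identityˡᶠ a))
      ; distrib = distribˡᶠ , (λ a b c → trans (*-commᶠ (b +ᶠ c) a) (trans (distribˡᶠ a b c) (cong₂ _+ᶠ_ (*-commᶠ a b) (*-commᶠ a c)))) }
    ; *-comm = *-commᶠ }

  private
    ringᶠ : CommutativeRing _ _
    ringᶠ = record { isCommutativeRing = isCommutativeRingᶠ }
    open CommutativeRing ringᶠ using (semiring; zeroˡ)
    open import Algebra.Properties.Semiring.Exp semiring using (_^_)
    open import Algebra.Properties.Semiring.Mult semiring using () renaming (_×_ to _×ᶠ_)
    open RingSolver ringᶠ

    ×-residue : ∀ n → n ×ᶠ [ 1 ] ≡ [ n ]
    ×-residue zero    = refl
    ×-residue (suc n) = trans (cong ([ 1 ] +ᶠ_) (×-residue n)) ([]-+ 1 n)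

  -- Induction on the representative: (1 + n)^p = 1 + n^p.
  fermat : ∀ a → a ^ p ≡ a
  fermat a = trans (cong (_^ p) (sym ([val] a))) (trans (go (val a)) ([val] a))
    where
    1^ : ∀ n → [ 1 ] ^ n ≡ [ 1 ]
    1^ zero    = refl
    1^ (suc n) = trans (cong ([ 1 ] *ᶠ_) (1^ n)) (*-identityˡᶠ [ 1 ])
    go : ∀ n → [ n ] ^ p ≡ [ n ]
    go zero    = zeroˡ ([ 0 ] ^ suc k)
    go (suc n) = begin
      [ suc n ] ^ p                ≡⟨ cong (_^ p) (sym ([]-+ 1 n)) ⟩
      ([ 1 ] +ᶠ [ n ]) ^ p         ≡⟨ FreshmansDream.freshman ringᶠ p-prime (trans (×-residue p) [p]≡0) [ 1 ] [ n ] ⟩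
      [ 1 ] ^ p +ᶠ [ n ] ^ p       ≡⟨ cong₂ _+ᶠ_ (1^ p) (go n) ⟩
      [ 1 ] +ᶠ [ n ]               ≡⟨ []-+ 1 n ⟩
      [ suc n ]                    ∎
      where open ≡.≡-Reasoning

  private
    val-0 : ∀ a → p ∣ val a → a ≡ [ 0 ]
    val-0 (mk𝔽 zero    _)   d = refl
    val-0 (mk𝔽 (suc n) n<p) d = ⊥-elim-irr (ℕₚ.<⇒≱ n<p (∣⇒≤ d))

    no-zero-divisors : ∀ a b → a *ᶠ b ≡ [ 0 ] → a ≡ [ 0 ] ⊎ b ≡ [ 0 ]
    no-zero-divisors a b e with euclidsLemma (val a) (val b) p-prime (m%n≡0⇒n∣m (val a ℕ.* val b) p (cong val e))
    ... | inj₁ d = inj₁ (val-0 a d)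
    ... | inj₂ d = inj₂ (val-0 b d)

    -- Here a (a · a^(p-2) - 1) = a^p - a = 0, and there are no zero divisors.
    inverseᶠ : ∀ a → ¬ (a ≡ [ 0 ]) → a *ᶠ a ^ k ≡ [ 1 ]
    inverseᶠ a a≢0 = conclude (no-zero-divisors a (a *ᶠ a ^ k +ᶠ neg [ 1 ]) (trans
      (solve 2 (λ a b → a :* (a :* b :- :ι 1) := a :* (a :* b) :- a) refl a (a ^ k))
      (trans (cong (_+ᶠ neg a) (fermat a)) (trans (+-commᶠ a (neg a)) (negˡ a)))))
      where
      conclude : a ≡ [ 0 ] ⊎ a *ᶠ a ^ k +ᶠ neg [ 1 ] ≡ [ 0 ] → a *ᶠ a ^ k ≡ [ 1 ]
      conclude (inj₁ z) = ⊥-elim (a≢0 z)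
      conclude (inj₂ z) = trans (solve 1 (λ x → x := x :- :ι 1 :+ :ι 1) refl (a *ᶠ a ^ k)) (trans (cong (_+ᶠ [ 1 ]) z) (+-identityˡᶠ [ 1 ]))

  primeField : Field
  primeField = record
    { Carrier = 𝔽 ; _+_ = _+ᶠ_ ; _*_ = _*ᶠ_ ; -_ = neg_ ; 0# = [ 0 ] ; 1# = [ 1 ]
    ; isCommutativeRing = isCommutativeRingᶠ
    ; _⁻¹ = _^ k
    ; inverse = inverseᶠ
    ; 1≢0 = λ e → ℕₚ.0≢1+n (sym (cong val e))
    ; _≟_ = λ a b → dec a b }
    where
    dec : ∀ a b → Dec (a ≡ b)
    dec a b with val a ℕₚ.≟ val b
    ... | yes e = yes (val-injective e)
    ... | no ¬e = no λ e → ¬e (cong val e)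

  ι≡[] : ∀ n → Field.ι primeField n ≡ [ n ]
  ι≡[] zero    = refl
  ι≡[] (suc n) = trans (FieldProps.ι-suc primeField n) (trans (cong ([ 1 ] +ᶠ_) (ι≡[] n)) ([]-+ 1 n))

Anisotropic : Field → Set
Anisotropic F = ∀ a b → a * a + b * b ≡ 0# → a ≡ 0# × b ≡ 0#
  where open Field F

-- The extension by a square root i of -1, for a field without one.
module GaussianExtension (F : Field) (anisotropic : Anisotropic F) where

  open Field F
  open FieldProps F
  open RingSolver commutativeRing hiding (ι)

  K : Set
  K = Carrier × Carrier

  infixl 7 _*ᴷ_
  infixl 6 _+ᴷ_

  _+ᴷ_ _*ᴷ_ : K → K → K
  (a , b) +ᴷ (c , d) = a + c , b + d
  (a , b) *ᴷ (c , d) = a * c - b * d , a * d + b * c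

  negᴷ : K → K
  negᴷ (a , b) = - a , - b

  isCommutativeRingᴷ : AS.IsCommutativeRing _≡_ _+ᴷ_ _*ᴷ_ negᴷ (0# , 0#) (1# , 0#)
  isCommutativeRingᴷ = record
    { isRing = record
      { +-isAbelianGroup = record
        { isGroup = record
          { isMonoid = record
            { isSemigroup = record
              { isMagma = record { isEquivalence = ≡.isEquivalence ; ∙-cong = cong₂ _+ᴷ_ }
              ; assoc = λ (a , b) (c , d) (e , f) → cong₂ _,_ (+-assoc a c e) (+-assoc b d f) }
            ; identity = (λ (a , b) → cong₂ _,_ (+-identityˡ a) (+-identityˡ b)) , (λ (a , b) → cong₂ _,_ (+-identityʳ a) (+-identityʳ b)) }
          ; inverse = (λ (a , b) → cong₂ _,_ (-‿inverseˡ a) (-‿inverseˡ b)) , (λ (a , b) → cong₂ _,_ (-‿inverseʳ a) (-‿inverseʳ b))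
          ; ⁻¹-cong = cong negᴷ }
        ; comm = λ (a , b) (c , d) → cong₂ _,_ (+-comm a c) (+-comm b d) }
      ; *-cong = cong₂ _*ᴷ_
      ; *-assoc = λ (a , b) (c , d) (e , f) → cong₂ _,_
          (solve 6 (λ a b c d e f → (a :* c :- b :* d) :* e :- (a :* d :+ b :* c) :* f := a :* (c :* e :- d :* f) :- b :* (c :* f :+ d :* e)) refl a b c d e f)
          (solve 6 (λ a b c d e f → (a :* c :- b :* d) :* f :+ (a :* d :+ b :* c) :* e := a :* (c :* f :+ d :* e) :+ b :* (c :* e :- d :* f)) refl a b c d e f)
      ; *-identity = (λ (a , b) → cong₂ _,_
            (solve 2 (λ a b → :ι 1 :* a :- :ι 0 :* b := a) refl a b) (solve 2 (λ a b → :ι 1 :* b :+ :ι 0 :* a := b) refl a b))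
          , (λ (a , b) → cong₂ _,_
            (solve 2 (λ a b → a :* :ι 1 :- b :* :ι 0 := a) refl a b) (solve 2 (λ a b → a :* :ι 0 :+ b :* :ι 1 := b) refl a b))
      ; distrib = (λ (a , b) (c , d) (e , f) → cong₂ _,_
            (solve 6 (λ a b c d e f → a :* (c :+ e) :- b :* (d :+ f) := (a :* c :- b :* d) :+ (a :* e :- b :* f)) refl a b c d e f)
            (solve 6 (λ a b c d e f → a :* (d :+ f) :+ b :* (c :+ e) := (a :* d :+ b :* c) :+ (a :* f :+ b :* e)) refl a b c d e f))
          , (λ (a , b) (c , d) (e , f) → cong₂ _,_
            (solve 6 (λ a b c d e f → (c :+ e) :* a :- (d :+ f) :* b := (c :* a :- d :* b) :+ (e :* a :- f :* b)) refl a b c d e f)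
            (solve 6 (λ a b c d e f → (c :+ e) :* b :+ (d :+ f) :* a := (c :* b :+ d :* a) :+ (e :* b :+ f :* a)) refl a b c d e f)) }
    ; *-comm = λ (a , b) (c , d) → cong₂ _,_
          (solve 4 (λ a b c d → a :* c :- b :* d := c :* a :- d :* b) refl a b c d)
          (solve 4 (λ a b c d → a :* d :+ b :* c := c :* b :+ d :* a) refl a b c d) }

  gaussianField : Field
  gaussianField = record
    { Carrier = K ; _+_ = _+ᴷ_ ; _*_ = _*ᴷ_ ; -_ = negᴷ ; 0# = 0# , 0# ; 1# = 1# , 0#
    ; isCommutativeRing = isCommutativeRingᴷ
    ; _⁻¹ = λ (a , b) → a * norm⁻¹ a b , - b * norm⁻¹ a b
    ; inverse = λ (a , b) n → cong₂ _,_
        (trans (solve 3 (λ a b n → a :* (a :* n) :- b :* (:- b :* n) := (a :* a :+ b :* b) :* n) refl a b (norm⁻¹ a b))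
          (inverse (a * a + b * b) λ e → n (cong₂ _,_ (proj₁ (anisotropic a b e)) (proj₂ (anisotropic a b e)))))
        (solve 3 (λ a b n → a :* (:- b :* n) :+ b :* (a :* n) := :ι 0) refl a b (norm⁻¹ a b))
    ; 1≢0 = λ e → 1≢0 (cong proj₁ e)
    ; _≟_ = λ (a , b) (c , d) → dec a b c d }
    where
    norm⁻¹ : Carrier → Carrier → Carrier
    norm⁻¹ a b = (a * a + b * b) ⁻¹
    dec : ∀ a b c d → Dec ((a , b) ≡ (c , d))
    dec a b c d with a ≟ c | b ≟ d
    ... | yes refl | yes refl = yes refl
    ... | no a≢c   | _        = no λ { refl → a≢c refl }
    ... | _        | no b≢d   = no λ { refl → b≢d refl }

  emb : Carrier → K
  emb a = a , 0#

  𝕚 : K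
  𝕚 = 0# , 1#

  emb-+ : ∀ a b → emb (a + b) ≡ emb a +ᴷ emb b
  emb-+ a b = cong (a + b ,_) (sym (+-identityˡ 0#))

  emb-* : ∀ a b → emb (a * b) ≡ emb a *ᴷ emb b
  emb-* a b = cong₂ _,_ (solve 2 (λ a b → a :* b := a :* b :- :ι 0 :* :ι 0) refl a b)
                        (solve 2 (λ a b → :ι 0 := a :* :ι 0 :+ :ι 0 :* b) refl a b)

  emb-neg : ∀ a → emb (- a) ≡ negᴷ (emb a)
  emb-neg a = cong (- a ,_) (solve 0 (:ι 0 := :- :ι 0) refl)

  emb-injective : ∀ {a b} → emb a ≡ emb b → a ≡ b
  emb-injective = cong proj₁

  𝕚² : 𝕚 *ᴷ 𝕚 ≡ negᴷ (1# , 0#)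
  𝕚² = cong₂ _,_ (solve 0 (:ι 0 :* :ι 0 :- :ι 1 :* :ι 1 := :- :ι 1) refl)
                 (solve 0 (:ι 0 :* :ι 1 :+ :ι 1 :* :ι 0 := :- :ι 0) refl)

  decompose : ∀ a b → (a , b) ≡ emb a +ᴷ 𝕚 *ᴷ emb b
  decompose a b = cong₂ _,_ (solve 2 (λ a b → a := a :+ (:ι 0 :* b :- :ι 1 :* :ι 0)) refl a b)
                            (solve 2 (λ a b → b := :ι 0 :+ (:ι 0 :* :ι 0 :+ :ι 1 :* b)) refl a b)

module Eigenvalues (F K : Field) (emb : Field.Carrier F → Field.Carrier K) (M : ℕ) where
  private
    module F = Field F
    module K = Field K

  -- The eigenvalues ω, ω̃ of the rotation attached to x, whose squares have
  -- order dividing M (x² - 4 a square) or M + 1 (x² - 4 a non-square).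
  record Torus (x : F.Carrier) : Set where
    field
      ω ω̃   : K.Carrier
      ωω̃≡1  : ω K.* ω̃ ≡ K.1#
      ω+ω̃≡x : ω K.+ ω̃ ≡ emb x
      κ     : ℕ
      order : (ω K.* ω) K.^ (M ℕ.+ κ) ≡ K.1#
      type  : (κ ≡ 0 × (x F.* x F.- (F.1# F.+ F.1#) F.* (F.1# F.+ F.1#)) F.^ M ≡ F.1#)
            ⊎ (κ ≡ 1 × (x F.* x F.- (F.1# F.+ F.1#) F.* (F.1# F.+ F.1#)) F.^ M ≡ F.- F.1#)

-- A field F of odd characteristic p and its extension K by 𝕚 = √-1, with p = 2M + 1.
record Setting : Set₁ where
  field
    F K : Field
  module F = Field F
  module K = Field K
  field
    emb           : F.Carrier → K.Carrier
    emb-+         : ∀ a b → emb (a F.+ b) ≡ emb a K.+ emb b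
    emb-*         : ∀ a b → emb (a F.* b) ≡ emb a K.* emb b
    emb-neg       : ∀ a → emb (F.- a) ≡ K.- emb a
    emb-injective : ∀ {a b} → emb a ≡ emb b → a ≡ b
    emb-1         : emb F.1# ≡ K.1#
    𝕚             : K.Carrier
    𝕚²            : 𝕚 K.* 𝕚 ≡ K.- K.1#
    p             : ℕ
    p-prime       : Prime p
    ιp≡0          : K.ι p ≡ K.0#
    ι≢0           : ∀ j → 0 ℕ.< j → j ℕ.< p → ¬ (K.ι j ≡ K.0#)
    M             : ℕ
    p≡1+2M        : p ≡ suc (M ℕ.+ M)
    2<p           : 2 ℕ.< p
    legendre      : ∀ {a} → ¬ (a ≡ F.0#) → a F.^ M ≡ F.1# ⊎ a F.^ M ≡ F.- F.1#
    1≢-1          : ¬ (F.1# ≡ F.- F.1#)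
    neg-power     : ∀ a → (F.- a) F.^ M ≡ F.- (a F.^ M)
    anisotropic   : Anisotropic F
    torus         : ∀ x → ¬ (x F.* x F.- (F.1# F.+ F.1#) F.* (F.1# F.+ F.1#) ≡ F.0#) → Eigenvalues.Torus F K emb M x

-- A field with p = 3 + 4t elements, and its quadratic extension; the
-- Legendre symbol is a ↦ a ^ M.
module Residues (F : Field) (t : ℕ) (p-prime : Prime (3 ℕ.+ t ℕ.* 4))
  (fermat : ∀ a → Field._^_ F a (3 ℕ.+ t ℕ.* 4) ≡ a)
  (ιp≡0 : Field.ι F (3 ℕ.+ t ℕ.* 4) ≡ Field.0# F)
  (ι≢0 : ∀ j → 0 ℕ.< j → j ℕ.< 3 ℕ.+ t ℕ.* 4 → ¬ (Field.ι F j ≡ Field.0# F)) where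

  p M : ℕ
  p = 3 ℕ.+ t ℕ.* 4
  M = 1 ℕ.+ t ℕ.* 2

  p≡1+2M : p ≡ suc (M ℕ.+ M)
  p≡1+2M = solve 1 (λ t → con 3 :+ t :* con 4 := con 1 :+ ((con 1 :+ t :* con 2) :+ (con 1 :+ t :* con 2))) refl t
    where open +-*-Solver

  open Field F
  open FieldProps F
  open RingSolver commutativeRing hiding (ι)

  1≢-1 : ¬ (1# ≡ - 1#)
  1≢-1 e = ι≢0 2 (s≤s z≤n) (s≤s (s≤s (s≤s z≤n))) (trans (cong (_+ 1#) e) (-‿inverseˡ 1#))

  legendre² : ∀ {a} → ¬ (a ≡ 0#) → a ^ M * a ^ M ≡ 1#
  legendre² {a} a≢0 = *-cancelˡ a≢0 (begin
    a * (a ^ M * a ^ M)    ≡⟨ cong (a *_) (sym (^-homo-* a M M)) ⟩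
    a ^ suc (M ℕ.+ M)      ≡⟨ cong (a ^_) (sym p≡1+2M) ⟩
    a ^ p                  ≡⟨ fermat a ⟩
    a                      ≡⟨ sym (*-identityʳ a) ⟩
    a * 1#                 ∎)
    where open ≡.≡-Reasoning

  legendre : ∀ {a} → ¬ (a ≡ 0#) → a ^ M ≡ 1# ⊎ a ^ M ≡ - 1#
  legendre a≢0 = square-eq (trans (legendre² a≢0) (sym (*-identityʳ 1#)))

  neg-odd-power : ∀ s a → (- a) ^ (1 ℕ.+ s ℕ.* 2) ≡ - (a ^ (1 ℕ.+ s ℕ.* 2))
  neg-odd-power zero    a = solve 1 (λ a → :- a :* :ι 1 := :- (a :* :ι 1)) refl a
  neg-odd-power (suc s) a = trans (cong (λ u → - a * (- a * u)) (neg-odd-power s a))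
    (solve 2 (λ a u → :- a :* (:- a :* (:- u)) := :- (a :* (a :* u))) refl a (a ^ (1 ℕ.+ s ℕ.* 2)))

  -- The exponent M = 1 + 2t is odd, a consequence of p ≡ 3 modulo 4. For a = 1 this says that -1 is
  -- a non-residue.
  legendre-neg : ∀ a → (- a) ^ M ≡ - (a ^ M)
  legendre-neg = neg-odd-power t

  -- Otherwise a² = -b² with both sides nonzero, and taking M-th powers gives 1 = -1.
  anisotropic : Anisotropic F
  anisotropic a b e = decide (a ≟ 0#) (b ≟ 0#)
    where
    open ≡.≡-Reasoning
    clash : ¬ (a ≡ 0#) → ¬ (b ≡ 0#) → 1# ≡ - 1#
    clash a≢0 b≢0 = begin
      1#                     ≡⟨ sym (legendre² a≢0) ⟩
      a ^ M * a ^ M          ≡⟨ sym (^-distrib-* a a M) ⟩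
      (a * a) ^ M            ≡⟨ cong (_^ M) (x-y≡0⇒x≡y (trans (solve 2 (λ x y → x :- (:- y) := x :+ y) refl (a * a) (b * b)) e)) ⟩
      (- (b * b)) ^ M        ≡⟨ legendre-neg (b * b) ⟩
      - ((b * b) ^ M)        ≡⟨ cong -_ (trans (^-distrib-* b b M) (legendre² b≢0)) ⟩
      - 1#                   ∎
    decide : Dec (a ≡ 0#) → Dec (b ≡ 0#) → a ≡ 0# × b ≡ 0#
    decide (yes a≡0) _         = a≡0 , square-zero (trans (trans (sym (+-identityˡ (b * b))) (cong (_+ b * b) (sym (trans (cong (_* a) a≡0) (zeroˡ a))))) e)
    decide (no _)    (yes b≡0) = square-zero (trans (trans (sym (+-identityʳ (a * a))) (cong (a * a +_) (sym (trans (cong (_* b) b≡0) (zeroˡ b))))) e) , b≡0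
    decide (no a≢0)  (no b≢0)  = ⊥-elim (1≢-1 (clash a≢0 b≢0))

  -- a candidate square root of a, or of -a, is a ^ ((p+1)/4)
  root : Carrier → Carrier
  root a = a ^ suc t

  root² : ∀ a → root a * root a ≡ a ^ M * a
  root² a = begin
    a ^ suc t * a ^ suc t     ≡⟨ sym (^-homo-* a (suc t) (suc t)) ⟩
    a ^ (suc t ℕ.+ suc t)     ≡⟨ cong (a ^_) (NS.solve 1 (λ t → NS.con 1 NS.:+ t NS.:+ (NS.con 1 NS.:+ t) NS.:= NS.con 1 NS.:+ t NS.:* NS.con 2 NS.:+ NS.con 1) refl t) ⟩
    a ^ (M ℕ.+ 1)             ≡⟨ ^-homo-* a M 1 ⟩
    a ^ M * (a * 1#)          ≡⟨ cong (a ^ M *_) (*-identityʳ a) ⟩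
    a ^ M * a                 ∎
    where
    open ≡.≡-Reasoning
    module NS = +-*-Solver

  open GaussianExtension F anisotropic public
  module K′ = Field gaussianField

  conj : K → K
  conj (a , b) = a , - b

  private
    module KP = FieldProps gaussianField
    module KS = RingSolver K′.commutativeRing

  emb-^ : ∀ a n → emb (a ^ n) ≡ emb a K′.^ n
  emb-^ a zero    = refl
  emb-^ a (suc n) = trans (emb-* a (a ^ n)) (cong (emb a K′.*_) (emb-^ a n))

  ιᴷ : ∀ n → K′.ι n ≡ emb (ι n)
  ιᴷ zero    = refl
  ιᴷ (suc n) = trans (KP.ι-suc n) (trans (cong (K′.1# K′.+_) (ιᴷ n)) (sym (trans (cong emb (ι-suc n)) (emb-+ 1# (ι n)))))

  ιᴷp≡0 : K′.ι p ≡ K′.0#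
  ιᴷp≡0 = trans (ιᴷ p) (cong emb ιp≡0)

  ιᴷ≢0 : ∀ j → 0 ℕ.< j → j ℕ.< p → ¬ (K′.ι j ≡ K′.0#)
  ιᴷ≢0 j 0<j j<p e = ι≢0 j 0<j j<p (emb-injective (trans (sym (ιᴷ j)) e))

  private
    open import Algebra.Properties.Semiring.Mult K′.semiring using () renaming (_×_ to _×ᴷ_)
    ×ᴷ-ι : ∀ n → n ×ᴷ K′.1# ≡ K′.ι n
    ×ᴷ-ι zero    = refl
    ×ᴷ-ι (suc n) = trans (cong (K′.1# K′.+_) (×ᴷ-ι n)) (sym (KP.ι-suc n))

    𝕚^odd : ∀ s → 𝕚 K′.^ (3 ℕ.+ s ℕ.* 4) ≡ K′.- 𝕚
    𝕚^odd zero    = trans (KS.solve 1 (λ i → i KS.:* (i KS.:* (i KS.:* KS.:ι 1)) KS.:= i KS.:* (i KS.:* i)) refl 𝕚)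
                      (trans (cong (𝕚 K′.*_) 𝕚²) (KS.solve 1 (λ i → i KS.:* (KS.:- KS.:ι 1) KS.:= KS.:- i) refl 𝕚))
    𝕚^odd (suc s) = trans (cong (λ u → 𝕚 K′.* (𝕚 K′.* (𝕚 K′.* (𝕚 K′.* u)))) (𝕚^odd s))
      (trans (KS.solve 1 (λ i → i KS.:* (i KS.:* (i KS.:* (i KS.:* (KS.:- i)))) KS.:= (i KS.:* i) KS.:* (i KS.:* i) KS.:* (KS.:- i)) refl 𝕚)
        (trans (cong (λ u → u K′.* u K′.* (K′.- 𝕚)) 𝕚²)
          (KS.solve 1 (λ i → (KS.:- KS.:ι 1) KS.:* (KS.:- KS.:ι 1) KS.:* (KS.:- i) KS.:= KS.:- i) refl 𝕚)))

  -- Elements of F are fixed by Fermat, and 𝕚^p = -𝕚 because p ≡ 3 modulo 4.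
  frobenius : ∀ z → z K′.^ p ≡ conj z
  frobenius (a , b) = begin
    (a , b) K′.^ p
      ≡⟨ cong (K′._^ p) (decompose a b) ⟩
    (emb a K′.+ 𝕚 K′.* emb b) K′.^ p
      ≡⟨ FreshmansDream.freshman K′.commutativeRing p-prime (trans (×ᴷ-ι p) ιᴷp≡0) (emb a) (𝕚 K′.* emb b) ⟩
    emb a K′.^ p K′.+ (𝕚 K′.* emb b) K′.^ p
      ≡⟨ cong₂ K′._+_ (frob-emb a) (trans (K′.^-distrib-* 𝕚 (emb b) p) (cong₂ K′._*_ (𝕚^odd t) (frob-emb b))) ⟩
    emb a K′.+ (K′.- 𝕚) K′.* emb b
      ≡⟨ cong₂ _,_ (solve 2 (λ a b → a :+ (:- :ι 0 :* b :- (:- :ι 1) :* :ι 0) := a) refl a b)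
                   (solve 1 (λ b → :ι 0 :+ (:- :ι 0 :* :ι 0 :+ (:- :ι 1) :* b) := :- b) refl b) ⟩
    (a , - b) ∎
    where
    open ≡.≡-Reasoning
    frob-emb : ∀ a → emb a K′.^ p ≡ emb a
    frob-emb a = trans (sym (emb-^ a p)) (cong emb (fermat a))

  open Eigenvalues F gaussianField emb M public

  private
    2# 4# h : Carrier
    2# = 1# + 1#
    4# = 2# * 2#
    h  = 2# ⁻¹

    2h : 2# * h ≡ 1#
    2h = inverse 2# (ι≢0 2 (s≤s z≤n) (s≤s (s≤s (s≤s z≤n))))

    double-h : ∀ x → x * h + x * h ≡ x
    double-h x = trans (solve 2 (λ x h → x :* h :+ x :* h := x :* ((:ι 1 :+ :ι 1) :* h)) refl x h) (trans (cong (x *_) 2h) (*-identityʳ x))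

    4hh : ∀ {y} → y ≡ 4# → y * (h * h) ≡ 1#
    4hh refl = trans (solve 1 (λ h → (:ι 1 :+ :ι 1) :* (:ι 1 :+ :ι 1) :* (h :* h) := (:ι 1 :+ :ι 1) :* h :* ((:ι 1 :+ :ι 1) :* h)) refl h)
                 (trans (cong₂ _*_ 2h 2h) (*-identityʳ 1#))

  -- Let d = x² - 4 and s = `root d`, so that s² is d or -d. In the first case ω = (x + s)/2 lies in
  -- F, and (ω²)^M = 1. In the second case ω = (x + s𝕚)/2, and (ω²)^(M+1) = ω · ω^p is ω times its
  -- conjugate, which is 1.
  torus : ∀ x → ¬ (x * x - 4# ≡ 0#) → Torus x
  torus x d≢0 = decide (legendre d≢0)
    where
    d = x * x - 4#
    s = root d
    split : (x + s) * h + (x - s) * h ≡ x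
    split = trans (solve 3 (λ x s h → (x :+ s) :* h :+ (x :- s) :* h := x :* h :+ x :* h) refl x s h) (double-h x)
    x²-d : ∀ {e} → e ≡ d → x * x - e ≡ 4#
    x²-d refl = solve 2 (λ x f → x :- (x :- f) := f) refl (x * x) 4#
    decide : d ^ M ≡ 1# ⊎ d ^ M ≡ - 1# → Torus x
    decide (inj₁ e) = record
      { ω = emb w ; ω̃ = emb w̃
      ; ωω̃≡1 = trans (sym (emb-* w w̃)) (cong emb ww̃)
      ; ω+ω̃≡x = trans (sym (emb-+ w w̃)) (cong emb split)
      ; κ = 0
      ; order = trans (cong ((emb w K′.* emb w) K′.^_) (ℕₚ.+-identityʳ M)) (trans (cong (K′._^ M) (sym (emb-* w w)))
                  (trans (sym (emb-^ (w * w) M)) (cong emb (trans (^-distrib-* w w M) (legendre² w≢0)))))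
      ; type = inj₁ (refl , e) }
      where
      w = (x + s) * h
      w̃ = (x - s) * h
      ww̃ : w * w̃ ≡ 1#
      ww̃ = trans (solve 3 (λ x s h → (x :+ s) :* h :* ((x :- s) :* h) := (x :* x :- s :* s) :* (h :* h)) refl x s h)
             (4hh (x²-d (trans (root² d) (trans (cong (_* d) e) (*-identityˡ d)))))
      w≢0 : ¬ (w ≡ 0#)
      w≢0 z = 1≢0 (trans (sym ww̃) (trans (cong (_* w̃) z) (zeroˡ w̃)))
    decide (inj₂ e) = record
      { ω = w ; ω̃ = conj w
      ; ωω̃≡1 = ww̃
      ; ω+ω̃≡x = cong₂ _,_ (double-h x) (-‿inverseʳ (s * h))
      ; κ = 1
      ; order = trans (K′.^-distrib-* w w (M ℕ.+ 1)) (trans (sym (K′.^-homo-* w (M ℕ.+ 1) (M ℕ.+ 1)))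
                  (trans (cong (w K′.^_) exponent) (trans (cong (w K′.*_) (frobenius w)) ww̃)))
      ; type = inj₂ (refl , e) }
      where
      w : K
      w = x * h , s * h
      exponent : M ℕ.+ 1 ℕ.+ (M ℕ.+ 1) ≡ suc p
      exponent = trans (NS.solve 1 (λ m → m NS.:+ NS.con 1 NS.:+ (m NS.:+ NS.con 1) NS.:= NS.con 2 NS.:+ (m NS.:+ m)) refl M) (cong suc (sym p≡1+2M))
        where module NS = +-*-Solver
      ww̃ : w K′.* conj w ≡ K′.1#
      ww̃ = cong₂ _,_
        (trans (solve 3 (λ x s h → x :* h :* (x :* h) :- s :* h :* (:- (s :* h)) := (x :* x :- (:- (s :* s))) :* (h :* h)) refl x s h)
          (4hh (x²-d (trans (cong -_ (trans (root² d) (cong (_* d) e))) (solve 1 (λ d → :- ((:- :ι 1) :* d) := d) refl d)))))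
        (solve 3 (λ x s h → x :* h :* (:- (s :* h)) :+ s :* h :* (x :* h) := :ι 0) refl x s h)

  setting : Setting
  setting = record
    { F = F ; K = gaussianField
    ; emb = emb ; emb-+ = emb-+ ; emb-* = emb-* ; emb-neg = emb-neg ; emb-injective = emb-injective ; emb-1 = refl
    ; 𝕚 = 𝕚 ; 𝕚² = 𝕚²
    ; p = p ; p-prime = p-prime ; ιp≡0 = ιᴷp≡0 ; ι≢0 = ιᴷ≢0
    ; M = M ; p≡1+2M = p≡1+2M ; 2<p = s≤s (s≤s (s≤s z≤n))
    ; legendre = legendre ; 1≢-1 = 1≢-1 ; neg-power = legendre-neg
    ; anisotropic = anisotropic ; torus = torus }

-- The quadratics attached to a conic, and how often their values have a given symbol

-- Parity prevents prescribing 2J + Q exactly. It counts the blocks of free coefficients in the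
-- auxiliary polynomial, and one block too many does no harm.
half-gap : ∀ T Q → Q ℕ.≤ T → ∃ λ J → T ℕ.≤ J ℕ.+ J ℕ.+ Q × J ℕ.+ J ℕ.+ Q ℕ.≤ suc T
half-gap T Q Q≤T with half (T ℕ.∸ Q)
  where
  half : ∀ n → ∃ λ J → n ℕ.≤ J ℕ.+ J × J ℕ.+ J ℕ.≤ suc n
  half zero          = 0 , z≤n , z≤n
  half (suc zero)    = 1 , s≤s z≤n , ℕₚ.≤-refl
  half (suc (suc n)) with half n
  ... | J , l , u = suc J , subst (suc (suc n) ℕ.≤_) (cong suc (sym (ℕₚ.+-suc J J))) (s≤s (s≤s l))
                          , subst (ℕ._≤ suc (suc (suc n))) (cong suc (sym (ℕₚ.+-suc J J))) (s≤s (s≤s u))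
... | J , l , u = J , subst (ℕ._≤ J ℕ.+ J ℕ.+ Q) (ℕₚ.m∸n+n≡m Q≤T) (ℕₚ.+-monoˡ-≤ Q l)
                    , subst (J ℕ.+ J ℕ.+ Q ℕ.≤_) (cong suc (ℕₚ.m∸n+n≡m Q≤T)) (ℕₚ.+-monoˡ-≤ Q u)

module Quadratics (F : Field) (p : ℕ) (p-prime : Prime p)
                  (ιp≡0 : Field.ι F p ≡ Field.0# F)
                  (ι≢0 : ∀ j → 0 ℕ.< j → j ℕ.< p → ¬ (Field.ι F j ≡ Field.0# F))
                  (M : ℕ) (p≡1+2M : p ≡ suc (M ℕ.+ M)) (2<p : 2 ℕ.< p) where
  open Field F
  open FieldProps F
  open Polynomials F
  open RootCounting F using (lin; ev-lin)
  open RingSolver commutativeRing hiding (ι)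
  open Stepanov F p p-prime ιp≡0 ι≢0 using (module Auxiliary)

  2# 4# : Carrier
  2# = 1# + 1#
  4# = 2# * 2#

  2≢0 : ¬ (2# ≡ 0#)
  2≢0 = ι≢0 2 (s≤s z≤n) 2<p

  -- If u = α w + α' w⁻¹ then u² - 4 is the value of this polynomial at w², divided by w².
  quad : Carrier → Carrier → Poly
  quad α α′ = α′ * α′ ∷ 2# * (α * α′) - 4# ∷ α * α ∷ []

  ev-quad : ∀ α α′ w w′ → w * w′ ≡ 1# →
            ev (quad α α′) (w * w) ≡ (w * w) * ((α * w + α′ * w′) * (α * w + α′ * w′) - 4#)
  ev-quad α α′ w w′ e = begin
    α′ * α′ + w * w * (2# * (α * α′) - 4# + w * w * (α * α + w * w * 0#))
      ≡⟨ solve 3 (λ a b w → b :* b :+ w :* w :* ((:ι 1 :+ :ι 1) :* (a :* b) :- (:ι 1 :+ :ι 1) :* (:ι 1 :+ :ι 1) :+ w :* w :* (a :* a :+ w :* w :* :ι 0))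
           := b :* b :* (:ι 1 :* :ι 1) :+ (:ι 1 :+ :ι 1) :* (a :* b) :* (w :* w) :* :ι 1 :- (:ι 1 :+ :ι 1) :* (:ι 1 :+ :ι 1) :* (w :* w) :+ w :* w :* (w :* w) :* (a :* a)) refl α α′ w ⟩
    α′ * α′ * (1# * 1#) + 2# * (α * α′) * (w * w) * 1# - 4# * (w * w) + w * w * (w * w) * (α * α)
      ≡⟨ cong (λ u → α′ * α′ * (u * u) + 2# * (α * α′) * (w * w) * u - 4# * (w * w) + w * w * (w * w) * (α * α)) (sym e) ⟩
    α′ * α′ * (w * w′ * (w * w′)) + 2# * (α * α′) * (w * w) * (w * w′) - 4# * (w * w) + w * w * (w * w) * (α * α)
      ≡⟨ solve 4 (λ a b w v → b :* b :* (w :* v :* (w :* v)) :+ (:ι 1 :+ :ι 1) :* (a :* b) :* (w :* w) :* (w :* v) :- (:ι 1 :+ :ι 1) :* (:ι 1 :+ :ι 1) :* (w :* w) :+ w :* w :* (w :* w) :* (a :* a)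
           := (w :* w) :* ((a :* w :+ b :* v) :* (a :* w :+ b :* v) :- (:ι 1 :+ :ι 1) :* (:ι 1 :+ :ι 1))) refl α α′ w w′ ⟩
    (w * w) * ((α * w + α′ * w′) * (α * w + α′ * w′) - 4#) ∎
    where open ≡.≡-Reasoning

  module _ (δ : Carrier) (δ≢0 : ¬ (δ ≡ 0#)) where

    -- then the roots of quad α α′ are the squares of (1 ± δ)/α
    Half : Carrier → Carrier → Set
    Half α α′ = ¬ (α ≡ 0#) × ¬ (α′ ≡ 0#) × α * α′ ≡ 1# - δ * δ

    rt : Carrier → Carrier → Carrier
    rt ε α = (1# + ε) * α ⁻¹ * ((1# + ε) * α ⁻¹)

    cofactor : Carrier → Carrier → Poly
    cofactor ε α = - (α * α * rt (- ε) α) ∷ α * α ∷ []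

    module _ {α α′ : Carrier} (H : Half α α′) where
      private
        a = α ⁻¹
        αa : α * a ≡ 1#
        αa = inverse α (proj₁ H)
        α′≡ : α′ ≡ (1# - δ * δ) * a
        α′≡ = *-cancelˡ (proj₁ H) (trans (proj₂ (proj₂ H)) (trans (solve 1 (λ u → u := u :* :ι 1) refl _)
                (trans (cong ((1# - δ * δ) *_) (sym αa)) (solve 3 (λ u α a → u :* (α :* a) := α :* (u :* a)) refl _ α a))))

      1+ε≢0 : ∀ ε → ε * ε ≡ δ * δ → ¬ (1# + ε ≡ 0#)
      1+ε≢0 ε ε² e = proj₁ (proj₂ H) (trans α′≡ (trans (cong (_* a) (trans (cong (λ u → 1# - u) (sym ε²))
        (trans (solve 1 (λ ε → :ι 1 :- ε :* ε := (:ι 1 :+ ε) :* (:ι 1 :- ε)) refl ε) (trans (cong (_* (1# - ε)) e) (zeroˡ _))))) (zeroˡ a)))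

      rt≢0 : ∀ ε → ε * ε ≡ δ * δ → ¬ (rt ε α ≡ 0#)
      rt≢0 ε ε² = *-nonzero r r
        where
        a≢0 : ¬ (a ≡ 0#)
        a≢0 e = 1≢0 (trans (sym αa) (trans (cong (α *_) e) (zeroʳ α)))
        r = *-nonzero (1+ε≢0 ε ε²) a≢0

      quad-factor : ∀ ε → ε * ε ≡ δ * δ → quad α α′ ≈ lin (rt ε α) ⊗ cofactor ε α
      quad-factor ε ε² = ∷-cong c₀ (∷-cong c₁ (∷-cong c₂ ≈-refl))
        where
        open ≡.≡-Reasoning
        c₀ : α′ * α′ ≡ - rt ε α * - (α * α * rt (- ε) α) + 0#
        c₀ = begin
          α′ * α′
            ≡⟨ cong₂ _*_ α′≡ α′≡ ⟩
          (1# - δ * δ) * a * ((1# - δ * δ) * a)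
            ≡⟨ cong (λ u → (1# - u) * a * ((1# - u) * a)) (sym ε²) ⟩
          (1# - ε * ε) * a * ((1# - ε * ε) * a)
            ≡⟨ solve 2 (λ e a → (:ι 1 :- e :* e) :* a :* ((:ι 1 :- e :* e) :* a) := (:ι 1 :- e :* e) :* a :* ((:ι 1 :- e :* e) :* a) :* (:ι 1 :* :ι 1)) refl ε a ⟩
          (1# - ε * ε) * a * ((1# - ε * ε) * a) * (1# * 1#)
            ≡⟨ cong (λ u → (1# - ε * ε) * a * ((1# - ε * ε) * a) * (u * u)) (sym αa) ⟩
          (1# - ε * ε) * a * ((1# - ε * ε) * a) * (α * a * (α * a))
            ≡⟨ solve 3 (λ e a α → (:ι 1 :- e :* e) :* a :* ((:ι 1 :- e :* e) :* a) :* (α :* a :* (α :* a))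
                 := :- ((:ι 1 :+ e) :* a :* ((:ι 1 :+ e) :* a)) :* (:- (α :* α :* ((:ι 1 :+ :- e) :* a :* ((:ι 1 :+ :- e) :* a)))) :+ :ι 0) refl ε a α ⟩
          - rt ε α * - (α * α * rt (- ε) α) + 0# ∎
        c₁ : 2# * (α * α′) - 4# ≡ - rt ε α * (α * α) + (1# * - (α * α * rt (- ε) α) + 0#)
        c₁ = begin
          2# * (α * α′) - 4#
            ≡⟨ cong (λ u → 2# * u - 4#) (trans (proj₂ (proj₂ H)) (cong (λ u → 1# - u) (sym ε²))) ⟩
          2# * (1# - ε * ε) - 4#
            ≡⟨ solve 1 (λ e → (:ι 1 :+ :ι 1) :* (:ι 1 :- e :* e) :- (:ι 1 :+ :ι 1) :* (:ι 1 :+ :ι 1) := :- ((:ι 1 :+ :ι 1) :* (:ι 1 :+ e :* e)) :* (:ι 1 :* :ι 1)) refl ε ⟩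
          - (2# * (1# + ε * ε)) * (1# * 1#)
            ≡⟨ cong (λ u → - (2# * (1# + ε * ε)) * (u * u)) (sym αa) ⟩
          - (2# * (1# + ε * ε)) * (α * a * (α * a))
            ≡⟨ solve 3 (λ e a α → :- ((:ι 1 :+ :ι 1) :* (:ι 1 :+ e :* e)) :* (α :* a :* (α :* a))
                 := :- ((:ι 1 :+ e) :* a :* ((:ι 1 :+ e) :* a)) :* (α :* α) :+ (:ι 1 :* (:- (α :* α :* ((:ι 1 :+ :- e) :* a :* ((:ι 1 :+ :- e) :* a)))) :+ :ι 0)) refl ε a α ⟩
          - rt ε α * (α * α) + (1# * - (α * α * rt (- ε) α) + 0#) ∎
        c₂ : α * α ≡ 1# * (α * α)
        c₂ = sym (*-identityˡ _)

      -- This is α² times the difference of the two roots, that is (1 + ε)² - (1 - ε)². Being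
      -- nonzero, it makes the root simple.
      ev-cofactor : ∀ ε → ev (cofactor ε α) (rt ε α) ≡ 4# * ε
      ev-cofactor ε = trans (solve 3 (λ e a α → :- (α :* α :* ((:ι 1 :+ :- e) :* a :* ((:ι 1 :+ :- e) :* a))) :+ ((:ι 1 :+ e) :* a :* ((:ι 1 :+ e) :* a)) :* (α :* α :+ ((:ι 1 :+ e) :* a :* ((:ι 1 :+ e) :* a)) :* :ι 0)
            := (α :* a :* (α :* a)) :* ((:ι 1 :+ :ι 1) :* (:ι 1 :+ :ι 1) :* e)) refl ε a α)
        (trans (cong (λ u → (u * u) * (4# * ε)) αa) (solve 1 (λ x → :ι 1 :* :ι 1 :* x := x) refl _))

      cofactor≢0 : ∀ ε → ¬ (ε ≡ 0#) → ¬ (ev (cofactor ε α) (rt ε α) ≡ 0#)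
      cofactor≢0 ε ε≢0 e = *-nonzero (*-nonzero 2≢0 2≢0) ε≢0 (trans (sym (ev-cofactor ε)) e)

    -δ² : - δ * - δ ≡ δ * δ
    -δ² = solve 1 (λ d → :- d :* :- d := d :* d) refl δ

    -δ≢0 : ¬ (- δ ≡ 0#)
    -δ≢0 e = δ≢0 (trans (solve 1 (λ d → d := :- (:- d)) refl δ) (trans (cong -_ e) (solve 0 (:- :ι 0 := :ι 0) refl)))

    root-eq : ∀ {α α′ β β′} → Half α α′ → Half β β′ → ∀ ε ε′ → rt ε α - rt ε′ β ≡ 0# → (1# + ε) * (1# + ε) * (β * β) ≡ (1# + ε′) * (1# + ε′) * (α * α)
    root-eq {α} {β = β} H H′ ε ε′ d = begin
      (1# + ε) * (1# + ε) * (β * β)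
        ≡⟨ solve 2 (λ u v → u :* v := u :* v :* (:ι 1 :* :ι 1)) refl _ _ ⟩
      (1# + ε) * (1# + ε) * (β * β) * (1# * 1#)
        ≡⟨ cong (λ u → (1# + ε) * (1# + ε) * (β * β) * (u * u)) (sym (inverse α (proj₁ H))) ⟩
      (1# + ε) * (1# + ε) * (β * β) * (α * α ⁻¹ * (α * α ⁻¹))
        ≡⟨ solve 4 (λ e b α a → e :* e :* (b :* b) :* (α :* a :* (α :* a)) := e :* a :* (e :* a) :* (α :* α :* (b :* b))) refl (1# + ε) β α (α ⁻¹) ⟩
      rt ε α * (α * α * (β * β))
        ≡⟨ cong (_* (α * α * (β * β))) (x-y≡0⇒x≡y d) ⟩
      rt ε′ β * (α * α * (β * β))
        ≡⟨ solve 4 (λ e b β α → e :* b :* (e :* b) :* (α :* α :* (β :* β)) := e :* e :* (α :* α) :* (β :* b :* (β :* b))) refl (1# + ε′) (β ⁻¹) β α ⟩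
      (1# + ε′) * (1# + ε′) * (α * α) * (β * β ⁻¹ * (β * β ⁻¹))
        ≡⟨ cong (λ u → (1# + ε′) * (1# + ε′) * (α * α) * (u * u)) (inverse β (proj₁ H′)) ⟩
      (1# + ε′) * (1# + ε′) * (α * α) * (1# * 1#)
        ≡⟨ solve 2 (λ u v → u :* v :* (:ι 1 :* :ι 1) := u :* v) refl _ _ ⟩
      (1# + ε′) * (1# + ε′) * (α * α) ∎
      where open ≡.≡-Reasoning

    -- The given root must be one of the two roots of the second quadratic. The one with the same ε
    -- would force α² = β²; the one with -ε gives the relation.
    common-root : ∀ {α α′ β β′} → Half α α′ → Half β β′ → ∀ ε → ε * ε ≡ δ * δ →
      ev (quad β β′) (rt ε α) ≡ 0# → ¬ (α * α ≡ β * β) →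
      (1# + ε) * (1# + ε) * (β * β) ≡ (1# - ε) * (1# - ε) * (α * α)
    common-root {α} {α′} {β} {β′} H H′ ε ε² e α²≢β² = decide (zero-product (*-cancel-0 (*-nonzero β≢0 β≢0) eq))
      where
      β≢0 = proj₁ H′
      n = 1+ε≢0 H ε ε²
      expand : ∀ b r s s′ → b * ((r - s) * (r - s′)) ≡ (r - s) * (- (b * s′) + r * (b + r * 0#))
      expand = solve 4 (λ b r s s′ → b :* ((r :- s) :* (r :- s′)) := (r :- s) :* (:- (b :* s′) :+ r :* (b :+ r :* :ι 0))) refl
      eq : β * β * ((rt ε α - rt ε β) * (rt ε α - rt (- ε) β)) ≡ 0#
      eq = trans (expand (β * β) (rt ε α) (rt ε β) (rt (- ε) β))
             (trans (cong (_* ev (cofactor ε β) (rt ε α)) (sym (ev-lin (rt ε β) (rt ε α))))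
             (trans (sym (ev-⊗ (lin (rt ε β)) (cofactor ε β) (rt ε α))) (trans (ev-cong (rt ε α) (≈-sym (quad-factor H′ ε ε²))) e)))
      decide : rt ε α - rt ε β ≡ 0# ⊎ rt ε α - rt (- ε) β ≡ 0# →
               (1# + ε) * (1# + ε) * (β * β) ≡ (1# - ε) * (1# - ε) * (α * α)
      decide (inj₁ d) = ⊥-elim (α²≢β² (sym (*-cancelˡ (*-nonzero n n) (root-eq H H′ ε ε d))))
      decide (inj₂ d) = root-eq H H′ ε (- ε) d

    -- The product of the two instances of `common-root`, for δ and for -δ.
    shared-roots : ∀ {α α′ β β′} → Half α α′ → Half β β′ → ¬ (α * α ≡ β * β) →
      ev (quad β β′) (rt δ α) ≡ 0# → ev (quad β β′) (rt (- δ) α) ≡ 0# →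
      β * β * (β * β) ≡ α * α * (α * α)
    shared-roots {α} {α′} {β} {β′} H H′ n₁ e e′ = *-cancelˡ (*-nonzero (*-nonzero u u) (*-nonzero v v))
      (trans (spread (1# + δ) (1# + - δ) (β * β)) (trans
        (cong₂ _*_ (common-root H H′ δ refl e n₁) (common-root H H′ (- δ) -δ² e′ n₁))
        (gather δ (α * α))))
      where
      u = 1+ε≢0 H δ refl
      v = 1+ε≢0 H (- δ) -δ²
      spread : ∀ x y b → x * x * (y * y) * (b * b) ≡ (x * x * b) * (y * y * b)
      spread = solve 3 (λ x y b → x :* x :* (y :* y) :* (b :* b) := (x :* x :* b) :* (y :* y :* b)) refl
      gather : ∀ d b → ((1# - d) * (1# - d) * b) * ((1# - (- d)) * (1# - (- d)) * b) ≡ (1# + d) * (1# + d) * ((1# + - d) * (1# + - d)) * (b * b)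
      gather = solve 2 (λ d b → ((:ι 1 :- d) :* (:ι 1 :- d) :* b) :* ((:ι 1 :- (:- d)) :* (:ι 1 :- (:- d)) :* b)
               := (:ι 1 :+ d) :* (:ι 1 :+ d) :* ((:ι 1 :+ :- d) :* (:ι 1 :+ :- d)) :* (b :* b)) refl

    -- The product of the two quadratics needs a simple root. If both roots of the first were
    -- shared, then α⁴ = β⁴, and the remaining possibility α² = -β² agrees with `common-root` only
    -- if 1 + δ² = 0.
    separating-root : ∀ {α α′ β β′} → Half α α′ → Half β β′ → ¬ (α * α ≡ β * β) →
      ¬ (α * α ≡ - (β * β) × 1# + δ * δ ≡ 0#) →
      ∃ λ ε → ε * ε ≡ δ * δ × ¬ (ε ≡ 0#) × ¬ (ev (quad β β′) (rt ε α) ≡ 0#)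
    separating-root {α} {α′} {β} {β′} H H′ n₁ n₂ = decide (ev (quad β β′) (rt δ α) ≟ 0#) (ev (quad β β′) (rt (- δ) α) ≟ 0#)
      where
      decide : Dec (ev (quad β β′) (rt δ α) ≡ 0#) → Dec (ev (quad β β′) (rt (- δ) α) ≡ 0#) →
               ∃ λ ε → ε * ε ≡ δ * δ × ¬ (ε ≡ 0#) × ¬ (ev (quad β β′) (rt ε α) ≡ 0#)
      decide (no n)  _       = δ , refl , δ≢0 , n
      decide (yes _) (no n)  = - δ , -δ² , -δ≢0 , n
      decide (yes e) (yes e′) = ⊥-elim (absurd (square-eq (shared-roots H H′ n₁ e e′)))
        where
        absurd : β * β ≡ α * α ⊎ β * β ≡ - (α * α) → ⊥
        absurd (inj₁ d) = n₁ (sym d)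
        absurd (inj₂ d) = n₂ (trans (solve 1 (λ x → x := :- (:- x)) refl (α * α)) (cong -_ (sym d)) ,
          *-cancel-0 (*-nonzero 2≢0 (*-nonzero (proj₁ H) (proj₁ H)))
            (trans (expand δ (α * α)) (x≡y⇒x-y≡0 (sym (trans (cong ((1# + δ) * (1# + δ) *_) (sym d)) (common-root H H′ δ refl e n₁))))))
          where
          expand : ∀ d a → 2# * a * (1# + d * d) ≡ (1# - d) * (1# - d) * a - (1# + d) * (1# + d) * - a
          expand = solve 2 (λ d a → (:ι 1 :+ :ι 1) :* a :* (:ι 1 :+ d :* d)
                     := (:ι 1 :- d) :* (:ι 1 :- d) :* a :- (:ι 1 :+ d) :* (:ι 1 :+ d) :* (:- a)) refl

triangular : ℕ → ℕ
triangular zero    = 0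
triangular (suc n) = n ℕ.+ triangular n

double-triangular : ∀ n → triangular n ℕ.+ triangular n ℕ.+ n ≡ n ℕ.* n
double-triangular zero    = refl
double-triangular (suc n) = begin
  n ℕ.+ T ℕ.+ (n ℕ.+ T) ℕ.+ suc n   ≡⟨ solve 2 (λ n T → n :+ T :+ (n :+ T) :+ (con 1 :+ n) := con 1 :+ (n :+ n) :+ (T :+ T :+ n)) refl n T ⟩
  suc (n ℕ.+ n) ℕ.+ (T ℕ.+ T ℕ.+ n) ≡⟨ cong (suc (n ℕ.+ n) ℕ.+_) (double-triangular n) ⟩
  suc (n ℕ.+ n) ℕ.+ n ℕ.* n         ≡⟨ solve 1 (λ n → con 1 :+ (n :+ n) :+ n :* n := (con 1 :+ n) :* (con 1 :+ n)) refl n ⟩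
  suc n ℕ.* suc n                   ∎
  where
  open ≡.≡-Reasoning
  open +-*-Solver
  T = triangular n

module CharacterSums (F : Field) (p : ℕ) (p-prime : Prime p)
                  (ιp≡0 : Field.ι F p ≡ Field.0# F)
                  (ι≢0 : ∀ j → 0 ℕ.< j → j ℕ.< p → ¬ (Field.ι F j ≡ Field.0# F))
                  (M : ℕ) (p≡1+2M : p ≡ suc (M ℕ.+ M)) (2<p : 2 ℕ.< p) where
  open Field F
  open FieldProps F
  open Polynomials F
  open RootCounting F using (lin; ev-lin)
  open Quadratics F p p-prime ιp≡0 ι≢0 M p≡1+2M 2<p public
  open Stepanov F p p-prime ιp≡0 ι≢0 using (module Auxiliary)

  module General
    (f : Poly) (k₀ : ℕ) (f-length : length f ℕ.≤ suc k₀) (f₀≢0 : ¬ (coef f 0 ≡ 0#))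
    (ρ : Carrier) (h : Poly) (f≈ : f ≈ lin ρ ⊗ h) (ρ≢0 : ¬ (ρ ≡ 0#)) (hρ≢0 : ¬ (ev h ρ ≡ 0#))
    (κ : ℕ) (c : Carrier)
    (τ : Carrier) (τ≢0 : ¬ (τ ≡ 0#)) (L : ℕ) (τᴸ : τ ^ L ≡ 1#) (L≤p : L ℕ.≤ p)
    (is : List ℕ) (distinct : AllPairs (λ i j → ¬ (τ ^ i ≡ τ ^ j)) is)
    (good : All (λ i → ¬ (ev f (τ ^ i) ≡ 0#) × (τ ^ i) ^ κ * ev f (τ ^ i) ^ M ≡ c) is)
    where

    -- This is `few-good-points` for powers of a single τ, with the numbers of equations and
    -- unknowns in closed form: the k-th derivative costs κ + (I + 1) + k₀ k equations.
    bound : ∀ I → suc I ℕ.+ suc I ℕ.+ k₀ ℕ.≤ suc L → suc I ℕ.≤ L → ∀ m J Q → m ℕ.≤ p → k₀ ℕ.* M ℕ.≤ Q ℕ.* L →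
            m ℕ.* (κ ℕ.+ suc I) ℕ.+ k₀ ℕ.* triangular m ℕ.< suc I ℕ.* (J ℕ.+ J ℕ.+ Q) →
            length is ℕ.* m ℕ.< (J ℕ.+ Q) ℕ.* L
    bound I I-small I<L m J Q m≤p k₀M≤QL l = subst (λ n → n ℕ.* m ℕ.< (J ℕ.+ Q) ℕ.* L) (length-map (τ ^_) is)
      (few-good-points m J Q m≤p I<L k₀M≤QL (subst₂ ℕ._<_ (sym (equations≡ m)) (sym (dim≡ J Q)) l)
        (map (τ ^_) is) (Allₚ.map⁺ (All.map (λ {i} → point i) good)) (distinct-map distinct))
      where
      open ≡ using (subst₂)
      open Auxiliary f k₀ f-length f₀≢0 ρ h f≈ ρ≢0 hρ≢0 M p≡1+2M L I I-small L≤p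
      open Bounds κ c
      open +-*-Solver using (solve; _:=_; _:+_; _:*_; con)
      degree≡ : ∀ k → degree k ≡ suc I ℕ.+ k₀ ℕ.* k
      degree≡ zero    = sym (trans (cong (suc I ℕ.+_) (ℕₚ.*-zeroʳ k₀)) (ℕₚ.+-identityʳ (suc I)))
      degree≡ (suc k) = trans (cong (k₀ ℕ.+_) (degree≡ k))
        (solve 3 (λ k₀ i k → k₀ :+ (i :+ k₀ :* k) := i :+ k₀ :* (con 1 :+ k)) refl k₀ (suc I) k)
      equations≡ : ∀ m → equations m ≡ m ℕ.* (κ ℕ.+ suc I) ℕ.+ k₀ ℕ.* triangular m
      equations≡ zero    = sym (ℕₚ.*-zeroʳ k₀)
      equations≡ (suc m) = trans (cong₂ (λ u w → κ ℕ.+ u ℕ.+ w) (degree≡ m) (equations≡ m))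
        (solve 5 (λ κ i k₀ m t → κ :+ (i :+ k₀ :* m) :+ (m :* (κ :+ i) :+ k₀ :* t) := (con 1 :+ m) :* (κ :+ i) :+ k₀ :* (m :+ t)) refl κ (suc I) k₀ m (triangular m))
      dim≡ : ∀ J Q → dim J Q ≡ suc I ℕ.* (J ℕ.+ J ℕ.+ Q)
      dim≡ zero    zero    = sym (ℕₚ.*-zeroʳ I)
      dim≡ zero    (suc Q) = trans (cong (suc I ℕ.+_) (dim≡ zero Q)) (sym (ℕₚ.*-suc (suc I) Q))
      dim≡ (suc J) Q       = trans (cong (λ u → suc I ℕ.+ (suc I ℕ.+ u)) (dim≡ J Q))
        (solve 3 (λ i j q → i :+ (i :+ i :* (j :+ j :+ q)) := i :* (con 1 :+ j :+ (con 1 :+ j) :+ q)) refl (suc I) J Q)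
      point : ∀ i → ¬ (ev f (τ ^ i) ≡ 0#) × (τ ^ i) ^ κ * ev f (τ ^ i) ^ M ≡ c →
              ¬ (τ ^ i ≡ 0#) × ¬ (ev f (τ ^ i) ≡ 0#) × (τ ^ i) ^ L ≡ 1# × (τ ^ i) ^ κ * ev f (τ ^ i) ^ M ≡ c
      point i (n , g) = ^-nonzero i τ≢0 , n , order , g
        where
        order : (τ ^ i) ^ L ≡ 1#
        order = trans (^-assocʳ τ i L) (trans (cong (τ ^_) (ℕₚ.*-comm i L)) (trans (sym (^-assocʳ τ L i)) (trans (cong (_^ i) τᴸ) (1^n i))))
      distinct-map : ∀ {is} → AllPairs (λ i j → ¬ (τ ^ i ≡ τ ^ j)) is → AllPairs (λ s t → ¬ (s ≡ t)) (map (τ ^_) is)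
      distinct-map []       = []
      distinct-map (d ∷ ds) = Allₚ.map⁺ d ∷ distinct-map ds

  module _ (δ : Carrier) (δ≢0 : ¬ (δ ≡ 0#)) (κ₁ : ℕ) (κ₁≤1 : κ₁ ℕ.≤ 1) (c : Carrier)
    (τ : Carrier) (τ≢0 : ¬ (τ ≡ 0#)) (L n : ℕ) (τᴸ : τ ^ L ≡ 1#) (L≤p : L ℕ.≤ p) (Ln≡ : L ℕ.* n ≡ M ℕ.+ κ₁)
    (is : List ℕ) (distinct : AllPairs (λ i j → ¬ (τ ^ i ≡ τ ^ j)) is)
    (v : ℕ) (128t≤L : 128 ℕ.* suc v ℕ.≤ L)
    where

    -- With t = suc v the parameters are m = 8t, suc I = 64t - 1 (or 64t - 2 for
    -- two characters) and Q = deg f · n; J is then the least integer giving more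
    -- coefficients than conditions.
    private
      m : ℕ
      m = 8 ℕ.* suc v

      T₈ = triangular m

      T₈≤ : T₈ ℕ.+ T₈ ℕ.+ m ≡ m ℕ.* m
      T₈≤ = double-triangular m

      m≤p : m ℕ.≤ p
      m≤p = ℕₚ.≤-trans (ℕₚ.*-monoˡ-≤ (suc v) {8} {128} (ℕₚ.m≤m+n 8 120)) (ℕₚ.≤-trans 128t≤L L≤p)

      M≤Ln : M ℕ.≤ L ℕ.* n
      M≤Ln = ℕₚ.≤-trans (ℕₚ.m≤m+n M κ₁) (ℕₚ.≤-reflexive (sym Ln≡))

    -- After division by 8t the outcome says that the points make up at most about 9/16 of L, as
    -- long as n is small compared with t.
    one-character : ∀ {α α′} → Half δ δ≢0 α α′ → ∀ Q → Q ≡ 2 ℕ.* n → Q ℕ.≤ 9 ℕ.* suc v ℕ.+ 1 →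
      All (λ i → ¬ (ev (quad α α′) (τ ^ i) ≡ 0#) × (τ ^ i) ^ κ₁ * ev (quad α α′) (τ ^ i) ^ M ≡ c) is →
      ∃ λ J → J ℕ.+ J ℕ.≤ 9 ℕ.* suc v ℕ.+ 2 ℕ.+ Q × length is ℕ.* m ℕ.< J ℕ.* L
    one-character {α} {α′} H Q refl Q≤T good with half-gap (9 ℕ.* suc v ℕ.+ 1) Q Q≤T
    ... | J , lo , hi = J ℕ.+ Q , upper , General.bound (quad α α′) 2 ℕₚ.≤-refl (*-nonzero α′≢0 α′≢0)
        (rt δ δ≢0 δ α) (cofactor δ δ≢0 δ α) (quad-factor δ δ≢0 H δ refl) (rt≢0 δ δ≢0 H δ refl) (cofactor≢0 δ δ≢0 H δ δ≢0)
        κ₁ c τ τ≢0 L τᴸ L≤p is distinct good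
        I I-small I<L m J Q m≤p k₀M≤ enough
      where
      open +-*-Solver using (solve; _:=_; _:+_; _:*_; con)
      α′≢0 = proj₁ (proj₂ H)
      I = 62 ℕ.+ 64 ℕ.* v
      upper : J ℕ.+ Q ℕ.+ (J ℕ.+ Q) ℕ.≤ 9 ℕ.* suc v ℕ.+ 2 ℕ.+ Q
      upper = ℕₚ.≤-trans (ℕₚ.≤-reflexive (solve 2 (λ j q → j :+ q :+ (j :+ q) := j :+ j :+ q :+ q) refl J Q))
        (ℕₚ.≤-trans (ℕₚ.+-monoˡ-≤ Q hi) (ℕₚ.≤-reflexive (solve 2 (λ v q → con 1 :+ (v :+ con 1) :+ q := v :+ con 2 :+ q) refl (9 ℕ.* suc v) Q)))
      I-small : suc I ℕ.+ suc I ℕ.+ 2 ℕ.≤ suc L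
      I-small = ℕₚ.m≤n⇒m≤1+n (ℕₚ.≤-trans (ℕₚ.≤-reflexive
        (solve 1 (λ v → con 63 :+ con 64 :* v :+ (con 63 :+ con 64 :* v) :+ con 2 := con 128 :* (con 1 :+ v)) refl v)) 128t≤L)
      I<L : suc I ℕ.≤ L
      I<L = ℕₚ.≤-trans (ℕₚ.m≤m+n (suc I) (65 ℕ.+ 64 ℕ.* v)) (ℕₚ.≤-trans (ℕₚ.≤-reflexive
        (solve 1 (λ v → con 63 :+ con 64 :* v :+ (con 65 :+ con 64 :* v) := con 128 :* (con 1 :+ v)) refl v)) 128t≤L)
      k₀M≤ : 2 ℕ.* M ℕ.≤ 2 ℕ.* n ℕ.* L
      k₀M≤ = ℕₚ.≤-trans (ℕₚ.*-monoʳ-≤ 2 M≤Ln) (ℕₚ.≤-reflexive (solve 2 (λ l n → con 2 :* (l :* n) := con 2 :* n :* l) refl L n))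
      enough : m ℕ.* (κ₁ ℕ.+ suc I) ℕ.+ 2 ℕ.* T₈ ℕ.< suc I ℕ.* (J ℕ.+ J ℕ.+ Q)
      enough = begin-strict
        m ℕ.* (κ₁ ℕ.+ suc I) ℕ.+ 2 ℕ.* T₈
          ≤⟨ ℕₚ.+-monoˡ-≤ (2 ℕ.* T₈) (ℕₚ.*-monoʳ-≤ m (ℕₚ.+-monoˡ-≤ (suc I) κ₁≤1)) ⟩
        m ℕ.* (1 ℕ.+ suc I) ℕ.+ 2 ℕ.* T₈
          ≡⟨ solve 3 (λ m i t → m :* (con 1 :+ i) :+ con 2 :* t := m :* i :+ (t :+ t :+ m)) refl m (suc I) T₈ ⟩
        m ℕ.* suc I ℕ.+ (T₈ ℕ.+ T₈ ℕ.+ m)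
          ≡⟨ cong (m ℕ.* suc I ℕ.+_) T₈≤ ⟩
        m ℕ.* suc I ℕ.+ m ℕ.* m
          -- The slack: with t = `suc v`, the product (64t - 1)(9t + 1) exceeds 8t (64t - 1) + (8t)²
          -- by 63t - 1.
          <⟨ ℕₚ.m<m+n _ {62 ℕ.+ 63 ℕ.* v} (s≤s z≤n) ⟩
        m ℕ.* suc I ℕ.+ m ℕ.* m ℕ.+ (62 ℕ.+ 63 ℕ.* v)
          ≡⟨ solve 1 (λ v → con 8 :* (con 1 :+ v) :* (con 63 :+ con 64 :* v) :+ con 8 :* (con 1 :+ v) :* (con 8 :* (con 1 :+ v)) :+ (con 62 :+ con 63 :* v)
               := (con 63 :+ con 64 :* v) :* (con 9 :* (con 1 :+ v) :+ con 1)) refl v ⟩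
        suc I ℕ.* (9 ℕ.* suc v ℕ.+ 1)
          ≤⟨ ℕₚ.*-monoʳ-≤ (suc I) lo ⟩
        suc I ℕ.* (J ℕ.+ J ℕ.+ Q) ∎
        where open ℕₚ.≤-Reasoning

    -- The degree is now 4, which doubles the contribution of m² and raises the share to about
    -- 10/16. The sign ε of the simple root is not known in advance; `separating-root` chooses it.
    two-characters : ∀ {α α′ β β′} → Half δ δ≢0 α α′ → Half δ δ≢0 β β′ → ¬ (α * α ≡ β * β) → ¬ (α * α ≡ - (β * β) × 1# + δ * δ ≡ 0#) →
      ∀ Q → Q ≡ 4 ℕ.* n → Q ℕ.≤ 10 ℕ.* suc v ℕ.+ 1 →
      All (λ i → ¬ (ev (quad α α′) (τ ^ i) ≡ 0#) × ¬ (ev (quad β β′) (τ ^ i) ≡ 0#)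
               × (τ ^ i) ^ (κ₁ ℕ.+ κ₁) * (ev (quad α α′) (τ ^ i) * ev (quad β β′) (τ ^ i)) ^ M ≡ c) is →
      ∃ λ J → J ℕ.+ J ℕ.≤ 10 ℕ.* suc v ℕ.+ 2 ℕ.+ Q × length is ℕ.* m ℕ.< J ℕ.* L
    two-characters {α} {α′} {β} {β′} H H′ n₁ n₂ Q refl Q≤T good =
      result (half-gap (10 ℕ.* suc v ℕ.+ 1) Q Q≤T) (separating-root δ δ≢0 H H′ n₁ n₂)
      where
      open +-*-Solver using (solve; _:=_; _:+_; _:*_; con)
      f = quad α α′ ⊗ quad β β′
      I = 61 ℕ.+ 64 ℕ.* v
      f₀≢0 : ¬ (coef f 0 ≡ 0#)
      f₀≢0 e = *-nonzero (*-nonzero (proj₁ (proj₂ H)) (proj₁ (proj₂ H))) (*-nonzero (proj₁ (proj₂ H′)) (proj₁ (proj₂ H′)))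
        (trans (sym (+-identityʳ (α′ * α′ * (β′ * β′)))) e)
      good′ : All (λ i → ¬ (ev f (τ ^ i) ≡ 0#) × (τ ^ i) ^ (κ₁ ℕ.+ κ₁) * ev f (τ ^ i) ^ M ≡ c) is
      good′ = All.map (λ {i} (a , b , e) →
          (λ z → *-nonzero a b (trans (sym (ev-⊗ (quad α α′) (quad β β′) (τ ^ i))) z))
        , trans (cong (λ u → (τ ^ i) ^ (κ₁ ℕ.+ κ₁) * u ^ M) (ev-⊗ (quad α α′) (quad β β′) (τ ^ i))) e) good
      I-small : suc I ℕ.+ suc I ℕ.+ 4 ℕ.≤ suc L
      I-small = ℕₚ.m≤n⇒m≤1+n (ℕₚ.≤-trans (ℕₚ.≤-reflexive
        (solve 1 (λ v → con 62 :+ con 64 :* v :+ (con 62 :+ con 64 :* v) :+ con 4 := con 128 :* (con 1 :+ v)) refl v)) 128t≤L)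
      I<L : suc I ℕ.≤ L
      I<L = ℕₚ.≤-trans (ℕₚ.m≤m+n (suc I) (66 ℕ.+ 64 ℕ.* v)) (ℕₚ.≤-trans (ℕₚ.≤-reflexive
        (solve 1 (λ v → con 62 :+ con 64 :* v :+ (con 66 :+ con 64 :* v) := con 128 :* (con 1 :+ v)) refl v)) 128t≤L)
      k₀M≤ : 4 ℕ.* M ℕ.≤ 4 ℕ.* n ℕ.* L
      k₀M≤ = ℕₚ.≤-trans (ℕₚ.*-monoʳ-≤ 4 M≤Ln) (ℕₚ.≤-reflexive (solve 2 (λ l n → con 4 :* (l :* n) := con 4 :* n :* l) refl L n))
      enough : ∀ J → 10 ℕ.* suc v ℕ.+ 1 ℕ.≤ J ℕ.+ J ℕ.+ Q →
               m ℕ.* (κ₁ ℕ.+ κ₁ ℕ.+ suc I) ℕ.+ 4 ℕ.* T₈ ℕ.< suc I ℕ.* (J ℕ.+ J ℕ.+ Q)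
      enough J lo = begin-strict
        m ℕ.* (κ₁ ℕ.+ κ₁ ℕ.+ suc I) ℕ.+ 4 ℕ.* T₈
          ≤⟨ ℕₚ.+-monoˡ-≤ (4 ℕ.* T₈) (ℕₚ.*-monoʳ-≤ m (ℕₚ.+-monoˡ-≤ (suc I) (ℕₚ.+-mono-≤ κ₁≤1 κ₁≤1))) ⟩
        m ℕ.* (2 ℕ.+ suc I) ℕ.+ 4 ℕ.* T₈
          ≡⟨ solve 3 (λ m i t → m :* (con 2 :+ i) :+ con 4 :* t := m :* i :+ con 2 :* (t :+ t :+ m)) refl m (suc I) T₈ ⟩
        m ℕ.* suc I ℕ.+ 2 ℕ.* (T₈ ℕ.+ T₈ ℕ.+ m)
          ≡⟨ cong (λ u → m ℕ.* suc I ℕ.+ 2 ℕ.* u) T₈≤ ⟩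
        m ℕ.* suc I ℕ.+ 2 ℕ.* (m ℕ.* m)
          <⟨ ℕₚ.m<m+n _ {58 ℕ.+ 60 ℕ.* v} (s≤s z≤n) ⟩
        m ℕ.* suc I ℕ.+ 2 ℕ.* (m ℕ.* m) ℕ.+ (58 ℕ.+ 60 ℕ.* v)
          ≡⟨ solve 1 (λ v → con 8 :* (con 1 :+ v) :* (con 62 :+ con 64 :* v) :+ con 2 :* (con 8 :* (con 1 :+ v) :* (con 8 :* (con 1 :+ v))) :+ (con 58 :+ con 60 :* v)
               := (con 62 :+ con 64 :* v) :* (con 10 :* (con 1 :+ v) :+ con 1)) refl v ⟩
        suc I ℕ.* (10 ℕ.* suc v ℕ.+ 1)
          ≤⟨ ℕₚ.*-monoʳ-≤ (suc I) lo ⟩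
        suc I ℕ.* (J ℕ.+ J ℕ.+ Q) ∎
        where open ℕₚ.≤-Reasoning
      result : (∃ λ J → 10 ℕ.* suc v ℕ.+ 1 ℕ.≤ J ℕ.+ J ℕ.+ Q × J ℕ.+ J ℕ.+ Q ℕ.≤ suc (10 ℕ.* suc v ℕ.+ 1)) →
               (∃ λ ε → ε * ε ≡ δ * δ × ¬ (ε ≡ 0#) × ¬ (ev (quad β β′) (rt δ δ≢0 ε α) ≡ 0#)) →
               ∃ λ J → J ℕ.+ J ℕ.≤ 10 ℕ.* suc v ℕ.+ 2 ℕ.+ Q × length is ℕ.* m ℕ.< J ℕ.* L
      result (J , lo , hi) (ε , ε² , ε≢0 , separates) = J ℕ.+ Q , upper , General.bound f 4 ℕₚ.≤-refl f₀≢0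
          (rt δ δ≢0 ε α) (cofactor δ δ≢0 ε α ⊗ quad β β′) f≈ (rt≢0 δ δ≢0 H ε ε²)
          (λ z → *-nonzero (cofactor≢0 δ δ≢0 H ε ε≢0) separates (trans (sym (ev-⊗ (cofactor δ δ≢0 ε α) (quad β β′) (rt δ δ≢0 ε α))) z))
          (κ₁ ℕ.+ κ₁) c τ τ≢0 L τᴸ L≤p is distinct good′
          I I-small I<L m J Q m≤p k₀M≤ (enough J lo)
        where
        upper : J ℕ.+ Q ℕ.+ (J ℕ.+ Q) ℕ.≤ 10 ℕ.* suc v ℕ.+ 2 ℕ.+ Q
        upper = ℕₚ.≤-trans (ℕₚ.≤-reflexive (solve 2 (λ j q → j :+ q :+ (j :+ q) := j :+ j :+ q :+ q) refl J Q))
          (ℕₚ.≤-trans (ℕₚ.+-monoˡ-≤ Q hi) (ℕₚ.≤-reflexive (solve 2 (λ v q → con 1 :+ (v :+ con 1) :+ q := v :+ con 2 :+ q) refl (10 ℕ.* suc v) Q)))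
        f≈ : f ≈ lin (rt δ δ≢0 ε α) ⊗ (cofactor δ δ≢0 ε α ⊗ quad β β′)
        f≈ = ≈-trans (⊗-cong (quad-factor δ δ≢0 H ε ε²) (≈-refl {quad β β′})) (⊗-assoc (lin (rt δ δ≢0 ε α)) (cofactor δ δ≢0 ε α) (quad β β′))

-- Orders and counting

least : (P : ℕ → Set) → (∀ n → Dec (P n)) → ∀ n → P n → ∃ λ m → P m × (∀ j → P j → m ℕ.≤ j)
least P P? zero    Pn = 0 , Pn , λ j _ → z≤n
least P P? (suc n) Pn with P? 0
... | yes P0 = 0 , P0 , λ j _ → z≤n
... | no ¬P0 with least (λ k → P (suc k)) (λ k → P? (suc k)) n Pn
...   | m , Pm , min = suc m , Pm , λ { zero P0 → ⊥-elim (¬P0 P0) ; (suc j) Pj → s≤s (min j Pj) }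

indicator : ∀ {P : Set} → Dec P → ℕ
indicator (yes _) = 1
indicator (no _)  = 0

count : {P : ℕ → Set} → (∀ n → Dec (P n)) → ℕ → ℕ
count P? zero    = 0
count P? (suc n) = indicator (P? n) ℕ.+ count P? n

select : {P : ℕ → Set} → (∀ n → Dec (P n)) → ℕ → List ℕ
select P? zero    = []
select P? (suc n) with P? n
... | yes _ = n ∷ select P? n
... | no _  = select P? n

length-select : {P : ℕ → Set} (P? : ∀ n → Dec (P n)) → ∀ n → length (select P? n) ≡ count P? n
length-select P? zero    = refl
length-select P? (suc n) with P? n
... | yes _ = cong suc (length-select P? n)
... | no _  = length-select P? n

select-sound : {P : ℕ → Set} (P? : ∀ n → Dec (P n)) → ∀ n → All P (select P? n)
select-sound P? zero    = []
select-sound P? (suc n) with P? n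
... | yes Pn = Pn ∷ select-sound P? n
... | no _   = select-sound P? n

select-< : {P : ℕ → Set} (P? : ∀ n → Dec (P n)) → ∀ n → All (ℕ._< n) (select P? n)
select-< P? zero    = []
select-< P? (suc n) with P? n
... | yes _ = ℕₚ.n<1+n n ∷ All.map ℕₚ.m<n⇒m<1+n (select-< P? n)
... | no _  = All.map ℕₚ.m<n⇒m<1+n (select-< P? n)

select-descending : {P : ℕ → Set} (P? : ∀ n → Dec (P n)) → ∀ n → AllPairs (λ i j → j ℕ.< i) (select P? n)
select-descending P? zero    = []
select-descending P? (suc n) with P? n
... | yes _ = select-< P? n ∷ select-descending P? n
... | no _  = select-descending P? n

count-all : {P : ℕ → Set} (P? : ∀ n → Dec (P n)) → (∀ n → P n) → ∀ n → count P? n ≡ n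
count-all P? h zero    = refl
count-all P? h (suc n) with P? n
... | yes _ = cong suc (count-all P? h n)
... | no ¬p = ⊥-elim (¬p (h n))

bounded-search : {P : ℕ → Set} → (∀ n → Dec (P n)) → ∀ n → (∃ λ i → i ℕ.< n × P i) ⊎ (∀ i → i ℕ.< n → ¬ P i)
bounded-search P? zero    = inj₂ λ i ()
bounded-search P? (suc n) with P? n | bounded-search P? n
... | yes Pn | _                    = inj₁ (n , ℕₚ.n<1+n n , Pn)
... | no _   | inj₁ (i , i<n , Pi)  = inj₁ (i , ℕₚ.m<n⇒m<1+n i<n , Pi)
... | no ¬Pn | inj₂ none            = inj₂ λ i i≤n Pi → extend i i≤n Pi
  where
  extend : ∀ i → i ℕ.< suc n → ¬ _
  extend i i≤n Pi with i ℕₚ.≟ n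
  ... | yes refl = ¬Pn Pi
  ... | no i≢n   = none i (ℕₚ.≤∧≢⇒< (ℕₚ.≤-pred i≤n) i≢n) Pi

-- A and C: the middle term has the symbol of x on either sequence;
-- E₀, E₁, E₂: the two sequences agree at three consecutive places.
window : ∀ {A C E₁ E₀ E₂ : Set} (dA : Dec A) (dC : Dec C) (d₁ : Dec E₁) (d₀ : Dec E₀) (d₂ : Dec E₂) →
  (¬ E₀ → A × C) → (¬ E₂ → A × C) → (¬ E₀ → ¬ E₂ → ⊥) → (¬ E₁ → E₀) → (¬ E₁ → E₂) → (¬ E₁ → A ⊎ C) → (A → C → E₁) →
  5 ℕ.≤ indicator dA ℕ.+ indicator dC ℕ.+ (indicator d₁ ℕ.+ (indicator d₀ ℕ.+ indicator d₀ ℕ.+ (indicator d₂ ℕ.+ indicator d₂)))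
window _ _ _ (no n₀) (no n₂) _ _ h₃ _ _ _ _ = ⊥-elim (h₃ n₀ n₂)
window (yes _) (yes _) (yes _) (no _) (yes _) _ _ _ _ _ _ _ = ℕₚ.≤-refl
window (yes _) (yes _) (yes _) (yes _) (no _) _ _ _ _ _ _ _ = ℕₚ.≤-refl
window (yes a) (yes c) (no n₁) _ _ _ _ _ _ _ _ h = ⊥-elim (n₁ (h a c))
window (no ¬a) _ _ (no n₀) _ h _ _ _ _ _ _ = ⊥-elim (¬a (proj₁ (h n₀)))
window _ (no ¬c) _ (no n₀) _ h _ _ _ _ _ _ = ⊥-elim (¬c (proj₂ (h n₀)))
window (no ¬a) _ _ _ (no n₂) _ h _ _ _ _ _ = ⊥-elim (¬a (proj₁ (h n₂)))
window _ (no ¬c) _ _ (no n₂) _ h _ _ _ _ _ = ⊥-elim (¬c (proj₂ (h n₂)))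
window dA dC (yes _) (yes _) (yes _) _ _ _ _ _ _ _ = ℕₚ.m≤n+m 5 (indicator dA ℕ.+ indicator dC)
window (yes _) (no _) (no _) (yes _) (yes _) _ _ _ _ _ _ _ = ℕₚ.≤-refl
window (no _) (yes _) (no _) (yes _) (yes _) _ _ _ _ _ _ _ = ℕₚ.≤-refl
window (no ¬a) (no ¬c) (no n₁) (yes _) (yes _) _ _ _ _ _ h _ with h n₁
... | inj₁ a = ⊥-elim (¬a a)
... | inj₂ c = ⊥-elim (¬c c)

-- Here a and c count the indices where u, respectively u′, has the type of x, and e those where the
-- two types agree. Summing `window` over a period gives a + c + 5e ≥ 5L, whereas the three bounds
-- allow only about (9 + 9 + 5 · 10)/16 = 68/16 of L. The conditions on n and t absorb the error
-- terms, 24n + 14 ≤ 12t.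
accounting : ∀ L t n a c e J₁ J₂ J₃ → 5 ℕ.* L ℕ.≤ a ℕ.+ c ℕ.+ (e ℕ.+ (e ℕ.+ e ℕ.+ (e ℕ.+ e))) →
  a ℕ.* (8 ℕ.* t) ℕ.< J₁ ℕ.* L → c ℕ.* (8 ℕ.* t) ℕ.< J₂ ℕ.* L → e ℕ.* (8 ℕ.* t) ℕ.< J₃ ℕ.* L →
  J₁ ℕ.+ J₁ ℕ.≤ 9 ℕ.* t ℕ.+ 2 ℕ.+ 2 ℕ.* n → J₂ ℕ.+ J₂ ℕ.≤ 9 ℕ.* t ℕ.+ 2 ℕ.+ 2 ℕ.* n → J₃ ℕ.+ J₃ ℕ.≤ 10 ℕ.* t ℕ.+ 2 ℕ.+ 4 ℕ.* n →
  4 ℕ.* n ℕ.≤ t → 3 ℕ.≤ t → ⊥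
accounting L t n a c e J₁ J₂ J₃ total lt₁ lt₂ lt₃ up₁ up₂ up₃ 4n≤t 3≤t = ℕₚ.n≮n (80 ℕ.* t ℕ.* L) (begin-strict
  80 ℕ.* t ℕ.* L
    ≡⟨ solve 2 (λ t l → con 80 :* t :* l := con 5 :* l :* (con 16 :* t)) refl t L ⟩
  5 ℕ.* L ℕ.* (16 ℕ.* t)
    ≤⟨ ℕₚ.*-monoˡ-≤ (16 ℕ.* t) total ⟩
  (a ℕ.+ c ℕ.+ (e ℕ.+ (e ℕ.+ e ℕ.+ (e ℕ.+ e)))) ℕ.* (16 ℕ.* t)
    ≡⟨ solve 4 (λ a c e t → (a :+ c :+ (e :+ (e :+ e :+ (e :+ e)))) :* (con 16 :* t)
         := con 2 :* (a :* (con 8 :* t)) :+ (con 2 :* (c :* (con 8 :* t)) :+ con 10 :* (e :* (con 8 :* t)))) refl a c e t ⟩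
  2 ℕ.* (a ℕ.* (8 ℕ.* t)) ℕ.+ (2 ℕ.* (c ℕ.* (8 ℕ.* t)) ℕ.+ 10 ℕ.* (e ℕ.* (8 ℕ.* t)))
    <⟨ ℕₚ.+-mono-<-≤ (ℕₚ.*-monoʳ-< 2 lt₁) (ℕₚ.+-mono-≤ (ℕₚ.*-monoʳ-≤ 2 (ℕₚ.<⇒≤ lt₂)) (ℕₚ.*-monoʳ-≤ 10 (ℕₚ.<⇒≤ lt₃))) ⟩
  2 ℕ.* (J₁ ℕ.* L) ℕ.+ (2 ℕ.* (J₂ ℕ.* L) ℕ.+ 10 ℕ.* (J₃ ℕ.* L))
    ≡⟨ solve 4 (λ j k i l → con 2 :* (j :* l) :+ (con 2 :* (k :* l) :+ con 10 :* (i :* l)) := ((j :+ j) :+ ((k :+ k) :+ con 5 :* (i :+ i))) :* l) refl J₁ J₂ J₃ L ⟩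
  ((J₁ ℕ.+ J₁) ℕ.+ ((J₂ ℕ.+ J₂) ℕ.+ 5 ℕ.* (J₃ ℕ.+ J₃))) ℕ.* L
    ≤⟨ ℕₚ.*-monoˡ-≤ L (ℕₚ.+-mono-≤ up₁ (ℕₚ.+-mono-≤ up₂ (ℕₚ.*-monoʳ-≤ 5 up₃))) ⟩
  (9 ℕ.* t ℕ.+ 2 ℕ.+ 2 ℕ.* n ℕ.+ (9 ℕ.* t ℕ.+ 2 ℕ.+ 2 ℕ.* n ℕ.+ 5 ℕ.* (10 ℕ.* t ℕ.+ 2 ℕ.+ 4 ℕ.* n))) ℕ.* L
    ≡⟨ cong (ℕ._* L) (solve 2 (λ t n → con 9 :* t :+ con 2 :+ con 2 :* n :+ (con 9 :* t :+ con 2 :+ con 2 :* n :+ con 5 :* (con 10 :* t :+ con 2 :+ con 4 :* n))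
         := con 68 :* t :+ (con 6 :* (con 4 :* n) :+ con 14)) refl t n) ⟩
  (68 ℕ.* t ℕ.+ (6 ℕ.* (4 ℕ.* n) ℕ.+ 14)) ℕ.* L
    ≤⟨ ℕₚ.*-monoˡ-≤ L (ℕₚ.+-monoʳ-≤ (68 ℕ.* t) (ℕₚ.+-mono-≤ (ℕₚ.*-monoʳ-≤ 6 4n≤t) (ℕₚ.≤-trans (ℕₚ.m≤m+n 14 4) (ℕₚ.*-monoʳ-≤ 6 3≤t)))) ⟩
  (68 ℕ.* t ℕ.+ (6 ℕ.* t ℕ.+ 6 ℕ.* t)) ℕ.* L
    ≡⟨ solve 2 (λ t l → (con 68 :* t :+ (con 6 :* t :+ con 6 :* t)) :* l := con 80 :* t :* l) refl t L ⟩
  80 ℕ.* t ℕ.* L ∎)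
  where
  open +-*-Solver
  open ℕₚ.≤-Reasoning

sum-to : (ℕ → ℕ) → ℕ → ℕ
sum-to f zero    = 0
sum-to f (suc n) = f n ℕ.+ sum-to f n

count≡sum : {P : ℕ → Set} (P? : ∀ n → Dec (P n)) → ∀ n → count P? n ≡ sum-to (λ i → indicator (P? i)) n
count≡sum P? zero    = refl
count≡sum P? (suc n) = cong (indicator (P? n) ℕ.+_) (count≡sum P? n)

sum-shift : ∀ f n → f n ≡ f 0 → sum-to (λ i → f (suc i)) n ≡ sum-to f n
sum-shift f n e = ℕₚ.+-cancelʳ-≡ (f 0) _ _ (trans (go n) (trans (cong (ℕ._+ sum-to f n) e) (ℕₚ.+-comm (f 0) _)))
  where
  go : ∀ n → sum-to (λ i → f (suc i)) n ℕ.+ f 0 ≡ sum-to f (suc n)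
  go zero    = ℕₚ.+-comm 0 (f 0)
  go (suc n) = trans (ℕₚ.+-assoc (f (suc n)) _ (f 0)) (cong (f (suc n) ℕ.+_) (go n))

sum-≥ : ∀ f n k → (∀ i → i ℕ.< n → k ℕ.≤ f i) → k ℕ.* n ℕ.≤ sum-to f n
sum-≥ f zero    k h = ℕₚ.≤-reflexive (ℕₚ.*-zeroʳ k)
sum-≥ f (suc n) k h = subst (ℕ._≤ sum-to f (suc n)) (sym (ℕₚ.*-suc k n))
  (ℕₚ.+-mono-≤ (h n (ℕₚ.n<1+n n)) (sum-≥ f n k (λ i i<n → h i (ℕₚ.m<n⇒m<1+n i<n))))

sum-+ : ∀ f g n → sum-to (λ i → f i ℕ.+ g i) n ≡ sum-to f n ℕ.+ sum-to g n
sum-+ f g zero    = refl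
sum-+ f g (suc n) = trans (cong (f n ℕ.+ g n ℕ.+_) (sum-+ f g n))
  (NS.solve 4 (λ a b c d → a NS.:+ b NS.:+ (c NS.:+ d) NS.:= a NS.:+ c NS.:+ (b NS.:+ d)) refl (f n) (g n) _ _)
  where module NS = +-*-Solver

module Orders (K : Field) where
  open Field K
  open FieldProps K

  record Order (τ : Carrier) : Set where
    field
      L       : ℕ
      L>0     : 0 ℕ.< L
      τᴸ      : τ ^ L ≡ 1#
      minimal : ∀ j → 0 ℕ.< j → τ ^ j ≡ 1# → L ℕ.≤ j

  order-of : ∀ τ D → 0 ℕ.< D → τ ^ D ≡ 1# → Order τ
  order-of τ (suc D) _ e = found (least (λ j → τ ^ suc j ≡ 1#) (λ j → τ ^ suc j ≟ 1#) D e)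
    where
    found : (∃ λ m → τ ^ suc m ≡ 1# × (∀ j → τ ^ suc j ≡ 1# → m ℕ.≤ j)) → Order τ
    found (m , e , min) = record { L = suc m ; L>0 = s≤s z≤n ; τᴸ = e ; minimal = λ { (suc j) _ e → s≤s (min j e) } }

  double-power : ∀ ω D → (ω * ω) ^ D ≡ 1# → ω ^ (D ℕ.+ D) ≡ 1#
  double-power ω D e = trans (^-homo-* ω D D) (trans (sym (^-distrib-* ω ω D)) e)

  order-of-square : ∀ {ω} (O : Order ω) (O₂ : Order (ω * ω)) → Order.L O ℕ.≤ Order.L O₂ ℕ.+ Order.L O₂
  order-of-square {ω} O O₂ = Order.minimal O (L ℕ.+ L) (ℕₚ.≤-trans (Order.L>0 O₂) (ℕₚ.m≤m+n L L)) (double-power ω L (Order.τᴸ O₂))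
    where L = Order.L O₂

  inverse-power : ∀ {w w̃} n → w * w̃ ≡ 1# → w ^ n ≡ 1# → w̃ ^ n ≡ 1#
  inverse-power {w} {w̃} n e wⁿ = begin
    w̃ ^ n            ≡⟨ sym (*-identityˡ _) ⟩
    1# * w̃ ^ n       ≡⟨ cong (_* w̃ ^ n) (sym wⁿ) ⟩
    w ^ n * w̃ ^ n    ≡⟨ sym (^-distrib-* w w̃ n) ⟩
    (w * w̃) ^ n      ≡⟨ trans (cong (_^ n) e) (1^n n) ⟩
    1# ∎
    where open ≡.≡-Reasoning

  module _ {τ : Carrier} (O : Order τ) where
    open Order O

    order-divides : ∀ D → τ ^ D ≡ 1# → ∃ λ n → L ℕ.* n ≡ D
    order-divides D e = go L L>0 τᴸ minimal
      where
      go : ∀ L → 0 ℕ.< L → τ ^ L ≡ 1# → (∀ j → 0 ℕ.< j → τ ^ j ≡ 1# → L ℕ.≤ j) → ∃ λ n → L ℕ.* n ≡ D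
      go L@(suc _) _ τᴸ minimal = D / L , sym (trans D≡ (trans (cong (ℕ._+ (D / L) ℕ.* L) r≡0) (ℕₚ.*-comm (D / L) L)))
        where
        D≡ = m≡m%n+[m/n]*n D L
        τʳ : τ ^ (D % L) ≡ 1#
        τʳ = begin
          τ ^ (D % L)                               ≡⟨ sym (*-identityʳ _) ⟩
          τ ^ (D % L) * 1#                          ≡⟨ cong (τ ^ (D % L) *_) (sym (trans (cong (_^ (D / L)) τᴸ) (1^n (D / L)))) ⟩
          τ ^ (D % L) * (τ ^ L) ^ (D / L)           ≡⟨ cong (τ ^ (D % L) *_) (trans (^-assocʳ τ L (D / L)) (cong (τ ^_) (ℕₚ.*-comm L (D / L)))) ⟩
          τ ^ (D % L) * τ ^ (D / L ℕ.* L)           ≡⟨ sym (^-homo-* τ (D % L) (D / L ℕ.* L)) ⟩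
          τ ^ (D % L ℕ.+ D / L ℕ.* L)               ≡⟨ cong (τ ^_) (sym D≡) ⟩
          τ ^ D                                     ≡⟨ e ⟩
          1# ∎
          where open ≡.≡-Reasoning
        r≡0 : D % L ≡ 0
        r≡0 = zero-or (D % L) τʳ (m%n<n D L)
          where
          zero-or : ∀ r → τ ^ r ≡ 1# → r ℕ.< L → r ≡ 0
          zero-or zero    _ _   = refl
          zero-or (suc r) e r<L = ⊥-elim (ℕₚ.<⇒≱ r<L (minimal (suc r) (s≤s z≤n) e))

    order-distinct : ¬ (τ ≡ 0#) → ∀ i j → i ℕ.< j → j ℕ.< L → ¬ (τ ^ i ≡ τ ^ j)
    order-distinct τ≢0 i j i<j j<L e = ℕₚ.<⇒≱ j<L (ℕₚ.≤-trans
      (minimal (j ℕ.∸ i) (ℕₚ.m<n⇒0<n∸m i<j) (sym (*-cancelˡ (^-nonzero i τ≢0) (begin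
        τ ^ i * 1#               ≡⟨ *-identityʳ _ ⟩
        τ ^ i                    ≡⟨ e ⟩
        τ ^ j                    ≡⟨ cong (τ ^_) (sym (ℕₚ.m+[n∸m]≡n (ℕₚ.<⇒≤ i<j))) ⟩
        τ ^ (i ℕ.+ (j ℕ.∸ i))    ≡⟨ ^-homo-* τ i (j ℕ.∸ i) ⟩
        τ ^ i * τ ^ (j ℕ.∸ i)    ∎)))) (ℕₚ.m∸n≤m j i))
      where open ≡.≡-Reasoning

-- The rotation on a conic in closed form, and the pattern of types along it

module Conics (S : Setting) where

  open Setting S
  open K
  open FieldProps K
  open RingSolver commutativeRing hiding (ι)
  open Polynomials K using (ev)
  open CharacterSums K p p-prime ιp≡0 ι≢0 M p≡1+2M 2<p
  open Eigenvalues F K emb M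
  open Orders K

  disc : F.Carrier → F.Carrier
  disc x = x F.* x F.- (F.1# F.+ F.1#) F.* (F.1# F.+ F.1#)

  emb-disc : ∀ x → emb (disc x) ≡ emb x * emb x - 4#
  emb-disc x = trans (emb-+ _ _) (cong₂ _+_ (emb-* x x) (trans (emb-neg _) (cong -_ (trans (emb-* _ _) (cong₂ _*_ two two)))))
    where
    two : emb (F.1# F.+ F.1#) ≡ 2#
    two = trans (emb-+ F.1# F.1#) (cong₂ _+_ emb-1 emb-1)

  emb-0 : emb F.0# ≡ 0#
  emb-0 = trans (cong emb (sym (F.-‿inverseʳ F.1#))) (trans (emb-+ _ _) (trans (cong (emb F.1# +_) (emb-neg F.1#)) (-‿inverseʳ _)))

  emb-≢0 : ∀ {a} → ¬ (a ≡ F.0#) → ¬ (emb a ≡ 0#)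
  emb-≢0 a≢0 e = a≢0 (emb-injective (trans e (sym emb-0)))

  emb-^ : ∀ a n → emb (a F.^ n) ≡ emb a ^ n
  emb-^ a zero    = emb-1
  emb-^ a (suc n) = trans (emb-* a (a F.^ n)) (cong (emb a *_) (emb-^ a n))

  module Progression (κ : ℕ) (κ≤1 : κ ℕ.≤ 1) (w w̃ : Carrier) (ww̃≡1 : w * w̃ ≡ 1#) (wᴰ : (w * w) ^ (M ℕ.+ κ) ≡ 1#) where

    τ : Carrier
    τ = w * w

    w≢0 : ¬ (w ≡ 0#)
    w≢0 e = 1≢0 (trans (sym ww̃≡1) (trans (cong (_* w̃) e) (zeroˡ w̃)))

    τ≢0 : ¬ (τ ≡ 0#)
    τ≢0 = *-nonzero w≢0 w≢0

    module _ (α α′ : Carrier) (u : ℕ → F.Carrier) (u≡ : ∀ n → emb (u n) ≡ α * w ^ n + α′ * w̃ ^ n)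
             (u≢±2 : ∀ n → ¬ (disc (u n) ≡ F.0#)) where

      ev-at : ∀ n → ev (quad α α′) (τ ^ n) ≡ τ ^ n * emb (disc (u n))
      ev-at n = begin
        ev (quad α α′) (τ ^ n)
          ≡⟨ cong (ev (quad α α′)) (^-distrib-* w w n) ⟩
        ev (quad α α′) (w ^ n * w ^ n)
          ≡⟨ ev-quad α α′ (w ^ n) (w̃ ^ n) (trans (sym (^-distrib-* w w̃ n)) (trans (cong (_^ n) ww̃≡1) (1^n n))) ⟩
        (w ^ n * w ^ n) * ((α * w ^ n + α′ * w̃ ^ n) * (α * w ^ n + α′ * w̃ ^ n) - 4#)
          ≡⟨ cong₂ _*_ (sym (^-distrib-* w w n)) (sym (trans (emb-disc (u n)) (cong (λ v → v * v - 4#) (u≡ n)))) ⟩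
        τ ^ n * emb (disc (u n)) ∎
        where open ≡.≡-Reasoning

      ev≢0 : ∀ n → ¬ (ev (quad α α′) (τ ^ n) ≡ 0#)
      ev≢0 n e = *-nonzero (^-nonzero n τ≢0) (emb-≢0 (u≢±2 n)) (trans (sym (ev-at n)) e)

      τⁿᴰ : ∀ n → (τ ^ n) ^ (M ℕ.+ κ) ≡ 1#
      τⁿᴰ n = trans (^-assocʳ τ n (M ℕ.+ κ)) (trans (cong (τ ^_) (ℕₚ.*-comm n (M ℕ.+ κ)))
        (trans (sym (^-assocʳ τ (M ℕ.+ κ) n)) (trans (cong (_^ n) wᴰ) (1^n n))))

      -- The factor τ^n in `ev-at` contributes τ^(nM), which τ^(nκ) completes to τ^(n(M+κ)) = 1.
      -- This is why a power X^κ is carried through the auxiliary construction.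
      symbol : ∀ n → (τ ^ n) ^ κ * ev (quad α α′) (τ ^ n) ^ M ≡ emb (disc (u n) F.^ M)
      symbol n = begin
        (τ ^ n) ^ κ * ev (quad α α′) (τ ^ n) ^ M
          ≡⟨ cong (λ e → (τ ^ n) ^ κ * e ^ M) (ev-at n) ⟩
        (τ ^ n) ^ κ * (τ ^ n * emb (disc (u n))) ^ M
          ≡⟨ cong ((τ ^ n) ^ κ *_) (^-distrib-* (τ ^ n) _ M) ⟩
        (τ ^ n) ^ κ * ((τ ^ n) ^ M * emb (disc (u n)) ^ M)
          ≡⟨ solve 3 (λ a b c → a :* (b :* c) := b :* a :* c) refl _ _ _ ⟩
        (τ ^ n) ^ M * (τ ^ n) ^ κ * emb (disc (u n)) ^ M
          ≡⟨ cong (_* emb (disc (u n)) ^ M) (trans (sym (^-homo-* (τ ^ n) M κ)) (τⁿᴰ n)) ⟩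
        1# * emb (disc (u n)) ^ M
          ≡⟨ trans (*-identityˡ _) (sym (emb-^ (disc (u n)) M)) ⟩
        emb (disc (u n) F.^ M) ∎
        where open ≡.≡-Reasoning

    module _ (O : Order τ) (δ : Carrier) (δ≢0 : ¬ (δ ≡ 0#)) where
      open Order O

      cofactor-order : ∃ λ n → L ℕ.* n ≡ M ℕ.+ κ
      cofactor-order = order-divides O (M ℕ.+ κ) wᴰ

      private
        n = proj₁ cofactor-order
        Ln≡ = proj₂ cofactor-order

      2Ln≤p+1 : 2 ℕ.* (L ℕ.* n) ℕ.≤ suc p
      2Ln≤p+1 = begin
        2 ℕ.* (L ℕ.* n)       ≡⟨ cong (2 ℕ.*_) Ln≡ ⟩
        2 ℕ.* (M ℕ.+ κ)       ≤⟨ ℕₚ.*-monoʳ-≤ 2 (ℕₚ.+-monoʳ-≤ M κ≤1) ⟩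
        2 ℕ.* (M ℕ.+ 1)       ≡⟨ NS.solve 1 (λ m → NS.con 2 NS.:* (m NS.:+ NS.con 1) NS.:= NS.con 2 NS.:+ (m NS.:+ m)) refl M ⟩
        suc (suc (M ℕ.+ M))   ≡⟨ cong suc (sym p≡1+2M) ⟩
        suc p                 ∎
        where
        open ℕₚ.≤-Reasoning
        module NS = +-*-Solver

      n>0 : 0 ℕ.< n
      n>0 = pos n Ln≡
        where
        M>0 : ∀ M → p ≡ suc (M ℕ.+ M) → 0 ℕ.< M
        M>0 zero    e = ⊥-elim (ℕₚ.<⇒≱ 2<p (subst (ℕ._≤ 2) (sym e) (s≤s z≤n)))
        M>0 (suc M) e = s≤s z≤n
        pos : ∀ n → L ℕ.* n ≡ M ℕ.+ κ → 0 ℕ.< n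
        pos zero    e = ⊥-elim (ℕₚ.<⇒≢ (ℕₚ.≤-trans (M>0 M p≡1+2M) (ℕₚ.m≤m+n M κ)) (trans (sym (ℕₚ.*-zeroʳ L)) e))
        pos (suc n) e = s≤s z≤n

      2L≤p+1 : 2 ℕ.* L ℕ.≤ suc p
      2L≤p+1 = ℕₚ.≤-trans (ℕₚ.*-monoʳ-≤ 2 (ℕₚ.≤-trans (ℕₚ.≤-reflexive (sym (ℕₚ.*-identityʳ L))) (ℕₚ.*-monoʳ-≤ L n>0))) 2Ln≤p+1

      L≤p : L ℕ.≤ p
      L≤p = ℕₚ.≤-pred (ℕₚ.≤-trans (ℕₚ.≤-trans (s≤s (ℕₚ.m≤m+n L 0)) (ℕₚ.+-monoˡ-≤ (L ℕ.+ 0) L>0)) 2L≤p+1)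

      distinct : {P : ℕ → Set} (P? : ∀ n → Dec (P n)) → AllPairs (λ i j → ¬ (τ ^ i ≡ τ ^ j)) (select P? L)
      distinct P? = build (select-descending P? L) (select-< P? L)
        where
        build : ∀ {is} → AllPairs (λ i j → j ℕ.< i) is → All (ℕ._< L) is → AllPairs (λ i j → ¬ (τ ^ i ≡ τ ^ j)) is
        build []       []       = []
        build (d ∷ ds) (l ∷ ls) = All.map (λ {j} j<i e → order-distinct O τ≢0 j _ j<i l (sym e)) d ∷ build ds ls

      module _ (v : ℕ) (128t≤L : 128 ℕ.* suc v ℕ.≤ L) where

        count-one : ∀ {α α′} → Half δ δ≢0 α α′ → (u : ℕ → F.Carrier) → (∀ n → emb (u n) ≡ α * w ^ n + α′ * w̃ ^ n) →
          (∀ n → ¬ (disc (u n) ≡ F.0#)) → 2 ℕ.* n ℕ.≤ 9 ℕ.* suc v ℕ.+ 1 →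
          (c : F.Carrier) (P? : ∀ i → Dec (disc (u i) F.^ M ≡ c)) →
          ∃ λ J → J ℕ.+ J ℕ.≤ 9 ℕ.* suc v ℕ.+ 2 ℕ.+ 2 ℕ.* n × count P? L ℕ.* (8 ℕ.* suc v) ℕ.< J ℕ.* L
        count-one {α} {α′} H u u≡ u≢±2 l c P? = convert (one-character δ δ≢0 κ κ≤1 (emb c) τ τ≢0 L n τᴸ L≤p Ln≡
            (select P? L) (distinct P?) v 128t≤L H (2 ℕ.* n) refl l
            (All.map (λ {i} e → ev≢0 α α′ u u≡ u≢±2 i , trans (symbol α α′ u u≡ u≢±2 i) (cong emb e)) (select-sound P? L)))
          where
          convert : ∀ {X : ℕ → Set} → (∃ λ J → X J × length (select P? L) ℕ.* (8 ℕ.* suc v) ℕ.< J ℕ.* L) →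
                    ∃ λ J → X J × count P? L ℕ.* (8 ℕ.* suc v) ℕ.< J ℕ.* L
          convert (J , a , b) = J , a , subst (λ k → k ℕ.* (8 ℕ.* suc v) ℕ.< J ℕ.* L) (length-select P? L) b

        -- Two signs agree exactly when their product is 1, so agreement is the case c = 1 for the
        -- product of the quadratics; the two factors τ^κ add up to the exponent κ + κ.
        count-two : ∀ {α α′ β β′} → Half δ δ≢0 α α′ → Half δ δ≢0 β β′ →
          ¬ (α * α ≡ β * β) → ¬ (α * α ≡ - (β * β) × 1# + δ * δ ≡ 0#) →
          (u u′ : ℕ → F.Carrier) → (∀ n → emb (u n) ≡ α * w ^ n + α′ * w̃ ^ n) → (∀ n → emb (u′ n) ≡ β * w ^ n + β′ * w̃ ^ n) →
          (∀ n → ¬ (disc (u n) ≡ F.0#)) → (∀ n → ¬ (disc (u′ n) ≡ F.0#)) →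
          (∀ n → disc (u n) F.^ M F.* disc (u n) F.^ M ≡ F.1#) → 4 ℕ.* n ℕ.≤ 10 ℕ.* suc v ℕ.+ 1 →
          (P? : ∀ i → Dec (disc (u i) F.^ M ≡ disc (u′ i) F.^ M)) →
          ∃ λ J → J ℕ.+ J ℕ.≤ 10 ℕ.* suc v ℕ.+ 2 ℕ.+ 4 ℕ.* n × count P? L ℕ.* (8 ℕ.* suc v) ℕ.< J ℕ.* L
        count-two {α} {α′} {β} {β′} H H′ n₁ n₂ u u′ u≡ u′≡ u≢ u′≢ u² l P? = convert (two-characters δ δ≢0 κ κ≤1 1# τ τ≢0 L n τᴸ L≤p Ln≡
            (select P? L) (distinct P?) v 128t≤L H H′ n₁ n₂ (4 ℕ.* n) refl l
            (All.map (λ {i} e → ev≢0 α α′ u u≡ u≢ i , ev≢0 β β′ u′ u′≡ u′≢ i , product i e) (select-sound P? L)))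
          where
          convert : ∀ {X : ℕ → Set} → (∃ λ J → X J × length (select P? L) ℕ.* (8 ℕ.* suc v) ℕ.< J ℕ.* L) →
                    ∃ λ J → X J × count P? L ℕ.* (8 ℕ.* suc v) ℕ.< J ℕ.* L
          convert (J , a , b) = J , a , subst (λ k → k ℕ.* (8 ℕ.* suc v) ℕ.< J ℕ.* L) (length-select P? L) b
          product : ∀ i → disc (u i) F.^ M ≡ disc (u′ i) F.^ M →
            (τ ^ i) ^ (κ ℕ.+ κ) * (ev (quad α α′) (τ ^ i) * ev (quad β β′) (τ ^ i)) ^ M ≡ 1#
          product i e = begin
            (τ ^ i) ^ (κ ℕ.+ κ) * (q * q′) ^ M
              ≡⟨ cong₂ _*_ (^-homo-* (τ ^ i) κ κ) (^-distrib-* q q′ M) ⟩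
            (τ ^ i) ^ κ * (τ ^ i) ^ κ * (q ^ M * q′ ^ M)
              ≡⟨ solve 3 (λ a b c → a :* a :* (b :* c) := (a :* b) :* (a :* c)) refl _ _ _ ⟩
            ((τ ^ i) ^ κ * q ^ M) * ((τ ^ i) ^ κ * q′ ^ M)
              ≡⟨ cong₂ _*_ (symbol α α′ u u≡ u≢ i) (trans (symbol β β′ u′ u′≡ u′≢ i) (cong emb (sym e))) ⟩
            emb (disc (u i) F.^ M) * emb (disc (u i) F.^ M)
              ≡⟨ trans (sym (emb-* _ _)) (trans (cong emb (u² i)) emb-1) ⟩
            1# ∎
            where
            open ≡.≡-Reasoning
            q = ev (quad α α′) (τ ^ i)
            q′ = ev (quad β β′) (τ ^ i)

  private
    module FP = FieldProps F
    module FS = RingSolver F.commutativeRing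

  -- The linear recurrence u_0 = y, u_1 = z, u_(n+2) = x u_(n+1) - u_n: the second coordinates along
  -- the rotation orbit of (x, y, z).
  seq : F.Carrier → F.Carrier → F.Carrier → ℕ → F.Carrier
  seq x y z zero    = y
  seq x y z (suc n) = seq x z (x F.* z F.- y) n

  Markoff : F.Carrier → F.Carrier → F.Carrier → Set
  Markoff x y z = x F.* x F.+ y F.* y F.+ z F.* z ≡ x F.* y F.* z

  module Eigen (x : F.Carrier) (Tx : Torus x) (x≢0 : ¬ (x ≡ F.0#)) (x≢±2 : ¬ (disc x ≡ F.0#)) where
    open Torus Tx public

    κ≤1 : κ ℕ.≤ 1
    κ≤1 = go type
      where
      go : ∀ {A B : Set} → (κ ≡ 0 × A) ⊎ (κ ≡ 1 × B) → κ ℕ.≤ 1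
      go (inj₁ (refl , _)) = z≤n
      go (inj₂ (refl , _)) = ℕₚ.≤-refl

    σ : Carrier
    σ = ω - ω̃

    σ²≡ : σ * σ ≡ emb x * emb x - 4#
    σ²≡ = begin
      (ω - ω̃) * (ω - ω̃)
        ≡⟨ solve 2 (λ a b → (a :- b) :* (a :- b) := (a :+ b) :* (a :+ b) :- (:ι 1 :+ :ι 1) :* (:ι 1 :+ :ι 1) :* (a :* b)) refl ω ω̃ ⟩
      (ω + ω̃) * (ω + ω̃) - 4# * (ω * ω̃)
        ≡⟨ cong₂ (λ u w → u * u - 4# * w) ω+ω̃≡x ωω̃≡1 ⟩
      emb x * emb x - 4# * 1#
        ≡⟨ cong (λ u → emb x * emb x - u) (*-identityʳ 4#) ⟩
      emb x * emb x - 4# ∎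
      where open ≡.≡-Reasoning

    σ≢0 : ¬ (σ ≡ 0#)
    σ≢0 e = emb-≢0 x≢±2 (trans (emb-disc x) (trans (sym σ²≡) (trans (cong (_* σ) e) (zeroˡ σ))))

    s : Carrier
    s = σ ⁻¹

    σs : σ * s ≡ 1#
    σs = inverse σ σ≢0

    -- `Half` asks for a square root of 1 - α α′. On the conic α α′ = x²/(x² - 4), so this is -4/σ²,
    -- whose root involves 𝕚.
    δ : Carrier
    δ = 2# * 𝕚 * s

    δσ : δ * σ ≡ 2# * 𝕚
    δσ = trans (solve 3 (λ a s t → a :* s :* t := a :* (t :* s)) refl (2# * 𝕚) s σ) (trans (cong (2# * 𝕚 *_) σs) (*-identityʳ _))

    δ≢0 : ¬ (δ ≡ 0#)
    δ≢0 e = *-nonzero 2≢0 𝕚≢0 (trans (sym δσ) (trans (cong (_* σ) e) (zeroˡ σ)))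
      where
      𝕚≢0 : ¬ (𝕚 ≡ 0#)
      𝕚≢0 e = 1≢0 (trans (solve 0 (:ι 1 := :- (:- :ι 1)) refl) (trans (cong -_ (trans (sym 𝕚²) (trans (cong (_* 𝕚) e) (zeroˡ 𝕚)))) (solve 0 (:- :ι 0 := :ι 0) refl)))

    1-δ² : (1# - δ * δ) * (σ * σ) ≡ emb x * emb x
    1-δ² = begin
      (1# - δ * δ) * (σ * σ)
        ≡⟨ solve 2 (λ d t → (:ι 1 :- d :* d) :* (t :* t) := t :* t :- (d :* t) :* (d :* t)) refl δ σ ⟩
      σ * σ - (δ * σ) * (δ * σ)
        ≡⟨ cong₂ (λ u w → u - w * w) σ²≡ δσ ⟩
      emb x * emb x - 4# - (2# * 𝕚) * (2# * 𝕚)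
        ≡⟨ solve 2 (λ x i → x :- (:ι 1 :+ :ι 1) :* (:ι 1 :+ :ι 1) :- ((:ι 1 :+ :ι 1) :* i) :* ((:ι 1 :+ :ι 1) :* i)
             := x :- (:ι 1 :+ :ι 1) :* (:ι 1 :+ :ι 1) :* (:ι 1 :+ i :* i)) refl (emb x * emb x) 𝕚 ⟩
      emb x * emb x - 4# * (1# + 𝕚 * 𝕚)
        ≡⟨ cong (λ u → emb x * emb x - 4# * (1# + u)) 𝕚² ⟩
      emb x * emb x - 4# * (1# + - 1#)
        ≡⟨ solve 1 (λ x → x :- (:ι 1 :+ :ι 1) :* (:ι 1 :+ :ι 1) :* (:ι 1 :+ :- :ι 1) := x) refl (emb x * emb x) ⟩
      emb x * emb x ∎
      where open ≡.≡-Reasoning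

    A A′ : F.Carrier → F.Carrier → Carrier
    A  y z = (emb z - emb y * ω̃) * s
    A′ y z = (emb y * ω - emb z) * s

    next : ∀ y z → emb (x F.* z F.- y) ≡ (ω + ω̃) * emb z - emb y
    next y z = trans (emb-+ _ _) (cong₂ _+_ (trans (emb-* x z) (cong (_* emb z) (sym ω+ω̃≡x))) (emb-neg y))

    A-next : ∀ y z → A z (x F.* z F.- y) ≡ A y z * ω
    A-next y z = begin
      (emb (x F.* z F.- y) - emb z * ω̃) * s
        ≡⟨ cong (λ u → (u - emb z * ω̃) * s) (next y z) ⟩
      ((ω + ω̃) * emb z - emb y - emb z * ω̃) * s
        ≡⟨ solve 5 (λ a b y z s → ((a :+ b) :* z :- y :- z :* b) :* s := (z :* a :- y :* :ι 1) :* s) refl ω ω̃ (emb y) (emb z) s ⟩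
      (emb z * ω - emb y * 1#) * s
        ≡⟨ cong (λ u → (emb z * ω - emb y * u) * s) (sym ωω̃≡1) ⟩
      (emb z * ω - emb y * (ω * ω̃)) * s
        ≡⟨ solve 5 (λ a b y z s → (z :* a :- y :* (a :* b)) :* s := (z :- y :* b) :* s :* a) refl ω ω̃ (emb y) (emb z) s ⟩
      A y z * ω ∎
      where open ≡.≡-Reasoning

    A′-next : ∀ y z → A′ z (x F.* z F.- y) ≡ A′ y z * ω̃
    A′-next y z = begin
      (emb z * ω - emb (x F.* z F.- y)) * s
        ≡⟨ cong (λ u → (emb z * ω - u) * s) (next y z) ⟩
      (emb z * ω - ((ω + ω̃) * emb z - emb y)) * s
        ≡⟨ solve 5 (λ a b y z s → (z :* a :- ((a :+ b) :* z :- y)) :* s := (y :* :ι 1 :- z :* b) :* s) refl ω ω̃ (emb y) (emb z) s ⟩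
      (emb y * 1# - emb z * ω̃) * s
        ≡⟨ cong (λ u → (emb y * u - emb z * ω̃) * s) (sym ωω̃≡1) ⟩
      (emb y * (ω * ω̃) - emb z * ω̃) * s
        ≡⟨ solve 5 (λ a b y z s → (y :* (a :* b) :- z :* b) :* s := (y :* a :- z) :* s :* b) refl ω ω̃ (emb y) (emb z) s ⟩
      A′ y z * ω̃ ∎
      where open ≡.≡-Reasoning

    closed-form : ∀ n y z → emb (seq x y z n) ≡ A y z * ω ^ n + A′ y z * ω̃ ^ n
    closed-form zero y z = sym (begin
      (emb z - emb y * ω̃) * s * 1# + (emb y * ω - emb z) * s * 1#
        ≡⟨ solve 5 (λ a b y z s → (z :- y :* b) :* s :* :ι 1 :+ (y :* a :- z) :* s :* :ι 1 := y :* ((a :- b) :* s)) refl ω ω̃ (emb y) (emb z) s ⟩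
      emb y * (σ * s)    ≡⟨ cong (emb y *_) σs ⟩
      emb y * 1#         ≡⟨ *-identityʳ _ ⟩
      emb y              ∎)
      where open ≡.≡-Reasoning
    closed-form (suc n) y z = begin
      emb (seq x z (x F.* z F.- y) n)
        ≡⟨ closed-form n z (x F.* z F.- y) ⟩
      A z (x F.* z F.- y) * ω ^ n + A′ z (x F.* z F.- y) * ω̃ ^ n
        ≡⟨ cong₂ (λ u w → u * ω ^ n + w * ω̃ ^ n) (A-next y z) (A′-next y z) ⟩
      A y z * ω * ω ^ n + A′ y z * ω̃ * ω̃ ^ n
        ≡⟨ cong₂ _+_ (*-assoc (A y z) ω (ω ^ n)) (*-assoc (A′ y z) ω̃ (ω̃ ^ n)) ⟩
      A y z * ω ^ suc n + A′ y z * ω̃ ^ suc n ∎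
      where open ≡.≡-Reasoning

    -- The product (z - y ω̃)(y ω - z) expands to x y z - y² - z², and the equation of the surface
    -- turns this into x². Division by σ² gives 1 - δ².
    half : ∀ y z → Markoff x y z → Half δ δ≢0 (A y z) (A′ y z)
    half y z mk = (λ e → ≢0 (trans (cong (_* A′ y z) e) (zeroˡ _))) , (λ e → ≢0 (trans (cong (A y z *_) e) (zeroʳ _))) ,
      *-cancelˡ (*-nonzero σ≢0 σ≢0) (trans (*-comm (σ * σ) _) (trans AA′ (trans (sym 1-δ²) (*-comm _ (σ * σ)))))
      where
      open ≡.≡-Reasoning
      markoff : emb x * emb y * emb z - emb z * emb z - emb y * emb y ≡ emb x * emb x
      markoff = begin
        emb x * emb y * emb z - emb z * emb z - emb y * emb y
          ≡⟨ cong (λ u → u - emb z * emb z - emb y * emb y) (sym embed) ⟩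
        emb x * emb x + emb y * emb y + emb z * emb z - emb z * emb z - emb y * emb y
          ≡⟨ solve 3 (λ x y z → x :+ y :+ z :- z :- y := x) refl (emb x * emb x) (emb y * emb y) (emb z * emb z) ⟩
        emb x * emb x ∎
        where
        embed : emb x * emb x + emb y * emb y + emb z * emb z ≡ emb x * emb y * emb z
        embed = trans (sym (trans (emb-+ _ _) (cong₂ _+_ (trans (emb-+ _ _) (cong₂ _+_ (emb-* x x) (emb-* y y))) (emb-* z z))))
                  (trans (cong emb mk) (trans (emb-* _ z) (cong (_* emb z) (emb-* x y))))
      AA′ : A y z * A′ y z * (σ * σ) ≡ emb x * emb x
      AA′ = begin
        A y z * A′ y z * (σ * σ)
          ≡⟨ solve 4 (λ a b s t → a :* s :* (b :* s) :* (t :* t) := a :* b :* ((t :* s) :* (t :* s))) refl (emb z - emb y * ω̃) (emb y * ω - emb z) s σ ⟩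
        (emb z - emb y * ω̃) * (emb y * ω - emb z) * ((σ * s) * (σ * s))
          ≡⟨ cong (λ u → (emb z - emb y * ω̃) * (emb y * ω - emb z) * (u * u)) σs ⟩
        (emb z - emb y * ω̃) * (emb y * ω - emb z) * (1# * 1#)
          ≡⟨ solve 4 (λ a b y z → (z :- y :* b) :* (y :* a :- z) :* (:ι 1 :* :ι 1) := (a :+ b) :* y :* z :- z :* z :- y :* y :* (a :* b)) refl ω ω̃ (emb y) (emb z) ⟩
        (ω + ω̃) * emb y * emb z - emb z * emb z - emb y * emb y * (ω * ω̃)
          ≡⟨ cong₂ (λ u w → u * emb y * emb z - emb z * emb z - emb y * emb y * w) ω+ω̃≡x ωω̃≡1 ⟩
        emb x * emb y * emb z - emb z * emb z - emb y * emb y * 1#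
          ≡⟨ cong (λ u → emb x * emb y * emb z - emb z * emb z - u) (*-identityʳ _) ⟩
        emb x * emb y * emb z - emb z * emb z - emb y * emb y
          ≡⟨ markoff ⟩
        emb x * emb x ∎
      ≢0 : ¬ (A y z * A′ y z ≡ 0#)
      ≢0 e = *-nonzero (emb-≢0 x≢0) (emb-≢0 x≢0) (trans (sym AA′) (trans (cong (_* (σ * σ)) e) (zeroˡ _)))

    module P₁ = Progression κ κ≤1 ω ω̃ ωω̃≡1 order

    -- The product of `A` and `A′` is the same at all points of the conic. Hence a sign of `A`
    -- carries over to `A′` and to the whole sequence, whose first two terms are y and z.
    same-point : ∀ y z y′ z′ → Markoff x y z → Markoff x y′ z′ → A y z * A y z ≡ A y′ z′ * A y′ z′ →
                 (y ≡ y′ × z ≡ z′) ⊎ (y ≡ F.- y′ × z ≡ F.- z′)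
    same-point y z y′ z′ mk mk′ e = decide (square-eq e)
      where
      open ≡.≡-Reasoning
      H = half y z mk
      H′ = half y′ z′ mk′
      AA : A y z * A′ y z ≡ A y′ z′ * A′ y′ z′
      AA = trans (proj₂ (proj₂ H)) (sym (proj₂ (proj₂ H′)))
      decide : A y z ≡ A y′ z′ ⊎ A y z ≡ - A y′ z′ → (y ≡ y′ × z ≡ z′) ⊎ (y ≡ F.- y′ × z ≡ F.- z′)
      decide (inj₁ a) = inj₁ (at 0 , at 1)
        where
        a′ : A′ y z ≡ A′ y′ z′
        a′ = *-cancelˡ (proj₁ H) (trans AA (cong (_* A′ y′ z′) (sym a)))
        at : ∀ n → seq x y z n ≡ seq x y′ z′ n
        at n = emb-injective (trans (closed-form n y z) (trans (cong₂ (λ u w → u * ω ^ n + w * ω̃ ^ n) a a′) (sym (closed-form n y′ z′))))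
      decide (inj₂ a) = inj₂ (at 0 , at 1)
        where
        a′ : A′ y z ≡ - A′ y′ z′
        a′ = *-cancelˡ (proj₁ H) (trans AA (trans (solve 2 (λ a b → a :* b := :- a :* :- b) refl (A y′ z′) (A′ y′ z′)) (cong (_* (- A′ y′ z′)) (sym a))))
        at : ∀ n → seq x y z n ≡ F.- seq x y′ z′ n
        at n = emb-injective (trans (closed-form n y z) (trans (cong₂ (λ u w → u * ω ^ n + w * ω̃ ^ n) a a′)
          (trans (solve 4 (λ a b w v → :- a :* w :+ :- b :* v := :- (a :* w :+ b :* v)) refl (A y′ z′) (A′ y′ z′) (ω ^ n) (ω̃ ^ n))
            (trans (cong -_ (sym (closed-form n y′ z′))) (sym (emb-neg _))))))

    -- The hypothesis on δ means x² = 8.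
    opposite-points : ∀ y z y′ z′ → Markoff x y z → Markoff x y′ z′ → A y z * A y z ≡ - (A y′ z′ * A y′ z′) → 1# + δ * δ ≡ 0# →
                      ∀ n → disc (seq x y z n) ≡ F.- disc (seq x y′ z′ n)
    opposite-points y z y′ z′ mk mk′ e δ²≡-1 n = emb-injective (trans (discs y z mk) (trans
        (cong₂ (λ u w → u * (ω ^ n * ω ^ n) + w * (ω̃ ^ n * ω̃ ^ n)) e e′)
        (trans (solve 4 (λ a b w v → :- a :* w :+ :- b :* v := :- (a :* w :+ b :* v)) refl (α₂ * α₂) (α₂′ * α₂′) (ω ^ n * ω ^ n) (ω̃ ^ n * ω̃ ^ n))
          (trans (cong -_ (sym (discs y′ z′ mk′))) (sym (emb-neg _))))))
      where
      open ≡.≡-Reasoning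
      α₁ = A y z
      α₁′ = A′ y z
      α₂ = A y′ z′
      α₂′ = A′ y′ z′
      H = half y z mk
      H′ = half y′ z′ mk′
      e′ : α₁′ * α₁′ ≡ - (α₂′ * α₂′)
      e′ = *-cancelˡ (*-nonzero (proj₁ H) (proj₁ H)) (begin
        α₁ * α₁ * (α₁′ * α₁′)          ≡⟨ solve 2 (λ a b → a :* a :* (b :* b) := a :* b :* (a :* b)) refl α₁ α₁′ ⟩
        α₁ * α₁′ * (α₁ * α₁′)          ≡⟨ cong (λ u → u * u) (trans (proj₂ (proj₂ H)) (sym (proj₂ (proj₂ H′)))) ⟩
        α₂ * α₂′ * (α₂ * α₂′)          ≡⟨ solve 2 (λ a b → a :* b :* (a :* b) := :- (a :* a) :* :- (b :* b)) refl α₂ α₂′ ⟩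
        - (α₂ * α₂) * - (α₂′ * α₂′)    ≡⟨ cong (_* (- (α₂′ * α₂′))) (sym e) ⟩
        α₁ * α₁ * - (α₂′ * α₂′)        ∎)
      product2 : ∀ {a b} → a * b ≡ 1# - δ * δ → a * b ≡ 2#
      product2 {a} {b} ab = trans ab (trans (solve 1 (λ d → :ι 1 :- d := (:ι 1 :+ :ι 1) :- (:ι 1 :+ d)) refl (δ * δ))
        (trans (cong (λ u → 2# - u) δ²≡-1) (solve 0 ((:ι 1 :+ :ι 1) :- :ι 0 := :ι 1 :+ :ι 1) refl)))
      ωω̃ⁿ : ω ^ n * ω̃ ^ n ≡ 1#
      ωω̃ⁿ = trans (sym (^-distrib-* ω ω̃ n)) (trans (cong (_^ n) ωω̃≡1) (1^n n))
      discs : ∀ y z → Markoff x y z → emb (disc (seq x y z n)) ≡ A y z * A y z * (ω ^ n * ω ^ n) + A′ y z * A′ y z * (ω̃ ^ n * ω̃ ^ n)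
      discs y z mk = begin
        emb (disc (seq x y z n))
          ≡⟨ trans (emb-disc _) (cong (λ u → u * u - 4#) (closed-form n y z)) ⟩
        (A y z * ω ^ n + A′ y z * ω̃ ^ n) * (A y z * ω ^ n + A′ y z * ω̃ ^ n) - 4#
          ≡⟨ solve 4 (λ a b w v → (a :* w :+ b :* v) :* (a :* w :+ b :* v) :- (:ι 1 :+ :ι 1) :* (:ι 1 :+ :ι 1)
               := a :* a :* (w :* w) :+ b :* b :* (v :* v) :+ ((:ι 1 :+ :ι 1) :* (a :* b) :* (w :* v) :- (:ι 1 :+ :ι 1) :* (:ι 1 :+ :ι 1)))
               refl (A y z) (A′ y z) (ω ^ n) (ω̃ ^ n) ⟩
        A y z * A y z * (ω ^ n * ω ^ n) + A′ y z * A′ y z * (ω̃ ^ n * ω̃ ^ n) + (2# * (A y z * A′ y z) * (ω ^ n * ω̃ ^ n) - 4#)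
          ≡⟨ cong₂ (λ u w → A y z * A y z * (ω ^ n * ω ^ n) + A′ y z * A′ y z * (ω̃ ^ n * ω̃ ^ n) + (2# * u * w - 4#)) (product2 (proj₂ (proj₂ (half y z mk)))) ωω̃ⁿ ⟩
        A y z * A y z * (ω ^ n * ω ^ n) + A′ y z * A′ y z * (ω̃ ^ n * ω̃ ^ n) + (2# * 2# * 1# - 4#)
          ≡⟨ solve 1 (λ u → u :+ ((:ι 1 :+ :ι 1) :* (:ι 1 :+ :ι 1) :* :ι 1 :- (:ι 1 :+ :ι 1) :* (:ι 1 :+ :ι 1)) := u) refl _ ⟩
        A y z * A y z * (ω ^ n * ω ^ n) + A′ y z * A′ y z * (ω̃ ^ n * ω̃ ^ n) ∎

    module Alternation
      (y z y′ z′ : F.Carrier) (mk : Markoff x y z) (mk′ : Markoff x y′ z′)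
      (u≢±2 : ∀ n → ¬ (disc (seq x y z n) ≡ F.0#)) (u′≢±2 : ∀ n → ¬ (disc (seq x y′ z′ n) ≡ F.0#))
      (different : ¬ ((y ≡ y′ × z ≡ z′) ⊎ (y ≡ F.- y′ × z ≡ F.- z′)))
      (O : Order (ω * ω)) (large : 256 ℕ.* suc p ℕ.≤ Order.L O ℕ.* Order.L O)
      -- `Full i` will later say that the rotation fixing the second coordinate stabilises the i-th
      -- translate of the block.
      (Full : ℕ → Set) (Full? : ∀ n → Dec (Full n))
      where
      open Order O

      u u′ : ℕ → F.Carrier
      u  = seq x y z
      u′ = seq x y′ z′

      a a′ : ℕ → F.Carrier
      a  n = disc (u n) F.^ M
      a′ n = disc (u′ n) F.^ M

      e : F.Carrier
      e = disc x F.^ M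

      private
        n₀ : ℕ
        n₀ = proj₁ (P₁.cofactor-order O δ δ≢0)

        -- Since 2 L n₀ ≤ p + 1 ≤ L²/256, the index n₀ is small compared with L.
        512n₀≤L : 512 ℕ.* n₀ ℕ.≤ L
        512n₀≤L = ℕₚ.*-cancelˡ-≤ L {{ℕ.>-nonZero L>0}} (begin
          L ℕ.* (512 ℕ.* n₀)               ≡⟨ NS.solve 2 (λ l n → l NS.:* (NS.con 512 NS.:* n) NS.:= NS.con 256 NS.:* (NS.con 2 NS.:* (l NS.:* n))) refl L n₀ ⟩
          256 ℕ.* (2 ℕ.* (L ℕ.* n₀))       ≤⟨ ℕₚ.*-monoʳ-≤ 256 (P₁.2Ln≤p+1 O δ δ≢0) ⟩
          256 ℕ.* suc p                    ≤⟨ large ⟩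
          L ℕ.* L                          ∎)
          where
          open ℕₚ.≤-Reasoning
          module NS = +-*-Solver

        512≤L : 512 ℕ.≤ L
        512≤L = ℕₚ.≤-trans (ℕₚ.*-monoʳ-≤ 512 {1} (P₁.n>0 O δ δ≢0)) 512n₀≤L

        α β : Carrier
        α = A y z
        β = A y′ z′

        α²≢β² : ¬ (α * α ≡ β * β)
        α²≢β² d = different (same-point y z y′ z′ mk mk′ d)

        squares : ∀ {b} → ¬ (b ≡ F.0#) → b F.^ M F.* b F.^ M ≡ F.1#
        squares b≢0 = go (legendre b≢0)
          where
          go : ∀ {c} → c ≡ F.1# ⊎ c ≡ F.- F.1# → c F.* c ≡ F.1#
          go (inj₁ refl) = F.*-identityˡ F.1#
          go (inj₂ refl) = FS.solve 0 ((FS.:- FS.:ι 1) FS.:* (FS.:- FS.:ι 1) FS.:= FS.:ι 1) refl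

      -- Only ω^(2L) = 1 is known, so the terms may change sign after L steps; their discriminants
      -- do not notice.
      periodic : ∀ y z → (∀ n → ¬ (disc (seq x y z n) ≡ F.0#)) → ∀ n → disc (seq x y z (n ℕ.+ L)) ≡ disc (seq x y z n)
      periodic y z nd n = emb-injective (*-cancelˡ (^-nonzero n P₁.τ≢0) (begin
        τ ^ n * emb (disc (seq x y z (n ℕ.+ L)))           ≡⟨ cong (_* emb (disc (seq x y z (n ℕ.+ L)))) (sym shift) ⟩
        τ ^ (n ℕ.+ L) * emb (disc (seq x y z (n ℕ.+ L)))   ≡⟨ sym (ev-at (n ℕ.+ L)) ⟩
        ev (quad (A y z) (A′ y z)) (τ ^ (n ℕ.+ L))         ≡⟨ cong (ev (quad (A y z) (A′ y z))) shift ⟩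
        ev (quad (A y z) (A′ y z)) (τ ^ n)                 ≡⟨ ev-at n ⟩
        τ ^ n * emb (disc (seq x y z n))                   ∎))
        where
        open ≡.≡-Reasoning
        τ = ω * ω
        ev-at = P₁.ev-at (A y z) (A′ y z) (seq x y z) (λ n → closed-form n y z) nd
        shift : τ ^ (n ℕ.+ L) ≡ τ ^ n
        shift = trans (^-homo-* τ n L) (trans (cong (τ ^ n *_) τᴸ) (*-identityʳ _))

      module _
        (F₁ : ∀ i → ¬ (a i ≡ a′ i) → Full i)
        (F₂ : ∀ i → Full i → a (suc i) ≡ e × a′ (suc i) ≡ e)
        (F₂′ : ∀ i → Full (suc i) → a i ≡ e × a′ i ≡ e)
        (F₃ : ∀ i → Full i → Full (suc i) → ⊥)
        (F₄ : ∀ i → Full i → Full (suc (suc i)) → Full (suc (suc (suc (suc i)))))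
        where

        -- In this case the discriminants of the two sequences are negatives of each other, so their
        -- types differ everywhere, -1 being a non-residue. Then 0 and 1 are both full, against
        -- `F₃`.
        not-opposite : ¬ (α * α ≡ - (β * β) × 1# + δ * δ ≡ 0#)
        not-opposite (d , d′) = F₃ 0 (F₁ 0 (differ 0)) (F₁ 1 (differ 1))
          where
          differ : ∀ i → ¬ (a i ≡ a′ i)
          differ i eq = clash (legendre (u′≢±2 i)) (trans (sym eq) (trans (cong (F._^ M) (opposite-points y z y′ z′ mk mk′ d d′ i)) (neg-power _)))
            where
            clash : ∀ {c} → c ≡ F.1# ⊎ c ≡ F.- F.1# → c ≡ F.- c → ⊥
            clash (inj₁ refl) d = 1≢-1 d
            clash (inj₂ refl) d = 1≢-1 (sym (trans d (FS.solve 0 (FS.:- (FS.:- FS.:ι 1) FS.:= FS.:ι 1) refl)))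

        -- If i and i + 2 are full then the symbol is constant on i + 1, i + 3, ….
        module Close (i : ℕ) (full₀ : Full i) (full₂ : Full (suc (suc i))) where

          full-even : ∀ k → Full (i ℕ.+ (k ℕ.+ k)) × Full (suc (suc (i ℕ.+ (k ℕ.+ k))))
          full-even zero    = subst Full (sym (ℕₚ.+-identityʳ i)) full₀ , subst (λ j → Full (suc (suc j))) (sym (ℕₚ.+-identityʳ i)) full₂
          full-even (suc k) = subst Full (sym eq) (proj₂ ih) , subst (λ j → Full (suc (suc j))) (sym eq) (F₄ _ (proj₁ ih) (proj₂ ih))
            where
            ih = full-even k
            eq : i ℕ.+ (suc k ℕ.+ suc k) ≡ suc (suc (i ℕ.+ (k ℕ.+ k)))
            eq = trans (cong (i ℕ.+_) (cong suc (ℕₚ.+-suc k k))) (trans (ℕₚ.+-suc i _) (cong suc (ℕₚ.+-suc i _)))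

          -- Every second term forms a progression of the same kind with ω² in place of ω, for which
          -- the relevant order is at least L/2.
          ω₂ ω̃₂ : Carrier
          ω₂ = ω * ω
          ω̃₂ = ω̃ * ω̃

          ω₂ω̃₂≡1 : ω₂ * ω̃₂ ≡ 1#
          ω₂ω̃₂≡1 = trans (solve 2 (λ a b → a :* a :* (b :* b) := a :* b :* (a :* b)) refl ω ω̃) (trans (cong₂ _*_ ωω̃≡1 ωω̃≡1) (*-identityˡ 1#))

          order₂ : (ω₂ * ω₂) ^ (M ℕ.+ κ) ≡ 1#
          order₂ = trans (^-distrib-* ω₂ ω₂ (M ℕ.+ κ)) (trans (cong₂ _*_ order order) (*-identityˡ 1#))

          module P₂ = Progression κ κ≤1 ω₂ ω̃₂ ω₂ω̃₂≡1 order₂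

          M+κ>0 : 0 ℕ.< M ℕ.+ κ
          M+κ>0 = subst (0 ℕ.<_) (proj₂ (P₁.cofactor-order O δ δ≢0)) (ℕₚ.*-mono-≤ L>0 (P₁.n>0 O δ δ≢0))

          O₂ : Order (ω₂ * ω₂)
          O₂ = order-of (ω₂ * ω₂) (M ℕ.+ κ) M+κ>0 order₂

          L₂ = Order.L O₂
          n₂ = proj₁ (P₂.cofactor-order O₂ δ δ≢0)

          L≤2L₂ : L ℕ.≤ L₂ ℕ.+ L₂
          L≤2L₂ = order-of-square O O₂

          values : ℕ → F.Carrier
          values k = u (suc (i ℕ.+ (k ℕ.+ k)))

          α₂ α₂′ : Carrier
          α₂  = A y z * ω ^ suc i
          α₂′ = A′ y z * ω̃ ^ suc i

          values≡ : ∀ k → emb (values k) ≡ α₂ * ω₂ ^ k + α₂′ * ω̃₂ ^ k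
          values≡ k = trans (closed-form (suc (i ℕ.+ (k ℕ.+ k))) y z) (cong₂ _+_ (shift (A y z) ω) (shift (A′ y z) ω̃))
            where
            shift : ∀ b w → b * w ^ suc (i ℕ.+ (k ℕ.+ k)) ≡ b * w ^ suc i * (w * w) ^ k
            shift b w = trans (cong (b *_) (trans (^-homo-* w (suc i) (k ℕ.+ k)) (cong (w ^ suc i *_)
              (trans (^-homo-* w k k) (sym (^-distrib-* w w k)))))) (sym (*-assoc b _ _))

          half₂ : Half δ δ≢0 α₂ α₂′
          half₂ = *-nonzero (proj₁ H) (^-nonzero (suc i) P₁.w≢0) , *-nonzero (proj₁ (proj₂ H)) (^-nonzero (suc i) w̃≢0) ,
            trans (solve 4 (λ a b w v → a :* w :* (b :* v) := a :* b :* (w :* v)) refl (A y z) (A′ y z) (ω ^ suc i) (ω̃ ^ suc i))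
              (trans (cong₂ _*_ (proj₂ (proj₂ H)) (trans (sym (^-distrib-* ω ω̃ (suc i))) (trans (cong (_^ suc i) ωω̃≡1) (1^n (suc i))))) (*-identityʳ _))
            where
            H = half y z mk
            w̃≢0 : ¬ (ω̃ ≡ 0#)
            w̃≢0 d = 1≢0 (trans (sym ωω̃≡1) (trans (cong (ω *_) d) (zeroʳ ω)))

          128n₂≤L₂ : 128 ℕ.* n₂ ℕ.≤ L₂
          128n₂≤L₂ = ℕₚ.*-cancelˡ-≤ (4 ℕ.* L₂) {{ℕ.>-nonZero (ℕₚ.*-mono-≤ {1} {4} (s≤s z≤n) (Order.L>0 O₂))}} (begin
            4 ℕ.* L₂ ℕ.* (128 ℕ.* n₂)        ≡⟨ NS.solve 2 (λ l n → NS.con 4 NS.:* l NS.:* (NS.con 128 NS.:* n) NS.:= NS.con 256 NS.:* (NS.con 2 NS.:* (l NS.:* n))) refl L₂ n₂ ⟩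
            256 ℕ.* (2 ℕ.* (L₂ ℕ.* n₂))      ≤⟨ ℕₚ.*-monoʳ-≤ 256 (P₂.2Ln≤p+1 O₂ δ δ≢0) ⟩
            256 ℕ.* suc p                    ≤⟨ large ⟩
            L ℕ.* L                          ≤⟨ ℕₚ.*-mono-≤ L≤2L₂ L≤2L₂ ⟩
            (L₂ ℕ.+ L₂) ℕ.* (L₂ ℕ.+ L₂)      ≡⟨ NS.solve 1 (λ l → (l NS.:+ l) NS.:* (l NS.:+ l) NS.:= NS.con 4 NS.:* l NS.:* l) refl L₂ ⟩
            4 ℕ.* L₂ ℕ.* L₂                  ∎)
            where
            open ℕₚ.≤-Reasoning
            module NS = +-*-Solver

          constant : ∀ k → disc (values k) F.^ M ≡ e
          constant k = proj₁ (F₂ _ (proj₁ (full-even k)))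

          contradiction : ⊥
          contradiction = finish (L₂ / 128) (ℕₚ.≤-trans (ℕₚ.≤-reflexive (ℕₚ.*-comm 128 (L₂ / 128))) (m/n*n≤m L₂ 128))
              (subst (ℕ._≤ L₂ / 128) (m*n/n≡m n₂ 128) (/-monoˡ-≤ 128 (ℕₚ.≤-trans (ℕₚ.≤-reflexive (ℕₚ.*-comm n₂ 128)) 128n₂≤L₂)))
            where
            finish : ∀ t → 128 ℕ.* t ℕ.≤ L₂ → n₂ ℕ.≤ t → ⊥
            finish zero    _ n≤0 = ℕₚ.<⇒≱ (P₂.n>0 O₂ δ δ≢0) n≤0
            finish (suc v) l n≤t = conclude (P₂.count-one O₂ δ δ≢0 v l half₂ values values≡ (λ k → u≢±2 (suc (i ℕ.+ (k ℕ.+ k))))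
                (ℕₚ.≤-trans (ℕₚ.*-monoʳ-≤ 2 n≤t) (ℕₚ.≤-trans (ℕₚ.*-monoˡ-≤ (suc v) {2} {9} (s≤s (s≤s z≤n))) (ℕₚ.m≤m+n _ 1)))
                e (λ k → disc (values k) F.^ M F.≟ e))
              where
              conclude : (∃ λ J → J ℕ.+ J ℕ.≤ 9 ℕ.* suc v ℕ.+ 2 ℕ.+ 2 ℕ.* n₂ × count (λ k → disc (values k) F.^ M F.≟ e) L₂ ℕ.* (8 ℕ.* suc v) ℕ.< J ℕ.* L₂) → ⊥
              -- All L₂ indices are counted, so 8t < J, while 2J ≤ 9t + 2 + 2n₂ ≤ 11t + 2 ≤ 16t.
              conclude (J , up , lt) = ℕₚ.<⇒≱ 8t<J (ℕₚ.*-cancelˡ-≤ 2 (begin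
                  2 ℕ.* J                              ≡⟨ cong (J ℕ.+_) (ℕₚ.+-identityʳ J) ⟩
                  J ℕ.+ J                              ≤⟨ up ⟩
                  9 ℕ.* suc v ℕ.+ 2 ℕ.+ 2 ℕ.* n₂       ≤⟨ ℕₚ.+-monoʳ-≤ (9 ℕ.* suc v ℕ.+ 2) (ℕₚ.*-monoʳ-≤ 2 n≤t) ⟩
                  9 ℕ.* suc v ℕ.+ 2 ℕ.+ 2 ℕ.* suc v    ≤⟨ ℕₚ.m≤m+n _ (3 ℕ.+ 5 ℕ.* v) ⟩
                  9 ℕ.* suc v ℕ.+ 2 ℕ.+ 2 ℕ.* suc v ℕ.+ (3 ℕ.+ 5 ℕ.* v)
                    ≡⟨ NS.solve 1 (λ v → NS.con 9 NS.:* (NS.con 1 NS.:+ v) NS.:+ NS.con 2 NS.:+ NS.con 2 NS.:* (NS.con 1 NS.:+ v) NS.:+ (NS.con 3 NS.:+ NS.con 5 NS.:* v)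
                         NS.:= NS.con 2 NS.:* (NS.con 8 NS.:* (NS.con 1 NS.:+ v))) refl v ⟩
                  2 ℕ.* (8 ℕ.* suc v) ∎))
                where
                open ℕₚ.≤-Reasoning
                module NS = +-*-Solver
                8t<J : 8 ℕ.* suc v ℕ.< J
                8t<J = ℕₚ.*-cancelʳ-< L₂ (8 ℕ.* suc v) J (subst (ℕ._< J ℕ.* L₂)
                  (trans (cong (ℕ._* (8 ℕ.* suc v)) (count-all _ constant L₂)) (ℕₚ.*-comm L₂ _)) lt)

        E? = λ i → a i F.≟ a′ i
        A? = λ i → a i F.≟ e
        C? = λ i → a′ i F.≟ e

        module Spread (gap : ∀ i → i ℕ.< L → Full i → Full (suc (suc i)) → ⊥) where

          private
            E A₁ C₁ : ℕ → ℕ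
            E  i = indicator (E? i)
            A₁ i = indicator (A? i)
            C₁ i = indicator (C? i)

            symbol-eq : ∀ {c} → c ≡ F.1# ⊎ c ≡ F.- F.1# → ∀ {b d} → b ≡ F.1# ⊎ b ≡ F.- F.1# → d ≡ F.1# ⊎ d ≡ F.- F.1# → ¬ (b ≡ d) → b ≡ c ⊎ d ≡ c
            symbol-eq (inj₁ refl) (inj₁ refl) _ n = inj₁ refl
            symbol-eq (inj₁ refl) (inj₂ refl) (inj₁ refl) n = inj₂ refl
            symbol-eq (inj₁ refl) (inj₂ refl) (inj₂ refl) n = ⊥-elim (n refl)
            symbol-eq (inj₂ refl) (inj₂ refl) _ n = inj₁ refl
            symbol-eq (inj₂ refl) (inj₁ refl) (inj₂ refl) n = inj₂ refl
            symbol-eq (inj₂ refl) (inj₁ refl) (inj₁ refl) n = ⊥-elim (n refl)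

            -- A disagreement makes an index full by `F₁`; then `F₂`, `F₂′` and `gap` supply the
            -- hypotheses of `window`. Of two different signs one equals that of x, which is
            -- `symbol-eq`.
            windows : ∀ i → i ℕ.< L → 5 ℕ.≤ A₁ (suc i) ℕ.+ C₁ (suc i) ℕ.+ (E (suc i) ℕ.+ (E i ℕ.+ E i ℕ.+ (E (suc (suc i)) ℕ.+ E (suc (suc i)))))
            windows i i<L = window (A? (suc i)) (C? (suc i)) (E? (suc i)) (E? i) (E? (suc (suc i)))
              (λ n → F₂ i (F₁ i n)) (λ n → F₂′ (suc i) (F₁ (suc (suc i)) n))
              (λ n m → gap i i<L (F₁ i n) (F₁ (suc (suc i)) m))
              (λ n → trans (proj₁ (F₂′ i (F₁ (suc i) n))) (sym (proj₂ (F₂′ i (F₁ (suc i) n)))))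
              (λ n → trans (proj₁ (F₂ (suc i) (F₁ (suc i) n))) (sym (proj₂ (F₂ (suc i) (F₁ (suc i) n)))))
              (symbol-eq (legendre x≢±2) (legendre (u≢±2 (suc i))) (legendre (u′≢±2 (suc i))))
              (λ p q → trans p (sym q))

            aᴸ : ∀ n → a (n ℕ.+ L) ≡ a n
            aᴸ n = cong (F._^ M) (periodic y z u≢±2 n)
            a′ᴸ : ∀ n → a′ (n ℕ.+ L) ≡ a′ n
            a′ᴸ n = cong (F._^ M) (periodic y′ z′ u′≢±2 n)

            Eᴸ : ∀ n → E (n ℕ.+ L) ≡ E n
            Eᴸ n = cong₂ (λ u w → indicator (u F.≟ w)) (aᴸ n) (a′ᴸ n)

            N-A N-C N-E : ℕ
            N-A = count A? L
            N-C = count C? L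
            N-E = count E? L

            -- By periodicity the sums over i, i + 1 and i + 2 are all the same count over one
            -- period.
            total : 5 ℕ.* L ℕ.≤ N-A ℕ.+ N-C ℕ.+ (N-E ℕ.+ (N-E ℕ.+ N-E ℕ.+ (N-E ℕ.+ N-E)))
            total = ℕₚ.≤-trans (sum-≥ _ L 5 windows) (ℕₚ.≤-reflexive (begin
              sum-to (λ i → A₁ (suc i) ℕ.+ C₁ (suc i) ℕ.+ (E (suc i) ℕ.+ (E i ℕ.+ E i ℕ.+ (E (suc (suc i)) ℕ.+ E (suc (suc i)))))) L
                ≡⟨ sum-+ (λ i → A₁ (suc i) ℕ.+ C₁ (suc i)) _ L ⟩
              sum-to (λ i → A₁ (suc i) ℕ.+ C₁ (suc i)) L ℕ.+ sum-to (λ i → E (suc i) ℕ.+ (E i ℕ.+ E i ℕ.+ (E (suc (suc i)) ℕ.+ E (suc (suc i))))) L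
                ≡⟨ cong₂ ℕ._+_ (sum-+ (λ i → A₁ (suc i)) (λ i → C₁ (suc i)) L) (trans (sum-+ (λ i → E (suc i)) _ L)
                     (cong (sum-to (λ i → E (suc i)) L ℕ.+_) (trans (sum-+ (λ i → E i ℕ.+ E i) _ L)
                       (cong₂ ℕ._+_ (sum-+ E E L) (sum-+ (λ i → E (suc (suc i))) (λ i → E (suc (suc i))) L))))) ⟩
              sum-to (λ i → A₁ (suc i)) L ℕ.+ sum-to (λ i → C₁ (suc i)) L ℕ.+ (sum-to (λ i → E (suc i)) L ℕ.+ (sum-to E L ℕ.+ sum-to E L ℕ.+ (sum-to (λ i → E (suc (suc i))) L ℕ.+ sum-to (λ i → E (suc (suc i))) L)))
                ≡⟨ cong₂ ℕ._+_ (cong₂ ℕ._+_ (trans (sum-shift A₁ L (cong (λ u → indicator (u F.≟ e)) (aᴸ 0))) (sym (count≡sum A? L)))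
                                              (trans (sum-shift C₁ L (cong (λ u → indicator (u F.≟ e)) (a′ᴸ 0))) (sym (count≡sum C? L))))
                     (cong₂ ℕ._+_ E₁ (cong₂ (λ u w → u ℕ.+ u ℕ.+ (w ℕ.+ w)) (sym (count≡sum E? L)) (trans (sum-shift (λ i → E (suc i)) L (Eᴸ 1)) E₁))) ⟩
              N-A ℕ.+ N-C ℕ.+ (N-E ℕ.+ (N-E ℕ.+ N-E ℕ.+ (N-E ℕ.+ N-E))) ∎))
              where
              open ≡.≡-Reasoning
              E₁ : sum-to (λ i → E (suc i)) L ≡ N-E
              E₁ = trans (sum-shift E L (Eᴸ 0)) (sym (count≡sum E? L))

          contradiction : ⊥
          -- With t the integer part of L/128, the bound 512 ≤ L gives t ≥ 4, and 512 n₀ ≤ L gives 4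
          -- n₀ ≤ t.
          contradiction = finish (L / 128) (ℕₚ.≤-trans (ℕₚ.≤-reflexive (ℕₚ.*-comm 128 (L / 128))) (m/n*n≤m L 128))
              (/-monoˡ-≤ 128 512≤L)
              (subst (ℕ._≤ L / 128) (m*n/n≡m (4 ℕ.* n₀) 128) (/-monoˡ-≤ 128 (ℕₚ.≤-trans (ℕₚ.≤-reflexive rearrange) 512n₀≤L)))
            where
            module NS = +-*-Solver
            rearrange : 4 ℕ.* n₀ ℕ.* 128 ≡ 512 ℕ.* n₀
            rearrange = NS.solve 1 (λ n → NS.con 4 NS.:* n NS.:* NS.con 128 NS.:= NS.con 512 NS.:* n) refl n₀
            finish : ∀ t → 128 ℕ.* t ℕ.≤ L → 4 ℕ.≤ t → 4 ℕ.* n₀ ℕ.≤ t → ⊥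
            finish (suc v) l 4≤t n≤t = conclude
                (P₁.count-one O δ δ≢0 v l (half y z mk) u (λ n → closed-form n y z) u≢±2 one e A?)
                (P₁.count-one O δ δ≢0 v l (half y′ z′ mk′) u′ (λ n → closed-form n y′ z′) u′≢±2 one e C?)
                (P₁.count-two O δ δ≢0 v l (half y z mk) (half y′ z′ mk′) α²≢β² not-opposite u u′
                  (λ n → closed-form n y z) (λ n → closed-form n y′ z′) u≢±2 u′≢±2 (λ n → squares (u≢±2 n))
                  (ℕₚ.≤-trans n≤t (ℕₚ.≤-trans (ℕₚ.m≤n*m (suc v) 10) (ℕₚ.m≤m+n _ 1))) E?)
              where
              m = 8 ℕ.* suc v
              2n≤t : 2 ℕ.* n₀ ℕ.≤ suc v
              2n≤t = ℕₚ.≤-trans (ℕₚ.*-monoˡ-≤ n₀ {2} {4} (s≤s (s≤s z≤n))) n≤t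
              one : 2 ℕ.* n₀ ℕ.≤ 9 ℕ.* suc v ℕ.+ 1
              one = ℕₚ.≤-trans 2n≤t (ℕₚ.≤-trans (ℕₚ.m≤n*m (suc v) 9) (ℕₚ.m≤m+n _ 1))
              conclude : (∃ λ J → J ℕ.+ J ℕ.≤ 9 ℕ.* suc v ℕ.+ 2 ℕ.+ 2 ℕ.* n₀ × N-A ℕ.* m ℕ.< J ℕ.* L) →
                         (∃ λ J → J ℕ.+ J ℕ.≤ 9 ℕ.* suc v ℕ.+ 2 ℕ.+ 2 ℕ.* n₀ × N-C ℕ.* m ℕ.< J ℕ.* L) →
                         (∃ λ J → J ℕ.+ J ℕ.≤ 10 ℕ.* suc v ℕ.+ 2 ℕ.+ 4 ℕ.* n₀ × N-E ℕ.* m ℕ.< J ℕ.* L) → ⊥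
              conclude (J₁ , up₁ , lt₁) (J₂ , up₂ , lt₂) (J₃ , up₃ , lt₃) =
                accounting L (suc v) n₀ N-A N-C N-E J₁ J₂ J₃ total lt₁ lt₂ lt₃ up₁ up₂ up₃ n≤t (ℕₚ.≤-trans (s≤s (s≤s (s≤s z≤n))) 4≤t)

        no-alternation : ⊥
        no-alternation = search (bounded-search (λ i → both (Full? i) (Full? (suc (suc i)))) L)
          where
          both : ∀ {A B : Set} → Dec A → Dec B → Dec (A × B)
          both (yes a) (yes b) = yes (a , b)
          both (no ¬a) _       = no (λ ab → ¬a (proj₁ ab))
          both (yes _) (no ¬b) = no (λ ab → ¬b (proj₂ ab))
          search : (∃ λ i → i ℕ.< L × Full i × Full (suc (suc i))) ⊎ (∀ i → i ℕ.< L → ¬ (Full i × Full (suc (suc i)))) → ⊥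
          search (inj₁ (i , _ , f , g)) = Close.contradiction i f g
          search (inj₂ none)            = Spread.contradiction (λ i l f g → none i l (f , g))

-- Finite sets up to an equivalence, and closure under generators

module FiniteQuotient {A : Set} (_~_ : A → A → Set) (_~?_ : ∀ a b → Dec (a ~ b))
  (~-refl : ∀ a → a ~ a) (~-sym : ∀ a b → a ~ b → b ~ a) (~-trans : ∀ a b c → a ~ b → b ~ c → a ~ c) where

  Separated : List A → Set
  Separated = AllPairs (λ a b → ¬ (a ~ b))

  Covers : List A → A → Set
  Covers ys a = Any (a ~_) ys

  private
    remove : ∀ {a} ys → Covers ys a → ∃ λ zs → length ys ≡ suc (length zs) × (∀ {b} → ¬ (a ~ b) → Covers ys b → Covers zs b)
    remove {a} (y ∷ ys) (here a~y) = ys , refl , λ { a≁b (here b~y) → ⊥-elim (a≁b (~-trans _ _ _ a~y (~-sym _ _ b~y))) ; a≁b (there c) → c }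
    remove {a} (y ∷ ys) (there c) with remove ys c
    ... | zs , len , keep = y ∷ zs , cong suc len , λ { a≁b (here b~y) → here b~y ; a≁b (there d) → there (keep a≁b d) }

  -- Pigeonhole principle: two separated elements cannot be covered by the same member of `ys`, so
  -- each may delete the member that covers it.
  separated-length : ∀ xs ys → Separated xs → All (Covers ys) xs → length xs ℕ.≤ length ys
  separated-length []       ys _        _        = z≤n
  separated-length (x ∷ xs) ys (s ∷ ss) (c ∷ cs) with remove ys c
  ... | zs , len , keep = subst (suc (length xs) ℕ.≤_) (sym len) (s≤s (separated-length xs zs ss (All.zipWith (λ (a , b) → keep a b) (s , cs))))

  transversal : (xs : List A) → ∃ λ ys → Separated ys × All (_∈ xs) ys × All (Covers ys) xs
  transversal []       = [] , [] , [] , []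
  transversal (x ∷ xs) with transversal xs
  ... | ys , sep , sub , cov with Any.any? (x ~?_) ys
  ...   | yes c = ys , sep , All.map there sub , c ∷ cov
  ...   | no ¬c = x ∷ ys , Allₚ.¬Any⇒All¬ ys ¬c ∷ sep , here refl ∷ All.map there sub , here (~-refl x) ∷ All.map there cov

  module Saturation {G : Set} (gens : List G) (every : ∀ g → g ∈ gens) (act : G → A → A)
    (act-~ : ∀ g a b → a ~ b → act g a ~ act g b)
    (Valid : A → Set) (act-valid : ∀ g a → Valid a → Valid (act g a))
    (ys : List A) (covers : ∀ a → Valid a → Covers ys a)
    (Reach : A → Set) (reach-act : ∀ g a → Reach a → Reach (act g a)) where

    Closed : List A → Set
    Closed xs = ∀ g {a} → Covers xs a → Covers xs (act g a)

    private
      escape? : ∀ xs → (∃ λ g → ∃ λ a → a ∈ xs × ¬ Covers xs (act g a)) ⊎ Closed xs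
      escape? xs with Any.any? (λ a → Any.any? (λ g → ¬? (Any.any? (act g a ~?_) xs)) gens) xs
      ... | yes e with find e
      ...   | a , a∈xs , f with find f
      ...     | g , _ , n = inj₁ (g , a , a∈xs , n)
      escape? xs | no ¬e = inj₂ closed
        where
        closed : Closed xs
        closed g {a} c with find c
        ... | b , b∈xs , a~b with Any.any? (act g b ~?_) xs
        ...   | yes d = Any.map (~-trans _ _ _ (act-~ g _ _ a~b)) d
        ...   | no ¬d = ⊥-elim (¬e (lose b∈xs (lose (every g) ¬d)))

    -- Points are added as long as a generator leads outside the list. The fuel is the room left
    -- below `suc (length ys)`, a length that a separated list cannot attain.
    saturate : ∀ n xs → length xs ℕ.+ n ≡ suc (length ys) → Separated xs → All Valid xs → All Reach xs →
               ∃ λ zs → Separated zs × All Valid zs × All Reach zs × Closed zs × (∀ {a} → Covers xs a → Covers zs a)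
    saturate zero xs len sep val rea = ⊥-elim (ℕₚ.<⇒≱ (ℕₚ.≤-reflexive (sym (trans (sym (ℕₚ.+-identityʳ _)) len)))
      (separated-length xs ys sep (All.map (covers _) val)))
    saturate (suc n) xs len sep val rea with escape? xs
    ... | inj₂ closed = xs , sep , val , rea , closed , λ c → c
    ... | inj₁ (g , a , a∈xs , new) with saturate n (act g a ∷ xs) (trans (sym (ℕₚ.+-suc (length xs) n)) len)
                                           (Allₚ.¬Any⇒All¬ xs new ∷ sep) (act-valid g _ (All.lookup val a∈xs) ∷ val) (reach-act g _ (All.lookup rea a∈xs) ∷ rea)
    ...   | zs , s , v , r , c , up = zs , s , v , r , c , λ d → up (there d)

-- Blocks

module Core (S : Setting) where

  open Setting S
  open Field F
  open FieldProps F
  open RingSolver commutativeRing hiding (ι)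
  open Conics S public
  open Eigenvalues F K emb M public
  open Orders K public
  private
    module KP = FieldProps K
    module KS = RingSolver K.commutativeRing

  Point : Set
  Point = Carrier × Carrier × Carrier

  Sol : Point → Set
  Sol (x , y , z) = Markoff x y z × ¬ (x ≡ 0# × y ≡ 0# × z ≡ 0#)

  flip₁ flip₂ flip₃ : Point → Point
  flip₁ (x , y , z) = - x , - y , z
  flip₂ (x , y , z) = - x , y , - z
  flip₃ (x , y , z) = x , - y , - z

  infix 4 _~_
  _~_ : Point → Point → Set
  P ~ Q = (Q ≡ P) ⊎ (Q ≡ flip₁ P) ⊎ (Q ≡ flip₂ P) ⊎ (Q ≡ flip₃ P)

  move : Gen → Point → Point
  move vieta (x , y , z) = x , y , x * y - z
  move sw₁₂  (x , y , z) = y , x , z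
  move sw₂₃  (x , y , z) = x , z , y

  moves : List Gen → Point → Point
  moves []      P = P
  moves (g ∷ w) P = move g (moves w P)

  moves-++ : ∀ v w P → moves (v ++ w) P ≡ moves v (moves w P)
  moves-++ []      w P = refl
  moves-++ (g ∷ v) w P = cong (move g) (moves-++ v w P)

  rot rot⁻ U : Point → Point
  rot  (x , y , z) = x , z , x * z - y
  rot⁻ (x , y , z) = x , x * y - z , y
  U    (x , y , z) = y * x - z , y , x

  -- U is the conjugate of rot by a cyclic permutation of the coordinates.
  cycle cycle⁻ : Point → Point
  cycle  (x , y , z) = z , x , y
  cycle⁻ (x , y , z) = y , z , x

  point-≡ : ∀ {x y z x′ y′ z′ : Carrier} → x ≡ x′ → y ≡ y′ → z ≡ z′ → (x , y , z) ≡ (x′ , y′ , z′)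
  point-≡ refl refl refl = refl

  rot⁻-rot : ∀ P → rot⁻ (rot P) ≡ P
  rot⁻-rot (x , y , z) = point-≡ refl (solve 3 (λ x y z → x :* z :- (x :* z :- y) := y) refl x y z) refl

  rot-rot⁻ : ∀ P → rot (rot⁻ P) ≡ P
  rot-rot⁻ (x , y , z) = point-≡ refl refl (solve 3 (λ x y z → x :* y :- (x :* y :- z) := z) refl x y z)

  -- Modelled on the matrices T = (1 1; 0 1) and U = (1 0; -1 1) up to sign: U T² U = -T⁻².
  U-rot²-U : ∀ P → U (rot (rot (U P))) ≡ rot⁻ (rot⁻ P)
  U-rot²-U (x , y , z) = point-≡
    (solve 3 (λ x y z → let a = y :* x :- z in (a :* x :- y) :* a :- (a :* (a :* x :- y) :- x) := x) refl x y z)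
    (solve 3 (λ x y z → (y :* x :- z) :* x :- y := x :* (x :* y :- z) :- y) refl x y z)
    (solve 3 (λ x y z → y :* x :- z := x :* y :- z) refl x y z)

  -- The braid relation U T U = T U T for T = `rot`, with one T moved to the left.
  braid : ∀ P → rot⁻ (U (rot (U P))) ≡ U (rot P)
  braid P = trans (cong rot⁻ (go P)) (rot⁻-rot (U (rot P)))
    where
    go : ∀ P → U (rot (U P)) ≡ rot (U (rot P))
    go (x , y , z) = point-≡
      (solve 3 (λ x y z → x :* (y :* x :- z) :- ((y :* x :- z) :* x :- y) := z :* x :- (x :* z :- y)) refl x y z)
      refl
      (solve 3 (λ x y z → y :* x :- z := (z :* x :- (x :* z :- y)) :* x :- z) refl x y z)

  move-Sol : ∀ g {P} → Sol P → Sol (move g P)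
  move-Sol vieta {x , y , z} (mk , nz) = mk′ , λ (a , b , c) → nz (a , b ,
      trans (solve 3 (λ x y z → z := x :* y :- (x :* y :- z)) refl x y z) (trans (cong₂ (λ u w → u * y - w) a c) (solve 1 (λ y → :ι 0 :* y :- :ι 0 := :ι 0) refl y)))
    where
    mk′ : Markoff x y (x * y - z)
    mk′ = trans (solve 3 (λ x y z → x :* x :+ y :* y :+ (x :* y :- z) :* (x :* y :- z)
                   := (x :* x :+ y :* y :+ z :* z) :+ x :* y :* (x :* y :- (z :+ z))) refl x y z)
            (trans (cong (_+ x * y * (x * y - (z + z))) mk) (solve 3 (λ x y z → x :* y :* z :+ x :* y :* (x :* y :- (z :+ z)) := x :* y :* (x :* y :- z)) refl x y z))
  move-Sol sw₁₂ {x , y , z} (mk , nz) = trans (solve 3 (λ x y z → y :+ x :+ z := x :+ y :+ z) refl (x * x) (y * y) (z * z))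
      (trans mk (solve 3 (λ x y z → x :* y :* z := y :* x :* z) refl x y z)) , λ (a , b , c) → nz (b , a , c)
  move-Sol sw₂₃ {x , y , z} (mk , nz) = trans (solve 3 (λ x y z → x :+ z :+ y := x :+ y :+ z) refl (x * x) (y * y) (z * z))
      (trans mk (solve 3 (λ x y z → x :* y :* z := x :* z :* y) refl x y z)) , λ (a , b , c) → nz (a , c , b)

  moves-Sol : ∀ w {P} → Sol P → Sol (moves w P)
  moves-Sol []      s = s
  moves-Sol (g ∷ w) s = move-Sol g (moves-Sol w s)

  -- With x = 0 the equation becomes y² + z² = 0.
  Sol-x≢0 : ∀ {x y z} → Sol (x , y , z) → ¬ (x ≡ 0#)
  Sol-x≢0 {x} {y} {z} (mk , nz) e = nz (e , anisotropic y z yz)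
    where
    yz : y * y + z * z ≡ 0#
    yz = trans (solve 3 (λ x y z → y :+ z := x :+ y :+ z :- x) refl (x * x) (y * y) (z * z)) (trans (cong (_- x * x) mk)
           (trans (cong (λ u → u * y * z - u * u) e) (solve 2 (λ y z → :ι 0 :* y :* z :- :ι 0 :* :ι 0 := :ι 0) refl y z)))

  -- For x = ± 2 the equation reads (y ∓ z)² + 2² = 0.
  Sol-disc : ∀ {x y z} → Sol (x , y , z) → ¬ (disc x ≡ 0#)
  Sol-disc {x} {y} {z} (mk , nz) e = 1≢-1 (trans (solve 0 (:ι 1 := :ι 1 :+ :ι 1 :- :ι 1) refl) (trans (cong (_- 1#) 2≡0) (+-identityˡ (- 1#))))
    where
    two : (1# + 1#) * (1# + 1#) ≡ x * x
    two = sym (x-y≡0⇒x≡y e)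
    -- multiplied by 4 = x², to avoid a case distinction on the sign of x
    2yx : (y + y - x * z) * (y + y - x * z) + (x + x) * (x + x) ≡ 0#
    2yx = begin
      (y + y - x * z) * (y + y - x * z) + (x + x) * (x + x)
        ≡⟨ solve 3 (λ x y z → (y :+ y :- x :* z) :* (y :+ y :- x :* z) :+ (x :+ x) :* (x :+ x)
             := (:ι 1 :+ :ι 1) :* (:ι 1 :+ :ι 1) :* (x :* x :+ y :* y :- x :* y :* z) :+ x :* x :* (z :* z)) refl x y z ⟩
      (1# + 1#) * (1# + 1#) * (x * x + y * y - x * y * z) + x * x * (z * z)
        ≡⟨ cong (λ u → u * (x * x + y * y - x * y * z) + x * x * (z * z)) two ⟩
      x * x * (x * x + y * y - x * y * z) + x * x * (z * z)
        ≡⟨ solve 4 (λ x y z u → x :* (x :+ y :- u) :+ x :* z := x :* (x :+ y :+ z :- u)) refl (x * x) (y * y) (z * z) (x * y * z) ⟩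
      x * x * (x * x + y * y + z * z - x * y * z)
        ≡⟨ cong (x * x *_) (x≡y⇒x-y≡0 mk) ⟩
      x * x * 0#
        ≡⟨ zeroʳ _ ⟩
      0# ∎
      where open ≡.≡-Reasoning
    2x≡0 : x + x ≡ 0#
    2x≡0 = proj₂ (anisotropic _ _ 2yx)
    2≡0 : 1# + 1# ≡ 0#
    2≡0 = *-cancel-0 (Sol-x≢0 {x} {y} {z} (mk , nz)) (trans (solve 1 (λ x → x :* (:ι 1 :+ :ι 1) := x :+ x) refl x) 2x≡0)

  iter : (Point → Point) → ℕ → Point → Point
  iter f zero    P = P
  iter f (suc n) P = iter f n (f P)

  -- Agreement with a word is required pointwise, so composites and iterates are handled without
  -- comparing functions.
  InGroup : (Point → Point) → Set
  InGroup g = ∃ λ w → ∀ P → moves w P ≡ g P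

  word-∘ : ∀ {f g} → InGroup f → InGroup g → InGroup (λ P → f (g P))
  word-∘ {f} {g} (v , ev) (w , ew) = v ++ w , λ P → trans (moves-++ v w P) (trans (ev _) (cong f (ew P)))

  word-iter : ∀ {f} n → InGroup f → InGroup (iter f n)
  word-iter zero    _ = [] , λ _ → refl
  word-iter (suc n) w = word-∘ (word-iter n w) w

  rot-word : InGroup rot
  rot-word = vieta ∷ sw₂₃ ∷ [] , λ _ → refl
  rot⁻-word : InGroup rot⁻
  rot⁻-word = sw₂₃ ∷ vieta ∷ [] , λ _ → refl
  cycle-word : InGroup cycle
  cycle-word = sw₁₂ ∷ sw₂₃ ∷ [] , λ _ → refl
  cycle⁻-word : InGroup cycle⁻
  cycle⁻-word = sw₂₃ ∷ sw₁₂ ∷ [] , λ _ → refl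
  U-word : InGroup U
  U-word = word-∘ cycle-word (word-∘ rot-word cycle⁻-word)

  word-Sol : ∀ {g} → InGroup g → ∀ {P} → Sol P → Sol (g P)
  word-Sol (w , e) {P} s = subst Sol (e P) (moves-Sol w s)

  Stab : (Point → Set) → (Point → Point) → Set
  Stab C g = ∀ P → Sol P → (C P → C (g P)) × (C (g P) → C P)

  -- Membership in C is not assumed decidable. The alternative `decide` for words is the source of
  -- all case distinctions about a block.
  record Block (C : Point → Set) : Set where
    field
      respects : ∀ {P Q} → Sol P → P ~ Q → C P → C Q
      decide   : ∀ w → Stab C (moves w) ⊎ (∀ P → Sol P → C P → C (moves w P) → ⊥)
  open Block

  stab-≗ : ∀ {C f g} → (∀ P → f P ≡ g P) → Stab C f → Stab C g
  stab-≗ {C} e s P q = (λ c → subst C (e P) (proj₁ (s P q) c)) , (λ c → proj₂ (s P q) (subst C (sym (e P)) c))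

  stab-or-moved : ∀ {C g} → Block C → InGroup g → Stab C g ⊎ (∀ P → Sol P → C P → C (g P) → ⊥)
  stab-or-moved {C} B (w , e) with decide B w
  ... | inj₁ s = inj₁ (stab-≗ e s)
  ... | inj₂ d = inj₂ λ P s c c′ → d P s c (subst C (sym (e P)) c′)

  stab-of : ∀ {C g} → Block C → InGroup g → ∀ {P} → Sol P → C P → C (g P) → Stab C g
  stab-of B w {P} s c c′ with stab-or-moved B w
  ... | inj₁ st = st
  ... | inj₂ d  = ⊥-elim (d P s c c′)

  -- A known point of C makes the two sides of the alternative exclude each other, which turns it
  -- into a decision.
  stab? : ∀ {C g} → Block C → InGroup g → ∀ {P} → Sol P → C P → Dec (Stab C g)
  stab? B w {P} s c with stab-or-moved B w
  ... | inj₁ st = yes st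
  ... | inj₂ d  = no λ st → d P s c (proj₁ (st P s) c)

  -- The translate of C by g⁻¹: a word v acts on it as g v g⁻¹ acts on C.
  conjugate : ∀ {C} g g⁻ → InGroup g → InGroup g⁻ → (∀ P → g⁻ (g P) ≡ P) → (∀ {P Q} → P ~ Q → g P ~ g Q) →
              Block C → Block (λ P → C (g P))
  conjugate {C} g g⁻ w w⁻ inv resp B = record
    { respects = λ s r c → respects B (word-Sol w s) (resp r) c
    ; decide = λ v → conj-decide v (stab-or-moved B (word-∘ w (word-∘ (v , λ _ → refl) w⁻))) }
    where
    conj-decide : ∀ v → Stab C (λ P → g (moves v (g⁻ P))) ⊎ (∀ P → Sol P → C P → C (g (moves v (g⁻ P))) → ⊥) →
                  Stab (λ P → C (g P)) (moves v) ⊎ (∀ P → Sol P → C (g P) → C (g (moves v P)) → ⊥)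
    conj-decide v (inj₁ st) = inj₁ λ P s →
      (λ c → subst (λ Q → C (g (moves v Q))) (inv P) (proj₁ (st (g P) (word-Sol w s)) c)) ,
      (λ c → proj₂ (st (g P) (word-Sol w s)) (subst (λ Q → C (g (moves v Q))) (sym (inv P)) c))
    conj-decide v (inj₂ d) = inj₂ λ P s c c′ → d (g P) (word-Sol w s) c (subst (λ Q → C (g (moves v Q))) (sym (inv P)) c′)

  rot⁻-~ : ∀ {P Q} → P ~ Q → rot⁻ P ~ rot⁻ Q
  rot⁻-~ {x , y , z} (inj₁ refl) = inj₁ refl
  rot⁻-~ {x , y , z} (inj₂ (inj₁ refl)) = inj₂ (inj₂ (inj₁ (point-≡ refl (solve 3 (λ x y z → :- x :* :- y :- z := x :* y :- z) refl x y z) refl)))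
  rot⁻-~ {x , y , z} (inj₂ (inj₂ (inj₁ refl))) = inj₂ (inj₁ (point-≡ refl (solve 3 (λ x y z → :- x :* y :- :- z := :- (x :* y :- z)) refl x y z) refl))
  rot⁻-~ {x , y , z} (inj₂ (inj₂ (inj₂ refl))) = inj₂ (inj₂ (inj₂ (point-≡ refl (solve 3 (λ x y z → x :* :- y :- :- z := :- (x :* y :- z)) refl x y z) refl)))

  cycle-~ : ∀ {P Q} → P ~ Q → cycle P ~ cycle Q
  cycle-~ (inj₁ refl) = inj₁ refl
  cycle-~ (inj₂ (inj₁ refl)) = inj₂ (inj₂ (inj₂ refl))
  cycle-~ (inj₂ (inj₂ (inj₁ refl))) = inj₂ (inj₁ refl)
  cycle-~ (inj₂ (inj₂ (inj₂ refl))) = inj₂ (inj₂ (inj₁ refl))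

  tr : (Point → Set) → Point → Set
  tr C P = C (rot⁻ P)

  tr-block : ∀ {C} → Block C → Block (tr C)
  tr-block = conjugate rot⁻ rot rot⁻-word rot-word rot-rot⁻ (λ {P} {Q} → rot⁻-~ {P} {Q})

  trⁿ : ℕ → (Point → Set) → Point → Set
  trⁿ zero    C = C
  trⁿ (suc n) C = tr (trⁿ n C)

  trⁿ-block : ∀ {C} n → Block C → Block (trⁿ n C)
  trⁿ-block zero    B = B
  trⁿ-block (suc n) B = tr-block (trⁿ-block n B)

  iter-comm : ∀ f n P → iter f n (f P) ≡ f (iter f n P)
  iter-comm f zero    P = refl
  iter-comm f (suc n) P = iter-comm f n (f P)

  trⁿ-iter : ∀ {C} n P → C P → trⁿ n C (iter rot n P)
  trⁿ-iter {C} zero    P c = c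
  trⁿ-iter {C} (suc n) P c = subst (trⁿ n C) (sym (trans (cong rot⁻ (iter-comm rot n P)) (rot⁻-rot _))) (trⁿ-iter n P c)

  -- Translation is by `rot` itself, and `rot` commutes with its own powers.
  stab-tr : ∀ {C} → Stab (tr C) rot → Stab C rot
  stab-tr {C} s P q = (λ c → subst C (rot⁻-rot (rot P)) (proj₁ (s (rot P) q′) (subst C (sym (rot⁻-rot P)) c))) ,
                      (λ c → subst C (rot⁻-rot P) (proj₂ (s (rot P) q′) (subst C (sym (rot⁻-rot (rot P))) c)))
    where q′ = word-Sol rot-word q

  stab-trⁿ : ∀ {C} n → Stab (trⁿ n C) rot → Stab C rot
  stab-trⁿ zero    s = s
  stab-trⁿ (suc n) s = stab-trⁿ n (stab-tr s)

  iter-seq : ∀ n x y z → iter rot n (x , y , z) ≡ (x , seq x y z n , seq x y z (suc n))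
  iter-seq zero    x y z = refl
  iter-seq (suc n) x y z = iter-seq n x z (x * z - y)

  seq-rec : ∀ n x y z → seq x y z (suc n) * x - seq x y z (suc (suc n)) ≡ seq x y z n
  seq-rec zero    x y z = solve 3 (λ x y z → z :* x :- (x :* z :- y) := y) refl x y z
  seq-rec (suc n) x y z = seq-rec n x z (x * z - y)

  -- ω^D is a sign, since its square is 1.
  seq-period : ∀ {x y z} (s : Sol (x , y , z)) (T : Torus x) D → (Torus.ω T K.* Torus.ω T) K.^ D ≡ K.1# →
               iter rot D (x , y , z) ~ (x , y , z)
  seq-period {x} {y} {z} s T D e = subst (_~ (x , y , z)) (sym (iter-seq D x y z)) (conclude (KP.square-eq (trans (sym (K.^-distrib-* ω ω D)) (trans e (sym (K.*-identityˡ K.1#))))))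
    where
    open Eigen x T (Sol-x≢0 s) (Sol-disc s) renaming (s to σ⁻¹)
    ω̃ᴰ : ∀ {ε} → ε K.* ε ≡ K.1# → ω K.^ D ≡ ε → ω̃ K.^ D ≡ ε
    ω̃ᴰ {ε} ε² d = begin
      ω̃ K.^ D                        ≡⟨ sym (K.*-identityˡ _) ⟩
      K.1# K.* ω̃ K.^ D               ≡⟨ cong (K._* ω̃ K.^ D) (sym ε²) ⟩
      ε K.* ε K.* ω̃ K.^ D            ≡⟨ trans (K.*-assoc ε ε _) (cong (λ u → ε K.* (u K.* ω̃ K.^ D)) (sym d)) ⟩
      ε K.* (ω K.^ D K.* ω̃ K.^ D)    ≡⟨ cong (ε K.*_) (trans (sym (K.^-distrib-* ω ω̃ D)) (trans (cong (K._^ D) ωω̃≡1) (KP.1^n D))) ⟩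
      ε K.* K.1#                     ≡⟨ K.*-identityʳ ε ⟩
      ε ∎
      where open ≡.≡-Reasoning
    at : ∀ ε → ω K.^ D ≡ ε → ω̃ K.^ D ≡ ε → ∀ n → emb (seq x y z (n ℕ.+ D)) ≡ ε K.* emb (seq x y z n)
    at ε d d̃ n = begin
      emb (seq x y z (n ℕ.+ D))
        ≡⟨ closed-form (n ℕ.+ D) y z ⟩
      A y z K.* ω K.^ (n ℕ.+ D) K.+ A′ y z K.* ω̃ K.^ (n ℕ.+ D)
        ≡⟨ cong₂ (λ u w → A y z K.* u K.+ A′ y z K.* w) (trans (K.^-homo-* ω n D) (cong (ω K.^ n K.*_) d)) (trans (K.^-homo-* ω̃ n D) (cong (ω̃ K.^ n K.*_) d̃)) ⟩
      A y z K.* (ω K.^ n K.* ε) K.+ A′ y z K.* (ω̃ K.^ n K.* ε)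
        ≡⟨ KS.solve 5 (λ a b w v e → a KS.:* (w KS.:* e) KS.:+ b KS.:* (v KS.:* e) KS.:= e KS.:* (a KS.:* w KS.:+ b KS.:* v)) refl (A y z) (A′ y z) (ω K.^ n) (ω̃ K.^ n) ε ⟩
      ε K.* (A y z K.* ω K.^ n K.+ A′ y z K.* ω̃ K.^ n)
        ≡⟨ cong (ε K.*_) (sym (closed-form n y z)) ⟩
      ε K.* emb (seq x y z n) ∎
      where open ≡.≡-Reasoning
    conclude : ω K.^ D ≡ K.1# ⊎ ω K.^ D ≡ K.- K.1# → (x , seq x y z D , seq x y z (suc D)) ~ (x , y , z)
    conclude (inj₁ d) = inj₁ (point-≡ refl (sym (same 0)) (sym (same 1)))
      where
      same : ∀ n → seq x y z (n ℕ.+ D) ≡ seq x y z n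
      same n = emb-injective (trans (at K.1# d (ω̃ᴰ (K.*-identityˡ K.1#) d) n) (K.*-identityˡ _))
    conclude (inj₂ d) = inj₂ (inj₂ (inj₂ (point-≡ refl (negated 0) (negated 1))))
      where
      negated : ∀ n → seq x y z n ≡ - seq x y z (n ℕ.+ D)
      negated n = emb-injective (trans (KS.solve 1 (λ u → u KS.:= KS.:- ((KS.:- KS.:ι 1) KS.:* u)) refl (emb (seq x y z n)))
        (trans (cong K.-_ (sym (at (K.- K.1#) d (ω̃ᴰ (KS.solve 0 ((KS.:- KS.:ι 1) KS.:* (KS.:- KS.:ι 1) KS.:= KS.:ι 1) refl) d) n))) (sym (emb-neg _))))

  sym-~ : ∀ {P Q} → P ~ Q → Q ~ P
  sym-~ (inj₁ refl) = inj₁ refl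
  sym-~ {x , y , z} (inj₂ (inj₁ refl)) = inj₂ (inj₁ (point-≡ (neg-neg x) (neg-neg y) refl))
    where neg-neg = solve 1 (λ x → x := :- :- x) refl
  sym-~ {x , y , z} (inj₂ (inj₂ (inj₁ refl))) = inj₂ (inj₂ (inj₁ (point-≡ (neg-neg x) refl (neg-neg z))))
    where neg-neg = solve 1 (λ x → x := :- :- x) refl
  sym-~ {x , y , z} (inj₂ (inj₂ (inj₂ refl))) = inj₂ (inj₂ (inj₂ (point-≡ refl (neg-neg y) (neg-neg z))))
    where neg-neg = solve 1 (λ x → x := :- :- x) refl

  -- By `seq-period`, the D-th power of `rot` fixes a point of the block up to signs; one such point
  -- is enough.
  stab-period : ∀ {C} → Block C → ∀ {x y z} (s : Sol (x , y , z)) → C (x , y , z) → (T : Torus x) → ∀ D →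
                (Torus.ω T K.* Torus.ω T) K.^ D ≡ K.1# → Stab C (iter rot D)
  stab-period {C} B {x} {y} {z} s c T D e = stab-of B (word-iter D rot-word) s c
    (respects B s (sym-~ {iter rot D (x , y , z)} (seq-period s T D e)) c)

  -- The periods of the two types divide the coprime numbers M and M + 1.
  mixed : ∀ {C} → Block C → ∀ {x y z x′ y′ z′} → Sol (x , y , z) → Sol (x′ , y′ , z′) → C (x , y , z) → C (x′ , y′ , z′) →
          ¬ (disc x ^ M ≡ disc x′ ^ M) → Stab C rot
  mixed {C} B {x} {y} {z} {x′} {y′} {z′} s s′ c c′ n = cases (Torus.type T) (Torus.type T′)
    where
    T = torus x (Sol-disc s)
    T′ = torus x′ (Sol-disc s′)
    combine : Stab C (iter rot M) → Stab C (iter rot (suc M)) → Stab C rot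
    combine st st′ P q = (λ c → proj₂ (st (rot P) q′) (proj₁ (st′ P q) c)) , (λ c → proj₂ (st′ P q) (proj₁ (st (rot P) q′) c))
      where q′ = word-Sol rot-word q
    period : ∀ {x y z} (s : Sol (x , y , z)) → C (x , y , z) → (T : Torus x) → ∀ k → Torus.κ T ≡ k → Stab C (iter rot (k ℕ.+ M))
    period s c T k refl = subst (λ D → Stab C (iter rot D)) (ℕₚ.+-comm M (Torus.κ T)) (stab-period B s c T (M ℕ.+ Torus.κ T) (Torus.order T))
    cases : (Torus.κ T ≡ 0 × disc x ^ M ≡ 1#) ⊎ (Torus.κ T ≡ 1 × disc x ^ M ≡ - 1#) →
            (Torus.κ T′ ≡ 0 × disc x′ ^ M ≡ 1#) ⊎ (Torus.κ T′ ≡ 1 × disc x′ ^ M ≡ - 1#) → Stab C rot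
    cases (inj₁ (_ , e)) (inj₁ (_ , e′)) = ⊥-elim (n (trans e (sym e′)))
    cases (inj₂ (_ , e)) (inj₂ (_ , e′)) = ⊥-elim (n (trans e (sym e′)))
    cases (inj₁ (k , _)) (inj₂ (k′ , _)) = combine (period s c T 0 k) (period s′ c′ T′ 1 k′)
    cases (inj₂ (k , _)) (inj₁ (k′ , _)) = combine (period s′ c′ T′ 0 k′) (period s c T 1 k)

  mixed-U : ∀ {C} → Block C → ∀ {x y z x′ y′ z′} → Sol (x , y , z) → Sol (x′ , y′ , z′) → C (x , y , z) → C (x′ , y′ , z′) →
            ¬ (disc y ^ M ≡ disc y′ ^ M) → Stab C U
  mixed-U {C} B s s′ c c′ n P q = mixed (conjugate cycle cycle⁻ cycle-word cycle⁻-word (λ _ → refl) (λ {P} {Q} → cycle-~ {P} {Q}) B)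
    (word-Sol cycle⁻-word s) (word-Sol cycle⁻-word s′) c c′ n (cycle⁻ P) (word-Sol cycle⁻-word q)

  second-disc : ∀ {x y z} → Sol (x , y , z) → ¬ (disc y ≡ 0#)
  second-disc s = Sol-disc (word-Sol cycle⁻-word s)

  -- Along with (x, y, z) the block contains its images under U and U⁻¹, whose first coordinates are
  -- y x - z and z. Were one of them of another type than x, `mixed` would make `rot` stabilise the
  -- block.
  neighbours : ∀ {C} → Block C → ¬ Stab C rot → ∀ {x y z} → Sol (x , y , z) → C (x , y , z) → Stab C U →
               disc z ^ M ≡ disc x ^ M × disc (y * x - z) ^ M ≡ disc x ^ M
  neighbours {C} B nT {x} {y} {z} s c st = equal z-side , equal y-side
    where
    equal : ∀ {a} → (¬ (disc a ^ M ≡ disc x ^ M) → Stab C rot) → disc a ^ M ≡ disc x ^ M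
    equal {a} h with (disc a ^ M) ≟ (disc x ^ M)
    ... | yes e = e
    ... | no n  = ⊥-elim (nT (h n))
    y-side : ¬ (disc (y * x - z) ^ M ≡ disc x ^ M) → Stab C rot
    y-side n = mixed B (word-Sol U-word s) s (proj₁ (st _ s) c) c n
    before : Point
    before = z , y , y * z - x
    U-before : U before ≡ (x , y , z)
    U-before = point-≡ (solve 3 (λ x y z → y :* z :- (y :* z :- x) := x) refl x y z) refl refl
    before-word : InGroup (λ (x , y , z) → z , y , y * z - x)
    before-word = word-∘ cycle-word (word-∘ rot⁻-word cycle⁻-word)
    before-Sol : Sol before
    before-Sol = word-Sol before-word s
    z-side : ¬ (disc z ^ M ≡ disc x ^ M) → Stab C rot
    z-side n = mixed B before-Sol s (proj₂ (st before before-Sol) (subst C (sym U-before) c)) c n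

  -- By `braid`, `rot` equals U⁻¹ (rot⁻¹ U rot) U, and the second hypothesis says that rot⁻¹ U rot
  -- stabilises C.
  adjacent : ∀ {C} → Stab C U → Stab (tr C) U → Stab C rot
  adjacent {C} st st′ P q =
    (λ c → proj₂ (st (rot P) (word-Sol rot-word q)) (subst C (braid P) (proj₁ (st′ (rot (U P)) q′) (subst C (sym (rot⁻-rot (U P))) (proj₁ (st P q) c))))) ,
    (λ c → proj₂ (st P q) (subst C (rot⁻-rot (U P)) (proj₂ (st′ (rot (U P)) q′) (subst C (sym (braid P)) (proj₁ (st (rot P) (word-Sol rot-word q)) c)))))
    where q′ = word-Sol (word-∘ rot-word U-word) q

  -- h₂ h₀ = rot⁻⁴, where hᵢ = rot⁻ⁱ U rotⁱ
  two-apart : ∀ {C} → Stab C U → Stab (tr (tr C)) U → Stab C (λ P → rot⁻ (rot⁻ (rot⁻ (rot⁻ P))))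
  two-apart {C} st st′ P q =
    (λ c → subst (λ Q → C (rot⁻ (rot⁻ Q))) (U-rot²-U P) (proj₁ (st′ (rot (rot (U P))) q′) (subst C (sym back) (proj₁ (st P q) c)))) ,
    (λ c → proj₂ (st P q) (subst C back (proj₂ (st′ (rot (rot (U P))) q′) (subst (λ Q → C (rot⁻ (rot⁻ Q))) (sym (U-rot²-U P)) c))))
    where
    q′ = word-Sol (word-∘ rot-word (word-∘ rot-word U-word)) q
    back : rot⁻ (rot⁻ (rot (rot (U P)))) ≡ U P
    back = trans (cong rot⁻ (rot⁻-rot (rot (U P)))) (rot⁻-rot (U P))

  -- By `two-apart` the fourth translate has the same solutions as C, so the first hypothesis can be
  -- carried over to it.
  four-on : ∀ {C} → Stab C U → Stab (tr (tr C)) U → Stab (tr (tr (tr (tr C)))) U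
  four-on {C} st st′ P q =
    (λ c → proj₁ (s⁴ (U P) (word-Sol U-word q)) (proj₁ (st P q) (proj₂ (s⁴ P q) c))) ,
    (λ c → proj₁ (s⁴ P q) (proj₂ (st P q) (proj₂ (s⁴ (U P) (word-Sol U-word q)) c)))
    where s⁴ = two-apart st st′

  -- The i-th iterates of both points lie in the i-th translate of the block. A known point there is
  -- what makes `Full` decidable, and it brings `mixed-U` and `neighbours` to bear at every index.
  key : ∀ {C} → Block C → ¬ Stab C rot → ∀ {x y z y′ z′} → Sol (x , y , z) → Sol (x , y′ , z′) →
        C (x , y , z) → C (x , y′ , z′) → ¬ ((x , y , z) ~ (x , y′ , z′)) →
        (T : Torus x) (O : Order (Torus.ω T K.* Torus.ω T)) → 256 ℕ.* suc p ℕ.≤ Order.L O ℕ.* Order.L O → ⊥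
  key {C} B nT {x} {y} {z} {y′} {z′} s s′ c c′ n T O large =
    Alternation.no-alternation y z y′ z′ (proj₁ s) (proj₁ s′) u≢ u′≢ different O large
      Full (λ i → stab? (trⁿ-block i B) U-word (sᵢ i) (cᵢ i)) F₁ F₂ F₂′ F₃ (λ i → four-on)
    where
    open Eigen x T (Sol-x≢0 s) (Sol-disc s) renaming (s to σ⁻¹)
    module Along {y z} (s : Sol (x , y , z)) (c : C (x , y , z)) where
      P : ℕ → Point
      P i = x , seq x y z i , seq x y z (suc i)
      solᵢ : ∀ i → Sol (P i)
      solᵢ i = subst Sol (iter-seq i x y z) (word-Sol (word-iter i rot-word) s)
      inᵢ : ∀ i → trⁿ i C (P i)
      inᵢ i = subst (trⁿ i C) (iter-seq i x y z) (trⁿ-iter i _ c)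
      nonzero : ∀ i → ¬ (disc (seq x y z i) ≡ 0#)
      nonzero i = second-disc (solᵢ i)
    open Along s c renaming (solᵢ to sᵢ; inᵢ to cᵢ; nonzero to u≢)
    open Along s′ c′ using () renaming (solᵢ to sᵢ′; inᵢ to cᵢ′; nonzero to u′≢)
    different : ¬ ((y ≡ y′ × z ≡ z′) ⊎ (y ≡ - y′ × z ≡ - z′))
    different (inj₁ (refl , refl)) = n (inj₁ refl)
    different (inj₂ (e , d)) = n (inj₂ (inj₂ (inj₂ (point-≡ refl (flip e) (flip d)))))
      where
      flip : ∀ {a b} → a ≡ - b → b ≡ - a
      flip {a} {b} refl = solve 1 (λ b → b := :- :- b) refl b
    Full : ℕ → Set
    Full i = Stab (trⁿ i C) U
    nTᵢ : ∀ i → ¬ Stab (trⁿ i C) rot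
    nTᵢ i st = nT (stab-trⁿ i st)
    F₁ : ∀ i → ¬ (disc (seq x y z i) ^ M ≡ disc (seq x y′ z′ i) ^ M) → Full i
    F₁ i n = mixed-U (trⁿ-block i B) (sᵢ i) (sᵢ′ i) (cᵢ i) (cᵢ′ i) n
    F₂ : ∀ i → Full i → disc (seq x y z (suc i)) ^ M ≡ disc x ^ M × disc (seq x y′ z′ (suc i)) ^ M ≡ disc x ^ M
    F₂ i f = proj₁ (neighbours (trⁿ-block i B) (nTᵢ i) (sᵢ i) (cᵢ i) f) , proj₁ (neighbours (trⁿ-block i B) (nTᵢ i) (sᵢ′ i) (cᵢ′ i) f)
    F₂′ : ∀ i → Full (suc i) → disc (seq x y z i) ^ M ≡ disc x ^ M × disc (seq x y′ z′ i) ^ M ≡ disc x ^ M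
    -- The backward neighbour of the (i + 1)-st point has first coordinate x u_(i+1) - u_(i+2) =
    -- u_i.
    F₂′ i f = subst (λ v → disc v ^ M ≡ disc x ^ M) (seq-rec i x y z) (proj₂ (neighbours (trⁿ-block (suc i) B) (nTᵢ (suc i)) (sᵢ (suc i)) (cᵢ (suc i)) f)) ,
              subst (λ v → disc v ^ M ≡ disc x ^ M) (seq-rec i x y′ z′) (proj₂ (neighbours (trⁿ-block (suc i) B) (nTᵢ (suc i)) (sᵢ′ (suc i)) (cᵢ′ (suc i)) f))
    F₃ : ∀ i → Full i → Full (suc i) → ⊥
    F₃ i f g = nTᵢ i (adjacent f g)

  -- The coefficient `A` is multiplied by ω^j along the rotation, so returning up to signs means ω^j
  -- = ±1. The sign changes that affect x are impossible because x ≠ -x.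
  period-minimal : ∀ {x y z} (s : Sol (x , y , z)) (T : Torus x) j → (x , y , z) ~ iter rot j (x , y , z) →
                   (Torus.ω T K.* Torus.ω T) K.^ j ≡ K.1#
  period-minimal {x} {y} {z} s T j r = conclude (subst ((x , y , z) ~_) (iter-seq j x y z) r)
    where
    open Eigen x T (Sol-x≢0 s) (Sol-disc s) renaming (s to σ⁻¹)
    A-seq : ∀ j y z → A (seq x y z j) (seq x y z (suc j)) ≡ A y z K.* ω K.^ j
    A-seq zero    y z = sym (K.*-identityʳ _)
    A-seq (suc j) y z = trans (A-seq j z (x * z - y)) (trans (cong (K._* ω K.^ j) (A-next y z)) (K.*-assoc _ _ _))
    A-neg : ∀ y z → A (- y) (- z) ≡ K.- A y z
    A-neg y z = trans (cong₂ (λ u w → (w K.- u K.* ω̃) K.* σ⁻¹) (emb-neg y) (emb-neg z))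
      (KS.solve 4 (λ a y z s → (KS.:- z KS.:- (KS.:- y) KS.:* a) KS.:* s KS.:= KS.:- ((z KS.:- y KS.:* a) KS.:* s)) refl ω̃ (emb y) (emb z) σ⁻¹)
    sq : ∀ ε → ε K.* ε ≡ K.1# → A y z K.* ω K.^ j ≡ A y z K.* ε → (ω K.* ω) K.^ j ≡ K.1#
    sq ε ε² e = trans (K.^-distrib-* ω ω j) (trans (cong (λ u → u K.* u) (KP.*-cancelˡ (proj₁ (half y z (proj₁ s))) e)) ε²)
    plus : seq x y z j ≡ y → seq x y z (suc j) ≡ z → (ω K.* ω) K.^ j ≡ K.1#
    plus e e′ = sq K.1# (K.*-identityˡ K.1#) (trans (sym (A-seq j y z)) (trans (cong₂ A e e′) (sym (K.*-identityʳ _))))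
    minus : seq x y z j ≡ - y → seq x y z (suc j) ≡ - z → (ω K.* ω) K.^ j ≡ K.1#
    minus e e′ = sq (K.- K.1#) (KS.solve 0 ((KS.:- KS.:ι 1) KS.:* (KS.:- KS.:ι 1) KS.:= KS.:ι 1) refl)
      (trans (sym (A-seq j y z)) (trans (cong₂ A e e′) (trans (A-neg y z) (KS.solve 1 (λ a → KS.:- a KS.:= a KS.:* (KS.:- KS.:ι 1)) refl (A y z)))))
    x≢-x : ¬ (x ≡ - x)
    x≢-x e = *-nonzero (Sol-x≢0 s) 2≢0 (trans (solve 1 (λ x → x :* (:ι 1 :+ :ι 1) := x :- (:- x)) refl x) (x≡y⇒x-y≡0 e))
      where
      2≢0 : ¬ (1# + 1# ≡ 0#)
      2≢0 d = 1≢-1 (trans (solve 0 (:ι 1 := :ι 1 :+ :ι 1 :- :ι 1) refl) (trans (cong (_- 1#) d) (+-identityˡ (- 1#))))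
    conclude : (x , y , z) ~ (x , seq x y z j , seq x y z (suc j)) → (ω K.* ω) K.^ j ≡ K.1#
    conclude (inj₁ e) = plus (cong (λ q → proj₁ (proj₂ q)) e) (cong (λ q → proj₂ (proj₂ q)) e)
    conclude (inj₂ (inj₁ e)) = ⊥-elim (x≢-x (cong proj₁ e))
    conclude (inj₂ (inj₂ (inj₁ e))) = ⊥-elim (x≢-x (cong proj₁ e))
    conclude (inj₂ (inj₂ (inj₂ e))) = minus (cong (λ q → proj₁ (proj₂ q)) e) (cong (λ q → proj₂ (proj₂ q)) e)

  order-of-torus : ∀ {x y z} → Sol (x , y , z) → (T : Torus x) → Order (Torus.ω T K.* Torus.ω T)
  order-of-torus s T = order-of _ (M ℕ.+ Torus.κ T) (ℕₚ.≤-trans (M>0 M p≡1+2M) (ℕₚ.m≤m+n M (Torus.κ T))) (Torus.order T)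
    where
    M>0 : ∀ M → p ≡ suc (M ℕ.+ M) → 0 ℕ.< M
    M>0 zero    e = ⊥-elim (ℕₚ.<⇒≱ 2<p (subst (ℕ._≤ 2) (sym e) (s≤s z≤n)))
    M>0 (suc M) e = s≤s z≤n

  3# : Carrier
  3# = 1# + 1# + 1#

  centre : Point
  centre = 3# , 3# , 3#

  sw₁₂-word : InGroup (move sw₁₂)
  sw₁₂-word = sw₁₂ ∷ [] , λ _ → refl
  sw₂₃-word : InGroup (move sw₂₃)
  sw₂₃-word = sw₂₃ ∷ [] , λ _ → refl

  -- Here a b = ±c², so the equation reads 3c² = ±c³ with c ≠ 0, and ±c = 3.
  all-equal : ∀ {a b c} → Sol (a , b , c) → a * a ≡ c * c → b * b ≡ c * c → (a , b , c) ~ centre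
  all-equal {a} {b} {c} s ea eb = cases (square-eq ea) (square-eq eb)
    where
    c≢0 : ¬ (c ≡ 0#)
    c≢0 = Sol-x≢0 (word-Sol cycle-word s)
    cube : ∀ {d} → a * b ≡ d * (c * c) → d * c ≡ 3#
    cube {d} e = *-cancelˡ (*-nonzero c≢0 c≢0) (begin
      c * c * (d * c)              ≡⟨ solve 2 (λ c d → c :* c :* (d :* c) := d :* (c :* c) :* c) refl c d ⟩
      d * (c * c) * c              ≡⟨ cong (_* c) (sym e) ⟩
      a * b * c                    ≡⟨ sym (proj₁ s) ⟩
      a * a + b * b + c * c        ≡⟨ cong₂ (λ u w → u + w + c * c) ea eb ⟩
      c * c + c * c + c * c        ≡⟨ solve 1 (λ c → c :+ c :+ c := c :* (:ι 1 :+ :ι 1 :+ :ι 1)) refl (c * c) ⟩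
      c * c * 3#                   ∎)
      where open ≡.≡-Reasoning
    cases : a ≡ c ⊎ a ≡ - c → b ≡ c ⊎ b ≡ - c → (a , b , c) ~ centre
    cases (inj₁ refl) (inj₁ refl) = inj₁ (point-≡ (sym c3) (sym c3) (sym c3))
      where
      c3 : c ≡ 3#
      c3 = trans (sym (*-identityˡ c)) (cube (sym (*-identityˡ _)))
    cases (inj₂ refl) (inj₂ refl) = inj₂ (inj₁ (point-≡ (trans (sym c3) (neg-neg c)) (trans (sym c3) (neg-neg c)) (sym c3)))
      where
      neg-neg = solve 1 (λ x → x := :- :- x) refl
      c3 : c ≡ 3#
      c3 = trans (sym (*-identityˡ c)) (cube (solve 1 (λ c → :- c :* :- c := :ι 1 :* (c :* c)) refl c))
    cases (inj₁ refl) (inj₂ refl) = inj₂ (inj₂ (inj₁ (point-≡ (sym c3) (sym c3) (sym c3))))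
      where
      c3 : - c ≡ 3#
      c3 = trans (solve 1 (λ c → :- c := (:- :ι 1) :* c) refl c) (cube (solve 1 (λ c → c :* :- c := (:- :ι 1) :* (c :* c)) refl c))
    cases (inj₂ refl) (inj₁ refl) = inj₂ (inj₂ (inj₂ (point-≡ (sym c3) (sym c3) (sym c3))))
      where
      c3 : - c ≡ 3#
      c3 = trans (solve 1 (λ c → :- c := (:- :ι 1) :* c) refl c) (cube (solve 1 (λ c → :- c :* c := (:- :ι 1) :* (c :* c)) refl c))

  -- If some `rot`^j with 0 < j < L stabilises the block, the block has a second point on the conic
  -- of the centre. If not, every point of the block has rotation period at least L, and a member
  -- (x, y, z) with y² ≠ z² is paired with (x, z, y); by `all-equal` some permutation of the other
  -- element provides such a member.
  block-invariant : ∀ {C} → Block C → Sol centre → C centre → ∀ {w} → Sol w → C w → ¬ (w ~ centre) →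
    (T : Torus 3#) (O : Order (Torus.ω T K.* Torus.ω T)) → 256 ℕ.* suc p ℕ.≤ Order.L O ℕ.* Order.L O →
    ¬ Stab C rot → ⊥
  block-invariant {C} B sv cv {a , b , c} sw cw w≁v T O large nT =
    search (bounded-search (λ j → both (j ℕₚ.≟ 0) (stab? B (word-iter j rot-word) sv cv)) (Order.L O))
    where
    both : ∀ {j} {S : Set} → Dec (j ≡ 0) → Dec S → Dec (¬ (j ≡ 0) × S)
    both (yes e) _       = no λ (n , _) → n e
    both (no n)  (yes s) = yes (n , s)
    both (no _)  (no ¬s) = no λ (_ , s) → ¬s s
    st₁₂ : Stab C (move sw₁₂)
    st₁₂ = stab-of B sw₁₂-word sv cv cv
    st₂₃ : Stab C (move sw₂₃)
    st₂₃ = stab-of B sw₂₃-word sv cv cv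
    search : (∃ λ j → j ℕ.< Order.L O × ¬ (j ≡ 0) × Stab C (iter rot j)) ⊎ (∀ j → j ℕ.< Order.L O → ¬ (¬ (j ≡ 0) × Stab C (iter rot j))) → ⊥
    search (inj₁ (zero , _ , n , _)) = n refl
    search (inj₁ (suc j , j<L , _ , st)) = key B nT sv
      (subst Sol (iter-seq (suc j) 3# 3# 3#) (word-Sol (word-iter (suc j) rot-word) sv)) cv
      (subst C (iter-seq (suc j) 3# 3# 3#) (proj₁ (st centre sv) cv))
      (λ r → ℕₚ.<⇒≱ j<L (Order.minimal O (suc j) (s≤s z≤n) (period-minimal sv T (suc j) (subst (centre ~_) (sym (iter-seq (suc j) 3# 3# 3#)) r))))
      T O large
    search (inj₂ none) = arrange (b * b ≟ c * c) (a * a ≟ c * c)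
      where
      use : ∀ {x y z} → Sol (x , y , z) → C (x , y , z) → ¬ (y * y ≡ z * z) → ⊥
      use {x} {y} {z} s d n = key B nT s (word-Sol sw₂₃-word s) d (proj₁ (st₂₃ _ s) d) distinct Tx Ox
          (ℕₚ.≤-trans large (ℕₚ.*-mono-≤ L≤ L≤))
        where
        Tx = torus x (Sol-disc s)
        Ox = order-of-torus s Tx
        -- A smaller order would give a stabilising power of `rot` of the kind just excluded.
        L≤ : Order.L O ℕ.≤ Order.L Ox
        L≤ = ℕₚ.≮⇒≥ λ l → none (Order.L Ox) l ((λ e → ℕₚ.<⇒≢ (Order.L>0 Ox) (sym e)) , stab-period B s d Tx (Order.L Ox) (Order.τᴸ Ox))
        distinct : ¬ ((x , y , z) ~ (x , z , y))
        distinct (inj₁ e) = n (cong (λ u → u * u) (sym (cong (λ q → proj₁ (proj₂ q)) e)))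
        distinct (inj₂ (inj₁ e)) = n (trans (solve 1 (λ y → y :* y := :- y :* :- y) refl y) (cong (λ u → u * u) (sym (cong (λ q → proj₁ (proj₂ q)) e))))
        distinct (inj₂ (inj₂ (inj₁ e))) = n (cong (λ u → u * u) (sym (cong (λ q → proj₁ (proj₂ q)) e)))
        distinct (inj₂ (inj₂ (inj₂ e))) = n (trans (solve 1 (λ y → y :* y := :- y :* :- y) refl y) (cong (λ u → u * u) (sym (cong (λ q → proj₁ (proj₂ q)) e))))
      arrange : Dec (b * b ≡ c * c) → Dec (a * a ≡ c * c) → ⊥
      arrange (no n)  _       = use sw cw n
      arrange (yes _) (no n)  = use (word-Sol sw₁₂-word sw) (proj₁ (st₁₂ _ sw) cw) n
      arrange (yes e) (yes d) = w≁v (all-equal sw d e)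

  private
    neg-neg : ∀ a → - - a ≡ a
    neg-neg = solve 1 (λ a → :- :- a := a) refl

  ~-trans : ∀ {P Q R} → P ~ Q → Q ~ R → P ~ R
  ~-trans (inj₁ refl) s = s
  ~-trans r (inj₁ refl) = r
  ~-trans {x , y , z} (inj₂ (inj₁ refl)) (inj₂ (inj₁ refl)) = inj₁ (point-≡ (neg-neg x) (neg-neg y) refl)
  ~-trans {x , y , z} (inj₂ (inj₁ refl)) (inj₂ (inj₂ (inj₁ refl))) = inj₂ (inj₂ (inj₂ (point-≡ (neg-neg x) refl refl)))
  ~-trans {x , y , z} (inj₂ (inj₁ refl)) (inj₂ (inj₂ (inj₂ refl))) = inj₂ (inj₂ (inj₁ (point-≡ refl (neg-neg y) refl)))
  ~-trans {x , y , z} (inj₂ (inj₂ (inj₁ refl))) (inj₂ (inj₁ refl)) = inj₂ (inj₂ (inj₂ (point-≡ (neg-neg x) refl refl)))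
  ~-trans {x , y , z} (inj₂ (inj₂ (inj₁ refl))) (inj₂ (inj₂ (inj₁ refl))) = inj₁ (point-≡ (neg-neg x) refl (neg-neg z))
  ~-trans {x , y , z} (inj₂ (inj₂ (inj₁ refl))) (inj₂ (inj₂ (inj₂ refl))) = inj₂ (inj₁ (point-≡ refl refl (neg-neg z)))
  ~-trans {x , y , z} (inj₂ (inj₂ (inj₂ refl))) (inj₂ (inj₁ refl)) = inj₂ (inj₂ (inj₁ (point-≡ refl (neg-neg y) refl)))
  ~-trans {x , y , z} (inj₂ (inj₂ (inj₂ refl))) (inj₂ (inj₂ (inj₁ refl))) = inj₂ (inj₁ (point-≡ refl refl (neg-neg z)))
  ~-trans {x , y , z} (inj₂ (inj₂ (inj₂ refl))) (inj₂ (inj₂ (inj₂ refl))) = inj₁ (point-≡ refl (neg-neg y) (neg-neg z))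

  _≟ᴾ_ : (P Q : Point) → Dec (P ≡ Q)
  (x , y , z) ≟ᴾ (x′ , y′ , z′) with x ≟ x′ | y ≟ y′ | z ≟ z′
  ... | yes refl | yes refl | yes refl = yes refl
  ... | no n     | _        | _        = no λ { refl → n refl }
  ... | _        | no n     | _        = no λ { refl → n refl }
  ... | _        | _        | no n     = no λ { refl → n refl }

  _~?_ : (P Q : Point) → Dec (P ~ Q)
  P ~? Q = (Q ≟ᴾ P) ⊎-dec ((Q ≟ᴾ flip₁ P) ⊎-dec ((Q ≟ᴾ flip₂ P) ⊎-dec (Q ≟ᴾ flip₃ P)))

  move-~ : ∀ g {P Q} → P ~ Q → move g P ~ move g Q
  move-~ g (inj₁ refl) = inj₁ refl
  move-~ vieta {x , y , z} (inj₂ (inj₁ refl)) = inj₂ (inj₁ (point-≡ refl refl (solve 3 (λ x y z → :- x :* :- y :- z := x :* y :- z) refl x y z)))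
  move-~ vieta {x , y , z} (inj₂ (inj₂ (inj₁ refl))) = inj₂ (inj₂ (inj₁ (point-≡ refl refl (solve 3 (λ x y z → :- x :* y :- :- z := :- (x :* y :- z)) refl x y z))))
  move-~ vieta {x , y , z} (inj₂ (inj₂ (inj₂ refl))) = inj₂ (inj₂ (inj₂ (point-≡ refl refl (solve 3 (λ x y z → x :* :- y :- :- z := :- (x :* y :- z)) refl x y z))))
  move-~ sw₁₂ (inj₂ (inj₁ refl)) = inj₂ (inj₁ refl)
  move-~ sw₁₂ (inj₂ (inj₂ (inj₁ refl))) = inj₂ (inj₂ (inj₂ refl))
  move-~ sw₁₂ (inj₂ (inj₂ (inj₂ refl))) = inj₂ (inj₂ (inj₁ refl))
  move-~ sw₂₃ (inj₂ (inj₁ refl)) = inj₂ (inj₂ (inj₁ refl))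
  move-~ sw₂₃ (inj₂ (inj₂ (inj₁ refl))) = inj₂ (inj₁ refl)
  move-~ sw₂₃ (inj₂ (inj₂ (inj₂ refl))) = inj₂ (inj₂ (inj₂ refl))

  moves-~ : ∀ w {P Q} → P ~ Q → moves w P ~ moves w Q
  moves-~ []      r = r
  moves-~ (g ∷ w) {P} {Q} r = move-~ g {moves w P} {moves w Q} (moves-~ w r)

  move-involutive : ∀ g P → move g (move g P) ≡ P
  move-involutive vieta (x , y , z) = point-≡ refl refl (solve 3 (λ x y z → x :* y :- (x :* y :- z) := z) refl x y z)
  move-involutive sw₁₂  P = refl
  move-involutive sw₂₃  P = refl

  inv : List Gen → List Gen
  inv []      = []
  inv (g ∷ w) = inv w ++ g ∷ []

  inv-moves : ∀ w P → moves (inv w) (moves w P) ≡ P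
  inv-moves []      P = refl
  inv-moves (g ∷ w) P = trans (moves-++ (inv w) (g ∷ []) _) (trans (cong (moves (inv w)) (move-involutive g (moves w P))) (inv-moves w P))

  moves-inv : ∀ w P → moves w (moves (inv w) P) ≡ P
  moves-inv []      P = refl
  moves-inv (g ∷ w) P = trans (cong (λ Q → move g (moves w Q)) (moves-++ (inv w) (g ∷ []) P))
    (trans (cong (move g) (moves-inv w (move g P))) (move-involutive g P))

  moves-cancel : ∀ w {P Q} → moves w P ~ moves w Q → P ~ Q
  moves-cancel w {P} {Q} r = subst (_~ Q) (inv-moves w P) (subst (moves (inv w) (moves w P) ~_) (inv-moves w Q) (moves-~ (inv w) {moves w P} {moves w Q} r))

  Orb : Point → Point → Set
  Orb o P = ∃ λ w → moves w o ~ P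

  orb-move : ∀ {o} g {P} → Orb o P → Orb o (move g P)
  orb-move g {P} (w , r) = g ∷ w , move-~ g {moves w _} {P} r

  orb-moves : ∀ {o} w {P} → Orb o P → Orb o (moves w P)
  orb-moves []      r = r
  orb-moves (g ∷ w) r = orb-move g (orb-moves w r)

  orb-~ : ∀ {o P Q} → P ~ Q → Orb o P → Orb o Q
  orb-~ {o} {P} {Q} s (w , r) = w , ~-trans {moves w o} {P} {Q} r s

  orb-connect : ∀ {o P Q} → Orb o P → Orb o Q → Orb P Q
  orb-connect {o} {P} {Q} (v , r) (w , s) = w ++ inv v , subst (_~ Q) (sym (moves-++ w (inv v) P))
    (~-trans {moves w (moves (inv v) P)} {moves w o} {Q}
      (moves-~ w (sym-~ {o} {moves (inv v) P} (subst (_~ moves (inv v) P) (inv-moves v o) (moves-~ (inv v) {moves v o} {P} r)))) s)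

  ~-refl : ∀ {P} → P ~ P
  ~-refl = inj₁ refl

  open FiniteQuotient _~_ _~?_ (λ P → ~-refl {P}) (λ P Q → sym-~ {P} {Q}) (λ P Q R → ~-trans {P} {Q} {R}) public

  -- arithmetic in F[σ], where ω = (x + σ)/2 and σ² = x² - 4
  module SquareRoot (x : Carrier) (T : Torus x) (x≢±2 : ¬ (disc x ≡ 0#)) (h : Carrier) (2h≡1 : h + h ≡ 1#) where
    open Torus T

    σ : K.Carrier
    σ = ω K.- ω̃

    σ²≡disc : σ K.* σ ≡ emb (disc x)
    σ²≡disc = begin
      (ω K.- ω̃) K.* (ω K.- ω̃)
        ≡⟨ KS.solve 2 (λ a b → (a KS.:- b) KS.:* (a KS.:- b) KS.:= (a KS.:+ b) KS.:* (a KS.:+ b) KS.:- (KS.:ι 1 KS.:+ KS.:ι 1) KS.:* (KS.:ι 1 KS.:+ KS.:ι 1) KS.:* (a KS.:* b)) refl ω ω̃ ⟩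
      (ω K.+ ω̃) K.* (ω K.+ ω̃) K.- 4ᴷ K.* (ω K.* ω̃)
        ≡⟨ cong₂ (λ u w → u K.* u K.- 4ᴷ K.* w) ω+ω̃≡x ωω̃≡1 ⟩
      emb x K.* emb x K.- 4ᴷ K.* K.1#
        ≡⟨ cong (λ u → emb x K.* emb x K.- u) (K.*-identityʳ 4ᴷ) ⟩
      emb x K.* emb x K.- 4ᴷ
        ≡⟨ sym (emb-disc x) ⟩
      emb (disc x) ∎
      where
      open ≡.≡-Reasoning
      4ᴷ = (K.1# K.+ K.1#) K.* (K.1# K.+ K.1#)

    value : K.Carrier → Carrier → Carrier → K.Carrier
    value s a b = emb a K.+ emb b K.* s

    value-* : ∀ s → s K.* s ≡ emb (disc x) → ∀ a b c d →
              value s (a * c + disc x * (b * d)) (a * d + b * c) ≡ value s a b K.* value s c d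
    value-* s s² a b c d = begin
      emb (a * c + disc x * (b * d)) K.+ emb (a * d + b * c) K.* s
        ≡⟨ cong₂ (λ u w → u K.+ w K.* s) (trans (emb-+ _ _) (cong₂ K._+_ (emb-* a c) (trans (emb-* _ _) (cong₂ K._*_ (sym s²) (emb-* b d)))))
                                           (trans (emb-+ _ _) (cong₂ K._+_ (emb-* a d) (emb-* b c))) ⟩
      emb a K.* emb c K.+ s K.* s K.* (emb b K.* emb d) K.+ (emb a K.* emb d K.+ emb b K.* emb c) K.* s
        ≡⟨ KS.solve 5 (λ a b c d s → a KS.:* c KS.:+ s KS.:* s KS.:* (b KS.:* d) KS.:+ (a KS.:* d KS.:+ b KS.:* c) KS.:* s
             KS.:= (a KS.:+ b KS.:* s) KS.:* (c KS.:+ d KS.:* s)) refl (emb a) (emb b) (emb c) (emb d) s ⟩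
      value s a b K.* value s c d ∎
      where open ≡.≡-Reasoning

    -σ²≡disc : (K.- σ) K.* (K.- σ) ≡ emb (disc x)
    -σ²≡disc = trans (KS.solve 1 (λ s → (KS.:- s) KS.:* (KS.:- s) KS.:= s KS.:* s) refl σ) σ²≡disc

    emb-2h : emb h K.+ emb h ≡ K.1#
    emb-2h = trans (sym (emb-+ h h)) (trans (cong emb 2h≡1) emb-1)

    value-ω : value σ (x * h) h ≡ ω
    value-ω = trans (cong (K._+ emb h K.* σ) (trans (emb-* x h) (cong (K._* emb h) (sym ω+ω̃≡x))))
      (trans (KS.solve 3 (λ a b h → (a KS.:+ b) KS.:* h KS.:+ h KS.:* (a KS.:- b) KS.:= a KS.:* (h KS.:+ h)) refl ω ω̃ (emb h))
        (trans (cong (ω K.*_) emb-2h) (K.*-identityʳ ω)))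

    value-ω̃ : value (K.- σ) (x * h) h ≡ ω̃
    value-ω̃ = trans (cong (K._+ emb h K.* (K.- σ)) (trans (emb-* x h) (cong (K._* emb h) (sym ω+ω̃≡x))))
      (trans (KS.solve 3 (λ a b h → (a KS.:+ b) KS.:* h KS.:+ h KS.:* (KS.:- (a KS.:- b)) KS.:= b KS.:* (h KS.:+ h)) refl ω ω̃ (emb h))
        (trans (cong (ω̃ K.*_) emb-2h) (K.*-identityʳ ω̃)))

    value-1 : ∀ s → value s 1# 0# ≡ K.1#
    value-1 s = trans (cong₂ (λ u w → u K.+ w K.* s) emb-1 emb-0) (KS.solve 1 (λ s → KS.:ι 1 KS.:+ KS.:ι 0 KS.:* s KS.:= KS.:ι 1) refl s)

    -- If x² - 4 is a square in F, adjoining a formal root does not give a field, and the evaluation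
    -- at σ alone is not injective. The evaluations at σ and -σ together are.
    value-unit : ∀ a b → value σ a b ≡ K.1# → value (K.- σ) a b ≡ K.1# → a ≡ 1# × b ≡ 0#
    value-unit a b e e′ = emb-injective (trans a≡ (sym emb-1)) , b≡0
      where
      σ≢0 : ¬ (σ ≡ K.0#)
      σ≢0 d = emb-≢0 x≢±2 (trans (sym σ²≡disc) (trans (cong (K._* σ) d) (K.zeroˡ σ)))
      double : ∀ u v → u ≡ v → emb h K.* (u K.- v) ≡ K.0#
      double u .u refl = trans (cong (emb h K.*_) (K.-‿inverseʳ u)) (K.zeroʳ _)
      embb : emb b ≡ K.0#
      embb = KP.*-cancel-0 σ≢0 (begin
        σ K.* emb b                                         ≡⟨ KS.solve 2 (λ s b → s KS.:* b KS.:= s KS.:* b KS.:* KS.:ι 1) refl σ (emb b) ⟩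
        σ K.* emb b K.* K.1#                                ≡⟨ cong (σ K.* emb b K.*_) (sym emb-2h) ⟩
        σ K.* emb b K.* (emb h K.+ emb h)                   ≡⟨ KS.solve 4 (λ s a b h → s KS.:* b KS.:* (h KS.:+ h) KS.:= h KS.:* ((a KS.:+ b KS.:* s) KS.:- (a KS.:+ b KS.:* (KS.:- s)))) refl σ (emb a) (emb b) (emb h) ⟩
        emb h K.* (value σ a b K.- value (K.- σ) a b)       ≡⟨ double _ _ (trans e (sym e′)) ⟩
        K.0# ∎)
        where open ≡.≡-Reasoning
      b≡0 : b ≡ 0#
      b≡0 = emb-injective (trans embb (sym emb-0))
      a≡ : emb a ≡ K.1#
      a≡ = trans (KS.solve 2 (λ a s → a KS.:= a KS.:+ KS.:ι 0 KS.:* s) refl (emb a) σ) (trans (cong (λ u → emb a K.+ u K.* σ) (sym embb)) e)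

  -- Orbits over a finite field and blocks through the centre

  module Enumerated (elements : List Carrier) (complete : ∀ a → a ∈ elements) where

    Sol? : ∀ P → Dec (Sol P)
    Sol? (x , y , z) = ((x * x + y * y + z * z) ≟ (x * y * z)) ×-dec ¬? ((x ≟ 0#) ×-dec ((y ≟ 0#) ×-dec (z ≟ 0#)))

    solutions : List Point
    solutions = filter Sol? (cartesianProduct elements (cartesianProduct elements elements))

    solutions-complete : ∀ {P} → Sol P → P ∈ solutions
    solutions-complete {x , y , z} s = ∈-filter⁺ Sol? (∈-cartesianProduct⁺ (complete x) (∈-cartesianProduct⁺ (complete y) (complete z))) s

    representatives : ∃ λ ys → Separated ys × All Sol ys × (∀ {P} → Sol P → Covers ys P)
    representatives = convert (transversal solutions)
      where
      convert : (∃ λ ys → Separated ys × All (_∈ solutions) ys × All (Covers ys) solutions) →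
                ∃ λ ys → Separated ys × All Sol ys × (∀ {P} → Sol P → Covers ys P)
      convert (ys , sep , sub , cov) = ys , sep , All.map (λ m → All.lookup (Allₚ.all-filter Sol? (cartesianProduct elements (cartesianProduct elements elements))) m) sub ,
        λ s → All.lookup cov (solutions-complete s)

    orbit : ∀ o → Sol o → ∃ λ zs → Separated zs × All Sol zs × All (Orb o) zs × (∀ {P} → Orb o P → Covers zs P)
    orbit o s = convert (saturate (length ys) (o ∷ []) refl ([] ∷ []) (s ∷ []) (([] , inj₁ refl) ∷ []))
      where
      ys = proj₁ representatives
      gens : List Gen
      gens = vieta ∷ sw₁₂ ∷ sw₂₃ ∷ []
      every : ∀ g → g ∈ gens
      every vieta = here refl
      every sw₁₂  = there (here refl)
      every sw₂₃  = there (there (here refl))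
      open Saturation gens every move (λ g P Q → move-~ g {P} {Q}) Sol (λ g P → move-Sol g {P}) ys (λ P → proj₂ (proj₂ (proj₂ representatives)) {P})
                      (Orb o) (λ g P → orb-move g {P})
      convert : (∃ λ zs → Separated zs × All Sol zs × All (Orb o) zs × Closed zs × (∀ {P} → Covers (o ∷ []) P → Covers zs P)) →
                ∃ λ zs → Separated zs × All Sol zs × All (Orb o) zs × (∀ {P} → Orb o P → Covers zs P)
      convert (zs , sep , val , rea , closed , up) = zs , sep , val , rea , λ {P} (w , r) → Any.map (λ {Q} → ~-trans {P} {moves w o} {Q} (sym-~ {moves w o} {P} r)) (along w)
        where
        along : ∀ w → Covers zs (moves w o)
        along []      = up {o} (here (inj₁ refl))
        along (g ∷ w) = closed g {moves w o} (along w)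

    orb? : ∀ {o} → Sol o → ∀ P → Dec (Orb o P)
    orb? {o} s P = locate (orbit o s)
      where
      locate : (∃ λ zs → Separated zs × All Sol zs × All (Orb o) zs × (∀ {P} → Orb o P → Covers zs P)) → Dec (Orb o P)
      locate (zs , _ , _ , rea , cov) with Any.any? (P ~?_) zs
      ... | no ¬c = no λ r → ¬c (cov {P} r)
      ... | yes c with find c
      ...   | z , z∈zs , r = yes (orb-~ {o} {z} {P} (sym-~ {P} {z} r) (All.lookup rea z∈zs))

    module _ {o : Point} (so : Sol o) (sv : Sol centre) (T : Torus 3#) (O : Order (Torus.ω T K.* Torus.ω T))
             (large : 256 ℕ.* suc p ℕ.≤ Order.L O ℕ.* Order.L O) where

      private
        zs = proj₁ (orbit o so)
        ys = proj₁ representatives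
        L  = Order.L O

      -- Otherwise the rotation orbit of the centre would lie outside the orbit of o.
      centre-in-orbit : (length ys ℕ.∸ length zs) ℕ.* (length ys ℕ.∸ length zs) ℕ.≤ p → Orb o centre
      centre-in-orbit half = conclude (orb? so centre)
        where
        point : ℕ → Point
        point j = iter rot j centre
        point-Sol : ∀ j → Sol (point j)
        point-Sol j = word-Sol (word-iter j rot-word) sv
        path : ℕ → List Point
        path zero    = []
        path (suc n) = point n ∷ path n
        path-length : ∀ n → length (path n) ≡ n
        path-length zero    = refl
        path-length (suc n) = cong suc (path-length n)
        path-All : ∀ {Q : Point → Set} n → (∀ j → j ℕ.< n → Q (point j)) → All Q (path n)
        path-All zero    h = []
        path-All (suc n) h = h n (ℕₚ.n<1+n n) ∷ path-All n (λ j l → h j (ℕₚ.m<n⇒m<1+n l))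
        iter-+ : ∀ i j P → iter rot (i ℕ.+ j) P ≡ iter rot i (iter rot j P)
        iter-+ i zero    P = cong (λ n → iter rot n P) (ℕₚ.+-identityʳ i)
        iter-+ i (suc j) P = trans (cong (λ n → iter rot n P) (ℕₚ.+-suc i j)) (iter-+ i j (rot P))
        apart : ∀ i j → i ℕ.< j → j ℕ.< L → ¬ (point i ~ point j)
        apart i j i<j j<L r = ℕₚ.<⇒≱ j<L (ℕₚ.≤-trans (Order.minimal O (j ℕ.∸ i) (ℕₚ.m<n⇒0<n∸m i<j)
            (period-minimal si T (j ℕ.∸ i) (subst₂ _~_ (iter-seq i 3# 3# 3#) shift r))) (ℕₚ.m∸n≤m j i))
          where
          si : Sol (3# , seq 3# 3# 3# i , seq 3# 3# 3# (suc i))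
          si = subst Sol (iter-seq i 3# 3# 3#) (point-Sol i)
          shift : point j ≡ iter rot (j ℕ.∸ i) (3# , seq 3# 3# 3# i , seq 3# 3# 3# (suc i))
          shift = trans (cong point (sym (ℕₚ.m∸n+n≡m (ℕₚ.<⇒≤ i<j)))) (trans (iter-+ (j ℕ.∸ i) i centre) (cong (iter rot (j ℕ.∸ i)) (iter-seq i 3# 3# 3#)))
        path-separated : ∀ n → n ℕ.≤ L → Separated (path n)
        path-separated zero    _ = []
        path-separated (suc n) l = path-All n (λ j j<n r → apart j n j<n l (sym-~ {point n} {point j} r)) ∷ path-separated n (ℕₚ.≤-trans (ℕₚ.n≤1+n n) l)
        outside : ¬ Orb o centre → ∀ j → ¬ Orb o (point j)
        outside n j r = n (orb-~ {o} {moves (inv w) (point j)} {centre} (inj₁ (sym (trans (cong (moves (inv w)) (sym (e centre))) (inv-moves w centre)))) (orb-moves (inv w) r))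
          where
          w = proj₁ (word-iter j rot-word)
          e = proj₂ (word-iter j rot-word)
        conclude : Dec (Orb o centre) → Orb o centre
        conclude (yes r) = r
        -- The L points of the rotation orbit and those of the orbit of `o` would be pairwise
        -- inequivalent, so L² ≤ p, against 256 (p + 1) ≤ L².
        conclude (no n)  = ⊥-elim (ℕₚ.<⇒≱ (ℕₚ.≤-trans (ℕₚ.m≤n*m (suc p) 256) large) (ℕₚ.≤-trans (ℕₚ.*-mono-≤ L≤ L≤) half))
          where
          separated : Separated (path L ++ zs)
          separated = AllPairsₚ.++⁺ (path-separated L ℕₚ.≤-refl) (proj₁ (proj₂ (orbit o so)))
            (path-All L (λ j _ → All.map (λ {z} oz r → outside n j (orb-~ {o} {z} {point j} (sym-~ {point j} {z} r) oz)) (proj₁ (proj₂ (proj₂ (proj₂ (orbit o so)))))))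
          bound : length (path L ++ zs) ℕ.≤ length ys
          bound = separated-length (path L ++ zs) ys separated
            (Allₚ.++⁺ (path-All L (λ j _ → proj₂ (proj₂ (proj₂ representatives)) (point-Sol j)))
                      (All.map (λ s → proj₂ (proj₂ (proj₂ representatives)) s) (proj₁ (proj₂ (proj₂ (orbit o so))))))
          L≤ : L ℕ.≤ length ys ℕ.∸ length zs
          L≤ = ℕₚ.m+n≤o⇒m≤o∸n L (subst (ℕ._≤ length ys) (trans (length-++ (path L)) (cong (ℕ._+ length zs) (path-length L))) bound)

      centred-block : ∀ {C} → Block C → C centre → (∀ P → Sol P → C P → Orb o P) → Orb o centre →
                      (∀ P → Sol P → C P → centre ~ P) ⊎ (∀ P → Sol P → Orb o P → C P)
      centred-block {C} B cv sub ov = decide-other (Any.any? other? solutions)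
        where
        -- A point of the orbit is the image of the centre under a word w, and it lies in C exactly
        -- when w stabilises C. This makes the search for a second element possible.
        C? : ∀ P → Sol P → Dec (C P)
        C? P s with orb? so P
        ... | no n  = no λ c → n (sub P s c)
        ... | yes r with orb-connect {o} {centre} {P} ov r
        ...   | w , e with stab? B (w , λ _ → refl) sv cv
        ...     | yes st = yes (Block.respects B (moves-Sol w sv) e (proj₁ (st centre sv) cv))
        ...     | no ¬st = no λ c → ¬st (stab-of B (w , λ _ → refl) sv cv (Block.respects B s (sym-~ {moves w centre} {P} e) c))
        other? : ∀ P → Dec (Sol P × C P × ¬ (P ~ centre))
        other? P with Sol? P
        ... | no n = no λ (s , _) → n s
        ... | yes s with C? P s | P ~? centre
        ...   | no n  | _     = no λ (_ , c , _) → n c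
        ...   | yes _ | yes r = no λ (_ , _ , n) → n r
        ...   | yes c | no n  = yes (s , c , n)
        whole : Stab C rot → ∀ P → Sol P → Orb o P → C P
        whole st P s r with orb-connect {o} {centre} {P} ov r
        ... | w , e = Block.respects B (moves-Sol w sv) e (proj₁ (all w centre sv) cv)
          where
          st₁₂ : Stab C (move sw₁₂)
          st₁₂ = stab-of B sw₁₂-word sv cv cv
          st₂₃ : Stab C (move sw₂₃)
          st₂₃ = stab-of B sw₂₃-word sv cv cv
          one : ∀ g → Stab C (move g)
          one sw₁₂ = st₁₂
          one sw₂₃ = st₂₃
          -- `vieta` is `rot` after the exchange of the last two coordinates.
          one vieta P s = (λ c → proj₁ (st _ (move-Sol sw₂₃ s)) (proj₁ (st₂₃ P s) c)) , (λ c → proj₂ (st₂₃ P s) (proj₂ (st _ (move-Sol sw₂₃ s)) c))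
          all : ∀ w → Stab C (moves w)
          all []      P s = (λ c → c) , (λ c → c)
          all (g ∷ w) P s = (λ c → proj₁ (one g _ (moves-Sol w s)) (proj₁ (all w P s) c)) , (λ c → proj₂ (all w P s) (proj₂ (one g _ (moves-Sol w s)) c))
        decide-other : Dec (Any (λ P → Sol P × C P × ¬ (P ~ centre)) solutions) →
                       (∀ P → Sol P → C P → centre ~ P) ⊎ (∀ P → Sol P → Orb o P → C P)
        decide-other (no none) = inj₁ λ P s c → single P s c (P ~? centre)
          where
          single : ∀ P → Sol P → C P → Dec (P ~ centre) → centre ~ P
          single P s c (yes r) = sym-~ {P} {centre} r
          single P s c (no n)  = ⊥-elim (none (lose (solutions-complete s) (s , c , n)))
        decide-other (yes some) with find some
        ... | P , _ , s , c , n = inj₂ (whole (rotation-invariant (stab? B rot-word sv cv)))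
          where
          rotation-invariant : Dec (Stab C rot) → Stab C rot
          rotation-invariant (yes st) = st
          rotation-invariant (no ¬st) = ⊥-elim (block-invariant B sv cv s c n T O large ¬st)

      -- A word w carries an element of the block to the centre. The translated block is treated by
      -- `centred-block`, and both of its outcomes survive the translation back.
      primitive-orbit : ∀ {C} → Block C → (∀ P → Sol P → C P → Orb o P) → Orb o centre → ∀ {b} → Sol b → C b →
                  (∃ λ c → Sol c × (∀ P → Sol P → (C P → c ~ P) × (c ~ P → C P))) ⊎ (∀ P → Sol P → Orb o P → C P)
      primitive-orbit {C} B sub ov {b} sb cb with orb-connect {o} {b} {centre} (sub b sb cb) ov
      ... | w , e = translate (centred-block B′ c′ (λ P s c → subst (Orb o) (moves-inv w P) (orb-moves w (sub _ (moves-Sol (inv w) s) c))) ov)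
        where
        C′ : Point → Set
        C′ P = C (moves (inv w) P)
        B′ : Block C′
        B′ = conjugate (moves (inv w)) (moves w) (inv w , λ _ → refl) (w , λ _ → refl) (moves-inv w) (λ {P} {Q} → moves-~ (inv w) {P} {Q}) B
        back : moves (inv w) centre ~ b
        back = sym-~ {b} {moves (inv w) centre} (subst (_~ moves (inv w) centre) (inv-moves w b) (moves-~ (inv w) {moves w b} {centre} e))
        c′ : C′ centre
        c′ = Block.respects B sb (sym-~ {moves (inv w) centre} {b} back) cb
        to : ∀ P → C P → C′ (moves w P)
        to P c = subst C (sym (inv-moves w P)) c
        translate : (∀ P → Sol P → C′ P → centre ~ P) ⊎ (∀ P → Sol P → Orb o P → C′ P) →
                    (∃ λ c → Sol c × (∀ P → Sol P → (C P → c ~ P) × (c ~ P → C P))) ⊎ (∀ P → Sol P → Orb o P → C P)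
        translate (inj₁ single) = inj₁ (b , sb , λ P s →
          (λ c → moves-cancel w {b} {P} (~-trans {moves w b} {centre} {moves w P} e (single (moves w P) (moves-Sol w s) (to P c)))) ,
          (λ r → Block.respects B sb r cb))
        translate (inj₂ whole) = inj₂ λ P s r → subst C (inv-moves w P) (whole (moves w P) (moves-Sol w s) (orb-moves w r))

-- The action modulo p

module Modular (t : ℕ) (p-prime : Prime (3 ℕ.+ t ℕ.* 4)) where

  open PrimeField (1 ℕ.+ t ℕ.* 4) p-prime

  private
    ιp≡0 : Field.ι primeField p ≡ [ 0 ]
    ιp≡0 = trans (ι≡[] p) [p]≡0

    ι≢0 : ∀ j → 0 ℕ.< j → j ℕ.< p → ¬ (Field.ι primeField j ≡ [ 0 ])
    ι≢0 j 0<j j<p e = ℕₚ.<⇒≢ 0<j (sym (trans (sym (m<n⇒m%n≡m j<p)) (cong val (trans (sym (ι≡[] j)) e))))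

  module R = Residues primeField t p-prime fermat ιp≡0 ι≢0
  open Core R.setting

  elements : List 𝔽
  elements = map [_] (upTo p)

  val-< : ∀ a → val a ℕ.< p
  val-< a = subst (ℕ._< p) (cong val ([val] a)) (m%n<n (val a) p)

  elements-complete : ∀ a → a ∈ elements
  elements-complete a = subst (_∈ elements) ([val] a) (∈-map⁺ [_] (∈-upTo⁺ (val-< a)))

  open Enumerated elements elements-complete

  toP : Triple → Point
  toP (x , y , z) = [ x ] , [ y ] , [ z ]

  fromP : Point → Triple
  fromP (a , b , c) = val a , val b , val c

  fromP-injective : ∀ {P Q} → fromP P ≡ fromP Q → P ≡ Q
  fromP-injective e = point-≡ (val-injective (cong proj₁ e)) (val-injective (cong (λ q → proj₁ (proj₂ q)) e)) (val-injective (cong (λ q → proj₂ (proj₂ q)) e))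

  fromP-toP : ∀ {q} → Xs p q → fromP (toP q) ≡ q
  fromP-toP (x<p , y<p , z<p , _) = cong₂ _,_ (m<n⇒m%n≡m x<p) (cong₂ _,_ (m<n⇒m%n≡m y<p) (m<n⇒m%n≡m z<p))

  gen-fromP : ∀ g P → gen p g (fromP P) ≡ fromP (move g P)
  gen-fromP vieta (a , b , c) = cong (λ u → val a , val b , u) (%-distribˡ-+ (val a ℕ.* val b) (p ℕ.∸ val c) p)
  gen-fromP sw₁₂  (a , b , c) = refl
  gen-fromP sw₂₃  (a , b , c) = refl

  act-fromP : ∀ w P → act p w (fromP P) ≡ fromP (moves w P)
  act-fromP []      P = refl
  act-fromP (g ∷ w) P = trans (cong (gen p g) (act-fromP w P)) (gen-fromP g (moves w P))

  private
    sum-of-squares : ∀ (a b c : 𝔽) → [ val a ℕ.* val a ℕ.+ val b ℕ.* val b ℕ.+ val c ℕ.* val c ] ≡ a *ᶠ a +ᶠ b *ᶠ b +ᶠ c *ᶠ c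
    sum-of-squares a b c = sym (trans (cong (_+ᶠ c *ᶠ c) ([]-+ (val a ℕ.* val a) (val b ℕ.* val b))) ([]-+ (val a ℕ.* val a ℕ.+ val b ℕ.* val b) (val c ℕ.* val c)))

    product : ∀ (a b c : 𝔽) → [ val a ℕ.* val b ℕ.* val c ] ≡ a *ᶠ b *ᶠ c
    product a b c = sym (trans (cong (λ u → a *ᶠ b *ᶠ u) (sym ([val] c))) ([]-* (val a ℕ.* val b) (val c)))

  Sol⇒Xs : ∀ {P} → Sol P → Xs p (fromP P)
  Sol⇒Xs {a , b , c} (mk , nz) = val-< a , val-< b , val-< c , nonzero (val a ℕₚ.≟ 0) (val b ℕₚ.≟ 0) (val c ℕₚ.≟ 0) ,
    cong val (trans (sum-of-squares a b c) (trans mk (sym (product a b c))))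
    where
    nonzero : Dec (val a ≡ 0) → Dec (val b ≡ 0) → Dec (val c ≡ 0) → NonZeroTriple (val a , val b , val c)
    nonzero (no n)  _       _       = nz₁ n
    nonzero (yes _) (no n)  _       = nz₂ n
    nonzero (yes _) (yes _) (no n)  = nz₃ n
    nonzero (yes x) (yes y) (yes z) = ⊥-elim (nz (val-injective x , val-injective y , val-injective z))

  Xs⇒Sol : ∀ {P} → Xs p (fromP P) → Sol P
  Xs⇒Sol {a , b , c} (_ , _ , _ , nz , mk) = trans (sym (sum-of-squares a b c)) (trans (val-injective mk) (product a b c)) , zero-triple nz
    where
    zero-triple : NonZeroTriple (val a , val b , val c) → ¬ (a ≡ [ 0 ] × b ≡ [ 0 ] × c ≡ [ 0 ])
    zero-triple (nz₁ n) (e , _ , _) = n (cong val e)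
    zero-triple (nz₂ n) (_ , e , _) = n (cong val e)
    zero-triple (nz₃ n) (_ , _ , e) = n (cong val e)

  toP-Sol : ∀ {q} → Xs p q → Sol (toP q)
  toP-Sol {q} x = Xs⇒Sol {toP q} (subst (Xs p) (sym (fromP-toP x)) x)

  ~⇒∼ : ∀ {P Q} → P ~ Q → fromP P ∼[ p ] fromP Q
  ~⇒∼ (inj₁ e)               = inj₁ (cong fromP e)
  ~⇒∼ (inj₂ (inj₁ e))        = inj₂ (inj₁ (cong fromP e))
  ~⇒∼ (inj₂ (inj₂ (inj₁ e))) = inj₂ (inj₂ (inj₁ (cong fromP e)))
  ~⇒∼ (inj₂ (inj₂ (inj₂ e))) = inj₂ (inj₂ (inj₂ (cong fromP e)))

  ∼⇒~ : ∀ {P Q} → fromP P ∼[ p ] fromP Q → P ~ Q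
  ∼⇒~ {P} {Q} (inj₁ e)               = inj₁ (fromP-injective {Q} {P} e)
  ∼⇒~ {P} {Q} (inj₂ (inj₁ e))        = inj₂ (inj₁ (fromP-injective {Q} {flip₁ P} e))
  ∼⇒~ {P} {Q} (inj₂ (inj₂ (inj₁ e))) = inj₂ (inj₂ (inj₁ (fromP-injective {Q} {flip₂ P} e)))
  ∼⇒~ {P} {Q} (inj₂ (inj₂ (inj₂ e))) = inj₂ (inj₂ (inj₂ (fromP-injective {Q} {flip₃ P} e)))

  Orb⇒Orbit : ∀ {o P} → Orb o P → Orbit p (fromP o) (fromP P)
  Orb⇒Orbit {o} {P} (w , r) = w , subst (_∼[ p ] fromP P) (sym (act-fromP w o)) (~⇒∼ {moves w o} {P} r)

  Orbit⇒Orb : ∀ {o P} → Orbit p (fromP o) (fromP P) → Orb o P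
  Orbit⇒Orb {o} {P} (w , r) = w , ∼⇒~ {moves w o} {P} (subst (_∼[ p ] fromP P) (act-fromP w o) r)

  size : ∀ (Q : Triple → Set) zs → Separated zs → All Sol zs → All (λ P → Q (fromP P)) zs →
         (∀ {P} → Sol P → Q (fromP P) → Covers zs P) → HasSize p Q (length zs)
  size Q zs sep sol all cov = map fromP zs , length-map fromP zs ,
    Allₚ.map⁺ (All.zipWith (λ {P} (s , q) → Sol⇒Xs {P} s , q) (sol , all)) ,
    AllPairsₚ.map⁺ (AllPairs.map (λ {P} {Q} n r → n (∼⇒~ {P} {Q} r)) sep) ,
    λ q x m → subst (λ q → Any (q ∼[ p ]_) (map fromP zs)) (fromP-toP x)
      (Anyₚ.map⁺ (Any.map (λ {Q} → ~⇒∼ {toP q} {Q}) (cov {toP q} (toP-Sol x) (subst Q (sym (fromP-toP x)) m))))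

  block : ∀ {B} → Respects∼ p B → IsBlock p B → Block (λ P → B (fromP P))
  block {B} resp isBlock = record
    { respects = λ {P} {Q} s r b → resp (fromP P) (fromP Q) (Sol⇒Xs {P} s) (~⇒∼ {P} {Q} r) b
    ; decide = λ w → convert w (isBlock w) }
    where
    convert : ∀ w → (∀ q → Xs p q → (Image p w B q → B q) × (B q → Image p w B q)) ⊎ (∀ q → Xs p q → Image p w B q → B q → ⊥) →
              Stab (λ P → B (fromP P)) (moves w) ⊎ (∀ P → Sol P → B (fromP P) → B (fromP (moves w P)) → ⊥)
    image : ∀ w P → Sol P → B (fromP P) → Image p w B (fromP (moves w P))
    image w P s b = fromP P , Sol⇒Xs {P} s , b , inj₁ (sym (act-fromP w P))
    convert w (inj₁ same) = inj₁ λ P s →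
      (λ b → proj₁ (same _ (Sol⇒Xs {moves w P} (moves-Sol w s))) (image w P s b)) ,
      (λ b → preimage P s (proj₂ (same _ (Sol⇒Xs {moves w P} (moves-Sol w s))) b))
      where
      -- An element of `Image` comes from some member of B, not necessarily from P. Words act
      -- injectively on classes, so that member is equivalent to P.
      preimage : ∀ P → Sol P → Image p w B (fromP (moves w P)) → B (fromP P)
      preimage P s (q , x , b , r) = resp q (fromP P) x (subst (_∼[ p ] fromP P) (fromP-toP x)
        (~⇒∼ {toP q} {P} (moves-cancel w {toP q} {P} (∼⇒~ {moves w (toP q)} {moves w P}
          (subst (_∼[ p ] fromP (moves w P)) (trans (cong (act p w) (sym (fromP-toP x))) (act-fromP w (toP q))) r))))) b
    convert w (inj₂ disjoint) = inj₂ λ P s b b′ → disjoint _ (Sol⇒Xs {moves w P} (moves-Sol w s)) (image w P s b) b′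

  private
    module F = Field primeField
    module K = Field R.gaussianField
    module FP = FieldProps primeField
    module KP = FieldProps R.gaussianField
    module FS = RingSolver F.commutativeRing
    module KS = RingSolver K.commutativeRing

  disc-3≡5 : disc 3# ≡ [ 5 ]
  disc-3≡5 = trans (FS.solve 0 ((FS.:ι 1 FS.:+ FS.:ι 1 FS.:+ FS.:ι 1) FS.:* (FS.:ι 1 FS.:+ FS.:ι 1 FS.:+ FS.:ι 1)
      FS.:- (FS.:ι 1 FS.:+ FS.:ι 1) FS.:* (FS.:ι 1 FS.:+ FS.:ι 1) FS.:= FS.:ι 5) refl) (ι≡[] 5)

  disc-3≢0 : ¬ (disc 3# ≡ [ 0 ])
  disc-3≢0 e = five t refl (trans (sym disc-3≡5) e)
    where
    five : ∀ s → s ≡ t → ¬ ([ 5 ] ≡ [ 0 ])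
    -- For p = 3 the residue of 5 is 2; in all other cases 5 < 7 ≤ p.
    five zero    refl e = ℕₚ.1+n≢0 (cong val e)
    five (suc s) refl e = ι≢0 5 (s≤s z≤n) (ℕₚ.m≤m+n 6 (1 ℕ.+ s ℕ.* 4)) (trans (ι≡[] 5) e)

  T₃ : Torus 3#
  T₃ = R.torus 3# disc-3≢0

  private
    h : ℕ
    h = suc p / 2

    h≡ : h ≡ 2 ℕ.+ t ℕ.* 2
    h≡ = trans (cong (_/ 2) (NS.solve 1 (λ t → NS.con 4 NS.:+ t NS.:* NS.con 4 NS.:= (NS.con 2 NS.:+ t NS.:* NS.con 2) NS.:* NS.con 2) refl t)) (m*n/n≡m (2 ℕ.+ t ℕ.* 2) 2)
      where module NS = +-*-Solver

    2h≡1 : [ h ] +ᶠ [ h ] ≡ [ 1 ]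
    2h≡1 = trans ([]-+ h h) (trans (cong [_] h+h) (trans (sym ([]-+ 1 p)) (trans (cong ([ 1 ] +ᶠ_) [p]≡0) (F.+-identityʳ [ 1 ]))))
      where
      module NS = +-*-Solver
      h+h : h ℕ.+ h ≡ 1 ℕ.+ p
      h+h = trans (cong (λ u → u ℕ.+ u) h≡) (NS.solve 1 (λ t → NS.con 2 NS.:+ t NS.:* NS.con 2 NS.:+ (NS.con 2 NS.:+ t NS.:* NS.con 2) NS.:= NS.con 4 NS.:+ t NS.:* NS.con 4) refl t)

    [md] : ∀ n → [ md p n ] ≡ [ n ]
    [md] n = val-injective (m%n%n≡m%n n p)

  module Golden where
    open Torus T₃
    open SquareRoot 3# T₃ disc-3≢0 [ h ] 2h≡1

    -- Sends √5 to s, which will be σ or -σ, the two square roots of `disc 3#` = 5. The element (3 +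
    -- √5)/2 then goes to ω or ω̃.
    evaluate : K.Carrier → F2 → K.Carrier
    evaluate s (a , b) = value s [ a ] [ b ]

    evaluate-mul2 : ∀ s → s K.* s ≡ R.emb (disc 3#) → ∀ x y → evaluate s (mul2 p x y) ≡ evaluate s x K.* evaluate s y
    evaluate-mul2 s s² (a , b) (c , d) = trans (cong₂ (value s) first-component second-component) (value-* s s² [ a ] [ b ] [ c ] [ d ])
      where
      first-component : [ md p (a ℕ.* c ℕ.+ 5 ℕ.* (b ℕ.* d)) ] ≡ [ a ] *ᶠ [ c ] +ᶠ disc 3# *ᶠ ([ b ] *ᶠ [ d ])
      first-component = trans ([md] (a ℕ.* c ℕ.+ 5 ℕ.* (b ℕ.* d))) (trans (sym ([]-+ (a ℕ.* c) (5 ℕ.* (b ℕ.* d)))) (cong₂ _+ᶠ_ (sym ([]-* a c))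
        (trans (sym ([]-* 5 (b ℕ.* d))) (cong₂ _*ᶠ_ (sym disc-3≡5) (sym ([]-* b d))))))
      second-component : [ md p (a ℕ.* d ℕ.+ b ℕ.* c) ] ≡ [ a ] *ᶠ [ d ] +ᶠ [ b ] *ᶠ [ c ]
      second-component = trans ([md] (a ℕ.* d ℕ.+ b ℕ.* c)) (trans (sym ([]-+ (a ℕ.* d) (b ℕ.* c))) (cong₂ _+ᶠ_ (sym ([]-* a d)) (sym ([]-* b c))))

    evaluate-golden² : ∀ s w → value s (3# *ᶠ [ h ]) [ h ] ≡ w → evaluate s (golden² p) ≡ w
    evaluate-golden² s w e = trans (cong₂ (value s) (trans ([md] (3 ℕ.* h)) (trans (sym ([]-* 3 h)) (cong (_*ᶠ [ h ]) (sym (ι≡[] 3))))) ([md] h)) e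

    evaluate-pow2 : ∀ s w → s K.* s ≡ R.emb (disc 3#) → value s (3# *ᶠ [ h ]) [ h ] ≡ w →
                    ∀ k → evaluate s (pow2 p (golden² p) k) ≡ w K.^ k
    evaluate-pow2 s w s² e zero    = value-1 s
    evaluate-pow2 s w s² e (suc k) = trans (evaluate-mul2 s s² (golden² p) (pow2 p (golden² p) k))
      (cong₂ K._*_ (evaluate-golden² s w e) (evaluate-pow2 s w s² e k))

    order-ω : Order ω
    order-ω = order-of ω (D ℕ.+ D) (ℕₚ.≤-trans (s≤s z≤n) (ℕₚ.m≤m+n D D)) (double-power ω D order)
      where D = R.M ℕ.+ κ

    k : ℕ
    k = Order.L order-ω

    unit⇒ω^j : ∀ j → pow2 p (golden² p) j ≡ (md p 1 , 0) → ω K.^ j ≡ K.1#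
    unit⇒ω^j j e = trans (sym (evaluate-pow2 σ ω σ²≡disc value-ω j)) (trans (cong (evaluate σ) e) (value-1 σ))

    -- Both evaluations equal 1, so the components are 1 and 0 as residues. A result of `mul2` is
    -- already reduced, hence these are its components as numbers.
    ω^j⇒unit : ∀ j → 0 ℕ.< j → ω K.^ j ≡ K.1# → pow2 p (golden² p) j ≡ (md p 1 , 0)
    ω^j⇒unit (suc j) _ e = cong₂ _,_ (reduced₁ (cong val (proj₁ ab))) (reduced₂ (cong val (proj₂ ab)))
      where
      a = proj₁ (pow2 p (golden² p) (suc j))
      b = proj₂ (pow2 p (golden² p) (suc j))
      ab : [ a ] ≡ [ 1 ] × [ b ] ≡ [ 0 ]
      ab = value-unit [ a ] [ b ] (trans (evaluate-pow2 σ ω σ²≡disc value-ω (suc j)) e)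
             (trans (evaluate-pow2 (K.- σ) ω̃ -σ²≡disc value-ω̃ (suc j)) (inverse-power {ω} {ω̃} (suc j) ωω̃≡1 e))
      mul2-reduced : ∀ x y → proj₁ (mul2 p x y) % p ≡ proj₁ (mul2 p x y) × proj₂ (mul2 p x y) % p ≡ proj₂ (mul2 p x y)
      mul2-reduced (a , b) (c , d) = m%n%n≡m%n (a ℕ.* c ℕ.+ 5 ℕ.* (b ℕ.* d)) p , m%n%n≡m%n (a ℕ.* d ℕ.+ b ℕ.* c) p
      reduced : a % p ≡ a × b % p ≡ b
      reduced = mul2-reduced (golden² p) (pow2 p (golden² p) j)
      reduced₁ : a % p ≡ 1 → a ≡ 1
      reduced₁ e = trans (sym (proj₁ reduced)) e
      reduced₂ : b % p ≡ 0 → b ≡ 0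
      reduced₂ e = trans (sym (proj₂ reduced)) e

    golden-order : IsMulOrder p (golden² p) k
    golden-order = Order.L>0 order-ω , ω^j⇒unit k (Order.L>0 order-ω) (Order.τᴸ order-ω) ,
                   λ j 0<j e → Order.minimal order-ω j 0<j (unit⇒ω^j j e)

    module _ (prop : ∀ k → IsMulOrder p (golden² p) k → 1024 ℕ.* (p ℕ.+ 1) ℕ.≤ k ℕ.* k) where

      large-k : 1024 ℕ.* suc p ℕ.≤ k ℕ.* k
      large-k = subst (λ u → 1024 ℕ.* u ℕ.≤ k ℕ.* k) (ℕₚ.+-comm p 1) (prop k golden-order)

      κ≤1 : κ ℕ.≤ 1
      κ≤1 = go type
        where
        go : ∀ {A B : Set} → (κ ≡ 0 × A) ⊎ (κ ≡ 1 × B) → κ ℕ.≤ 1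
        go (inj₁ (e , _)) = ℕₚ.≤-trans (ℕₚ.≤-reflexive e) z≤n
        go (inj₂ (e , _)) = ℕₚ.≤-reflexive e

      k≤p+1 : k ℕ.≤ suc p
      k≤p+1 = ℕₚ.≤-trans (Order.minimal order-ω (D ℕ.+ D) (ℕₚ.≤-trans (s≤s z≤n) (ℕₚ.m≤m+n D D)) (double-power ω D order))
        (ℕₚ.≤-trans (ℕₚ.+-mono-≤ (ℕₚ.+-monoʳ-≤ R.M κ≤1) (ℕₚ.+-monoʳ-≤ R.M κ≤1)) (ℕₚ.≤-reflexive
          (trans (NS.solve 1 (λ m → m NS.:+ NS.con 1 NS.:+ (m NS.:+ NS.con 1) NS.:= NS.con 2 NS.:+ (m NS.:+ m)) refl R.M) (cong suc (sym R.p≡1+2M)))))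
        where
        D = R.M ℕ.+ κ
        module NS = +-*-Solver

      -- From (p + 1)² ≥ k² ≥ 1024 (p + 1). In particular p ≠ 3, where (3, 3, 3) would be the zero
      -- triple.
      p-large : 1024 ℕ.≤ suc p
      p-large = ℕₚ.*-cancelʳ-≤ 1024 (suc p) (suc p) (ℕₚ.≤-trans large-k (ℕₚ.*-mono-≤ k≤p+1 k≤p+1))

      3≢0 : ¬ (3# ≡ [ 0 ])
      3≢0 = ι≢0 3 (s≤s z≤n) (ℕₚ.≤-trans (ℕₚ.m≤m+n 4 1019) (ℕₚ.≤-pred p-large))

      centre-Sol : Sol centre
      centre-Sol = FS.solve 0 (let x = FS.:ι 1 FS.:+ FS.:ι 1 FS.:+ FS.:ι 1 in x FS.:* x FS.:+ x FS.:* x FS.:+ x FS.:* x FS.:= x FS.:* x FS.:* x) refl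
                 , λ (e , _) → 3≢0 e

      O₃ : Order (ω K.* ω)
      O₃ = order-of-torus centre-Sol T₃

      -- Passing from ω to ω² at most halves the order, so 32 √(p + 1) becomes 16 √(p + 1).
      large : 256 ℕ.* suc p ℕ.≤ Order.L O₃ ℕ.* Order.L O₃
      large = ℕₚ.*-cancelˡ-≤ 4 (begin
          4 ℕ.* (256 ℕ.* suc p)     ≡⟨ sym (ℕₚ.*-assoc 4 256 (suc p)) ⟩
          1024 ℕ.* suc p            ≤⟨ large-k ⟩
          k ℕ.* k                   ≤⟨ ℕₚ.*-mono-≤ k≤2L k≤2L ⟩
          (L ℕ.+ L) ℕ.* (L ℕ.+ L)   ≡⟨ NS.solve 1 (λ l → (l NS.:+ l) NS.:* (l NS.:+ l) NS.:= NS.con 4 NS.:* (l NS.:* l)) refl L ⟩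
          4 ℕ.* (L ℕ.* L)           ∎)
        where
        open ℕₚ.≤-Reasoning
        module NS = +-*-Solver
        L = Order.L O₃
        k≤2L : k ℕ.≤ L ℕ.+ L
        k≤2L = order-of-square {ω} order-ω O₃

      primitivity : ∀ {oP} → Sol oP → HalfCond p → IsMaxOrbit p (fromP oP) → Primitive p (Orbit p (fromP oP))
      primitivity {oP} so half maximal B resp sub (b , xb , Bb) isBlock = convert (primitive-orbit so centre-Sol T₃ O₃ large
          (block resp isBlock) (λ P s c → Orbit⇒Orb {oP} {P} (sub (fromP P) (Sol⇒Xs {P} s) c)) centre∈ {toP b} (toP-Sol xb) (subst B (sym (fromP-toP xb)) Bb))
        where
        centre∈ : Orb oP centre
        centre∈ = centre-in-orbit so centre-Sol T₃ O₃ large (half (fromP oP) maximal _ _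
            (size (Orbit p (fromP oP)) (proj₁ (orbit oP so)) (proj₁ (proj₂ (orbit oP so))) (proj₁ (proj₂ (proj₂ (orbit oP so))))
              (All.map (λ {P} → Orb⇒Orbit {oP} {P}) (proj₁ (proj₂ (proj₂ (proj₂ (orbit oP so))))))
              (λ {P} _ r → proj₂ (proj₂ (proj₂ (proj₂ (orbit oP so)))) {P} (Orbit⇒Orb {oP} {P} r)))
            (size Whole (proj₁ representatives) (proj₁ (proj₂ representatives)) (proj₁ (proj₂ (proj₂ representatives)))
              (All.map (λ _ → tt) (proj₁ (proj₂ (proj₂ representatives))))
              (λ {P} s _ → proj₂ (proj₂ (proj₂ representatives)) {P} s)))
        convert : (∃ λ c → Sol c × (∀ P → Sol P → (B (fromP P) → c ~ P) × (c ~ P → B (fromP P)))) ⊎ (∀ P → Sol P → Orb oP P → B (fromP P)) →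
                  IsSingleton p B ⊎ SameAs p B (Orbit p (fromP oP))
        convert (inj₁ (c , sc , f)) = inj₁ (fromP c , Sol⇒Xs {c} sc , λ q xq → subst (λ q → (B q → fromP c ∼[ p ] q) × (fromP c ∼[ p ] q → B q)) (fromP-toP xq)
          ((λ Bq → ~⇒∼ {c} {toP q} (proj₁ (f (toP q) (toP-Sol xq)) Bq)) , (λ r → proj₂ (f (toP q) (toP-Sol xq)) (∼⇒~ {c} {toP q} r))))
        convert (inj₂ f) = inj₂ λ q xq → sub q xq , λ r → subst B (fromP-toP xq)
          (f (toP q) (toP-Sol xq) (Orbit⇒Orb {oP} {toP q} (subst (Orbit p (fromP oP)) (sym (fromP-toP xq)) r)))

  primitive-action : HalfCond p → (∀ k → IsMulOrder p (golden² p) k → 1024 ℕ.* (p ℕ.+ 1) ℕ.≤ k ℕ.* k) →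
                     ∀ o → IsMaxOrbit p o → Primitive p (Orbit p o)
  primitive-action half prop o maximal = subst (λ q → Primitive p (Orbit p q)) (fromP-toP (proj₁ maximal))
    (Golden.primitivity prop {toP o} (toP-Sol (proj₁ maximal)) half (subst (IsMaxOrbit p) (sym (fromP-toP (proj₁ maximal))) maximal))

theorem4p6 : (ℓ : ℕ) → Prime ℓ → ℓ % 4 ≡ 3
    → (N : ℕ) → IsNHalf N → N ≤ ℓ
    → PropP ℓ
    → (o : Triple) → IsMaxOrbit ℓ o
    → Primitive ℓ (Orbit ℓ o)
theorem4p6 ℓ ℓ-prime ℓ%4≡3 N isNHalf N≤ℓ (inj₁ ℓ%4≡1) = ⊥-elim (ℕₚ.<⇒≢ (s≤s (s≤s z≤n)) (trans (sym ℓ%4≡1) ℓ%4≡3))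
theorem4p6 ℓ ℓ-prime ℓ%4≡3 N isNHalf N≤ℓ (inj₂ prop) =
  -- Writing ℓ as 3 + 4t exhibits (ℓ - 1)/2 = 1 + 2t as an odd number and provides the exponent t +
  -- 1 for square roots.
  reduce (ℓ / 4) (trans (m≡m%n+[m/n]*n ℓ 4) (cong (ℕ._+ (ℓ / 4) ℕ.* 4) ℓ%4≡3)) ℓ-prime (proj₁ isNHalf ℓ ℓ-prime N≤ℓ) prop
  where
  reduce : ∀ {ℓ} t → ℓ ≡ 3 ℕ.+ t ℕ.* 4 → Prime ℓ → HalfCond ℓ → (∀ k → IsMulOrder ℓ (golden² ℓ) k → 1024 ℕ.* (ℓ ℕ.+ 1) ℕ.≤ k ℕ.* k) →
           ∀ o → IsMaxOrbit ℓ o → Primitive ℓ (Orbit ℓ o)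
  reduce t refl pr = Modular.primitive-action t pr
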